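{- For every positive integer $h$ and every $0<\delta<1$ there is a constant $c=c(h,\delta)>0$ such that for all sufficiently large $x$, for more than $(1-\delta)x$ of the integers $n\le x$, both $\phi(n)$ and $\lambda(n)$ are $(1+1/h)$-dense in $[h,x^c]$.
   Context: $\phi$ is Euler's totient function and $\lambda(n)$ is Carmichael's function, the maximal order of an element of $(\mathbb{Z}/n\mathbb{Z})^*$. For real $u$ and a set $I$ of reals, an integer $n$ is said to be $u$-dense in $I$ if for every $y\in I$ the interval $(y,uy]$ contains a divisor of $n$. -}

module Defs where

open import Data.Nat as ℕ using (ℕ; zero; suc; _⊔_)
open import Data.Nat.DivMod using (_%_)
open import Data.Nat.GCD using (gcd)
open import Data.Nat.Divisibility using (_∣_)
open import Data.Bool using (Bool; true; false; if_then_else_)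
open import Data.List using (List; map; filter; length; foldr; upTo)
open import Data.Integer using (+_)
open import Data.Rational as ℚ using (ℚ; 1ℚ; _/_)
open import Data.Product using (∃; _×_)
open import Relation.Nullary.Decidable using (⌊_⌋)

ι : ℕ → ℚ
ι n = + n / 1

_^ℚ_ : ℚ → ℕ → ℚ
q ^ℚ zero = 1ℚ
q ^ℚ suc k = q ℚ.* (q ^ℚ k)

range1 : ℕ → List ℕ
range1 n = map suc (upTo n)

units : ℕ → List ℕ
units n = filter (λ a → gcd a n ℕ.≟ 1) (range1 n)

φ : ℕ → ℕ
φ n = length (units n)

-- multiplicative order of a modulo n (n ≥ 1):
-- least k ≥ 1 with a^k ≡ 1 (mod n); searched among k = 1..n
-- (for a unit a the order is ≤ φ(n) ≤ n, so the search always succeeds).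
ord : ℕ → ℕ → ℕ
ord a zero = 0
ord a (suc m) = go (suc m) 1
  where
  go : ℕ → ℕ → ℕ
  go zero k = 0
  go (suc f) k =
    if ⌊ (a ℕ.^ k) % suc m ℕ.≟ 1 % suc m ⌋ then k else go f (suc k)

λC : ℕ → ℕ
λC n = foldr _⊔_ 0 (map (λ a → ord a n) (units n))

-- m is u-dense in the interval [a, b^(p/q)] (a, b, u rational, p, q ≥ 1):
-- for every y with a ≤ y ≤ b^(p/q), i.e. y^q ≤ b^p, the interval (y, u y]
-- contains a divisor of m.  (y ranges over ℚ.)
DenseIn : ℚ → ℕ → ℚ → ℚ → ℕ → ℕ → Set
DenseIn u m a b p q =
  ∀ (y : ℚ) → a ℚ.≤ y → y ^ℚ q ℚ.≤ b ^ℚ p →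
  ∃ λ d → d ∣ m × y ℚ.< ι d × ι d ℚ.≤ u ℚ.* y

-- 1/h for a positive integer h (value at h = 0 is irrelevant, set to 0)
recip : ℕ → ℚ
recip zero = ℚ.0ℚ
recip (suc k) = + 1 / suc k

-- If a prime p ≡ 1 (mod q) divides n, then q divides λ(n), which divides φ(n); so divisors of λ(n) are produced from
-- prime factors of n. If m is (1 + 1/h)-dense in [h, Y) and q ≤ Y/h is coprime to m, then m q is dense in [h, q Y).
-- The start is D = 2^L (2h)!, which divides λ(n) for almost all n, because the reciprocals of the primes p ≡ 1 (mod l^e)
-- have a divergent sum. This holds for every prime power l^e by geometry of numbers in ℤ[ζ]: many elements congruent
-- to 1 modulo all small primes are nonunits, hence singular modulo a larger prime, and inert primes are too rare to
-- account for them.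
-- From D one climbs through the scales a = a₀ K^j, at each of which K² primes q in (2^a, 2^(K a)] dividing λ(n) suffice
-- to reach the next. If n yields fewer, then after removing the prime factors of n that produce them, it has no prime
-- factor p with p ≡ 1 modulo one of the remaining q. By the large sieve such p have reciprocal sum at least 1/128 in
-- each of T consecutive blocks (2^b, 2^(J b)], so this has probability O((128/129)^T), and the choice of the removed
-- factors costs only a power of T. With T growing linearly from the top scale downwards, the exceptional
-- probabilities of the scales are bounded by a geometric series.
module Submission where

-- The sieve estimates concern sets of moduli with a large reciprocal sum and say nothing about a
-- single modulus, so they cannot supply the fixed divisor at the bottom. That is why a weak form of
-- Dirichlet's theorem is proved separately, without characters or L-functions. Real analysis is
-- avoided throughout: sizes are measured by powers of 2, reciprocal sums are rational, and the only
-- analytic tool is one large sieve with the crude condition R^5 ≤ N. The number of scales below x^c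
-- is unbounded as x grows, so a fixed failure probability per scale would not do. On the other hand
-- the primes p used at a scale must be small compared with x, and T blocks end at 2^(10 K a J^T).
-- At the top scale T is therefore a constant number of windows, and this constant determines c.
-- Each step down divides a by K, and K is chosen to be at least J^`window`, so that one more window
-- of blocks fits below the same limit and the bound for the failure probability is halved.

-- Ordered field arithmetic in ℚ.

module Rat where

  open import Defs
  open import Data.Nat as ℕ using (ℕ; zero; suc)
  import Data.Nat.Properties as ℕₚ
  open import Data.Integer as ℤ using (ℤ; +_)
  import Data.Integer.Properties as ℤₚ
  open import Data.Rational
  open import Data.Rational.Properties
  import Data.Rational.Unnormalised as ℚᵘ
  import Data.Rational.Unnormalised.Properties as ℚᵘₚ
  open import Data.Empty using (⊥-elim)
  open import Data.Sum using (inj₁; inj₂)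
  open import Level using (0ℓ)
  open import Relation.Nullary using (yes; no)
  open import Relation.Nullary.Decidable using (dec⇒maybe)
  open import Relation.Binary.PropositionalEquality
  open import Tactic.RingSolver.Core.AlmostCommutativeRing using (AlmostCommutativeRing; fromCommutativeRing)
  open import Tactic.RingSolver using (solve-∀)

  ringℚ : AlmostCommutativeRing 0ℓ 0ℓ
  ringℚ = fromCommutativeRing +-*-commutativeRing λ x → dec⇒maybe (0ℚ ≟ x)

  ≤-by : ∀ {a b} t → 0ℚ ≤ t → b ≡ a + t → a ≤ b
  ≤-by {a} {b} t 0≤t eq = subst (a ≤_) (sym eq) (subst (_≤ a + t) (+-identityʳ a) (+-monoʳ-≤ a 0≤t))

  ≤⇒0≤- : ∀ {a b} → a ≤ b → 0ℚ ≤ b - a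
  ≤⇒0≤- {a} {b} a≤b = subst (_≤ b - a) (+-inverseʳ a) (+-monoˡ-≤ (- a) a≤b)

  ≡⇒≤ : ∀ {a b : ℚ} → a ≡ b → a ≤ b
  ≡⇒≤ refl = ≤-refl

  0≤+ : ∀ {a b} → 0ℚ ≤ a → 0ℚ ≤ b → 0ℚ ≤ a + b
  0≤+ 0≤a 0≤b = +-mono-≤ 0≤a 0≤b

  *-monoˡ : ∀ {a b c} → 0ℚ ≤ c → a ≤ b → c * a ≤ c * b
  *-monoˡ {c = c} 0≤c = *-monoˡ-≤-nonNeg c {{nonNegative 0≤c}}

  *-monoʳ : ∀ {a b c} → 0ℚ ≤ c → a ≤ b → a * c ≤ b * c
  *-monoʳ {c = c} 0≤c = *-monoʳ-≤-nonNeg c {{nonNegative 0≤c}}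

  0≤* : ∀ {a b} → 0ℚ ≤ a → 0ℚ ≤ b → 0ℚ ≤ a * b
  0≤* {a} {b} 0≤a 0≤b = subst (_≤ a * b) (*-zeroʳ a) (*-monoˡ 0≤a 0≤b)

  *-mono : ∀ {a b c d} → 0ℚ ≤ a → 0ℚ ≤ c → a ≤ b → c ≤ d → a * c ≤ b * d
  *-mono 0≤a 0≤c a≤b c≤d = ≤-trans (*-monoʳ 0≤c a≤b) (*-monoˡ (≤-trans 0≤a a≤b) c≤d)

  0≤² : ∀ a → 0ℚ ≤ a * a
  0≤² a with ≤-total 0ℚ a
  ... | inj₁ p = 0≤* p p
  ... | inj₂ q = subst (0ℚ ≤_) (lem a) (0≤* q' q')
    where
    q' : 0ℚ ≤ - a
    q' = neg-antimono-≤ q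
    lem : ∀ a → (- a) * (- a) ≡ a * a
    lem = solve-∀ ringℚ

  *-cancelˡ : ∀ {a b c} → 0ℚ < c → c * a ≤ c * b → a ≤ b
  *-cancelˡ {c = c} 0<c = *-cancelˡ-≤-pos c {{positive 0<c}}

  *-cancelˡ-< : ∀ {a b c} → 0ℚ ≤ c → c * a < c * b → a < b
  *-cancelˡ-< {c = c} 0≤c = *-cancelˡ-<-nonNeg c {{nonNegative 0≤c}}

  *-monoˡ-< : ∀ {a b c} → 0ℚ < c → a < b → c * a < c * b
  *-monoˡ-< {c = c} 0<c = *-monoʳ-<-pos c {{positive 0<c}}

  abstract
    -- Opaque copies of `ι` and `recip`: rationals are handled through the laws of this block and
    -- not through their normalised fractions.
    ν : ℕ → ℚ
    ν = ι

    ρ : ℕ → ℚ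
    ρ = recip

    ν≡ι : ∀ n → ν n ≡ ι n
    ν≡ι n = refl

    ρ≡recip : ∀ n → ρ n ≡ recip n
    ρ≡recip n = refl

    ν0 : ν 0 ≡ 0ℚ
    ν0 = refl

    ρ0 : ρ 0 ≡ 0ℚ
    ρ0 = refl

    ρ1 : ρ 1 ≡ 1ℚ
    ρ1 = refl

    ν1 : ν 1 ≡ 1ℚ
    ν1 = refl

    -- On unnormalised fractions the laws for `ν` and `ρ` become identities between integers.
    ιᵘ : ∀ n → toℚᵘ (ν n) ℚᵘ.≃ ℚᵘ.mkℚᵘ (+ n) 0
    ιᵘ n = toℚᵘ-fromℚᵘ (ℚᵘ.mkℚᵘ (+ n) 0)

    recipᵘ : ∀ n → toℚᵘ (ρ (suc n)) ℚᵘ.≃ ℚᵘ.mkℚᵘ (+ 1) n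
    recipᵘ n = toℚᵘ-fromℚᵘ (ℚᵘ.mkℚᵘ (+ 1) n)

    ν-+ : ∀ m n → ν (m ℕ.+ n) ≡ ν m + ν n
    ν-+ m n = toℚᵘ-injective (ℚᵘₚ.≃-trans (ιᵘ (m ℕ.+ n)) (ℚᵘₚ.≃-trans (ℚᵘ.*≡* eq)
      (ℚᵘₚ.≃-sym (ℚᵘₚ.≃-trans (toℚᵘ-homo-+ (ν m) (ν n)) (ℚᵘₚ.+-cong (ιᵘ m) (ιᵘ n))))))
      where
      eq : + (m ℕ.+ n) ℤ.* (+ 1) ≡ ((+ m) ℤ.* (+ 1) ℤ.+ (+ n) ℤ.* (+ 1)) ℤ.* (+ 1)
      eq = cong (ℤ._* (+ 1)) (sym (cong₂ ℤ._+_ (ℤₚ.*-identityʳ (+ m)) (ℤₚ.*-identityʳ (+ n))))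

    ν-* : ∀ m n → ν (m ℕ.* n) ≡ ν m * ν n
    ν-* m n = toℚᵘ-injective (ℚᵘₚ.≃-trans (ιᵘ (m ℕ.* n)) (ℚᵘₚ.≃-trans (ℚᵘ.*≡* eq)
      (ℚᵘₚ.≃-sym (ℚᵘₚ.≃-trans (toℚᵘ-homo-* (ν m) (ν n)) (ℚᵘₚ.*-cong (ιᵘ m) (ιᵘ n))))))
      where
      eq : + (m ℕ.* n) ℤ.* (+ 1) ≡ ((+ m) ℤ.* (+ n)) ℤ.* (+ 1)
      eq = cong (ℤ._* (+ 1)) (ℤₚ.pos-* m n)

    ν-suc : ∀ n → ν (suc n) ≡ 1ℚ + ν n
    ν-suc n = ν-+ 1 n

    ν-mono : ∀ {m n} → m ℕ.≤ n → ν m ≤ ν n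
    ν-mono {m} {n} m≤n = toℚᵘ-cancel-≤ (ℚᵘₚ.≤-respˡ-≃ (ℚᵘₚ.≃-sym (ιᵘ m)) (ℚᵘₚ.≤-respʳ-≃ (ℚᵘₚ.≃-sym (ιᵘ n))
      (ℚᵘ.*≤* (ℤₚ.*-monoʳ-≤-nonNeg (+ 1) (ℤ.+≤+ m≤n)))))

    ν-mono-< : ∀ {m n} → m ℕ.< n → ν m < ν n
    ν-mono-< {m} {n} m<n = toℚᵘ-cancel-< (ℚᵘₚ.<-respˡ-≃ (ℚᵘₚ.≃-sym (ιᵘ m)) (ℚᵘₚ.<-respʳ-≃ (ℚᵘₚ.≃-sym (ιᵘ n))
      (ℚᵘ.*<* (ℤₚ.*-monoʳ-<-pos (+ 1) (ℤ.+<+ m<n)))))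

    ν-cancel : ∀ {m n} → ν m ≤ ν n → m ℕ.≤ n
    ν-cancel {m} {n} p with m ℕ.≤? n
    ... | yes q = q
    ... | no q = ⊥-elim (<-irrefl refl (<-≤-trans (ν-mono-< (ℕₚ.≰⇒> q)) p))

    0≤ν : ∀ n → 0ℚ ≤ ν n
    0≤ν n = ν-mono {0} {n} ℕ.z≤n

    0<ν : ∀ {n} → 0 ℕ.< n → 0ℚ < ν n
    0<ν = ν-mono-< {0}

    1≤ν : ∀ {n} → 0 ℕ.< n → 1ℚ ≤ ν n
    1≤ν = ν-mono {1}

    νρ : ∀ {n} → 0 ℕ.< n → ν n * ρ n ≡ 1ℚ
    νρ {suc n} _ = toℚᵘ-injective (ℚᵘₚ.≃-trans (toℚᵘ-homo-* (ν (suc n)) (ρ (suc n)))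
      (ℚᵘₚ.≃-trans (ℚᵘₚ.*-cong (ιᵘ (suc n)) (recipᵘ n)) (ℚᵘ.*≡* eq)))
      where
      eq : ((+ suc n) ℤ.* (+ 1)) ℤ.* (+ 1) ≡ (+ 1) ℤ.* + (1 ℕ.* suc n)
      eq = trans (ℤₚ.*-identityʳ _) (trans (ℤₚ.*-identityʳ _)
             (sym (trans (ℤₚ.*-identityˡ _) (cong +_ (ℕₚ.*-identityˡ (suc n))))))

  ρν : ∀ {n} → 0 ℕ.< n → ρ n * ν n ≡ 1ℚ
  ρν {n} p = trans (*-comm (ρ n) (ν n)) (νρ p)

  0≤1 : 0ℚ ≤ 1ℚ
  0≤1 = subst (0ℚ ≤_) ν1 (0≤ν 1)

  0<1 : 0ℚ < 1ℚ
  0<1 = subst (0ℚ <_) ν1 (0<ν {1} (ℕ.s≤s ℕ.z≤n))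

  0<ρ : ∀ {n} → 0 ℕ.< n → 0ℚ < ρ n
  0<ρ {n} p = *-cancelˡ-< (0≤ν n) (subst₂ _<_ (sym (*-zeroʳ (ν n))) (sym (νρ p)) 0<1)

  0≤ρ : ∀ n → 0ℚ ≤ ρ n
  0≤ρ zero = ≡⇒≤ (sym ρ0)
  0≤ρ (suc n) = <⇒≤ (0<ρ (ℕ.s≤s ℕ.z≤n))

  *-cancelˡ-≡ : ∀ {a b c} → 0ℚ < a → a * b ≡ a * c → b ≡ c
  *-cancelˡ-≡ 0<a eq = ≤-antisym (*-cancelˡ 0<a (≡⇒≤ eq)) (*-cancelˡ 0<a (≡⇒≤ (sym eq)))

  ρ-* : ∀ m n → ρ (m ℕ.* n) ≡ ρ m * ρ n
  ρ-* zero n = trans ρ0 (sym (trans (cong (_* ρ n) ρ0) (*-zeroˡ (ρ n))))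
  ρ-* (suc m) zero = trans (cong ρ (ℕₚ.*-zeroʳ m)) (trans ρ0 (sym (trans (cong (ρ (suc m) *_) ρ0) (*-zeroʳ (ρ (suc m))))))
  ρ-* m@(suc _) n@(suc _) = *-cancelˡ-≡ (0<ν {m ℕ.* n} (ℕ.s≤s ℕ.z≤n))
    (trans (νρ {m ℕ.* n} (ℕ.s≤s ℕ.z≤n)) (sym (trans (cong (_* (ρ m * ρ n)) (ν-* m n))
    (trans (lem (ν m) (ν n) (ρ m) (ρ n)) (cong₂ _*_ (νρ {m} (ℕ.s≤s ℕ.z≤n)) (νρ {n} (ℕ.s≤s ℕ.z≤n)))))))
    where
    lem : ∀ a b c d → a * b * (c * d) ≡ (a * c) * (b * d)
    lem = solve-∀ ringℚ

  ρ-anti : ∀ {m n} → 0 ℕ.< m → m ℕ.≤ n → ρ n ≤ ρ m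
  ρ-anti {m} {n} 0<m m≤n = *-cancelˡ (0<ν 0<n) (*-cancelˡ (0<ν 0<m) (≤-trans (≡⇒≤ e1) (≤-trans (ν-mono m≤n) (≡⇒≤ e2))))
    where
    0<n = ℕₚ.≤-trans 0<m m≤n
    lem : ∀ a b c → a * (b * c) ≡ b * (a * c)
    lem = solve-∀ ringℚ
    e1 : ν m * (ν n * ρ n) ≡ ν m
    e1 = trans (cong (ν m *_) (νρ 0<n)) (*-identityʳ (ν m))
    e2 : ν n ≡ ν m * (ν n * ρ m)
    e2 = sym (trans (lem (ν m) (ν n) (ρ m)) (trans (cong (ν n *_) (νρ 0<m)) (*-identityʳ (ν n))))

  ρ≤1 : ∀ n → ρ n ≤ 1ℚ
  ρ≤1 zero = ≤-trans (≡⇒≤ ρ0) 0≤1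
  ρ≤1 (suc n) = subst (ρ (suc n) ≤_) ρ1 (ρ-anti {1} (ℕ.s≤s ℕ.z≤n) (ℕ.s≤s ℕ.z≤n))

-- Finite sums and products over lists.

module Sums where

  open Rat
  open import Data.Nat as ℕ using (ℕ; zero; suc)
  import Data.Nat.Properties as ℕₚ
  open import Data.Bool using (true; false; if_then_else_)
  open import Data.Rational
  open import Data.Rational.Properties
  open import Data.List using (List; []; _∷_; _++_; map; length; filter; concatMap)
  open import Data.List.Properties using (length-++)
  open import Data.List.Membership.Propositional using (_∈_)
  open import Data.List.Membership.Propositional.Properties using (∈-∃++; ∈-++⁻; ∈-++⁺ˡ; ∈-++⁺ʳ; ∈-filter⁻; ∈-map⁻)
  open import Data.List.Relation.Unary.Any using (here; there)
  open import Data.List.Relation.Unary.All as All using (All; []; _∷_)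
  import Data.List.Relation.Unary.AllPairs as AllPairs
  open AllPairs using ([]; _∷_)
  open import Data.List.Relation.Unary.Unique.Propositional using (Unique)
  open import Data.List.Relation.Binary.Permutation.Propositional using (_↭_; ↭-refl; ↭-trans; ↭-sym; prep)
  import Data.List.Relation.Binary.Permutation.Propositional as Perm
  open import Data.List.Relation.Binary.Permutation.Propositional.Properties using (shift; ↭-length)
  open import Data.Empty using (⊥; ⊥-elim)
  open import Data.Product using (∃-syntax; _,_; proj₁; proj₂)
  open import Data.Sum using (inj₁; inj₂)
  open import Function using (_∘_)
  open import Level using (0ℓ)
  open import Relation.Nullary using (yes; no; does)
  open import Relation.Unary using (Pred; Decidable)
  open import Relation.Binary.PropositionalEquality
  open import Tactic.RingSolver using (solve-∀)

  private
    variable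
      A B : Set

  ∑ : List A → (A → ℚ) → ℚ
  ∑ [] f = 0ℚ
  ∑ (x ∷ xs) f = f x + ∑ xs f

  ∑-cong : (xs : List A) {f g : A → ℚ} → (∀ {x} → x ∈ xs → f x ≡ g x) → ∑ xs f ≡ ∑ xs g
  ∑-cong [] eq = refl
  ∑-cong (x ∷ xs) eq = cong₂ _+_ (eq (here refl)) (∑-cong xs (eq ∘ there))

  ∑-mono : (xs : List A) {f g : A → ℚ} → (∀ {x} → x ∈ xs → f x ≤ g x) → ∑ xs f ≤ ∑ xs g
  ∑-mono [] le = ≤-refl
  ∑-mono (x ∷ xs) le = +-mono-≤ (le (here refl)) (∑-mono xs (le ∘ there))

  ∑-nonneg : (xs : List A) {f : A → ℚ} → (∀ {x} → x ∈ xs → 0ℚ ≤ f x) → 0ℚ ≤ ∑ xs f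
  ∑-nonneg [] le = ≤-refl
  ∑-nonneg (x ∷ xs) le = 0≤+ (le (here refl)) (∑-nonneg xs (le ∘ there))

  ∑-zero : (xs : List A) {f : A → ℚ} → (∀ {x} → x ∈ xs → f x ≡ 0ℚ) → ∑ xs f ≡ 0ℚ
  ∑-zero [] eq = refl
  ∑-zero (x ∷ xs) eq = trans (cong₂ _+_ (eq (here refl)) (∑-zero xs (eq ∘ there))) (+-identityˡ 0ℚ)

  ∑-++ : (xs ys : List A) (f : A → ℚ) → ∑ (xs ++ ys) f ≡ ∑ xs f + ∑ ys f
  ∑-++ [] ys f = sym (+-identityˡ (∑ ys f))
  ∑-++ (x ∷ xs) ys f = trans (cong (λ z → f x + z) (∑-++ xs ys f)) (sym (+-assoc (f x) (∑ xs f) (∑ ys f)))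

  ∑-map : (h : A → B) (xs : List A) (f : B → ℚ) → ∑ (map h xs) f ≡ ∑ xs (λ x → f (h x))
  ∑-map h [] f = refl
  ∑-map h (x ∷ xs) f = cong (λ z → f (h x) + z) (∑-map h xs f)

  ∑-concatMap : (h : A → List B) (xs : List A) (f : B → ℚ) →
    ∑ (concatMap h xs) f ≡ ∑ xs (λ x → ∑ (h x) f)
  ∑-concatMap h [] f = refl
  ∑-concatMap h (x ∷ xs) f = trans (∑-++ (h x) (concatMap h xs) f) (cong (λ z → ∑ (h x) f + z) (∑-concatMap h xs f))

  ∑-*ˡ : (xs : List A) (c : ℚ) (f : A → ℚ) → ∑ xs (λ x → c * f x) ≡ c * ∑ xs f
  ∑-*ˡ [] c f = sym (*-zeroʳ c)
  ∑-*ˡ (x ∷ xs) c f = trans (cong (λ z → c * f x + z) (∑-*ˡ xs c f)) (sym (*-distribˡ-+ c (f x) (∑ xs f)))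

  ∑-*ʳ : (xs : List A) (c : ℚ) (f : A → ℚ) → ∑ xs (λ x → f x * c) ≡ ∑ xs f * c
  ∑-*ʳ xs c f = trans (∑-cong xs (λ {x} _ → *-comm (f x) c)) (trans (∑-*ˡ xs c f) (*-comm c (∑ xs f)))

  ∑-+ : (xs : List A) (f g : A → ℚ) → ∑ xs (λ x → f x + g x) ≡ ∑ xs f + ∑ xs g
  ∑-+ [] f g = sym (+-identityˡ 0ℚ)
  ∑-+ (x ∷ xs) f g = trans (cong (λ z → f x + g x + z) (∑-+ xs f g)) (lem (f x) (g x) (∑ xs f) (∑ xs g))
    where
    lem : ∀ a b c d → a + b + (c + d) ≡ a + c + (b + d)
    lem = solve-∀ ringℚ

  ∑-swap : (xs : List A) (ys : List B) (f : A → B → ℚ) →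
    ∑ xs (λ x → ∑ ys (f x)) ≡ ∑ ys (λ y → ∑ xs (λ x → f x y))
  ∑-swap [] ys f = sym (∑-zero ys (λ _ → refl))
  ∑-swap (x ∷ xs) ys f = trans (cong (λ z → ∑ ys (f x) + z) (∑-swap xs ys f))
    (sym (∑-+ ys (f x) (λ y → ∑ xs (λ x′ → f x′ y))))

  ∑-* : (xs : List A) (ys : List B) (f : A → ℚ) (g : B → ℚ) →
    ∑ xs f * ∑ ys g ≡ ∑ xs (λ x → ∑ ys (λ y → f x * g y))
  ∑-* xs ys f g = trans (sym (∑-*ʳ xs (∑ ys g) f)) (∑-cong xs (λ {x} _ → sym (∑-*ˡ ys (f x) g)))

  ∑-const : (xs : List A) (c : ℚ) → ∑ xs (λ _ → c) ≡ ν (length xs) * c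
  ∑-const [] c = sym (trans (cong (_* c) ν0) (*-zeroˡ c))
  ∑-const (x ∷ xs) c = trans (cong (c +_) (∑-const xs c))
    (sym (trans (cong (_* c) (ν-suc (length xs))) (lem (ν (length xs)) c)))
    where
    lem : ∀ n c → (1ℚ + n) * c ≡ c + n * c
    lem = solve-∀ ringℚ

  ∑-1 : (xs : List A) → ∑ xs (λ _ → 1ℚ) ≡ ν (length xs)
  ∑-1 xs = trans (∑-const xs 1ℚ) (*-identityʳ _)

  ∑-filter : {P : Pred A 0ℓ} (P? : Decidable P) (xs : List A) (f : A → ℚ) →
    ∑ (filter P? xs) f ≡ ∑ xs (λ x → if does (P? x) then f x else 0ℚ)
  ∑-filter P? [] f = refl
  ∑-filter P? (x ∷ xs) f with does (P? x)
  ... | true = cong (λ z → f x + z) (∑-filter P? xs f)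
  ... | false = trans (∑-filter P? xs f) (sym (+-identityˡ _))

  ∑-↭ : {xs ys : List A} (f : A → ℚ) → xs ↭ ys → ∑ xs f ≡ ∑ ys f
  ∑-↭ f Perm.refl = refl
  ∑-↭ f (prep x p) = cong (λ z → f x + z) (∑-↭ f p)
  ∑-↭ f (Perm.swap {xs = xs} {ys = ys} x y p) = trans (cong (λ z → f x + (f y + z)) (∑-↭ f p)) (lem (f x) (f y) (∑ ys f))
    where
    lem : ∀ a b c → a + (b + c) ≡ b + (a + c)
    lem = solve-∀ ringℚ
  ∑-↭ f (Perm.trans p q) = trans (∑-↭ f p) (∑-↭ f q)

  ∉⇒≢ : {x y : A} {xs : List A} → y ∈ xs → All (x ≢_) xs → x ≢ y
  ∉⇒≢ y∈ all = All.lookup all y∈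

  -- The source of all comparisons of sums over nested sets, and of the fact that an injective
  -- self-map of a finite set permutes it.
  complement : {xs ys : List A} → Unique xs → (∀ {x} → x ∈ xs → x ∈ ys) → ∃[ zs ] ys ↭ xs ++ zs
  complement {xs = []} {ys} _ _ = ys , ↭-refl
  complement {xs = x ∷ xs} (x∉ ∷ u) sub with ∈-∃++ (sub (here refl))
  ... | as , bs , refl = proj₁ rec , ↭-trans (shift x as bs) (prep x (proj₂ rec))
    where
    sub′ : ∀ {y} → y ∈ xs → y ∈ as ++ bs
    sub′ {y} y∈ with ∈-++⁻ as (sub (there y∈))
    ... | inj₁ p = ∈-++⁺ˡ p
    ... | inj₂ (here refl) = ⊥-elim (∉⇒≢ y∈ x∉ refl)
    ... | inj₂ (there p) = ∈-++⁺ʳ as p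
    rec = complement u sub′

  ∑-⊆ : {xs ys : List A} {f : A → ℚ} → Unique xs → (∀ {x} → x ∈ xs → x ∈ ys) →
    (∀ x → 0ℚ ≤ f x) → ∑ xs f ≤ ∑ ys f
  ∑-⊆ {xs = xs} {ys} {f} u sub nn with complement u sub
  ... | zs , p = ≤-by (∑ zs f) (∑-nonneg zs (λ {x} _ → nn x)) (trans (∑-↭ f p) (∑-++ xs zs f))

  length-⊆ : {xs ys : List A} → Unique xs → (∀ {x} → x ∈ xs → x ∈ ys) → length xs ℕ.≤ length ys
  length-⊆ {xs = xs} {ys} u sub with complement u sub
  ... | zs , p = ℕₚ.≤-trans (ℕₚ.m≤m+n (length xs) (length zs))
    (ℕₚ.≤-reflexive (sym (trans (↭-length p) (length-++ xs))))

  ⊆⇒↭ : {xs ys : List A} → Unique xs → (∀ {x} → x ∈ xs → x ∈ ys) → length ys ℕ.≤ length xs → ys ↭ xs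
  ⊆⇒↭ {xs = xs} {ys} u sub le with complement u sub
  ... | [] , p = ↭-trans p (Perm.↭-reflexive (++-[] xs))
    where
    ++-[] : (l : List A) → l ++ [] ≡ l
    ++-[] [] = refl
    ++-[] (x ∷ l) = cong (x ∷_) (++-[] l)
  ... | z ∷ zs , p = ⊥-elim (ℕₚ.<-irrefl refl (ℕₚ.<-≤-trans lt le))
    where
    lt : length xs ℕ.< length ys
    lt = ℕₚ.≤-trans (ℕₚ.m<m+n (length xs) {suc (length zs)} (ℕ.s≤s ℕ.z≤n))
           (ℕₚ.≤-reflexive (sym (trans (↭-length p) (length-++ xs))))

  map-unique : {h : A → B} {xs : List A} → (∀ {x y} → x ∈ xs → y ∈ xs → h x ≡ h y → x ≡ y) →
    Unique xs → Unique (map h xs)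
  map-unique inj [] = []
  map-unique {h = h} {x ∷ xs} inj (x∉ ∷ u) = go xs (λ y∈ → y∈) ∷ map-unique (λ p q → inj (there p) (there q)) u
    where
    go : ∀ ys → (∀ {y} → y ∈ ys → y ∈ xs) → All (h x ≢_) (map h ys)
    go [] sub = []
    go (y ∷ ys) sub = (λ eq → ∉⇒≢ (sub (here refl)) x∉ (inj (here refl) (there (sub (here refl))) eq)) ∷ go ys (sub ∘ there)

  ++-unique : {xs ys : List A} → Unique xs → Unique ys → (∀ {x} → x ∈ xs → x ∈ ys → ⊥) → Unique (xs ++ ys)
  ++-unique [] v d = v
  ++-unique {xs = x ∷ xs} {ys} (x∉ ∷ u) v d = All.tabulate lem ∷ ++-unique u v (d ∘ there)
    where
    lem : ∀ {y} → y ∈ xs ++ ys → x ≢ y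
    lem y∈ refl with ∈-++⁻ xs y∈
    ... | inj₁ p = ∉⇒≢ p x∉ refl
    ... | inj₂ p = d (here refl) p

  filter-unique : {P : Pred A 0ℓ} (P? : Decidable P) {xs : List A} → Unique xs → Unique (filter P? xs)
  filter-unique P? [] = []
  filter-unique P? {x ∷ xs} (x∉ ∷ u) with does (P? x)
  ... | true = All.tabulate (λ y∈ → ∉⇒≢ (proj₁ (∈-filter⁻ P? y∈)) x∉) ∷ filter-unique P? u
  ... | false = filter-unique P? u

  below : ℕ → List ℕ
  below zero = []
  below (suc n) = n ∷ below n

  ∈-below : ∀ {i n} → i ℕ.< n → i ∈ below n
  ∈-below {i} {suc n} i<n with i ℕ.≟ n
  ... | yes refl = here refl
  ... | no i≢n = there (∈-below (ℕₚ.≤∧≢⇒< (ℕ.s≤s⁻¹ i<n) i≢n))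

  below-< : ∀ {i n} → i ∈ below n → i ℕ.< n
  below-< {n = suc n} (here refl) = ℕₚ.n<1+n n
  below-< {n = suc n} (there p) = ℕₚ.m<n⇒m<1+n (below-< p)

  below-unique : ∀ n → Unique (below n)
  below-unique zero = []
  below-unique (suc n) = All.tabulate (λ y∈ eq → ℕₚ.<-irrefl (sym eq) (below-< y∈)) ∷ below-unique n

  length-below : ∀ n → length (below n) ≡ n
  length-below zero = refl
  length-below (suc n) = cong suc (length-below n)

  ∏ : List A → (A → ℚ) → ℚ
  ∏ [] f = 1ℚ
  ∏ (x ∷ xs) f = f x * ∏ xs f

  ∏-cong : (xs : List A) {f g : A → ℚ} → (∀ {x} → x ∈ xs → f x ≡ g x) → ∏ xs f ≡ ∏ xs g
  ∏-cong [] eq = refl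
  ∏-cong (x ∷ xs) eq = cong₂ _*_ (eq (here refl)) (∏-cong xs (eq ∘ there))

  ∏-one : (xs : List A) {f : A → ℚ} → (∀ {x} → x ∈ xs → f x ≡ 1ℚ) → ∏ xs f ≡ 1ℚ
  ∏-one [] eq = refl
  ∏-one (x ∷ xs) eq = trans (cong₂ _*_ (eq (here refl)) (∏-one xs (eq ∘ there))) (*-identityˡ 1ℚ)

  ∏-* : (xs : List A) (f g : A → ℚ) → ∏ xs (λ x → f x * g x) ≡ ∏ xs f * ∏ xs g
  ∏-* [] f g = sym (*-identityˡ 1ℚ)
  ∏-* (x ∷ xs) f g = trans (cong (λ z → f x * g x * z) (∏-* xs f g)) (lem (f x) (g x) (∏ xs f) (∏ xs g))
    where
    lem : ∀ a b c d → a * b * (c * d) ≡ a * c * (b * d)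
    lem = solve-∀ ringℚ

  ∏-nonneg : (xs : List A) {f : A → ℚ} → (∀ {x} → x ∈ xs → 0ℚ ≤ f x) → 0ℚ ≤ ∏ xs f
  ∏-nonneg [] le = 0≤1
  ∏-nonneg (x ∷ xs) le = 0≤* (le (here refl)) (∏-nonneg xs (le ∘ there))

  ∏-mono : (xs : List A) {f g : A → ℚ} → (∀ {x} → x ∈ xs → 0ℚ ≤ f x) →
    (∀ {x} → x ∈ xs → f x ≤ g x) → ∏ xs f ≤ ∏ xs g
  ∏-mono [] nn le = ≤-refl
  ∏-mono (x ∷ xs) nn le = *-mono (nn (here refl)) (∏-nonneg xs (nn ∘ there)) (le (here refl)) (∏-mono xs (nn ∘ there) (le ∘ there))

-- Congruences between natural numbers.

module Mod where

  open import Data.Nat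
  open import Data.Nat.Properties
  open import Data.Nat.DivMod
  open import Data.Nat.Divisibility
  open import Data.Nat.Coprimality as Coprimality using (Coprime; coprime-Bézout)
  open import Data.Nat.GCD using (module Bézout)
  open import Data.Nat.Primality
  open import Data.Nat.Tactic.RingSolver using (solve-∀)
  open import Data.Empty using (⊥-elim)
  open import Data.Product using (∃-syntax; _,_)
  open import Data.Sum using (inj₁; inj₂)
  open import Relation.Nullary using (¬_)
  open import Relation.Binary.PropositionalEquality

  infix 4 _≈_[_]

  -- Congruence without subtraction: each side may be raised by multiples of the modulus. Modulo 0
  -- it is equality.
  _≈_[_] : ℕ → ℕ → ℕ → Set
  a ≈ b [ n ] = ∃[ i ] ∃[ j ] a + i * n ≡ b + j * n

  ≈-refl : ∀ {a n} → a ≈ a [ n ]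
  ≈-refl = 0 , 0 , refl

  ≡⇒≈ : ∀ {a b n} → a ≡ b → a ≈ b [ n ]
  ≡⇒≈ refl = ≈-refl

  ≈-sym : ∀ {a b n} → a ≈ b [ n ] → b ≈ a [ n ]
  ≈-sym (i , j , eq) = j , i , sym eq

  ≈-trans : ∀ {a b c n} → a ≈ b [ n ] → b ≈ c [ n ] → a ≈ c [ n ]
  ≈-trans {a} {b} {c} {n} (i , j , e) (k , l , e′) = i + k , j + l , (begin
    a + (i + k) * n      ≡⟨ lem a i k n ⟩
    a + i * n + k * n    ≡⟨ cong (_+ k * n) e ⟩
    b + j * n + k * n    ≡⟨ lem₂ b j k n ⟩
    b + k * n + j * n    ≡⟨ cong (_+ j * n) e′ ⟩
    c + l * n + j * n    ≡⟨ lem₃ c l j n ⟩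
    c + (j + l) * n      ∎)
    where
    open ≡-Reasoning
    lem : ∀ a i k n → a + (i + k) * n ≡ a + i * n + k * n
    lem = solve-∀
    lem₂ : ∀ b j k n → b + j * n + k * n ≡ b + k * n + j * n
    lem₂ = solve-∀
    lem₃ : ∀ c l j n → c + l * n + j * n ≡ c + (j + l) * n
    lem₃ = solve-∀

  ≈-+ : ∀ {a b c d n} → a ≈ b [ n ] → c ≈ d [ n ] → a + c ≈ b + d [ n ]
  ≈-+ {a} {b} {c} {d} {n} (i , j , e) (k , l , e′) =
    i + k , j + l , trans (lem a c i k n) (trans (cong₂ _+_ e e′) (sym (lem b d j l n)))
    where
    lem : ∀ a c i k n → a + c + (i + k) * n ≡ (a + i * n) + (c + k * n)
    lem = solve-∀

  ≈-* : ∀ {a b c d n} → a ≈ b [ n ] → c ≈ d [ n ] → a * c ≈ b * d [ n ]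
  ≈-* {a} {b} {c} {d} {n} (i , j , e) (k , l , e′) =
    a * k + i * c + i * k * n , b * l + j * d + j * l * n ,
    trans (lem a c i k n) (trans (cong₂ _*_ e e′) (sym (lem b d j l n)))
    where
    lem : ∀ a c i k n → a * c + (a * k + i * c + i * k * n) * n ≡ (a + i * n) * (c + k * n)
    lem = solve-∀

  ≈-^ : ∀ {a b n} k → a ≈ b [ n ] → a ^ k ≈ b ^ k [ n ]
  ≈-^ zero e = ≈-refl
  ≈-^ (suc k) e = ≈-* e (≈-^ k e)

  1^≈1 : ∀ {a n} k → a ≈ 1 [ n ] → a ^ k ≈ 1 [ n ]
  1^≈1 {a} {n} k e = subst (λ z → a ^ k ≈ z [ n ]) (^-zeroˡ k) (≈-^ k e)

  +-multiple-≈ : ∀ a k n → a + k * n ≈ a [ n ]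
  +-multiple-≈ a k n = 0 , k , +-identityʳ _

  ≈⇒% : ∀ {a b n} .{{_ : NonZero n}} → a ≈ b [ n ] → a % n ≡ b % n
  ≈⇒% {a} {b} {n} (i , j , e) = trans (sym ([m+kn]%n≡m%n a i n)) (trans (cong (_% n) e) ([m+kn]%n≡m%n b j n))

  %-≈ : ∀ a n .{{_ : NonZero n}} → a % n ≈ a [ n ]
  %-≈ a n = a / n , 0 , trans (sym (m≡m%n+[m/n]*n a n)) (sym (+-identityʳ a))

  %⇒≈ : ∀ {a b} n .{{_ : NonZero n}} → a % n ≡ b % n → a ≈ b [ n ]
  %⇒≈ {a} {b} n e = ≈-trans (≈-sym (%-≈ a n)) (≈-trans (≡⇒≈ e) (%-≈ b n))

  ∣⇒≈0 : ∀ {a n} → n ∣ a → a ≈ 0 [ n ]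
  ∣⇒≈0 {n = n} (divides q refl) = +-multiple-≈ 0 q n

  ≈0⇒∣ : ∀ {a n} → a ≈ 0 [ n ] → n ∣ a
  ≈0⇒∣ {a} {n} (i , j , e) = ∣m+n∣m⇒∣n (divides j (trans (+-comm (i * n) a) e)) (divides i refl)

  ≈-small : ∀ {a b n} → a < n → b < n → a ≈ b [ n ] → a ≡ b
  ≈-small {a} {b} {n@(suc _)} a<n b<n e = trans (sym (m<n⇒m%n≡m a<n)) (trans (≈⇒% e) (m<n⇒m%n≡m b<n))

  ≈-+-cancelˡ : ∀ c {a b n} → c + a ≈ c + b [ n ] → a ≈ b [ n ]
  ≈-+-cancelˡ c {a} {b} {n} (i , j , e) = i , j ,
    +-cancelˡ-≡ c _ _ (trans (sym (+-assoc c a (i * n))) (trans e (+-assoc c b (j * n))))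

  ≈-∣ : ∀ {a b m n} → m ∣ n → a ≈ b [ n ] → a ≈ b [ m ]
  ≈-∣ {a} {b} {m} (divides q refl) (i , j , e) = i * q , j * q ,
    trans (cong (a +_) (*-assoc i q m)) (trans e (sym (cong (b +_) (*-assoc j q m))))

  inverse : ∀ {a n} → Coprime a n → 0 < n → ∃[ u ] u * a ≈ 1 [ n ]
  inverse {a} {suc n′} c _ with coprime-Bézout c
  ... | Bézout.+- x y eq = x , 0 , y , trans (+-identityʳ _) (sym eq)
  -- Here 1 + x a = y n, so the inverse is -x, represented by x (n - 1).
  ... | Bézout.-+ x y eq = x * n′ , 1 , y * n′ ,
    trans (lem x n′ a) (cong suc (trans (cong (_* n′) eq) (lem₂ y n′)))
    where
    lem : ∀ x n a → x * n * a + 1 * suc n ≡ suc ((1 + x * a) * n)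
    lem = solve-∀
    lem₂ : ∀ y n → y * suc n * n ≡ y * n * suc n
    lem₂ = solve-∀

  ≈-*-cancelʳ : ∀ {a b c n} → Coprime c n → 0 < n → a * c ≈ b * c [ n ] → a ≈ b [ n ]
  ≈-*-cancelʳ {a} {b} {c} {n} cop 0<n e with inverse cop 0<n
  ... | u , eu = ≈-trans (≈-sym (step a)) (≈-trans (≈-* e ≈-refl) (step b))
    where
    lem : ∀ x c u → x * (u * c) ≡ x * c * u
    lem = solve-∀
    step : ∀ x → x * c * u ≈ x [ n ]
    step x = ≈-trans (≡⇒≈ (sym (lem x c u))) (subst (λ z → x * (u * c) ≈ z [ n ]) (*-identityʳ x) (≈-* (≈-refl {x}) eu))

  prime⇒0< : ∀ {p} → Prime p → 0 < p
  prime⇒0< {p} pp = >-nonZero⁻¹ p {{prime⇒nonZero pp}}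

  prime⇒1< : ∀ {p} → Prime p → 1 < p
  prime⇒1< {p} pp = nonTrivial⇒n>1 p {{prime⇒nonTrivial pp}}

  prime-∤⇒coprime : ∀ {p m} → Prime p → ¬ (p ∣ m) → Coprime p m
  prime-∤⇒coprime pp p∤m {d} (d∣p , d∣m) with prime⇒irreducible pp d∣p
  ... | inj₁ d≡1 = d≡1
  ... | inj₂ refl = ⊥-elim (p∤m d∣m)

  prime-∣-prime : ∀ {p q} → Prime p → Prime q → p ∣ q → p ≡ q
  prime-∣-prime pp pq p∣q with prime⇒irreducible pq p∣q
  ... | inj₁ refl = ⊥-elim (¬prime[1] pp)
  ... | inj₂ eq = eq

  prime-∣-^ : ∀ {p} a k → Prime p → p ∣ a ^ k → p ∣ a
  prime-∣-^ a zero pp d = ⊥-elim (¬prime[1] (subst Prime (∣1⇒≡1 d) pp))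
  prime-∣-^ a (suc k) pp d with euclidsLemma a (a ^ k) pp d
  ... | inj₁ p∣a = p∣a
  ... | inj₂ p∣a^k = prime-∣-^ a k pp p∣a^k

-- Complete sums of periodic functions and the large sieve.

module Sieve where

  open Rat
  open Sums
  open Mod
  open import Data.Nat as ℕ using (ℕ; zero; suc; NonZero)
  import Data.Nat.Properties as ℕₚ
  open import Data.Nat.DivMod using (_%_; _/_; m≡m%n+[m/n]*n; m%n<n)
  open import Data.Nat.Divisibility using (_∣_; _∣?_; divides; ∣1⇒≡1)
  open import Data.Nat.Coprimality as Coprimality using (Coprime)
  open import Data.Nat.Primality using (Prime; euclidsLemma; prime⇒nonZero; ¬prime[1])
  open import Data.Bool using (true; false; if_then_else_; _∨_)
  import Data.Bool.Properties as Boolₚ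
  open import Data.Rational hiding (NonZero; _/_)
  open import Data.Rational.Properties
  open import Data.List using (List; []; _∷_; map; length)
  open import Data.List.Properties using (length-map)
  open import Data.List.Membership.Propositional using (_∈_)
  open import Data.List.Membership.Propositional.Properties using (∈-map⁻)
  open import Data.List.Relation.Unary.Any using (here; there)
  open import Data.List.Relation.Unary.All as All using ([]; _∷_)
  import Data.List.Relation.Unary.AllPairs as AllPairs
  open AllPairs using ([]; _∷_)
  open import Data.List.Relation.Unary.Unique.Propositional using (Unique)
  open import Data.Empty using (⊥-elim)
  open import Data.Product using (∃-syntax; _×_; _,_; proj₁; proj₂)
  open import Data.Sum using (_⊎_; inj₁; inj₂)
  open import Function using (_∘_)
  open import Relation.Nullary using (Dec; yes; no; ¬_; does)
  open import Relation.Nullary.Decidable using (dec-true; dec-false)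
  open import Relation.Binary.PropositionalEquality
  open import Tactic.RingSolver using (solve-∀)

  Periodic : ℕ → (ℕ → ℚ) → Set
  Periodic m f = ∀ n → f (n ℕ.+ m) ≡ f n

  periodic-* : ∀ {m f} → Periodic m f → ∀ n k → f (n ℕ.+ k ℕ.* m) ≡ f n
  periodic-* {f = f} per n zero = cong f (ℕₚ.+-identityʳ n)
  periodic-* {m} {f} per n (suc k) = trans (cong f eq) (trans (per (n ℕ.+ k ℕ.* m)) (periodic-* per n k))
    where
    eq : n ℕ.+ (m ℕ.+ k ℕ.* m) ≡ n ℕ.+ k ℕ.* m ℕ.+ m
    eq = trans (cong (n ℕ.+_) (ℕₚ.+-comm m (k ℕ.* m))) (sym (ℕₚ.+-assoc n (k ℕ.* m) m))

  periodic-≈ : ∀ {m f a b} → Periodic m f → a ≈ b [ m ] → f a ≡ f b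
  periodic-≈ {f = f} {a} {b} per (i , j , e) = trans (sym (periodic-* per a i)) (trans (cong f e) (periodic-* per b j))

  periodic-∣ : ∀ {m n f} → m ∣ n → Periodic m f → Periodic n f
  periodic-∣ (divides q refl) per k = periodic-* per k q

  ∑-below-+ : ∀ a b (f : ℕ → ℚ) → ∑ (below (a ℕ.+ b)) f ≡ ∑ (below a) (λ i → f (i ℕ.+ b)) + ∑ (below b) f
  ∑-below-+ zero b f = sym (+-identityˡ _)
  ∑-below-+ (suc a) b f = trans (cong (λ z → f (a ℕ.+ b) + z) (∑-below-+ a b f)) (sym (+-assoc (f (a ℕ.+ b)) _ _))

  ∑-below-* : ∀ k m (f : ℕ → ℚ) → ∑ (below (k ℕ.* m)) f ≡ ∑ (below k) (λ j → ∑ (below m) (λ i → f (i ℕ.+ j ℕ.* m)))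
  ∑-below-* zero m f = refl
  ∑-below-* (suc k) m f = trans (∑-below-+ m (k ℕ.* m) f) (cong (λ z → ∑ (below m) (λ i → f (i ℕ.+ k ℕ.* m)) + z) (∑-below-* k m f))

  ∑-below-periods : ∀ {m f} → Periodic m f → ∀ k → ∑ (below (k ℕ.* m)) f ≡ ν k * ∑ (below m) f
  ∑-below-periods {m} {f} per k = trans (∑-below-* k m f)
    (trans (∑-cong (below k) (λ {j} _ → ∑-cong (below m) (λ {i} _ → periodic-* per i j)))
    (trans (∑-const (below k) _) (cong (λ z → ν z * ∑ (below m) f) (length-below k))))

  -- Since m is invertible modulo p, the map j ↦ i + j m permutes the residues modulo p.
  ∑-affine : ∀ {p m f} → 0 ℕ.< p → Coprime m p → Periodic p f → ∀ i →
    ∑ (below p) (λ j → f (i ℕ.+ j ℕ.* m)) ≡ ∑ (below p) f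
  ∑-affine {p@(suc _)} {m} {f} 0<p cop per i =
    trans (∑-cong (below p) (λ {j} _ → periodic-≈ per (≈-sym (%-≈ (i ℕ.+ j ℕ.* m) p))))
    (trans (sym (∑-map h (below p) f)) (sym (∑-↭ f (⊆⇒↭ uniq sub len))))
    where
    h : ℕ → ℕ
    h j = (i ℕ.+ j ℕ.* m) % p
    inj : ∀ {x y} → x ∈ below p → y ∈ below p → h x ≡ h y → x ≡ y
    inj x∈ y∈ eq = ≈-small (below-< x∈) (below-< y∈) (≈-*-cancelʳ cop 0<p (≈-+-cancelˡ i (%⇒≈ p eq)))
    uniq : Unique (map h (below p))
    uniq = map-unique inj (below-unique p)
    sub : ∀ {x} → x ∈ map h (below p) → x ∈ below p
    sub x∈ with ∈-map⁻ h {xs = below p} x∈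
    ... | j , _ , refl = ∈-below (m%n<n (i ℕ.+ j ℕ.* m) p)
    len : length (below p) ℕ.≤ length (map h (below p))
    len = ℕₚ.≤-reflexive (sym (length-map h (below p)))

  -- Write n = i + j m and sum over j first: `b` depends only on i, while the argument of `a` runs
  -- through all residues modulo p.
  ∑-crt : ∀ {p m a b} → 0 ℕ.< p → Coprime m p → Periodic p a → Periodic m b →
    ∑ (below (p ℕ.* m)) (λ n → a n * b n) ≡ ∑ (below p) a * ∑ (below m) b
  ∑-crt {p} {m} {a} {b} 0<p cop pa pb =
    trans (∑-below-* p m (λ n → a n * b n))
    (trans (∑-swap (below p) (below m) (λ j i → a (i ℕ.+ j ℕ.* m) * b (i ℕ.+ j ℕ.* m)))
    (trans (∑-cong (below m) (λ {i} _ → trans (∑-cong (below p) (λ {j} _ → cong (a (i ℕ.+ j ℕ.* m) *_) (periodic-* pb i j)))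
       (trans (∑-*ʳ (below p) (b i) (λ j → a (i ℕ.+ j ℕ.* m))) (cong (_* b i) (∑-affine {f = a} 0<p cop pa i)))))
    (∑-*ˡ (below m) (∑ (below p) a) b)))

  Π : {A : Set} → List A → (A → ℕ) → ℕ
  Π [] f = 1
  Π (x ∷ xs) f = f x ℕ.* Π xs f

  ν-Π : {A : Set} (xs : List A) (f : A → ℕ) → ν (Π xs f) ≡ ∏ xs (λ x → ν (f x))
  ν-Π [] f = ν1
  ν-Π (x ∷ xs) f = trans (ν-* (f x) (Π xs f)) (cong (ν (f x) *_) (ν-Π xs f))

  Π-mono : {A : Set} (xs : List A) {f g : A → ℕ} → (∀ {x} → x ∈ xs → f x ℕ.≤ g x) → Π xs f ℕ.≤ Π xs g
  Π-mono [] le = ℕₚ.≤-refl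
  Π-mono (x ∷ xs) le = ℕₚ.*-mono-≤ (le (here refl)) (Π-mono xs (le ∘ there))

  Π-* : {A : Set} (xs : List A) (f g : A → ℕ) → Π xs (λ x → f x ℕ.* g x) ≡ Π xs f ℕ.* Π xs g
  Π-* [] f g = refl
  Π-* (x ∷ xs) f g = trans (cong (f x ℕ.* g x ℕ.*_) (Π-* xs f g)) (ℕₚ.[m*n]*[o*p]≡[m*o]*[n*p] (f x) (g x) (Π xs f) (Π xs g))

  Π-cong : {A : Set} (xs : List A) {f g : A → ℕ} → (∀ {x} → x ∈ xs → f x ≡ g x) → Π xs f ≡ Π xs g
  Π-cong [] eq = refl
  Π-cong (x ∷ xs) eq = cong₂ ℕ._*_ (eq (here refl)) (Π-cong xs (eq ∘ there))

  Π-0< : {A : Set} (xs : List A) {f : A → ℕ} → (∀ {x} → x ∈ xs → 0 ℕ.< f x) → 0 ℕ.< Π xs f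
  Π-0< [] le = ℕ.s≤s ℕ.z≤n
  Π-0< (x ∷ xs) {f} le = ℕₚ.*-mono-≤ (le (here refl)) (Π-0< xs (le ∘ there))

  ∣-Π : {A : Set} {xs : List A} {f : A → ℕ} {x : A} → x ∈ xs → f x ∣ Π xs f
  ∣-Π {xs = y ∷ xs} {f} (here refl) = divides (Π xs f) (ℕₚ.*-comm (f y) (Π xs f))
  ∣-Π {xs = y ∷ xs} {f} (there x∈) with ∣-Π {f = f} x∈
  ... | divides q eq = divides (f y ℕ.* q) (trans (cong (f y ℕ.*_) eq) (sym (ℕₚ.*-assoc (f y) q _)))

  prime-∣-Π : {A : Set} {xs : List A} {f : A → ℕ} {p : ℕ} → Prime p → p ∣ Π xs f → ∃[ x ] (x ∈ xs × p ∣ f x)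
  prime-∣-Π {xs = []} pp d = ⊥-elim (¬prime[1] (subst Prime (∣1⇒≡1 d) pp))
  prime-∣-Π {xs = x ∷ xs} {f} pp d with euclidsLemma (f x) (Π xs f) pp d
  ... | inj₁ e = x , here refl , e
  ... | inj₂ e with prime-∣-Π {xs = xs} pp e
  ...   | y , y∈ , e′ = y , there y∈ , e′

  ∏-periodic : (ps : List ℕ) (m : ℕ → ℕ) (h : ℕ → ℕ → ℚ) → (∀ {p} → p ∈ ps → Periodic (m p) (h p)) →
    Periodic (Π ps m) (λ n → ∏ ps (λ p → h p n))
  ∏-periodic ps m h per n = ∏-cong ps (λ p∈ → periodic-∣ (∣-Π {f = m} p∈) (per p∈) n)

  -- The Chinese remainder theorem for a product of local factors. Allowing the period 1 lets the
  -- primes drop out on which the summand does not depend, which keeps the total period short.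
  ∑-∏ : (ps : List ℕ) (m : ℕ → ℕ) (h : ℕ → ℕ → ℚ) → Unique ps → (∀ {p} → p ∈ ps → Prime p) →
    (∀ {p} → p ∈ ps → m p ≡ p ⊎ m p ≡ 1) → (∀ {p} → p ∈ ps → Periodic (m p) (h p)) →
    ∑ (below (Π ps m)) (λ n → ∏ ps (λ p → h p n)) ≡ ∏ ps (λ p → ∑ (below (m p)) (h p))
  ∑-∏ [] m h u pr mp per = +-identityʳ 1ℚ
  ∑-∏ (p ∷ ps) m h (p∉ ∷ u) pr mp per =
    trans (∑-crt {m p} {Π ps m} {h p} {λ n → ∏ ps (λ q → h q n)} 0<mp cop (per (here refl)) (∏-periodic ps m h (per ∘ there)))
    (cong (∑ (below (m p)) (h p) *_) (∑-∏ ps m h u (pr ∘ there) (mp ∘ there) (per ∘ there)))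
    where
    pp = pr (here refl)
    0<mp : 0 ℕ.< m p
    0<mp with mp (here refl)
    ... | inj₁ e = subst (0 ℕ.<_) (sym e) (prime⇒0< pp)
    ... | inj₂ e = subst (0 ℕ.<_) (sym e) (ℕ.s≤s ℕ.z≤n)
    p∤ : ¬ (p ∣ Π ps m)
    p∤ d with prime-∣-Π {xs = ps} pp d
    ... | q , q∈ , e with mp (there q∈)
    ...   | inj₁ e′ = ∉⇒≢ q∈ p∉ (prime-∣-prime pp (pr (there q∈)) (subst (p ∣_) e′ e))
    ...   | inj₂ e′ = ¬prime[1] (subst Prime (∣1⇒≡1 (subst (p ∣_) e′ e)) pp)
    cop : Coprime (Π ps m) (m p)
    cop with mp (here refl)
    ... | inj₁ e = subst (Coprime (Π ps m)) (sym e) (Coprimality.sym (prime-∤⇒coprime pp p∤))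
    ... | inj₂ e = subst (Coprime (Π ps m)) (sym e) λ where (_ , d∣1) → ∣1⇒≡1 d∣1

  p≤∣p∣ : ∀ p → p ≤ ∣ p ∣
  p≤∣p∣ p with ≤-total 0ℚ p
  ... | inj₁ h = ≡⇒≤ (sym (0≤p⇒∣p∣≡p h))
  ... | inj₂ h = ≤-trans h (0≤∣p∣ p)

  ∣∏∣≤ : {A : Set} (xs : List A) {f g : A → ℚ} → (∀ {x} → x ∈ xs → ∣ f x ∣ ≤ g x) → ∣ ∏ xs f ∣ ≤ ∏ xs g
  ∣∏∣≤ [] le = ≡⇒≤ (0≤p⇒∣p∣≡p 0≤1)
  ∣∏∣≤ (x ∷ xs) {f} le = ≤-trans (≡⇒≤ (∣p*q∣≡∣p∣*∣q∣ (f x) (∏ xs f)))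
    (*-mono (0≤∣p∣ (f x)) (0≤∣p∣ (∏ xs f)) (le (here refl)) (∣∏∣≤ xs (le ∘ there)))

  ∏-zero : {A : Set} {xs : List A} {f : A → ℚ} {x : A} → x ∈ xs → f x ≡ 0ℚ → ∏ xs f ≡ 0ℚ
  ∏-zero {xs = y ∷ xs} {f} (here refl) e = trans (cong (_* ∏ xs f) e) (*-zeroˡ (∏ xs f))
  ∏-zero {xs = y ∷ xs} {f} (there x∈) e = trans (cong (f y *_) (∏-zero x∈ e)) (*-zeroʳ (f y))

  ∑-indicator : {A : Set} (_≟′_ : (x y : A) → Dec (x ≡ y)) {xs : List A} (x : A) (c : ℚ) → 0ℚ ≤ c → Unique xs →
    ∑ xs (λ y → if does (x ≟′ y) then c else 0ℚ) ≤ c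
  ∑-indicator _≟′_ {[]} x c 0≤c u = 0≤c
  ∑-indicator _≟′_ {y ∷ xs} x c 0≤c (y∉ ∷ u) with x ≟′ y
  ... | no _ = ≤-trans (≡⇒≤ (+-identityˡ _)) (∑-indicator _≟′_ x c 0≤c u)
  ... | yes refl = ≡⇒≤ (trans (cong (c +_) (∑-zero xs zeros)) (+-identityʳ c))
    where
    zeros : ∀ {z} → z ∈ xs → (if does (x ≟′ z) then c else 0ℚ) ≡ 0ℚ
    zeros {z} z∈ with x ≟′ z
    ... | no _ = refl
    ... | yes e = ⊥-elim (∉⇒≢ z∈ y∉ e)

  -- The functions f p are constant 1 on the residue classes that survive the sieve and have mean zero,
  -- so the products over the divisors of distinct squarefree numbers are orthogonal over a full period.
  module LargeSieve
    (P : List ℕ) (P-unique : Unique P) (P-prime : ∀ {p} → p ∈ P → Prime p)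
    (f : ℕ → ℕ → ℚ) (g : ℕ → ℚ)
    (f-periodic : ∀ {p} → p ∈ P → Periodic p (f p))
    (f-mean : ∀ {p} → p ∈ P → ∑ (below p) (f p) ≡ 0ℚ)
    (f-square : ∀ {p} → p ∈ P → g p * ∑ (below p) (λ n → f p n * f p n) ≡ ν p)
    (f-bound : ∀ {p} → p ∈ P → ∀ n → ∣ f p n ∣ ≤ ν p)
    (0≤g : ∀ {p} → p ∈ P → 0ℚ ≤ g p) (g≤1 : ∀ {p} → p ∈ P → g p ≤ 1ℚ)
    where

    -- `rad r ≡ r` is the way to say that r is squarefree with all its prime factors in `P`.
    rad : ℕ → ℕ
    rad r = Π P (λ p → if does (p ∣? r) then p else 1)

    G : ℕ → ℚ
    G r = ∏ P (λ p → if does (p ∣? r) then g p else 1ℚ)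

    E : ℕ → ℕ → ℕ → ℚ
    E r p n = if does (p ∣? r) then f p n else 1ℚ

    Ψ : ℕ → ℕ → ℚ
    Ψ r n = ∏ P (λ p → E r p n)

    0≤G : ∀ r → 0ℚ ≤ G r
    0≤G r = ∏-nonneg P lem
      where
      lem : ∀ {p} → p ∈ P → 0ℚ ≤ (if does (p ∣? r) then g p else 1ℚ)
      lem {p} p∈ with does (p ∣? r)
      ... | true = 0≤g p∈
      ... | false = 0≤1

    G≤1 : ∀ r → G r ≤ 1ℚ
    G≤1 r = ≤-trans (∏-mono P {g = λ _ → 1ℚ} lem₀ lem₁) (≡⇒≤ (∏-one P (λ _ → refl)))
      where
      lem₀ : ∀ {p} → p ∈ P → 0ℚ ≤ (if does (p ∣? r) then g p else 1ℚ)
      lem₀ {p} p∈ with does (p ∣? r)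
      ... | true = 0≤g p∈
      ... | false = 0≤1
      lem₁ : ∀ {p} → p ∈ P → (if does (p ∣? r) then g p else 1ℚ) ≤ 1ℚ
      lem₁ {p} p∈ with does (p ∣? r)
      ... | true = g≤1 p∈
      ... | false = ≤-refl

    ∣Ψ∣≤ : ∀ {r} → rad r ≡ r → ∀ n → ∣ Ψ r n ∣ ≤ ν r
    ∣Ψ∣≤ {r} e n = ≤-trans (∣∏∣≤ P lem) (≡⇒≤ (trans (sym (ν-Π P _)) (cong ν e)))
      where
      lem : ∀ {p} → p ∈ P → ∣ E r p n ∣ ≤ ν (if does (p ∣? r) then p else 1)
      lem {p} p∈ with does (p ∣? r)
      ... | true = f-bound p∈ n
      ... | false = ≡⇒≤ (trans (0≤p⇒∣p∣≡p 0≤1) (sym ν1))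

    module _ (r r′ : ℕ) where

      m : ℕ → ℕ
      m p = if does (p ∣? r) ∨ does (p ∣? r′) then p else 1

      h : ℕ → ℕ → ℚ
      h p n = E r p n * E r′ p n

      m-cases : ∀ {p} → p ∈ P → m p ≡ p ⊎ m p ≡ 1
      m-cases {p} _ with does (p ∣? r) ∨ does (p ∣? r′)
      ... | true = inj₁ refl
      ... | false = inj₂ refl

      h-periodic : ∀ {p} → p ∈ P → Periodic (m p) (h p)
      h-periodic {p} p∈ n with does (p ∣? r) | does (p ∣? r′)
      ... | true | true = cong₂ _*_ (f-periodic p∈ n) (f-periodic p∈ n)
      ... | true | false = cong (_* 1ℚ) (f-periodic p∈ n)
      ... | false | true = cong (1ℚ *_) (f-periodic p∈ n)
      ... | false | false = refl

      ΨΨ : ∀ n → Ψ r n * Ψ r′ n ≡ ∏ P (λ p → h p n)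
      ΨΨ n = sym (∏-* P (λ p → E r p n) (λ p → E r′ p n))

      complete : ∑ (below (Π P m)) (λ n → Ψ r n * Ψ r′ n) ≡ ∏ P (λ p → ∑ (below (m p)) (h p))
      complete = trans (∑-cong (below (Π P m)) (λ {n} _ → ΨΨ n)) (∑-∏ P m h P-unique P-prime m-cases h-periodic)

      ΨΨ-periodic : Periodic (Π P m) (λ n → Ψ r n * Ψ r′ n)
      ΨΨ-periodic n = trans (ΨΨ (n ℕ.+ Π P m)) (trans (∏-periodic P m h h-periodic n) (sym (ΨΨ n)))

      0<M : 0 ℕ.< Π P m
      0<M = Π-0< P lem
        where
        lem : ∀ {p} → p ∈ P → 0 ℕ.< m p
        lem {p} p∈ with does (p ∣? r) ∨ does (p ∣? r′)
        ... | true = prime⇒0< (P-prime p∈)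
        ... | false = ℕ.s≤s ℕ.z≤n

      M≤ : Π P m ℕ.≤ rad r ℕ.* rad r′
      M≤ = ℕₚ.≤-trans (Π-mono P lem) (ℕₚ.≤-reflexive (Π-* P _ _))
        where
        lem : ∀ {p} → p ∈ P → m p ℕ.≤ (if does (p ∣? r) then p else 1) ℕ.* (if does (p ∣? r′) then p else 1)
        lem {p} p∈ with does (p ∣? r) | does (p ∣? r′)
        ... | true | true = ℕₚ.m≤m*n p p {{prime⇒nonZero (P-prime p∈)}}
        ... | true | false = ℕₚ.≤-reflexive (sym (ℕₚ.*-identityʳ p))
        ... | false | true = ℕₚ.≤-reflexive (sym (ℕₚ.*-identityˡ p))
        ... | false | false = ℕₚ.≤-refl

      distinguish : ∀ ps → (∃[ p ] (p ∈ ps × does (p ∣? r) ≢ does (p ∣? r′))) ⊎ (∀ {p} → p ∈ ps → does (p ∣? r) ≡ does (p ∣? r′))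
      distinguish [] = inj₂ λ ()
      distinguish (p ∷ ps) with does (p ∣? r) Boolₚ.≟ does (p ∣? r′)
      ... | no ne = inj₁ (p , here refl , ne)
      ... | yes e with distinguish ps
      ...   | inj₁ (q , q∈ , ne) = inj₁ (q , there q∈ , ne)
      ...   | inj₂ all = inj₂ λ where
                (here refl) → e
                (there q∈) → all q∈

      -- Distinct radicals differ in some prime p of `P`, and a prime dividing exactly one of r and
      -- r′ contributes the factor Σ f p = 0.
      complete-≢ : rad r ≡ r → rad r′ ≡ r′ → r ≢ r′ → ∑ (below (Π P m)) (λ n → Ψ r n * Ψ r′ n) ≡ 0ℚ
      complete-≢ er er′ r≢ with distinguish P
      ... | inj₂ all = ⊥-elim (r≢ (trans (sym er) (trans (Π-cong P (λ {p} p∈ → cong (if_then p else 1) (all p∈))) er′)))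
      ... | inj₁ (p , p∈ , ne) = trans complete (∏-zero p∈ zero-factor)
        where
        zero-factor : ∑ (below (m p)) (h p) ≡ 0ℚ
        zero-factor with does (p ∣? r) | does (p ∣? r′)
        ... | true | true = ⊥-elim (ne refl)
        ... | true | false = trans (∑-cong (below p) (λ {n} _ → *-identityʳ (f p n))) (f-mean p∈)
        ... | false | true = trans (∑-cong (below p) (λ {n} _ → *-identityˡ (f p n))) (f-mean p∈)
        ... | false | false = ⊥-elim (ne refl)

      -- The range splits into complete periods and a remainder of fewer than M ≤ R^2 terms, each at
      -- most R^2 in absolute value. This crude error R^4 is what the condition R^5 ≤ N later
      -- absorbs.
      partial : rad r ≡ r → rad r′ ≡ r′ → ∀ R → r ℕ.≤ R → r′ ℕ.≤ R → ∀ N →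
        ∃[ k ] (k ℕ.* Π P m ℕ.≤ N × ∑ (below N) (λ n → Ψ r n * Ψ r′ n) ≤
          ν (R ℕ.* R ℕ.* (R ℕ.* R)) + ν k * ∑ (below (Π P m)) (λ n → Ψ r n * Ψ r′ n))
      partial er er′ R r≤R r′≤R N = N / M , k*M≤N ,
        ≤-trans (≡⇒≤ split) (+-mono-≤ (≤-trans tail-bound (≤-trans (≡⇒≤ (sym (ν-* t (R ℕ.* R)))) (ν-mono (ℕₚ.*-monoˡ-≤ (R ℕ.* R) t≤))))
          (≡⇒≤ (∑-below-periods ΨΨ-periodic (N / M))))
        where
        instance
          M≢0 : NonZero (Π P m)
          M≢0 = ℕ.>-nonZero 0<M
        M = Π P m
        t = N % M
        N≡ : N ≡ t ℕ.+ N / M ℕ.* M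
        N≡ = m≡m%n+[m/n]*n N M
        k*M≤N : N / M ℕ.* M ℕ.≤ N
        k*M≤N = ℕₚ.≤-trans (ℕₚ.m≤n+m _ t) (ℕₚ.≤-reflexive (sym N≡))
        F = λ n → Ψ r n * Ψ r′ n
        split : ∑ (below N) F ≡ ∑ (below t) (λ i → F (i ℕ.+ N / M ℕ.* M)) + ∑ (below (N / M ℕ.* M)) F
        split = trans (cong (λ z → ∑ (below z) F) N≡) (∑-below-+ t (N / M ℕ.* M) F)
        F≤ : ∀ n → F n ≤ ν (R ℕ.* R)
        F≤ n = ≤-trans (p≤∣p∣ (F n)) (≤-trans (≡⇒≤ (∣p*q∣≡∣p∣*∣q∣ (Ψ r n) (Ψ r′ n)))
          (≤-trans (*-mono (0≤∣p∣ (Ψ r n)) (0≤∣p∣ (Ψ r′ n)) (≤-trans (∣Ψ∣≤ er n) (ν-mono r≤R)) (≤-trans (∣Ψ∣≤ er′ n) (ν-mono r′≤R)))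
            (≡⇒≤ (sym (ν-* R R)))))
        tail-bound : ∑ (below t) (λ i → F (i ℕ.+ N / M ℕ.* M)) ≤ ν t * ν (R ℕ.* R)
        tail-bound = ≤-trans (∑-mono (below t) {g = λ _ → ν (R ℕ.* R)} (λ {i} _ → F≤ _))
          (≡⇒≤ (trans (∑-const (below t) (ν (R ℕ.* R))) (cong (λ z → ν z * ν (R ℕ.* R)) (length-below t))))
        t≤ : t ℕ.≤ R ℕ.* R
        t≤ = ℕₚ.≤-trans (ℕₚ.<⇒≤ (m%n<n N M)) (ℕₚ.≤-trans M≤ (ℕₚ.*-mono-≤ (subst (ℕ._≤ R) (sym er) r≤R) (subst (ℕ._≤ R) (sym er′) r′≤R)))

    complete-diagonal : ∀ {r} → rad r ≡ r → G r * ∑ (below (Π P (m r r))) (λ n → Ψ r n * Ψ r n) ≡ ν r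
    complete-diagonal {r} er = trans (cong (G r *_) (complete r r))
      (trans (sym (∏-* P _ _)) (trans (∏-cong P lem) (trans (sym (ν-Π P _)) (cong ν er))))
      where
      lem : ∀ {p} → p ∈ P → (if does (p ∣? r) then g p else 1ℚ) * ∑ (below (m r r p)) (h r r p) ≡ ν (if does (p ∣? r) then p else 1)
      lem {p} p∈ with does (p ∣? r)
      ... | true = f-square p∈
      ... | false = sym ν1

    M-diagonal : ∀ r → Π P (m r r) ≡ rad r
    M-diagonal r = Π-cong P (λ {p} _ → cong (if_then p else 1) (Boolₚ.∨-idem (does (p ∣? r))))

    -- Put F = Σ G r Ψ r. On S it is constant, equal to L = Σ G r, so |S| L^2 is at most the sum of
    -- F^2 below N, which by approximate orthogonality is at most L N + L^2 R^4. As L ≤ R and R^5 ≤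
    -- N, the second term is at most L N.
    large-sieve : ∀ {RR S : List ℕ} R N → Unique RR → (∀ {r} → r ∈ RR → 0 ℕ.< r × r ℕ.≤ R × rad r ≡ r) →
      R ℕ.* (R ℕ.* R ℕ.* (R ℕ.* R)) ℕ.≤ N → Unique S → (∀ {n} → n ∈ S → n ℕ.< N) →
      (∀ {n p r} → n ∈ S → p ∈ P → r ∈ RR → p ∣ r → f p n ≡ 1ℚ) →
      ν (length S) * ∑ RR G ≤ ν N + ν N
    large-sieve {RR} {S} R N RR-unique RR-ok R⁵≤N S-unique S<N S-one = final
      where
      L = ∑ RR G
      F : ℕ → ℚ
      F n = ∑ RR (λ r → G r * Ψ r n)
      R⁴ = R ℕ.* R ℕ.* (R ℕ.* R)
      0≤L : 0ℚ ≤ L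
      0≤L = ∑-nonneg RR (λ {r} _ → 0≤G r)
      L≤R : L ≤ ν R
      L≤R = ≤-trans (∑-mono RR {g = λ _ → 1ℚ} (λ {r} _ → G≤1 r)) (≤-trans (≡⇒≤ (∑-1 RR))
        (ν-mono (ℕₚ.≤-trans (length-⊆ RR-unique sub) (ℕₚ.≤-reflexive (trans (length-map suc (below R)) (length-below R))))))
        where
        open import Data.List.Membership.Propositional.Properties using (∈-map⁺)
        sub : ∀ {r} → r ∈ RR → r ∈ map suc (below R)
        sub {zero} r∈ = ⊥-elim (ℕₚ.<-irrefl refl (proj₁ (RR-ok r∈)))
        sub {suc r} r∈ = ∈-map⁺ suc (∈-below (proj₁ (proj₂ (RR-ok r∈))))
      F-on-S : ∀ {n} → n ∈ S → F n ≡ L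
      F-on-S {n} n∈ = ∑-cong RR (λ {r} r∈ → trans (cong (G r *_) (∏-one P (one r∈))) (*-identityʳ (G r)))
        where
        one : ∀ {r} → r ∈ RR → ∀ {p} → p ∈ P → E r p n ≡ 1ℚ
        one {r} r∈ {p} p∈ with p ∣? r
        ... | yes d = S-one n∈ p∈ r∈ d
        ... | no _ = refl
      F² : ∀ n → F n * F n ≡ ∑ RR (λ r → ∑ RR (λ r′ → G r * G r′ * (Ψ r n * Ψ r′ n)))
      F² n = trans (∑-* RR RR _ _) (∑-cong RR (λ {r} _ → ∑-cong RR (λ {r′} _ → lem (G r) (Ψ r n) (G r′) (Ψ r′ n))))
        where
        lem : ∀ a b c d → a * b * (c * d) ≡ a * c * (b * d)
        lem = solve-∀ ringℚ
      I : ℕ → ℕ → ℚ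
      I r r′ = ∑ (below N) (λ n → Ψ r n * Ψ r′ n)
      ∑F² : ∑ (below N) (λ n → F n * F n) ≡ ∑ RR (λ r → ∑ RR (λ r′ → G r * G r′ * I r r′))
      ∑F² = trans (∑-cong (below N) (λ {n} _ → F² n))
        (trans (∑-swap (below N) RR _) (∑-cong RR (λ {r} _ → trans (∑-swap (below N) RR _)
          (∑-cong RR (λ {r′} _ → ∑-*ˡ (below N) (G r * G r′) _)))))
      diag : ℕ → ℕ → ℚ
      diag r r′ = if does (r ℕ.≟ r′) then G r * ν N else 0ℚ
      term : ∀ {r r′} → r ∈ RR → r′ ∈ RR → G r * G r′ * I r r′ ≤ diag r r′ + G r * G r′ * ν R⁴
      term {r} {r′} r∈ r′∈ with RR-ok r∈ | RR-ok r′∈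
      ... | _ , r≤R , er | _ , r′≤R , er′ with partial r r′ er er′ R r≤R r′≤R N
      ...   | k , kM≤N , bound with r ℕ.≟ r′
      ...     | no r≢ = ≤-trans (*-monoˡ (0≤* (0≤G r) (0≤G r′)) (≤-trans bound (≡⇒≤ eq))) (≡⇒≤ (sym (trans (cong (_+ G r * G r′ * ν R⁴) diag≡) (+-identityˡ _))))
        where
        diag≡ : diag r r′ ≡ 0ℚ
        diag≡ = cong (if_then G r * ν N else 0ℚ) (dec-false (r ℕ.≟ r′) r≢)
        eq : ν R⁴ + ν k * ∑ (below (Π P (m r r′))) (λ n → Ψ r n * Ψ r′ n) ≡ ν R⁴
        eq = trans (cong (λ z → ν R⁴ + ν k * z) (complete-≢ r r′ er er′ r≢)) (trans (cong (ν R⁴ +_) (*-zeroʳ (ν k))) (+-identityʳ (ν R⁴)))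
      ...     | yes refl = ≤-trans (*-monoˡ (0≤* (0≤G r) (0≤G r)) bound) (≤-trans (≡⇒≤ eq)
          (+-monoˡ-≤ (G r * G r * ν R⁴) (≤-trans (*-monoˡ (0≤G r) (ν-mono kr≤N)) (≡⇒≤ (sym diag≡)))))
        where
        diag≡ : diag r r ≡ G r * ν N
        diag≡ = cong (if_then G r * ν N else 0ℚ) (dec-true (r ℕ.≟ r) refl)
        kr≤N : k ℕ.* r ℕ.≤ N
        kr≤N = subst (λ z → k ℕ.* z ℕ.≤ N) (trans (M-diagonal r) er) kM≤N
        C = ∑ (below (Π P (m r r))) (λ n → Ψ r n * Ψ r n)
        lem : ∀ g x k c → g * g * (x + k * c) ≡ g * (k * (g * c)) + g * g * x
        lem = solve-∀ ringℚ
        eq : G r * G r * (ν R⁴ + ν k * C) ≡ G r * ν (k ℕ.* r) + G r * G r * ν R⁴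
        eq = trans (lem (G r) (ν R⁴) (ν k) C) (cong (λ z → G r * z + G r * G r * ν R⁴)
          (trans (cong (ν k *_) (complete-diagonal er)) (sym (ν-* k r))))
      ∑F²≤ : ∑ (below N) (λ n → F n * F n) ≤ L * ν N + L * L * ν R⁴
      ∑F²≤ = ≤-trans (≡⇒≤ ∑F²) (≤-trans (∑-mono RR (λ {r} r∈ → ∑-mono RR (λ {r′} r′∈ → term r∈ r′∈)))
        (≤-trans (≡⇒≤ (∑-cong RR (λ {r} _ → ∑-+ RR (diag r) (λ r′ → G r * G r′ * ν R⁴))))
        (≤-trans (≡⇒≤ (∑-+ RR _ _)) (+-mono-≤ diag≤ (≡⇒≤ off≡)))))
        where
        diag≤ : ∑ RR (λ r → ∑ RR (diag r)) ≤ L * ν N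
        diag≤ = ≤-trans (∑-mono RR (λ {r} _ → ∑-indicator ℕ._≟_ r (G r * ν N) (0≤* (0≤G r) (0≤ν N)) RR-unique))
          (≡⇒≤ (∑-*ʳ RR (ν N) G))
        off≡ : ∑ RR (λ r → ∑ RR (λ r′ → G r * G r′ * ν R⁴)) ≡ L * L * ν R⁴
        off≡ = trans (∑-cong RR (λ {r} _ → ∑-*ʳ RR (ν R⁴) (λ r′ → G r * G r′))) (trans (∑-*ʳ RR (ν R⁴) _)
          (cong (_* ν R⁴) (sym (∑-* RR RR G G))))
      S≤ : ν (length S) * (L * L) ≤ L * ν N + L * L * ν R⁴
      S≤ = ≤-trans (≡⇒≤ (trans (sym (∑-const S (L * L))) (∑-cong S (λ n∈ → sym (cong₂ _*_ (F-on-S n∈) (F-on-S n∈))))))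
        (≤-trans (∑-⊆ S-unique (λ n∈ → ∈-below (S<N n∈)) (λ n → 0≤² (F n))) ∑F²≤)
      LL≤ : L * L * ν R⁴ ≤ L * ν N
      LL≤ = ≤-trans (≡⇒≤ (*-assoc L L (ν R⁴))) (*-monoˡ 0≤L (≤-trans (*-monoʳ (0≤ν R⁴) L≤R)
        (≤-trans (≡⇒≤ (sym (ν-* R R⁴))) (ν-mono R⁵≤N))))
      key : L * (ν (length S) * L) ≤ L * (ν N + ν N)
      key = ≤-trans (≡⇒≤ (lem L (ν (length S)))) (≤-trans S≤ (≤-trans (+-monoʳ-≤ (L * ν N) LL≤) (≡⇒≤ (sym (*-distribˡ-+ L (ν N) (ν N))))))
        where
        lem : ∀ l s → l * (s * l) ≡ s * (l * l)
        lem = solve-∀ ringℚ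
      final : ν (length S) * L ≤ ν N + ν N
      -- Cancelling L needs L > 0; otherwise the left side is at most 0.
      final with 0ℚ <? L
      ... | yes 0<L = *-cancelˡ 0<L key
      ... | no L≤0 = ≤-trans (*-monoˡ (0≤ν (length S)) (≮⇒≥ L≤0)) (≤-trans (≡⇒≤ (*-zeroʳ (ν (length S)))) (0≤+ (0≤ν N) (0≤ν N)))

-- Squarefree numbers and harmonic sums.

module Harmonic where

  open Rat
  open Sums
  open Mod
  open Sieve using (Π; ∣-Π; prime-∣-Π; ∑-below-+)
  open import Data.Nat as ℕ using (ℕ; zero; suc)
  import Data.Nat.Properties as ℕₚ
  open import Data.Nat.Induction using (<-rec)
  open import Data.Nat.Divisibility
  open import Data.Nat.Primality using (Prime; prime?; euclidsLemma; ¬prime[1]; prime⇒nonZero)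
  open import Data.Nat.Primality.Factorisation using (factorise; PrimeFactorisation)
  open import Data.Nat.ListAction using (product)
  open import Data.Nat.Tactic.RingSolver renaming (solve-∀ to solve-∀ℕ)
  open import Data.Bool using (if_then_else_)
  open import Data.Rational hiding (NonZero; _/_)
  open import Data.Rational.Properties
  open import Data.List using (List; []; _∷_; map; filter; cartesianProduct)
  open import Data.List.Membership.Propositional using (_∈_; find; lose)
  open import Data.List.Membership.Propositional.Properties using (∈-map⁻; ∈-map⁺; ∈-filter⁻; ∈-filter⁺; ∈-cartesianProduct⁺)
  open import Data.List.Relation.Unary.Any as Any using (here; there; any?)
  open import Data.List.Relation.Unary.All as All using (All; []; _∷_)
  import Data.List.Relation.Unary.AllPairs as AllPairs
  open AllPairs using ([]; _∷_)
  open import Data.List.Relation.Unary.Unique.Propositional using (Unique)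
  open import Data.Empty using (⊥-elim)
  open import Data.Product using (∃-syntax; _×_; _,_; proj₁; proj₂)
  open import Data.Sum using (inj₁; inj₂)
  open import Function using (_∘_)
  open import Relation.Nullary using (Dec; yes; no; ¬_; does; ¬?; _×-dec_)
  open import Relation.Nullary.Decidable using (dec-true)
  open import Relation.Binary.PropositionalEquality
  open import Tactic.RingSolver using (solve-∀)

  abstract
    ∃-prime-divisor : ∀ n → 1 ℕ.< n → ∃[ p ] (Prime p × p ∣ n)
    ∃-prime-divisor n 1<n = go (PrimeFactorisation.factors pf) (PrimeFactorisation.isFactorisation pf) (PrimeFactorisation.factorsPrime pf)
      where
      pf : PrimeFactorisation n
      pf = factorise n {{ℕ.>-nonZero (ℕₚ.<-trans (ℕ.s≤s ℕ.z≤n) 1<n)}}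
      go : ∀ fs → n ≡ product fs → All Prime fs → ∃[ p ] (Prime p × p ∣ n)
      go [] e _ = ⊥-elim (ℕₚ.<-irrefl (sym e) 1<n)
      go (p ∷ fs) e (pp ∷ _) = p , pp , divides (product fs) (trans e (ℕₚ.*-comm p (product fs)))

  upTo⁺ : ℕ → List ℕ
  upTo⁺ R = map suc (below R)

  ∈-upTo⁺ : ∀ {n R} → 0 ℕ.< n → n ℕ.≤ R → n ∈ upTo⁺ R
  ∈-upTo⁺ {suc n} _ n≤R = ∈-map⁺ suc (∈-below n≤R)

  upTo⁺-bounds : ∀ {n R} → n ∈ upTo⁺ R → 0 ℕ.< n × n ℕ.≤ R
  upTo⁺-bounds {R = R} n∈ with ∈-map⁻ suc {xs = below R} n∈
  ... | m , m∈ , refl = ℕ.s≤s ℕ.z≤n , below-< m∈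

  upTo⁺-unique : ∀ R → Unique (upTo⁺ R)
  upTo⁺-unique R = map-unique (λ _ _ → ℕₚ.suc-injective) (below-unique R)

  primesUpTo : ℕ → List ℕ
  primesUpTo R = filter prime? (upTo⁺ R)

  ∈-primesUpTo : ∀ {p R} → Prime p → p ℕ.≤ R → p ∈ primesUpTo R
  ∈-primesUpTo pp p≤R = ∈-filter⁺ prime? (∈-upTo⁺ (prime⇒0< pp) p≤R) pp

  primesUpTo-prime : ∀ {p R} → p ∈ primesUpTo R → Prime p
  primesUpTo-prime {R = R} p∈ = proj₂ (∈-filter⁻ prime? {xs = upTo⁺ R} p∈)

  primesUpTo-≤ : ∀ {p R} → p ∈ primesUpTo R → p ℕ.≤ R
  primesUpTo-≤ {R = R} p∈ = proj₂ (upTo⁺-bounds (proj₁ (∈-filter⁻ prime? {xs = upTo⁺ R} p∈)))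

  primesUpTo-unique : ∀ R → Unique (primesUpTo R)
  primesUpTo-unique R = filter-unique prime? (upTo⁺-unique R)

  SquareOf : ℕ → ℕ → Set
  SquareOf n k = Prime k × k ℕ.* k ∣ n

  squareOf? : ∀ n k → Dec (SquareOf n k)
  squareOf? n k = prime? k ×-dec (k ℕ.* k ∣? n)

  -- Only primes up to n are tested, which makes the notion decidable; for n > 0 the bound is
  -- removed by `squarefree-∤`.
  Squarefree : ℕ → Set
  Squarefree n = ¬ Any.Any (SquareOf n) (below (suc n))

  squarefree? : ∀ n → Dec (Squarefree n)
  squarefree? n = ¬? (any? (squareOf? n) (below (suc n)))

  squarefree-∤ : ∀ {n p} → 0 ℕ.< n → Squarefree n → Prime p → ¬ (p ℕ.* p ∣ n)
  squarefree-∤ {n} {p} 0<n sf pp d = sf (lose (∈-below (ℕ.s≤s p≤n)) (pp , d))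
    where
    p≤n : p ℕ.≤ n
    p≤n = ℕₚ.≤-trans (ℕₚ.m≤m*n p p {{prime⇒nonZero pp}}) (∣⇒≤ {{ℕ.>-nonZero 0<n}} d)

  squarefree-intro : ∀ {n} → (∀ {p} → Prime p → ¬ (p ℕ.* p ∣ n)) → Squarefree n
  squarefree-intro h any with find any
  ... | k , _ , pk , d = h pk d

  squarefree-∣ : ∀ {m n} → 0 ℕ.< n → m ∣ n → Squarefree n → Squarefree m
  squarefree-∣ 0<n m∣n sf = squarefree-intro λ pp d → squarefree-∤ 0<n sf pp (∣-trans d m∣n)

  squarefree-* : ∀ {q b} → 0 ℕ.< b → Prime q → ¬ (q ∣ b) → Squarefree b → Squarefree (q ℕ.* b)
  squarefree-* {q} {b} 0<b pq q∤b sf = squarefree-intro step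
    where
    step : ∀ {p} → Prime p → ¬ (p ℕ.* p ∣ q ℕ.* b)
    step {p} pp d with p ∣? q
    ... | yes p∣q with prime-∣-prime pp pq p∣q
    ...   | refl = q∤b (*-cancelˡ-∣ p {{prime⇒nonZero pp}} d)
    step {p} pp d | no p∤q with euclidsLemma q b pp (∣-trans (m∣m*n p) d)
    ... | inj₁ p∣q = p∤q p∣q
    ... | inj₂ (divides c refl) = squarefree-∤ 0<b sf pp (*-monoˡ-∣ p p∣c)
      where
      lem : ∀ q c p → q ℕ.* (c ℕ.* p) ≡ p ℕ.* (q ℕ.* c)
      lem = solve-∀ℕ
      p∣c : p ∣ c
      p∣c with euclidsLemma q c pp (*-cancelˡ-∣ p {{prime⇒nonZero pp}} (subst (p ℕ.* p ∣_) (lem q c p) d))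
      ... | inj₁ p∣q = ⊥-elim (p∤q p∣q)
      ... | inj₂ e = e

  module _ {P : List ℕ} (P-prime : ∀ {p} → p ∈ P → Prime p) where

    radical-∣ : ∀ {ps} n → (∀ {p} → p ∈ ps → Prime p) → Unique ps → Π ps (λ p → if does (p ∣? n) then p else 1) ∣ n
    radical-∣ {[]} n pr u = 1∣ n
    radical-∣ {p ∷ ps} n pr (p∉ ∷ u) with p ∣? n
    ... | no _ = subst (_∣ n) (sym (ℕₚ.*-identityˡ _)) (radical-∣ n (pr ∘ there) u)
    ... | yes p∣n with radical-∣ n (pr ∘ there) u
    ...   | divides q eq with euclidsLemma q (Π ps (λ p → if does (p ∣? n) then p else 1)) (pr (here refl)) (subst (p ∣_) eq p∣n)
    ...     | inj₁ (divides q′ refl) = divides q′ (trans eq (ℕₚ.*-assoc q′ p _))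
    ...     | inj₂ d with prime-∣-Π {xs = ps} (pr (here refl)) d
    ...       | x , x∈ , e with x ∣? n
    ...         | yes _ = ⊥-elim (∉⇒≢ x∈ p∉ (prime-∣-prime (pr (here refl)) (pr (there x∈)) e))
    ...         | no _ = ⊥-elim (¬prime[1] (subst Prime (∣1⇒≡1 e) (pr (here refl))))

    -- n is a multiple of the product. A prime dividing the cofactor divides n and hence the product
    -- as well, so its square would divide n.
    radical-squarefree : Unique P → ∀ {n} → 0 ℕ.< n → Squarefree n → (∀ {p} → Prime p → p ∣ n → p ∈ P) →
      Π P (λ p → if does (p ∣? n) then p else 1) ≡ n
    radical-squarefree u {n} 0<n sf mem with radical-∣ n P-prime u
    ... | divides zero eq = ⊥-elim (ℕₚ.<-irrefl (sym eq) 0<n)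
    ... | divides 1 eq = sym (trans eq (ℕₚ.*-identityˡ _))
    ... | divides e@(suc (suc _)) eq with ∃-prime-divisor e (ℕ.s≤s (ℕ.s≤s ℕ.z≤n))
    ...   | p , pp , p∣e = ⊥-elim (squarefree-∤ 0<n sf pp (subst (p ℕ.* p ∣_) (sym eq) (*-pres-∣ p∣e p∣rad)))
      where
      p∣n : p ∣ n
      p∣n = subst (p ∣_) (sym eq) (∣-trans p∣e (m∣m*n (Π P (λ p → if does (p ∣? n) then p else 1))))
      p∣rad : p ∣ Π P (λ p → if does (p ∣? n) then p else 1)
      p∣rad = subst (_∣ _) (cong (if_then p else 1) (dec-true (p ∣? n) p∣n)) (∣-Π {f = λ p → if does (p ∣? n) then p else 1} (mem pp p∣n))

  squarefree-part : ∀ n → 0 ℕ.< n → ∃[ b ] ∃[ k ] (n ≡ b ℕ.* (k ℕ.* k) × 0 ℕ.< b × 0 ℕ.< k × Squarefree b)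
  squarefree-part = <-rec _ step
    where
    step : ∀ n → (∀ {m} → m ℕ.< n → 0 ℕ.< m → _) → 0 ℕ.< n → _
    step n rec 0<n with any? (squareOf? n) (below (suc n))
    ... | no sf = n , 1 , sym (ℕₚ.*-identityʳ n) , 0<n , ℕ.s≤s ℕ.z≤n , sf
    ... | yes any with find any
    ...   | p , _ , pp , divides m eq = finish (rec m<n 0<m)
      where
      0<m : 0 ℕ.< m
      0<m = ℕₚ.n≢0⇒n>0 λ m≡0 → ℕₚ.<-irrefl (sym (trans eq (cong (ℕ._* (p ℕ.* p)) m≡0))) 0<n
      m<n : m ℕ.< n
      m<n = subst (m ℕ.<_) (sym eq) (ℕₚ.m<m*n m (p ℕ.* p) {{ℕ.>-nonZero 0<m}} (ℕₚ.*-mono-≤ {2} {p} {1} {p} (prime⇒1< pp) (prime⇒0< pp)))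
      lem : ∀ b k p → b ℕ.* (k ℕ.* k) ℕ.* (p ℕ.* p) ≡ b ℕ.* ((k ℕ.* p) ℕ.* (k ℕ.* p))
      lem = solve-∀ℕ
      finish : ∃[ b ] ∃[ k ] (m ≡ b ℕ.* (k ℕ.* k) × 0 ℕ.< b × 0 ℕ.< k × Squarefree b) → _
      finish (b , k , e , 0<b , 0<k , sf) = b , k ℕ.* p , trans eq (trans (cong (ℕ._* (p ℕ.* p)) e) (lem b k p)) ,
        0<b , ℕₚ.*-mono-≤ 0<k (prime⇒0< pp) , sf

  squarefrees : ℕ → List ℕ
  squarefrees R = filter squarefree? (upTo⁺ R)

  ∈-squarefrees : ∀ {n R} → 0 ℕ.< n → n ℕ.≤ R → Squarefree n → n ∈ squarefrees R
  ∈-squarefrees 0<n n≤R sf = ∈-filter⁺ squarefree? (∈-upTo⁺ 0<n n≤R) sf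

  squarefrees-spec : ∀ {n R} → n ∈ squarefrees R → 0 ℕ.< n × n ℕ.≤ R × Squarefree n
  squarefrees-spec {R = R} n∈ with ∈-filter⁻ squarefree? {xs = upTo⁺ R} n∈
  ... | m , sf = proj₁ (upTo⁺-bounds m) , proj₂ (upTo⁺-bounds m) , sf

  squarefrees-unique : ∀ R → Unique (squarefrees R)
  squarefrees-unique R = filter-unique squarefree? (upTo⁺-unique R)

  harmonic : ℕ → ℚ
  harmonic R = ∑ (upTo⁺ R) ρ

  -- The substitute for log R: this is the sum that the sieve produces, and `ℓ-lower` bounds it
  -- below by a quarter of the binary logarithm.
  ℓ : ℕ → ℚ
  ℓ R = ∑ (squarefrees R) ρ

  0≤ℓ : ∀ R → 0ℚ ≤ ℓ R
  0≤ℓ R = ∑-nonneg (squarefrees R) (λ {r} _ → 0≤ρ r)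

  ∑-cartesian : {A B : Set} (xs : List A) (ys : List B) (f : A → ℚ) (g : B → ℚ) →
    ∑ (cartesianProduct xs ys) (λ z → f (proj₁ z) * g (proj₂ z)) ≡ ∑ xs f * ∑ ys g
  ∑-cartesian [] ys f g = sym (*-zeroˡ (∑ ys g))
  ∑-cartesian (x ∷ xs) ys f g = trans (∑-++ (map (x ,_) ys) (cartesianProduct xs ys) _)
    (trans (cong₂ _+_ (trans (∑-map (x ,_) ys _) (∑-*ˡ ys (f x) g)) (∑-cartesian xs ys f g)) (sym (*-distribʳ-+ (∑ ys g) (f x) (∑ xs f))))

  telescope : ∀ n → 0 ℕ.< n → ρ (suc n ℕ.* suc n) + ρ (suc n) ≤ ρ n
  telescope n 0<n = *-cancelˡ (0<ν 0<n) (*-cancelˡ 0<s (*-cancelˡ 0<s (≤-by 1ℚ 0≤1 (trans r≡ (trans (fin (ν n)) (cong (_+ 1ℚ) (sym l≡)))))))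
    where
    s = suc n
    0<s : 0ℚ < ν s
    0<s = 0<ν (ℕ.s≤s ℕ.z≤n)
    νs : ν s ≡ 1ℚ + ν n
    νs = ν-suc n
    rs : ν s * ρ s ≡ 1ℚ
    rs = νρ (ℕ.s≤s ℕ.z≤n)
    lem₁ : ∀ a n x → a * (a * (n * (x * x + x))) ≡ n * ((a * x) * (a * x)) + n * (a * (a * x))
    lem₁ = solve-∀ ringℚ
    l≡ : ν s * (ν s * (ν n * (ρ (s ℕ.* s) + ρ s))) ≡ ν n * (1ℚ * 1ℚ) + ν n * ((1ℚ + ν n) * 1ℚ)
    l≡ = trans (cong (λ z → ν s * (ν s * (ν n * (z + ρ s)))) (ρ-* s s)) (trans (lem₁ (ν s) (ν n) (ρ s))
      (cong₂ (λ z y → ν n * (z * z) + ν n * (y * z)) rs νs))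
    r≡ : ν s * (ν s * (ν n * ρ n)) ≡ (1ℚ + ν n) * ((1ℚ + ν n) * 1ℚ)
    r≡ = cong₂ (λ y z → y * (y * z)) νs (νρ 0<n)
    fin : ∀ n → (1ℚ + n) * ((1ℚ + n) * 1ℚ) ≡ n * (1ℚ * 1ℚ) + n * ((1ℚ + n) * 1ℚ) + 1ℚ
    fin = solve-∀ ringℚ

  ∑ρ²≤2 : ∀ R → ∑ (upTo⁺ R) (λ k → ρ (k ℕ.* k)) ≤ ν 2
  ∑ρ²≤2 zero = 0≤ν 2
  ∑ρ²≤2 (suc R) = ≤-trans (≤-by (ρ (suc R)) (0≤ρ (suc R)) refl) (strong R)
    where
    -- The extra summand 1/(R+1) makes the induction telescope; it starts with 1 + 1.
    strong : ∀ R → ∑ (upTo⁺ (suc R)) (λ k → ρ (k ℕ.* k)) + ρ (suc R) ≤ ν 2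
    strong zero = ≡⇒≤ (trans (cong (λ z → z + 0ℚ + z) ρ1) (trans (cong (_+ 1ℚ) (+-identityʳ 1ℚ)) (sym (trans (ν-suc 1) (cong (1ℚ +_) ν1)))))
    strong (suc R) = ≤-trans (≡⇒≤ (lem (ρ (suc (suc R) ℕ.* suc (suc R))) (∑ (upTo⁺ (suc R)) (λ k → ρ (k ℕ.* k))) (ρ (suc (suc R)))))
      (≤-trans (+-monoʳ-≤ (∑ (upTo⁺ (suc R)) (λ k → ρ (k ℕ.* k))) (telescope (suc R) (ℕ.s≤s ℕ.z≤n))) (strong R))
      where
      lem : ∀ a b c → a + b + c ≡ b + (a + c)
      lem = solve-∀ ringℚ

  -- Every n is b k^2 with b squarefree, so the harmonic sum is at most the sum of the 1/b times the
  -- sum of the 1/k^2.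
  harmonic≤2ℓ : ∀ R → harmonic R ≤ ℓ R * ν 2
  harmonic≤2ℓ R = ≤-trans (≡⇒≤ (trans (∑-cong (upTo⁺ R) decompose) (sym (∑-map pair (upTo⁺ R) F))))
    (≤-trans (∑-⊆ pairs-unique pairs-sub (λ z → 0≤* (0≤ρ (proj₁ z)) (0≤ρ (proj₂ z ℕ.* proj₂ z))))
    (≤-trans (≡⇒≤ (∑-cartesian (squarefrees R) (upTo⁺ R) ρ (λ k → ρ (k ℕ.* k)))) (*-monoˡ (0≤ℓ R) (∑ρ²≤2 R))))
    where
    F : ℕ × ℕ → ℚ
    F z = ρ (proj₁ z) * ρ (proj₂ z ℕ.* proj₂ z)
    pair : ℕ → ℕ × ℕ
    pair zero = 0 , 0
    pair (suc n) = proj₁ (squarefree-part (suc n) (ℕ.s≤s ℕ.z≤n)) , proj₁ (proj₂ (squarefree-part (suc n) (ℕ.s≤s ℕ.z≤n)))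
    value : ℕ × ℕ → ℕ
    value (b , k) = b ℕ.* (k ℕ.* k)
    pair-value : ∀ n → value (pair n) ≡ n
    pair-value zero = refl
    pair-value (suc n) = sym (proj₁ (proj₂ (proj₂ (squarefree-part (suc n) (ℕ.s≤s ℕ.z≤n)))))
    decompose : ∀ {n} → n ∈ upTo⁺ R → ρ n ≡ F (pair n)
    decompose {n} _ = trans (cong ρ (sym (pair-value n))) (ρ-* (proj₁ (pair n)) _)
    pairs-unique : Unique (map pair (upTo⁺ R))
    pairs-unique = map-unique (λ {x} {y} _ _ e → trans (sym (pair-value x)) (trans (cong value e) (pair-value y))) (upTo⁺-unique R)
    pairs-sub : ∀ {z} → z ∈ map pair (upTo⁺ R) → z ∈ cartesianProduct (squarefrees R) (upTo⁺ R)
    pairs-sub z∈ with ∈-map⁻ pair z∈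
    ... | zero , n∈ , refl = ⊥-elim (ℕₚ.<-irrefl refl (proj₁ (upTo⁺-bounds n∈)))
    ... | suc n , n∈ , refl with squarefree-part (suc n) (ℕ.s≤s ℕ.z≤n)
    ...   | b , k , e , 0<b , 0<k , sf = ∈-cartesianProduct⁺ (∈-squarefrees 0<b (ℕₚ.≤-trans b≤ n≤R) sf) (∈-upTo⁺ 0<k (ℕₚ.≤-trans k≤ n≤R))
      where
      n≤R = proj₂ (upTo⁺-bounds n∈)
      instance
        k≢0 = ℕ.>-nonZero 0<k
        b≢0 = ℕ.>-nonZero 0<b
      b≤ : b ℕ.≤ suc n
      b≤ = ℕₚ.≤-trans (ℕₚ.m≤m*n b (k ℕ.* k) {{ℕₚ.m*n≢0 k k}}) (ℕₚ.≤-reflexive (sym e))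
      k≤ : k ℕ.≤ suc n
      k≤ = ℕₚ.≤-trans (ℕₚ.m≤m*n k k) (ℕₚ.≤-trans (ℕₚ.m≤n*m (k ℕ.* k) b) (ℕₚ.≤-reflexive (sym e)))

  private
    dyadic : ∀ k → harmonic (2 ℕ.^ suc k) ≡ ∑ (below (2 ℕ.^ k)) (λ i → ρ (suc (i ℕ.+ 2 ℕ.^ k))) + harmonic (2 ℕ.^ k)
    dyadic k = trans (cong harmonic (cong (2 ℕ.^ k ℕ.+_) (ℕₚ.+-identityʳ _)))
      (trans (∑-map suc (below (2 ℕ.^ k ℕ.+ 2 ℕ.^ k)) ρ) (trans (∑-below-+ (2 ℕ.^ k) (2 ℕ.^ k) _)
      (cong (∑ (below (2 ℕ.^ k)) (λ i → ρ (suc (i ℕ.+ 2 ℕ.^ k))) +_) (sym (∑-map suc (below (2 ℕ.^ k)) ρ)))))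

  0<2^ : ∀ k → 0 ℕ.< 2 ℕ.^ k
  0<2^ k = ℕₚ.m^n>0 2 k

  harmonic-lower : ∀ k → ν k * ρ 2 ≤ harmonic (2 ℕ.^ k)
  harmonic-lower zero = ≤-trans (≡⇒≤ (trans (cong (_* ρ 2) ν0) (*-zeroˡ (ρ 2)))) (∑-nonneg (upTo⁺ 1) (λ {n} _ → 0≤ρ n))
  harmonic-lower (suc k) = ≤-trans (≡⇒≤ (trans (cong (_* ρ 2) (ν-suc k)) (lem (ν k) (ρ 2))))
    (≤-trans (+-mono-≤ half (harmonic-lower k)) (≡⇒≤ (sym (dyadic k))))
    where
    lem : ∀ a b → (1ℚ + a) * b ≡ b + a * b
    lem = solve-∀ ringℚ
    term : ∀ {i} → i ∈ below (2 ℕ.^ k) → ρ (2 ℕ.^ suc k) ≤ ρ (suc (i ℕ.+ 2 ℕ.^ k))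
    term {i} i∈ = ρ-anti (ℕ.s≤s ℕ.z≤n) (ℕₚ.≤-trans (ℕₚ.+-monoˡ-≤ (2 ℕ.^ k) (below-< i∈)) (ℕₚ.+-monoʳ-≤ (2 ℕ.^ k) (ℕₚ.≤-reflexive (sym (ℕₚ.+-identityʳ _)))))
    half : ρ 2 ≤ ∑ (below (2 ℕ.^ k)) (λ i → ρ (suc (i ℕ.+ 2 ℕ.^ k)))
    half = ≤-trans (≡⇒≤ (sym (trans (∑-const (below (2 ℕ.^ k)) (ρ (2 ℕ.^ suc k)))
        (trans (cong₂ (λ a b → ν a * b) (length-below (2 ℕ.^ k)) (ρ-* 2 (2 ℕ.^ k)))
        (trans (lem₂ (ν (2 ℕ.^ k)) (ρ 2) (ρ (2 ℕ.^ k))) (trans (cong (ρ 2 *_) (νρ (0<2^ k))) (*-identityʳ (ρ 2))))))))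
      (∑-mono (below (2 ℕ.^ k)) term)
      where
      lem₂ : ∀ a b c → a * (b * c) ≡ b * (a * c)
      lem₂ = solve-∀ ringℚ

  harmonic-upper : ∀ k → harmonic (2 ℕ.^ k) ≤ ν (suc k)
  harmonic-upper zero = ≡⇒≤ (trans (cong (_+ 0ℚ) ρ1) (trans (+-identityʳ 1ℚ) (sym ν1)))
  harmonic-upper (suc k) = ≤-trans (≡⇒≤ (dyadic k)) (≤-trans (+-mono-≤ whole (harmonic-upper k)) (≡⇒≤ (sym (ν-suc (suc k)))))
    where
    term : ∀ {i} → i ∈ below (2 ℕ.^ k) → ρ (suc (i ℕ.+ 2 ℕ.^ k)) ≤ ρ (2 ℕ.^ k)
    term {i} _ = ρ-anti (0<2^ k) (ℕₚ.≤-trans (ℕₚ.m≤n+m (2 ℕ.^ k) i) (ℕₚ.n≤1+n _))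
    whole : ∑ (below (2 ℕ.^ k)) (λ i → ρ (suc (i ℕ.+ 2 ℕ.^ k))) ≤ 1ℚ
    whole = ≤-trans (∑-mono (below (2 ℕ.^ k)) term) (≡⇒≤ (trans (∑-const (below (2 ℕ.^ k)) (ρ (2 ℕ.^ k)))
      (trans (cong (λ z → ν z * ρ (2 ℕ.^ k)) (length-below (2 ℕ.^ k))) (νρ (0<2^ k)))))

  ℓ-lower : ∀ k → ν k * ρ 4 ≤ ℓ (2 ℕ.^ k)
  ℓ-lower k = *-cancelˡ (0<ν {2} (ℕ.s≤s ℕ.z≤n)) (≤-trans (≡⇒≤ eq) (≤-trans (harmonic-lower k)
    (≤-trans (harmonic≤2ℓ (2 ℕ.^ k)) (≡⇒≤ (*-comm (ℓ (2 ℕ.^ k)) (ν 2))))))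
    where
    lem : ∀ a b c → a * (b * (c * c)) ≡ (a * c) * (b * c)
    lem = solve-∀ ringℚ
    eq : ν 2 * (ν k * ρ 4) ≡ ν k * ρ 2
    eq = trans (cong (λ z → ν 2 * (ν k * z)) (ρ-* 2 2)) (trans (lem (ν 2) (ν k) (ρ 2))
      (trans (cong (_* (ν k * ρ 2)) (νρ (ℕ.s≤s ℕ.z≤n))) (*-identityˡ (ν k * ρ 2))))

-- Weights for sieving by one or two residue classes.

module Weights where

  open Rat
  open Sums
  open Mod
  open Sieve
  open import Data.Nat as ℕ using (ℕ; zero; suc)
  import Data.Nat.Properties as ℕₚ
  open import Data.Nat.DivMod using (_%_; [m+n]%n≡m%n; m<n⇒m%n≡m)
  open import Data.Nat.Divisibility using (_∣_; _∣?_; m%n≡0⇒n∣m)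
  open import Data.Nat.Primality using (Prime)
  open import Data.Bool using (Bool; true; false; if_then_else_; _∧_)
  open import Data.Rational hiding (NonZero; _/_)
  open import Data.Rational.Properties
  open import Data.List using (List; []; _∷_)
  open import Data.List.Membership.Propositional using (_∈_)
  open import Data.List.Relation.Unary.Unique.Propositional using (Unique)
  open import Data.Empty using (⊥-elim)
  open import Data.Product using (∃-syntax; _×_; _,_; proj₁; proj₂)
  open import Relation.Nullary using (¬_; does)
  open import Relation.Binary.PropositionalEquality
  open import Tactic.RingSolver using (solve-∀)

  residue : ℕ → ℕ → ℕ
  residue n zero = n
  residue n p@(suc _) = n % p

  -- If ω classes modulo p are removed, the weight is 1 on the remaining classes and -(p - ω)/ω on
  -- the removed ones, which makes the mean zero. `φ₁` removes the class 0, `φ₂` the classes 0 and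
  -- 1.
  φ₁ φ₂ : ℕ → ℕ → ℚ
  φ₁ p zero = - ν (p ℕ.∸ 1)
  φ₁ p (suc _) = 1ℚ
  φ₂ p zero = - (ν (p ℕ.∸ 2) * ρ 2)
  φ₂ p (suc zero) = - (ν (p ℕ.∸ 2) * ρ 2)
  φ₂ p (suc (suc _)) = 1ℚ

  weight : (ℕ → Bool) → ℕ → ℕ → ℚ
  weight isQ p n = if isQ p then φ₂ p (residue n p) else φ₁ p (residue n p)

  -- The usual ω/(p - ω), with ω = 2 at the marked primes and ω = 1 at the others.
  density : (ℕ → Bool) → ℕ → ℚ
  density isQ p = if isQ p then ν 2 * ρ (p ℕ.∸ 2) else ρ (p ℕ.∸ 1)

  private
    tail : ∀ k (f : ℕ → ℚ) → (∀ i → f (suc (suc i)) ≡ 1ℚ) → (c : ℚ → ℚ) →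
      ∑ (below (suc (suc k))) (λ n → c (f n)) ≡ ν k * c 1ℚ + (c (f 1) + (c (f 0) + 0ℚ))
    tail k f one c = trans (cong (λ z → ∑ (below z) (λ n → c (f n))) (ℕₚ.+-comm 2 k))
      (trans (∑-below-+ k 2 _) (cong (_+ (c (f 1) + (c (f 0) + 0ℚ)))
        (trans (∑-cong (below k) (λ {i} _ → cong c (trans (cong f (ℕₚ.+-comm i 2)) (one i))))
          (trans (∑-const (below k) (c 1ℚ)) (cong (λ z → ν z * c 1ℚ) (length-below k))))))

    residues : ∀ {p} → 0 ℕ.< p → (φ : ℕ → ℚ) → ∑ (below p) (λ n → φ (residue n p)) ≡ ∑ (below p) φ
    residues {p@(suc _)} _ φ = ∑-cong (below p) (λ n∈ → cong φ (m<n⇒m%n≡m (below-< n∈)))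

    -- ω = 1, p = k + 2
    mean₁ : ∀ k → ∑ (below (suc (suc k))) (φ₁ (suc (suc k))) ≡ 0ℚ
    mean₁ k = trans (tail k (φ₁ (suc (suc k))) (λ _ → refl) (λ z → z))
      (trans (cong (λ z → ν k * 1ℚ + (1ℚ + (- z + 0ℚ))) (ν-suc k)) (lem (ν k)))
      where
      lem : ∀ k → k * 1ℚ + (1ℚ + (- (1ℚ + k) + 0ℚ)) ≡ 0ℚ
      lem = solve-∀ ringℚ

    square₁ : ∀ k → ρ (suc k) * ∑ (below (suc (suc k))) (λ n → φ₁ (suc (suc k)) n * φ₁ (suc (suc k)) n) ≡ ν (suc (suc k))
    square₁ k = trans (cong (ρ (suc k) *_) (trans (tail k (φ₁ (suc (suc k))) (λ _ → refl) (λ z → z * z))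
        (trans (lem (ν k) (ν (suc k))) (cong (_+ ν (suc k) * ν (suc k)) (sym (ν-suc k))))))
      (trans (lem₂ (ρ (suc k)) (ν (suc k))) (trans (cong (λ z → z + z * ν (suc k)) (ρν (ℕ.s≤s ℕ.z≤n)))
        (trans (cong (1ℚ +_) (*-identityˡ (ν (suc k)))) (sym (ν-suc (suc k))))))
      where
      lem : ∀ k s → k * (1ℚ * 1ℚ) + (1ℚ * 1ℚ + (- s * - s + 0ℚ)) ≡ (1ℚ + k) + s * s
      lem = solve-∀ ringℚ
      lem₂ : ∀ r s → r * (s + s * s) ≡ r * s + r * s * s
      lem₂ = solve-∀ ringℚ

    half : ν 2 * ρ 2 ≡ 1ℚ
    half = νρ (ℕ.s≤s ℕ.z≤n)
    two : ν 2 ≡ 1ℚ + 1ℚ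
    two = trans (ν-suc 1) (cong (1ℚ +_) ν1)

    mean₂ : ∀ k → ∑ (below (suc (suc k))) (φ₂ (suc (suc k))) ≡ 0ℚ
    mean₂ k = trans (tail k (φ₂ (suc (suc k))) (λ _ → refl) (λ z → z))
      (trans (lem (ν k) (ρ 2)) (trans (cong (λ z → ν k * (1ℚ - z)) (trans (cong (_* ρ 2) (sym two)) half)) (*-zeroʳ (ν k))))
      where
      lem : ∀ k h → k * 1ℚ + (- (k * h) + (- (k * h) + 0ℚ)) ≡ k * (1ℚ - (1ℚ + 1ℚ) * h)
      lem = solve-∀ ringℚ

    square₂ : ∀ {k} → 0 ℕ.< k → ν 2 * ρ k * ∑ (below (suc (suc k))) (λ n → φ₂ (suc (suc k)) n * φ₂ (suc (suc k)) n) ≡ ν (suc (suc k))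
    square₂ {k} 0<k = trans (cong (ν 2 * ρ k *_) (tail k (φ₂ (suc (suc k))) (λ _ → refl) (λ z → z * z)))
      (trans (cong (λ z → z * ρ k * (ν k * (1ℚ * 1ℚ) + (- (ν k * ρ 2) * - (ν k * ρ 2) + (- (ν k * ρ 2) * - (ν k * ρ 2) + 0ℚ)))) two)
      (trans (lem (ρ k) (ν k) (ρ 2)) (trans (cong₂ (λ y z → y * (1ℚ + 1ℚ) + y * ν k * (z * z)) (ρν 0<k) (trans (cong (_* ρ 2) (sym two)) half))
      (trans (lem₂ (ν k)) (sym (trans (ν-suc (suc k)) (cong (1ℚ +_) (ν-suc k))))))))
      where
      lem : ∀ r k h → (1ℚ + 1ℚ) * r * (k * (1ℚ * 1ℚ) + (- (k * h) * - (k * h) + (- (k * h) * - (k * h) + 0ℚ))) ≡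
        r * k * (1ℚ + 1ℚ) + r * k * k * (((1ℚ + 1ℚ) * h) * ((1ℚ + 1ℚ) * h))
      lem = solve-∀ ringℚ
      lem₂ : ∀ k → 1ℚ * (1ℚ + 1ℚ) + 1ℚ * k * (1ℚ * 1ℚ) ≡ 1ℚ + (1ℚ + k)
      lem₂ = solve-∀ ringℚ

    ∣-∣≤ : ∀ {a b} → 0ℚ ≤ a → a ≤ b → ∣ - a ∣ ≤ b
    ∣-∣≤ {a} 0≤a a≤b = ≤-trans (≡⇒≤ (trans (∣-p∣≡∣p∣ a) (0≤p⇒∣p∣≡p 0≤a))) a≤b

    ∣1∣≤ : ∀ {p} → 0 ℕ.< p → ∣ 1ℚ ∣ ≤ ν p
    ∣1∣≤ 0<p = ≤-trans (≡⇒≤ (0≤p⇒∣p∣≡p 0≤1)) (1≤ν 0<p)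

    φ₁-bound : ∀ {p} → 0 ℕ.< p → ∀ i → ∣ φ₁ p i ∣ ≤ ν p
    φ₁-bound {p} _ zero = ∣-∣≤ (0≤ν (p ℕ.∸ 1)) (ν-mono (ℕₚ.m∸n≤m p 1))
    φ₁-bound 0<p (suc _) = ∣1∣≤ 0<p

    c≤ : ∀ p → 0ℚ ≤ ν (p ℕ.∸ 2) * ρ 2 × ν (p ℕ.∸ 2) * ρ 2 ≤ ν p
    c≤ p = 0≤* (0≤ν (p ℕ.∸ 2)) (0≤ρ 2) , ≤-trans (*-monoˡ (0≤ν (p ℕ.∸ 2)) (ρ≤1 2))
      (≤-trans (≡⇒≤ (*-identityʳ (ν (p ℕ.∸ 2)))) (ν-mono (ℕₚ.m∸n≤m p 2)))

    φ₂-bound : ∀ {p} → 0 ℕ.< p → ∀ i → ∣ φ₂ p i ∣ ≤ ν p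
    φ₂-bound {p} _ zero = ∣-∣≤ (proj₁ (c≤ p)) (proj₂ (c≤ p))
    φ₂-bound {p} _ (suc zero) = ∣-∣≤ (proj₁ (c≤ p)) (proj₂ (c≤ p))
    φ₂-bound 0<p (suc (suc _)) = ∣1∣≤ 0<p

  module _ (isQ : ℕ → Bool) where

    private
      w = weight isQ
      d = density isQ

    weight-periodic : ∀ p → Periodic p (w p)
    weight-periodic zero n = cong (w 0) (ℕₚ.+-identityʳ n)
    weight-periodic p@(suc _) n = cong (λ r → if isQ p then φ₂ p r else φ₁ p r) ([m+n]%n≡m%n n p)

    weight-mean : ∀ {p} → 1 ℕ.< p → ∑ (below p) (w p) ≡ 0ℚ
    weight-mean {p@(suc (suc k))} (ℕ.s≤s (ℕ.s≤s _)) with isQ p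
    ... | true = trans (residues {p} (ℕ.s≤s ℕ.z≤n) (φ₂ p)) (mean₂ k)
    ... | false = trans (residues {p} (ℕ.s≤s ℕ.z≤n) (φ₁ p)) (mean₁ k)

    weight-square : ∀ {p} → 1 ℕ.< p → (isQ p ≡ true → 4 ℕ.≤ p) → d p * ∑ (below p) (λ n → w p n * w p n) ≡ ν p
    weight-square {p@(suc (suc k))} (ℕ.s≤s (ℕ.s≤s _)) big with isQ p
    ... | true = trans (cong (ν 2 * ρ k *_) (residues {p} (ℕ.s≤s ℕ.z≤n) (λ z → φ₂ p z * φ₂ p z)))
      (square₂ (ℕₚ.≤-trans (ℕ.s≤s ℕ.z≤n) (ℕ.s≤s⁻¹ (ℕ.s≤s⁻¹ (big refl)))))
    ... | false = trans (cong (ρ (suc k) *_) (residues {p} (ℕ.s≤s ℕ.z≤n) (λ z → φ₁ p z * φ₁ p z))) (square₁ k)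

    weight-bound : ∀ {p} → 0 ℕ.< p → ∀ n → ∣ w p n ∣ ≤ ν p
    weight-bound {p} 0<p n with isQ p
    ... | true = φ₂-bound 0<p (residue n p)
    ... | false = φ₁-bound 0<p (residue n p)

    0≤density : ∀ p → 0ℚ ≤ d p
    0≤density p with isQ p
    ... | true = 0≤* (0≤ν 2) (0≤ρ (p ℕ.∸ 2))
    ... | false = 0≤ρ (p ℕ.∸ 1)

    -- At a marked prime the value is 2/(p - 2), and this is the reason for demanding p ≥ 4 there.
    density≤1 : ∀ {p} → (isQ p ≡ true → 4 ℕ.≤ p) → d p ≤ 1ℚ
    density≤1 {p} big with isQ p
    ... | true = ≤-trans (*-monoˡ (0≤ν 2) (ρ-anti (ℕ.s≤s ℕ.z≤n) (ℕₚ.∸-monoˡ-≤ 2 (big refl)))) (≡⇒≤ half)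
    ... | false = ρ≤1 (p ℕ.∸ 1)

    density-lower : ∀ {p} → 1 ℕ.< p → (isQ p ≡ true → 4 ℕ.≤ p) → (if isQ p then ν 2 else 1ℚ) * ρ p ≤ d p
    density-lower {p} 1<p big with isQ p
    ... | true = *-monoˡ (0≤ν 2) (ρ-anti (ℕₚ.≤-trans (ℕ.s≤s ℕ.z≤n) (ℕₚ.∸-monoˡ-≤ 2 (big refl))) (ℕₚ.m∸n≤m p 2))
    ... | false = ≤-trans (≡⇒≤ (*-identityˡ (ρ p))) (ρ-anti (ℕₚ.m<n⇒0<n∸m 1<p) (ℕₚ.m∸n≤m p 1))

    weight-one : ∀ {p n} → 1 ℕ.< p → ¬ (p ∣ n) → (isQ p ≡ true → ¬ (n ≈ 1 [ p ])) → w p n ≡ 1ℚ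
    weight-one {suc zero} (ℕ.s≤s ())
    weight-one {p@(suc (suc k))} {n} 1<p p∤n n≢1 with isQ p | n % p in eq
    ... | true | zero = ⊥-elim (p∤n (m%n≡0⇒n∣m n p eq))
    ... | true | suc zero = ⊥-elim (n≢1 refl (≈-trans (≈-sym (%-≈ n p)) (≡⇒≈ eq)))
    ... | true | suc (suc _) = refl
    ... | false | zero = ⊥-elim (p∤n (m%n≡0⇒n∣m n p eq))
    ... | false | suc _ = refl

    module SieveWith
      (P : List ℕ) (P-unique : Unique P) (P-prime : ∀ {p} → p ∈ P → Prime p)
      (big : ∀ {p} → p ∈ P → isQ p ≡ true → 4 ℕ.≤ p) where

      open LargeSieve P P-unique P-prime w d (λ {p} _ → weight-periodic p) (λ p∈ → weight-mean (prime⇒1< (P-prime p∈)))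
        (λ p∈ → weight-square (prime⇒1< (P-prime p∈)) (big p∈)) (λ p∈ → weight-bound (prime⇒0< (P-prime p∈)))
        (λ {p} _ → 0≤density p) (λ p∈ → density≤1 (big p∈)) public

      countQ : ℕ → ℚ
      countQ r = ∑ P (λ p → if does (p ∣? r) ∧ isQ p then 1ℚ else 0ℚ)

      private
        0≤countQ : ∀ (ps : List ℕ) r → 0ℚ ≤ ∑ ps (λ p → if does (p ∣? r) ∧ isQ p then 1ℚ else 0ℚ)
        0≤countQ ps r = ∑-nonneg ps lem
          where
          lem : ∀ {p} → p ∈ ps → 0ℚ ≤ (if does (p ∣? r) ∧ isQ p then 1ℚ else 0ℚ)
          lem {p} _ with does (p ∣? r) ∧ isQ p
          ... | true = 0≤1
          ... | false = ≤-refl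

        powers : ∀ (ps : List ℕ) r → 1ℚ + ∑ ps (λ p → if does (p ∣? r) ∧ isQ p then 1ℚ else 0ℚ) ≤ ∏ ps (λ p → if does (p ∣? r) ∧ isQ p then ν 2 else 1ℚ)
        powers [] r = ≡⇒≤ (+-identityʳ 1ℚ)
        powers (p ∷ ps) r with does (p ∣? r) ∧ isQ p
        ... | true = ≤-trans (≤-by s (0≤countQ ps r) (trans (cong (_* (1ℚ + s)) two) (lem s))) (*-monoˡ (0≤ν 2) (powers ps r))
          where
          s = ∑ ps (λ p → if does (p ∣? r) ∧ isQ p then 1ℚ else 0ℚ)
          lem : ∀ s → (1ℚ + 1ℚ) * (1ℚ + s) ≡ 1ℚ + (1ℚ + s) + s
          lem = solve-∀ ringℚ
        ... | false = ≤-trans (≡⇒≤ (cong (1ℚ +_) (+-identityˡ (∑ ps (λ p → if does (p ∣? r) ∧ isQ p then 1ℚ else 0ℚ)))))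
          (≤-trans (powers ps r) (≡⇒≤ (sym (*-identityˡ (∏ ps (λ p → if does (p ∣? r) ∧ isQ p then ν 2 else 1ℚ))))))

        ρ-Π : ∀ (ps : List ℕ) (f : ℕ → ℕ) → ρ (Π ps f) ≡ ∏ ps (λ p → ρ (f p))
        ρ-Π [] f = ρ1
        ρ-Π (p ∷ ps) f = trans (ρ-* (f p) (Π ps f)) (cong (ρ (f p) *_) (ρ-Π ps f))

      -- Each prime factor p of r contributes at least ω/p, so G r ≥ 2^c / r, where c counts the
      -- marked prime factors. The weaker bound (1 + c)/r is linear in c and can therefore be summed
      -- over the marked primes.
      G-lower-count : ∀ {r} → rad r ≡ r → (1ℚ + countQ r) * ρ r ≤ G r
      G-lower-count {r} e = ≤-trans (*-monoʳ (0≤ρ r) (powers P r))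
        (≤-trans (≡⇒≤ (trans (cong (∏ P (λ p → if does (p ∣? r) ∧ isQ p then ν 2 else 1ℚ) *_) (trans (cong ρ (sym e)) (ρ-Π P (λ p → if does (p ∣? r) then p else 1)))) (sym (∏-* P (λ p → if does (p ∣? r) ∧ isQ p then ν 2 else 1ℚ) (λ p → ρ (if does (p ∣? r) then p else 1))))))
        (∏-mono P nonneg step))
        where
        F : ℕ → ℚ
        F p = (if does (p ∣? r) ∧ isQ p then ν 2 else 1ℚ) * ρ (if does (p ∣? r) then p else 1)
        nonneg : ∀ {p} → p ∈ P → 0ℚ ≤ F p
        nonneg {p} _ with does (p ∣? r) ∧ isQ p
        ... | true = 0≤* (0≤ν 2) (0≤ρ (if does (p ∣? r) then p else 1))
        ... | false = 0≤* 0≤1 (0≤ρ (if does (p ∣? r) then p else 1))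
        step : ∀ {p} → p ∈ P → F p ≤ (if does (p ∣? r) then d p else 1ℚ)
        step {p} p∈ with does (p ∣? r)
        ... | true = density-lower (prime⇒1< (P-prime p∈)) (big p∈)
        ... | false = ≡⇒≤ (trans (cong (1ℚ *_) ρ1) (*-identityˡ 1ℚ))

      G-lower : ∀ {r} → rad r ≡ r → ρ r ≤ G r
      G-lower {r} e = ≤-trans (≤-by (countQ r * ρ r) (0≤* (0≤countQ P r) (0≤ρ r)) (lem (countQ r) (ρ r))) (G-lower-count e)
        where
        lem : ∀ c r → (1ℚ + c) * r ≡ r + c * r
        lem = solve-∀ ringℚ

-- Upper bounds for the number of primes and of primes with restricted p - 1.

module PrimeBounds where

  open Rat
  open Sums
  open Mod
  open Sieve using (Π)
  open Harmonic
  open Weights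
  open import Data.Nat as ℕ using (ℕ; suc)
  import Data.Nat.Properties as ℕₚ
  open import Data.Nat.Divisibility using (_∣_; _∣?_; divides; ∣⇒≤; m∣m*n)
  open import Data.Nat.Primality using (Prime; prime⇒nonZero)
  open import Data.Nat.Tactic.RingSolver renaming (solve-∀ to solve-∀ℕ)
  open import Data.Bool using (Bool; true; false; if_then_else_; _∧_)
  open import Data.Rational hiding (NonZero; _/_)
  open import Data.Rational.Properties
  open import Data.List using (List; map; length; filter)
  open import Data.List.Membership.Propositional using (_∈_)
  open import Data.List.Membership.Propositional.Properties using (∈-map⁻; ∈-map⁺; ∈-filter⁻; ∈-filter⁺)
  open import Data.List.Membership.DecPropositional ℕₚ._≟_ using (_∈?_)
  open import Data.List.Relation.Unary.Unique.Propositional using (Unique)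
  open import Data.Product using (∃-syntax; _×_; _,_; proj₁; proj₂)
  open import Relation.Nullary using (Dec; yes; no; ¬_; does; ¬?)
  open import Relation.Nullary.Decidable using (dec-true)
  open import Relation.Binary.PropositionalEquality
  open import Tactic.RingSolver using (solve-∀)

  infix 4 _<?′_

  -- Abstract, since the Boolean of the library's decision procedure reduces too eagerly for with-abstraction.
  abstract
    _<?′_ : ∀ a b → Dec (a ℕ.< b)
    a <?′ b = a ℕ.<? b

    primesBetween : ℕ → ℕ → List ℕ
    primesBetween i k = filter (λ p → 2 ℕ.^ i <?′ p) (primesUpTo (2 ℕ.^ k))

    ∈-primesBetween : ∀ {p i k} → Prime p → 2 ℕ.^ i ℕ.< p → p ℕ.≤ 2 ℕ.^ k → p ∈ primesBetween i k
    ∈-primesBetween {i = i} pp lo hi = ∈-filter⁺ (λ p → 2 ℕ.^ i <?′ p) (∈-primesUpTo pp hi) lo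

    primesBetween-spec : ∀ {p i k} → p ∈ primesBetween i k → Prime p × 2 ℕ.^ i ℕ.< p × p ℕ.≤ 2 ℕ.^ k
    primesBetween-spec {i = i} {k} p∈ with ∈-filter⁻ (λ p → 2 ℕ.^ i <?′ p) {xs = primesUpTo (2 ℕ.^ k)} p∈
    ... | m , lo = primesUpTo-prime {R = 2 ℕ.^ k} m , lo , primesUpTo-≤ {R = 2 ℕ.^ k} m

    primesBetween-unique : ∀ i k → Unique (primesBetween i k)
    primesBetween-unique i k = filter-unique (λ p → 2 ℕ.^ i <?′ p) (primesUpTo-unique (2 ℕ.^ k))

    ∑-primesBetween : ∀ i k f → ∑ (primesBetween i k) f ≡ ∑ (primesUpTo (2 ℕ.^ k)) (λ p → if does (2 ℕ.^ i <?′ p) then f p else 0ℚ)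
    ∑-primesBetween i k f = ∑-filter (λ p → 2 ℕ.^ i <?′ p) (primesUpTo (2 ℕ.^ k)) f

  2^-mono : ∀ {i j} → i ℕ.≤ j → 2 ℕ.^ i ℕ.≤ 2 ℕ.^ j
  2^-mono = ℕₚ.^-monoʳ-≤ 2

  ≈1⇒∣ : ∀ {p q} → 0 ℕ.< p → p ≈ 1 [ q ] → q ∣ p ℕ.∸ 1
  ≈1⇒∣ {suc p} _ e = ≈0⇒∣ (≈-+-cancelˡ 1 e)

  squarefree-multiples : ∀ {q} → Prime q → ∀ R → ∑ (squarefrees R) (λ r → if does (q ∣? r) then ρ r else 0ℚ) ≤ ρ q * ℓ R
  squarefree-multiples {q} pq R = ≤-trans (≡⇒≤ (sym (∑-filter (q ∣?_) (squarefrees R) ρ)))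
    (≤-trans (∑-⊆ {ys = map (q ℕ.*_) (squarefrees R)} (filter-unique (q ∣?_) (squarefrees-unique R)) sub 0≤ρ)
    (≡⇒≤ (trans (∑-map (q ℕ.*_) (squarefrees R) ρ) (trans (∑-cong (squarefrees R) (λ {r} _ → ρ-* q r)) (∑-*ˡ (squarefrees R) (ρ q) ρ)))))
    where
    sub : ∀ {r} → r ∈ filter (q ∣?_) (squarefrees R) → r ∈ map (q ℕ.*_) (squarefrees R)
    sub {r} r∈ with ∈-filter⁻ (q ∣?_) {xs = squarefrees R} r∈
    ... | m , divides b refl with squarefrees-spec {R = R} m
    ...   | 0<r , r≤R , sf = subst (_∈ map (q ℕ.*_) (squarefrees R)) (ℕₚ.*-comm q b) (∈-map⁺ (q ℕ.*_) (∈-squarefrees 0<b b≤R (squarefree-∣ 0<r (m∣m*n q) sf)))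
      where
      0<b : 0 ℕ.< b
      0<b = ℕₚ.n≢0⇒n>0 λ b≡0 → ℕₚ.<-irrefl (sym (cong (ℕ._* q) b≡0)) 0<r
      b≤R : b ℕ.≤ R
      b≤R = ℕₚ.≤-trans (ℕₚ.m≤m*n b q {{prime⇒nonZero pq}}) r≤R

  -- The multiples of q carry at most the fraction 1/q ≤ 1/2 of the whole sum.
  ℓ-coprime : ∀ {q} → Prime q → ∀ R → ρ 2 * ℓ R ≤ ∑ (filter (λ b → ¬? (q ∣? b)) (squarefrees R)) ρ
  ℓ-coprime {q} pq R = ≤-by (ρ 2 * ℓ R - X) (≤⇒0≤- (≤-trans (squarefree-multiples pq R) (*-monoʳ (0≤ℓ R) (ρ-anti (ℕ.s≤s ℕ.z≤n) (prime⇒1< pq)))))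
    (trans (lem Y X) (trans (cong (_- X) (sym split)) (trans (cong (λ z → z * ℓ R - X) (sym one)) (lem₂ (ρ 2) (ℓ R) X))))
    where
    X = ∑ (squarefrees R) (λ r → if does (q ∣? r) then ρ r else 0ℚ)
    Y = ∑ (filter (λ b → ¬? (q ∣? b)) (squarefrees R)) ρ
    lem : ∀ y x → y ≡ (x + y) - x
    lem = solve-∀ ringℚ
    lem₂ : ∀ h l x → (h + h) * l - x ≡ h * l + (h * l - x)
    lem₂ = solve-∀ ringℚ
    one : ρ 2 + ρ 2 ≡ 1ℚ
    one = trans (lem₃ (ρ 2)) (trans (cong (_* ρ 2) (sym (trans (ν-suc 1) (cong (1ℚ +_) ν1)))) (νρ (ℕ.s≤s ℕ.z≤n)))
      where
      lem₃ : ∀ h → h + h ≡ (1ℚ + 1ℚ) * h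
      lem₃ = solve-∀ ringℚ
    split : 1ℚ * ℓ R ≡ X + Y
    split = trans (*-identityˡ (ℓ R)) (trans (∑-cong (squarefrees R) (λ {r} _ → pick r))
      (trans (∑-+ (squarefrees R) _ _) (cong (X +_) (sym (∑-filter (λ b → ¬? (q ∣? b)) (squarefrees R) ρ)))))
      where
      pick : ∀ r → ρ r ≡ (if does (q ∣? r) then ρ r else 0ℚ) + (if does (¬? (q ∣? r)) then ρ r else 0ℚ)
      pick r with q ∣? r
      ... | yes _ = sym (+-identityʳ (ρ r))
      ... | no _ = sym (+-identityˡ (ρ r))

  squarefrees-ok : ∀ R {r} → r ∈ squarefrees R → 0 ℕ.< r × r ℕ.≤ R × Π (primesUpTo R) (λ p → if does (p ∣? r) then p else 1) ≡ r
  squarefrees-ok R {r} r∈ with squarefrees-spec {R = R} r∈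
  ... | 0<r , r≤R , sf = 0<r , r≤R , radical-squarefree (primesUpTo-prime {R = R}) (primesUpTo-unique R) 0<r sf
    (λ pp d → ∈-primesUpTo pp (ℕₚ.≤-trans (∣⇒≤ {{ℕ.>-nonZero 0<r}} d) r≤R))

  5th : ∀ v → 2 ℕ.^ v ℕ.* (2 ℕ.^ v ℕ.* 2 ℕ.^ v ℕ.* (2 ℕ.^ v ℕ.* 2 ℕ.^ v)) ≡ 2 ℕ.^ (5 ℕ.* v)
  5th v = trans (cong (λ z → 2 ℕ.^ v ℕ.* (z ℕ.* z)) (sym (ℕₚ.^-distribˡ-+-* 2 v v)))
    (trans (cong (2 ℕ.^ v ℕ.*_) (sym (ℕₚ.^-distribˡ-+-* 2 (v ℕ.+ v) (v ℕ.+ v)))) (trans (sym (ℕₚ.^-distribˡ-+-* 2 v _)) (cong (2 ℕ.^_) (lem v))))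
    where
    lem : ∀ v → v ℕ.+ (v ℕ.+ v ℕ.+ (v ℕ.+ v)) ≡ 5 ℕ.* v
    lem = solve-∀ℕ

  large-prime-∤ : ∀ {p n R} → p ∈ primesUpTo R → Prime n → R ℕ.< n → ¬ (p ∣ n)
  large-prime-∤ {p} {n} {R} p∈ pn R<n d = ℕₚ.<-irrefl (prime-∣-prime (primesUpTo-prime {R = R} p∈) pn d) (ℕₚ.≤-<-trans (primesUpTo-≤ {R = R} p∈) R<n)

  -- A bound of Chebyshev type: a prime above R = 2^v avoids the class 0 modulo every prime up to R,
  -- and L is at least v/4.
  primes-bound : ∀ v N {S : List ℕ} → 2 ℕ.^ (5 ℕ.* v) ℕ.≤ N → Unique S →
    (∀ {p} → p ∈ S → Prime p × 2 ℕ.^ v ℕ.< p × p ℕ.< N) → ν (length S) * (ν v * ρ 4) ≤ ν N + ν N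
  primes-bound v N {S} le S-unique S-spec = ≤-trans (*-monoˡ (0≤ν (length S)) L≥)
    (large-sieve R N (squarefrees-unique R) (squarefrees-ok R) (ℕₚ.≤-trans (ℕₚ.≤-reflexive (5th v)) le) S-unique (λ n∈ → proj₂ (proj₂ (S-spec n∈))) one)
    where
    R = 2 ℕ.^ v
    open SieveWith (λ _ → false) (primesUpTo R) (primesUpTo-unique R) (primesUpTo-prime {R = R}) (λ _ ())
    L≥ : ν v * ρ 4 ≤ ∑ (squarefrees R) G
    L≥ = ≤-trans (ℓ-lower v) (∑-mono (squarefrees R) (λ r∈ → G-lower (proj₂ (proj₂ (squarefrees-ok R r∈)))))
    one : ∀ {n p r} → n ∈ S → p ∈ primesUpTo R → r ∈ squarefrees R → p ∣ r → weight (λ _ → false) p n ≡ 1ℚ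
    one n∈ p∈ _ _ = weight-one (λ _ → false) (prime⇒1< (primesUpTo-prime {R = R} p∈))
      (large-prime-∤ {R = R} p∈ (proj₁ (S-spec n∈)) (proj₁ (proj₂ (S-spec n∈)))) (λ ())

  -- Modulo q in Q the class 1 is avoided too. By `G-lower-count`, L is at least the sum over q in Q
  -- of the 1/r with r a multiple of q. The r = q b with b ≤ 2^v squarefree and prime to q already
  -- give v/(8 q), whence the factor σ. As q b may reach 2^(2 v), R is 2^(2 v), and R^5 is 2^(10 v).
  shifted-primes-bound : ∀ v N {Q S : List ℕ} {σ : ℚ} → 2 ℕ.^ (10 ℕ.* v) ℕ.≤ N → Unique Q →
    (∀ {q} → q ∈ Q → Prime q × 4 ℕ.≤ q × q ℕ.≤ 2 ℕ.^ v) → σ ≤ ∑ Q ρ → Unique S →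
    (∀ {p} → p ∈ S → Prime p × 2 ℕ.^ (v ℕ.+ v) ℕ.< p × p ℕ.< N × (∀ {q} → q ∈ Q → ¬ (q ∣ p ℕ.∸ 1))) →
    ν (length S) * (σ * (ν v * ρ 8)) ≤ ν N + ν N
  shifted-primes-bound v N {Q} {S} {σ} le Q-unique Q-spec σ≤ S-unique S-spec = ≤-trans (*-monoˡ (0≤ν (length S)) L≥)
    (large-sieve R N (squarefrees-unique R) (squarefrees-ok R)
      (ℕₚ.≤-trans (ℕₚ.≤-reflexive (trans (5th (v ℕ.+ v)) (cong (2 ℕ.^_) (lem v)))) le) S-unique (λ n∈ → proj₁ (proj₂ (proj₂ (S-spec n∈)))) one)
    where
    lem : ∀ v → 5 ℕ.* (v ℕ.+ v) ≡ 10 ℕ.* v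
    lem = solve-∀ℕ
    R = 2 ℕ.^ (v ℕ.+ v)
    P = primesUpTo R
    isQ : ℕ → Bool
    isQ p = does (p ∈? Q)
    isQ⇒∈ : ∀ {p} → isQ p ≡ true → p ∈ Q
    isQ⇒∈ {p} e with p ∈? Q
    ... | yes p∈ = p∈
    open SieveWith isQ P (primesUpTo-unique R) (primesUpTo-prime {R = R}) (λ _ e → proj₁ (proj₂ (Q-spec (isQ⇒∈ e))))
    RR = squarefrees R
    Q⊆P : ∀ {q} → q ∈ Q → q ∈ P
    Q⊆P q∈ = ∈-primesUpTo (proj₁ (Q-spec q∈)) (ℕₚ.≤-trans (proj₂ (proj₂ (Q-spec q∈))) (2^-mono (ℕₚ.m≤m+n v v)))
    inner : ∀ {q} → q ∈ Q → ρ q * (ρ 2 * ℓ (2 ℕ.^ v)) ≤ ∑ RR (λ r → if does (q ∣? r) then ρ r else 0ℚ)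
    inner {q} q∈ = ≤-trans (*-monoˡ (0≤ρ q) (ℓ-coprime pq (2 ℕ.^ v)))
      (≤-trans (≡⇒≤ (trans (sym (∑-*ˡ bs (ρ q) ρ)) (trans (∑-cong bs (λ {b} _ → sym (ρ-* q b))) (sym (∑-map (q ℕ.*_) bs ρ)))))
      (≤-trans (∑-⊆ {ys = filter (q ∣?_) RR} (map-unique (λ {x} {y} _ _ → ℕₚ.*-cancelˡ-≡ x y q {{prime⇒nonZero pq}}) (filter-unique ∤? (squarefrees-unique (2 ℕ.^ v)))) sub 0≤ρ)
        (≡⇒≤ (∑-filter (q ∣?_) RR ρ))))
      where
      pq = proj₁ (Q-spec q∈)
      ∤? = λ b → ¬? (q ∣? b)
      bs = filter ∤? (squarefrees (2 ℕ.^ v))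
      sub : ∀ {r} → r ∈ map (q ℕ.*_) bs → r ∈ filter (q ∣?_) RR
      sub r∈ with ∈-map⁻ (q ℕ.*_) r∈
      ... | b , b∈ , refl with ∈-filter⁻ ∤? {xs = squarefrees (2 ℕ.^ v)} b∈
      ...   | b∈′ , q∤b with squarefrees-spec {R = 2 ℕ.^ v} b∈′
      ...     | 0<b , b≤ , sf = ∈-filter⁺ (q ∣?_) (∈-squarefrees (ℕₚ.*-mono-≤ (prime⇒0< pq) 0<b)
        (ℕₚ.≤-trans (ℕₚ.*-mono-≤ (proj₂ (proj₂ (Q-spec q∈))) b≤) (ℕₚ.≤-reflexive (sym (ℕₚ.^-distribˡ-+-* 2 v v))))
        (squarefree-* 0<b pq q∤b sf)) (m∣m*n b)
    half-ℓ : ν v * ρ 8 ≤ ρ 2 * ℓ (2 ℕ.^ v)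
    half-ℓ = ≤-trans (≡⇒≤ (trans (cong (ν v *_) (ρ-* 2 4)) (lem₂ (ν v) (ρ 2) (ρ 4)))) (*-monoˡ (0≤ρ 2) (ℓ-lower v))
      where
      lem₂ : ∀ a b c → a * (b * c) ≡ b * (a * c)
      lem₂ = solve-∀ ringℚ
    pick : ∀ r {q} → q ∈ Q → (if does (q ∣? r) then ρ r else 0ℚ) ≤ ρ r * (if does (q ∣? r) ∧ isQ q then 1ℚ else 0ℚ)
    pick r {q} q∈ rewrite dec-true (q ∈? Q) q∈ with does (q ∣? r)
    ... | true = ≡⇒≤ (sym (*-identityʳ (ρ r)))
    ... | false = ≡⇒≤ (sym (*-zeroʳ (ρ r)))
    L≥ : σ * (ν v * ρ 8) ≤ ∑ RR G
    L≥ = ≤-trans (*-mono′) (≤-trans (≡⇒≤ (sym (∑-*ʳ Q (ρ 2 * ℓ (2 ℕ.^ v)) ρ))) (≤-trans (∑-mono Q inner)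
      (≤-trans (≡⇒≤ (∑-swap Q RR (λ q r → if does (q ∣? r) then ρ r else 0ℚ))) (∑-mono RR bound))))
      where
      *-mono′ : σ * (ν v * ρ 8) ≤ ∑ Q ρ * (ρ 2 * ℓ (2 ℕ.^ v))
      *-mono′ = ≤-trans (*-monoʳ (0≤* (0≤ν v) (0≤ρ 8)) σ≤) (*-monoˡ (∑-nonneg Q (λ {q} _ → 0≤ρ q)) half-ℓ)
      bound : ∀ {r} → r ∈ RR → ∑ Q (λ q → if does (q ∣? r) then ρ r else 0ℚ) ≤ G r
      bound {r} r∈ = ≤-trans (∑-mono Q (λ q∈ → pick r q∈)) (≤-trans (≡⇒≤ (∑-*ˡ Q (ρ r) ind))
        (≤-trans (*-monoˡ (0≤ρ r) (∑-⊆ Q-unique Q⊆P 0≤ind)) (≤-trans (≤-by (ρ r) (0≤ρ r) (lem₃ (ρ r) (countQ r))) (G-lower-count (proj₂ (proj₂ (squarefrees-ok R r∈)))))))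
        where
        ind : ℕ → ℚ
        ind p = if does (p ∣? r) ∧ isQ p then 1ℚ else 0ℚ
        0≤ind : ∀ p → 0ℚ ≤ ind p
        0≤ind p with does (p ∣? r) ∧ isQ p
        ... | true = 0≤1
        ... | false = ≤-refl
        lem₃ : ∀ a c → (1ℚ + c) * a ≡ a * c + a
        lem₃ = solve-∀ ringℚ
    one : ∀ {n p r} → n ∈ S → p ∈ P → r ∈ RR → p ∣ r → weight isQ p n ≡ 1ℚ
    one n∈ p∈ _ _ with S-spec n∈
    ... | pn , lo , _ , free = weight-one isQ (prime⇒1< (primesUpTo-prime {R = R} p∈)) (large-prime-∤ {R = R} p∈ pn lo)
      (λ e ≈1 → free (isQ⇒∈ e) (≈1⇒∣ (prime⇒0< pn) ≈1))

-- Reciprocal sums of primes in blocks.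

module Blocks where

  open Rat
  open Sums
  open Mod
  open Sieve using (Π; Π-mono; ∑-below-+)
  open Harmonic
  open PrimeBounds
  open import Data.Nat as ℕ using (ℕ; zero; suc)
  import Data.Nat.Properties as ℕₚ
  open import Data.Nat.DivMod using (_/_; m≡m%n+[m/n]*n; m%n<n; m/n*n≤m; /-monoˡ-≤; m*n/n≡m)
  open import Data.Nat.Divisibility using (_∣_; _∣?_)
  open import Data.Nat.Primality using (Prime)
  open import Data.Nat.Tactic.RingSolver renaming (solve-∀ to solve-∀ℕ)
  open import Data.Bool using (true; false; if_then_else_)
  open import Data.Rational hiding (NonZero; _/_)
  open import Data.Rational.Properties
  open import Data.List using (List; []; _∷_; _++_; length; filter)
  open import Data.List.Properties using (length-map)
  open import Data.List.Membership.Propositional using (_∈_; lose)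
  open import Data.List.Membership.Propositional.Properties using (∈-filter⁻; ∈-filter⁺; ∈-++⁺ˡ; ∈-++⁺ʳ)
  open import Data.List.Relation.Unary.Any as Any using (Any; any?)
  open import Data.List.Relation.Unary.Unique.Propositional using (Unique)
  open import Data.Empty using (⊥-elim)
  open import Data.Product using (∃-syntax; _×_; _,_; proj₁; proj₂)
  open import Data.Sum using (_⊎_; inj₁; inj₂)
  open import Relation.Nullary using (Dec; yes; no; ¬_; does; ¬?)
  open import Relation.Nullary.Decidable using (dec-true)
  open import Relation.Binary.PropositionalEquality hiding (J)
  open import Tactic.RingSolver using (solve-∀)

  U : ℕ → ℕ → ℚ
  U i k = ∑ (primesBetween i k) ρ

  0≤U : ∀ i k → 0ℚ ≤ U i k
  0≤U i k = ∑-nonneg (primesBetween i k) (λ {p} _ → 0≤ρ p)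

  primesBetween-split : ∀ {p j k} i → p ∈ primesBetween j k → p ∈ primesBetween j i ⊎ p ∈ primesBetween i k
  primesBetween-split {p} {j} {k} i p∈ with primesBetween-spec {i = j} {k} p∈ | p ℕ.≤? 2 ℕ.^ i
  ... | pp , lo , hi | yes le = inj₁ (∈-primesBetween pp lo le)
  ... | pp , lo , hi | no nle = inj₂ (∈-primesBetween pp (ℕₚ.≰⇒> nle) hi)

  U-split : ∀ j i k → U j k ≤ U j i + U i k
  U-split j i k = ≤-trans (∑-⊆ {ys = primesBetween j i ++ primesBetween i k} (primesBetween-unique j k) sub 0≤ρ)
    (≡⇒≤ (∑-++ (primesBetween j i) (primesBetween i k) ρ))
    where
    sub : ∀ {p} → p ∈ primesBetween j k → p ∈ primesBetween j i ++ primesBetween i k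
    sub p∈ with primesBetween-split {j = j} {k} i p∈
    ... | inj₁ m = ∈-++⁺ˡ m
    ... | inj₂ m = ∈-++⁺ʳ (primesBetween j i) m

  U-anti : ∀ {i j} k → i ℕ.≤ j → U j k ≤ U i k
  U-anti {i} {j} k i≤j = ∑-⊆ (primesBetween-unique j k) sub 0≤ρ
    where
    sub : ∀ {p} → p ∈ primesBetween j k → p ∈ primesBetween i k
    sub p∈ with primesBetween-spec {i = j} {k} p∈
    ... | pp , lo , hi = ∈-primesBetween pp (ℕₚ.≤-<-trans (2^-mono i≤j) lo) hi

  primesBetween-empty : ∀ {p} i → ¬ (p ∈ primesBetween i i)
  primesBetween-empty i p∈ with primesBetween-spec {i = i} {i} p∈
  ... | _ , lo , hi = ℕₚ.<-irrefl refl (ℕₚ.<-≤-trans lo hi)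

  private
    mass≤ : ∀ t {S : List ℕ} → (∀ {p} → p ∈ S → 2 ℕ.^ t ℕ.< p) → ∑ S ρ ≤ ν (length S) * ρ (2 ℕ.^ t)
    mass≤ t {S} lo = ≤-trans (∑-mono S (λ p∈ → ρ-anti (0<2^ t) (ℕₚ.<⇒≤ (lo p∈)))) (≡⇒≤ (∑-const S (ρ (2 ℕ.^ t))))

    -- The form in which the sieve bounds are converted into bounds for reciprocal sums.
    scale : ∀ t v c d s {n} → suc t ℕ.≤ c ℕ.* v → 0 ℕ.< d → 0ℚ ≤ s →
      ν n * (s * (ν v * ρ d)) ≤ ν (4 ℕ.* 2 ℕ.^ t) + ν (4 ℕ.* 2 ℕ.^ t) →
      ν (suc t) * (s * (ν n * ρ (2 ℕ.^ t))) ≤ ν (c ℕ.* (d ℕ.* 8))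
    scale t v c d s {n} t≤ 0<d 0≤s b =
      ≤-trans (*-monoʳ (0≤* 0≤s (0≤* (0≤ν n) (0≤ρ T))) (≤-trans (ν-mono t≤) (≡⇒≤ (ν-* c v))))
      (≤-trans (≡⇒≤ (trans (cong (λ z → (ν c * z) * (s * (ν n * ρ T))) (sym (trans (cong (ν v *_) (ρν 0<d)) (*-identityʳ (ν v)))))
        (lem (ν c) (ν v) (ρ d) (ν d) (ν n) (ρ T) s)))
      (≤-trans (*-monoˡ (0≤* (0≤* (0≤ν c) (0≤ν d)) (0≤ρ T)) b)
      (≡⇒≤ (trans (cong (λ z → ν c * ν d * ρ T * (z + z)) (ν-* 4 T)) (trans (lem₂ (ν c) (ν d) (ν 4) (ν T) (ρ T))
        (trans (cong (λ z → ν c * (ν d * ((ν 4 + ν 4) * z))) (νρ (0<2^ t)))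
        (trans (cong (λ z → ν c * (ν d * z)) (trans (*-identityʳ (ν 4 + ν 4)) (sym (ν-+ 4 4))))
        (sym (trans (ν-* c (d ℕ.* 8)) (cong (ν c *_) (ν-* d 8))))))))))) 
      where
      T = 2 ℕ.^ t
      lem : ∀ c v r d n x s → (c * (v * (r * d))) * (s * (n * x)) ≡ c * d * x * (n * (s * (v * r)))
      lem = solve-∀ ringℚ
      lem₂ : ∀ c d f t r → c * d * r * (f * t + f * t) ≡ c * (d * ((f + f) * (t * r)))
      lem₂ = solve-∀ ringℚ

    4T : ∀ t → 2 ℕ.^ suc (suc t) ≡ 4 ℕ.* 2 ℕ.^ t
    4T t = lem (2 ℕ.^ t)
      where
      lem : ∀ x → 2 ℕ.* (2 ℕ.* x) ≡ 4 ℕ.* x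
      lem = solve-∀ℕ

    below-4T : ∀ {p} t → p ℕ.≤ 2 ℕ.^ suc t → p ℕ.< 4 ℕ.* 2 ℕ.^ t
    below-4T {p} t p≤ = subst (p ℕ.<_) (4T t) (ℕₚ.≤-<-trans p≤ (ℕₚ.^-monoʳ-< 2 (ℕ.s≤s (ℕ.s≤s ℕ.z≤n)) (ℕₚ.n<1+n (suc t))))

    quotient-bound : ∀ t d .{{_ : ℕ.NonZero d}} → d ℕ.≤ t → suc t ℕ.≤ (d ℕ.+ d) ℕ.* (t / d)
    quotient-bound t d d≤t = ℕₚ.≤-trans (ℕ.s≤s (ℕₚ.≤-reflexive (m≡m%n+[m/n]*n t d)))
      (ℕₚ.≤-trans (ℕₚ.+-monoˡ-≤ (t / d ℕ.* d) (ℕₚ.≤-trans (m%n<n t d) (ℕₚ.m≤n*m d (t / d) {{ℕ.>-nonZero 0<v}}))) (ℕₚ.≤-reflexive (lem (t / d) d)))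
      where
      0<v : 0 ℕ.< t / d
      0<v = ℕₚ.≤-trans (ℕₚ.≤-reflexive (sym (trans (cong (_/ d) (sym (ℕₚ.+-identityʳ d))) (m*n/n≡m 1 d)))) (/-monoˡ-≤ d d≤t)
      lem : ∀ v d → v ℕ.* d ℕ.+ v ℕ.* d ≡ (d ℕ.+ d) ℕ.* v
      lem = solve-∀ℕ

  -- This is `primes-bound` with v = t/5 and N = 4·2^t; as t + 1 ≤ 10 v, the constant is 10·4·8. For
  -- t < 5 the trivial bound 5·2 is smaller.
  dyadic-mass : ∀ t → ν (suc t) * U t (suc t) ≤ ν 320
  dyadic-mass t with 5 ℕ.≤? t
  ... | yes 5≤t = ≤-trans (*-monoˡ (0≤ν (suc t)) (≤-trans (mass≤ t (λ p∈ → proj₁ (proj₂ (spec p∈)))) (≡⇒≤ (sym (*-identityˡ _)))))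
      (scale t (t / 5) 10 4 1ℚ (quotient-bound t 5 5≤t) (ℕ.s≤s ℕ.z≤n) 0≤1
      (≤-trans (≡⇒≤ (cong (ν (length S) *_) (*-identityˡ _)))
      (primes-bound (t / 5) (4 ℕ.* 2 ℕ.^ t) N≥ (primesBetween-unique t (suc t)) λ p∈ → proj₁ (spec p∈) , lower p∈ , below-4T t (proj₂ (proj₂ (spec p∈))))))
    where
    S = primesBetween t (suc t)
    spec : ∀ {p} → p ∈ S → _
    spec = primesBetween-spec {i = t} {suc t}
    lower : ∀ {p} → p ∈ S → 2 ℕ.^ (t / 5) ℕ.< p
    lower p∈ = ℕₚ.≤-<-trans (2^-mono (ℕₚ.≤-trans (ℕₚ.m≤m*n (t / 5) 5) (m/n*n≤m t 5))) (proj₁ (proj₂ (spec p∈)))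
    N≥ : 2 ℕ.^ (5 ℕ.* (t / 5)) ℕ.≤ 4 ℕ.* 2 ℕ.^ t
    N≥ = ℕₚ.≤-trans (2^-mono (ℕₚ.≤-trans (ℕₚ.≤-reflexive (ℕₚ.*-comm 5 (t / 5))) (m/n*n≤m t 5))) (ℕₚ.m≤n*m (2 ℕ.^ t) 4)
  ... | no t<5 = ≤-trans (*-mono (0≤ν (suc t)) (0≤U t (suc t)) (ν-mono (ℕₚ.≰⇒> t<5)) mass≤2)
      (≤-trans (≡⇒≤ (sym (ν-* 5 2))) (ν-mono {10} {320} (ℕₚ.m≤m+n 10 310)))
    where
    S = primesBetween t (suc t)
    len : length S ℕ.≤ 2 ℕ.^ suc t
    len = ℕₚ.≤-trans (length-⊆ {ys = upTo⁺ (2 ℕ.^ suc t)} (primesBetween-unique t (suc t)) (λ p∈ → let (pp , _ , hi) = primesBetween-spec {i = t} {suc t} p∈ in ∈-upTo⁺ (prime⇒0< pp) hi))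
      (ℕₚ.≤-reflexive (trans (length-map suc (below (2 ℕ.^ suc t))) (length-below (2 ℕ.^ suc t))))
    mass≤2 : U t (suc t) ≤ ν 2
    mass≤2 = ≤-trans (mass≤ t (λ p∈ → proj₁ (proj₂ (primesBetween-spec {i = t} {suc t} p∈)))) (≤-trans (*-monoʳ (0≤ρ (2 ℕ.^ t)) (≤-trans (ν-mono len) (≡⇒≤ (ν-* 2 (2 ℕ.^ t)))))
      (≡⇒≤ (trans (*-assoc (ν 2) _ _) (trans (cong (ν 2 *_) (νρ (0<2^ t))) (*-identityʳ (ν 2))))))

  U-empty : ∀ i → U i i ≡ 0ℚ
  U-empty i = ∑-zero (primesBetween i i) (λ p∈ → ⊥-elim (primesBetween-empty i p∈))

  block-upper : ∀ i n → ν i * U i (n ℕ.+ i) ≤ ν n * ν 320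
  block-upper i zero = ≡⇒≤ (trans (cong (ν i *_) (U-empty i)) (trans (*-zeroʳ (ν i)) (sym (trans (cong (_* ν 320) ν0) (*-zeroˡ (ν 320))))))
  block-upper i (suc n) = ≤-trans (*-monoˡ (0≤ν i) (U-split i (n ℕ.+ i) (suc (n ℕ.+ i))))
    (≤-trans (≡⇒≤ (*-distribˡ-+ (ν i) (U i (n ℕ.+ i)) (U (n ℕ.+ i) (suc (n ℕ.+ i)))))
    (≤-trans (+-mono-≤ (block-upper i n) (≤-trans (*-monoʳ (0≤U (n ℕ.+ i) (suc (n ℕ.+ i))) (ν-mono (ℕₚ.≤-trans (ℕₚ.m≤n+m i n) (ℕₚ.n≤1+n _)))) (dyadic-mass (n ℕ.+ i))))
    (≡⇒≤ (trans (lem (ν n) (ν 320)) (cong (_* ν 320) (sym (ν-suc n)))))))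
    where
    lem : ∀ a b → a * b + b ≡ (1ℚ + a) * b
    lem = solve-∀ ringℚ

  private
    -- For 1 ≤ p ≤ 2^n this is the binary logarithm of p rounded up, an integral substitute for log
    -- p. Being a sum of indicators, it turns Σ bits(p)/p into a sum of the masses `U j k`.
    bits : ℕ → ℕ → ℕ
    bits zero p = 0
    bits (suc n) p = (if does (2 ℕ.^ n <?′ p) then 1 else 0) ℕ.+ bits n p

    bits-full : ∀ n {p} → 2 ℕ.^ n ℕ.< p → bits n p ≡ n
    bits-full zero lt = refl
    bits-full (suc n) {p} lt = cong₂ ℕ._+_ (cong (if_then 1 else 0) (dec-true (2 ℕ.^ n <?′ p) lt′)) (bits-full n lt′)
      where
      lt′ = ℕₚ.≤-<-trans (2^-mono (ℕₚ.n≤1+n n)) lt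

    ≤2^bits : ∀ k {p} → p ℕ.≤ 2 ℕ.^ k → p ℕ.≤ 2 ℕ.^ bits k p
    ≤2^bits zero le = le
    ≤2^bits (suc k) {p} le with 2 ℕ.^ k <?′ p
    ... | yes lt = subst (λ z → p ℕ.≤ 2 ℕ.^ suc z) (sym (bits-full k lt)) le
    ... | no nlt = ≤2^bits k (ℕₚ.≮⇒≥ nlt)

    ∑-bits : ∀ k n → ∑ (primesUpTo (2 ℕ.^ k)) (λ p → ν (bits n p) * ρ p) ≡ ∑ (below n) (λ j → U j k)
    ∑-bits k zero = ∑-zero (primesUpTo (2 ℕ.^ k)) (λ {p} _ → trans (cong (_* ρ p) ν0) (*-zeroˡ (ρ p)))
    ∑-bits k (suc n) = trans (∑-cong P (λ {p} _ → trans (cong (_* ρ p) (ν-+ _ (bits n p))) (trans (*-distribʳ-+ (ρ p) (ν (if does (2 ℕ.^ n <?′ p) then 1 else 0)) (ν (bits n p))) (cong (_+ ν (bits n p) * ρ p) (pick p)))))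
      (trans (∑-+ P _ _) (cong₂ _+_ (sym (∑-primesBetween n k ρ)) (∑-bits k n)))
      where
      P = primesUpTo (2 ℕ.^ k)
      pick : ∀ p → ν (if does (2 ℕ.^ n <?′ p) then 1 else 0) * ρ p ≡ (if does (2 ℕ.^ n <?′ p) then ρ p else 0ℚ)
      pick p with does (2 ℕ.^ n <?′ p)
      ... | true = trans (cong (_* ρ p) ν1) (*-identityˡ (ρ p))
      ... | false = trans (cong (_* ρ p) ν0) (*-zeroˡ (ρ p))

    Σⁿ : List ℕ → (ℕ → ℕ) → ℕ
    Σⁿ [] f = 0
    Σⁿ (x ∷ xs) f = f x ℕ.+ Σⁿ xs f

    ν-Σⁿ : ∀ xs f → ν (Σⁿ xs f) ≡ ∑ xs (λ x → ν (f x))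
    ν-Σⁿ [] f = ν0
    ν-Σⁿ (x ∷ xs) f = trans (ν-+ (f x) (Σⁿ xs f)) (cong (ν (f x) +_) (ν-Σⁿ xs f))

    2^Σⁿ : ∀ xs f → Π xs (λ x → 2 ℕ.^ f x) ≡ 2 ℕ.^ Σⁿ xs f
    2^Σⁿ [] f = refl
    2^Σⁿ (x ∷ xs) f = trans (cong (2 ℕ.^ f x ℕ.*_) (2^Σⁿ xs f)) (sym (ℕₚ.^-distribˡ-+-* 2 (f x) (Σⁿ xs f)))

  -- Mertens: compare Σ (1/r) Σ_{p ∣ r} log p over squarefree r ≤ 2^k, summed in both orders.
  mertens-lower : ∀ j → 0 ℕ.< j → ν j * ρ 2 ≤ ∑ (below (16 ℕ.* j)) (λ i → U i (16 ℕ.* j))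
  mertens-lower j 0<j = *-cancelˡ 0<ℓ (≤-trans (≡⇒≤ (lem₀ (ℓ K) (ν j) (ρ 2))) (≤-trans (*-monoˡ (0≤ν j) halfℓ) (≤-trans lower upper)))
    where
    -- The factor 16 gives ℓ(2^k) ≥ 4 j. The r ≤ 2^j contribute at most j + 1 ≤ 2 j, so at least
    -- half of ℓ comes from r > 2^j, for which A r ≥ j.
    k = 16 ℕ.* j
    K = 2 ℕ.^ k
    P = primesUpTo K
    RR = squarefrees K
    A : ℕ → ℕ
    A r = Σⁿ P (λ p → if does (p ∣? r) then bits k p else 0)
    lem₀ : ∀ a b c → a * (b * c) ≡ b * (c * a)
    lem₀ = solve-∀ ringℚ
    4j≤ℓ : ν (4 ℕ.* j) ≤ ℓ K
    4j≤ℓ = ≤-trans (≡⇒≤ (trans (sym (*-identityʳ _)) (trans (cong (ν (4 ℕ.* j) *_) (sym (νρ {4} (ℕ.s≤s ℕ.z≤n))))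
      (trans (sym (*-assoc (ν (4 ℕ.* j)) (ν 4) (ρ 4))) (cong (_* ρ 4) (trans (sym (ν-* (4 ℕ.* j) 4)) (cong ν (lem j)))))))) (ℓ-lower k)
      where
      lem : ∀ j → 4 ℕ.* j ℕ.* 4 ≡ 16 ℕ.* j
      lem = solve-∀ℕ
    0<ℓ : 0ℚ < ℓ K
    0<ℓ = <-≤-trans (0<ν (ℕₚ.*-mono-≤ {1} {4} {1} {j} (ℕ.s≤s ℕ.z≤n) 0<j)) 4j≤ℓ
    ℓ₀ = ∑ RR (λ r → if does (2 ℕ.^ j <?′ r) then 0ℚ else ρ r)
    ℓ₁ = ∑ RR (λ r → if does (2 ℕ.^ j <?′ r) then ρ r else 0ℚ)
    ℓ-split : ℓ K ≡ ℓ₁ + ℓ₀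
    ℓ-split = trans (∑-cong RR (λ {r} _ → pick r)) (∑-+ RR _ _)
      where
      pick : ∀ r → ρ r ≡ (if does (2 ℕ.^ j <?′ r) then ρ r else 0ℚ) + (if does (2 ℕ.^ j <?′ r) then 0ℚ else ρ r)
      pick r with does (2 ℕ.^ j <?′ r)
      ... | true = sym (+-identityʳ (ρ r))
      ... | false = sym (+-identityˡ (ρ r))
    ℓ₀≤ : ℓ₀ ≤ ρ 2 * ℓ K
    ℓ₀≤ = ≤-trans (∑-mono RR (λ {r} _ → flip r)) (≤-trans (≡⇒≤ (sym (∑-filter (λ r → ¬? (2 ℕ.^ j <?′ r)) RR ρ)))
      (≤-trans (∑-⊆ {ys = upTo⁺ (2 ℕ.^ j)} (filter-unique (λ r → ¬? (2 ℕ.^ j <?′ r)) (squarefrees-unique K)) sub 0≤ρ)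
      (≤-trans (harmonic-upper j) (≤-trans (ν-mono (ℕₚ.≤-trans (ℕₚ.+-monoˡ-≤ j 0<j) (ℕₚ.≤-reflexive (lem j))))
      (≤-trans (≡⇒≤ e) (*-monoˡ (0≤ρ 2) 4j≤ℓ))))))
      where
      lem : ∀ j → j ℕ.+ j ≡ 2 ℕ.* j
      lem = solve-∀ℕ
      lem₂ : ∀ j → 4 ℕ.* j ≡ 2 ℕ.* (2 ℕ.* j)
      lem₂ = solve-∀ℕ
      e : ν (2 ℕ.* j) ≡ ρ 2 * ν (4 ℕ.* j)
      e = sym (trans (cong (ρ 2 *_) (trans (cong ν (lem₂ j)) (ν-* 2 (2 ℕ.* j)))) (trans (sym (*-assoc (ρ 2) (ν 2) _)) (trans (cong (_* ν (2 ℕ.* j)) (ρν {2} (ℕ.s≤s ℕ.z≤n))) (*-identityˡ _))))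
      flip : ∀ r → (if does (2 ℕ.^ j <?′ r) then 0ℚ else ρ r) ≤ (if does (¬? (2 ℕ.^ j <?′ r)) then ρ r else 0ℚ)
      flip r with 2 ℕ.^ j <?′ r
      ... | yes _ = ≤-refl
      ... | no _ = ≤-refl
      sub : ∀ {r} → r ∈ filter (λ r → ¬? (2 ℕ.^ j <?′ r)) RR → r ∈ upTo⁺ (2 ℕ.^ j)
      sub r∈ with ∈-filter⁻ (λ r → ¬? (2 ℕ.^ j <?′ r)) {xs = RR} r∈
      ... | m , nlt = ∈-upTo⁺ (proj₁ (squarefrees-spec {R = K} m)) (ℕₚ.≮⇒≥ nlt)
    halfℓ : ρ 2 * ℓ K ≤ ℓ₁
    halfℓ = ≤-by (ρ 2 * ℓ K - ℓ₀) (≤⇒0≤- ℓ₀≤) (trans (lem ℓ₁ ℓ₀) (trans (cong (_- ℓ₀) (trans (sym ℓ-split) (trans (sym (*-identityˡ (ℓ K)))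
      (cong (_* ℓ K) (sym (trans (sym (lem₃ (ρ 2))) (trans (cong (_* ρ 2) (sym (trans (ν-suc 1) (cong (1ℚ +_) ν1)))) (νρ {2} (ℕ.s≤s ℕ.z≤n)))))))))
      (lem₂ (ρ 2) (ℓ K) ℓ₀)))
      where
      lem : ∀ y x → y ≡ (y + x) - x
      lem = solve-∀ ringℚ
      lem₂ : ∀ h l x → (h + h) * l - x ≡ h * l + (h * l - x)
      lem₂ = solve-∀ ringℚ
      lem₃ : ∀ h → (1ℚ + 1ℚ) * h ≡ h + h
      lem₃ = solve-∀ ringℚ
    r≤2^A : ∀ {r} → r ∈ RR → r ℕ.≤ 2 ℕ.^ A r
    r≤2^A {r} r∈ = ℕₚ.≤-trans (ℕₚ.≤-reflexive (sym (proj₂ (proj₂ (squarefrees-ok K r∈)))))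
      (ℕₚ.≤-trans (Π-mono P step) (ℕₚ.≤-reflexive (2^Σⁿ P _)))
      where
      step : ∀ {p} → p ∈ P → (if does (p ∣? r) then p else 1) ℕ.≤ 2 ℕ.^ (if does (p ∣? r) then bits k p else 0)
      step {p} p∈ with does (p ∣? r)
      ... | true = ≤2^bits k (primesUpTo-≤ {R = K} p∈)
      ... | false = ℕₚ.≤-refl
    lower : ν j * ℓ₁ ≤ ∑ RR (λ r → ρ r * ν (A r))
    lower = ≤-trans (≡⇒≤ (sym (∑-*ˡ RR (ν j) _))) (∑-mono RR step)
      where
      step : ∀ {r} → r ∈ RR → ν j * (if does (2 ℕ.^ j <?′ r) then ρ r else 0ℚ) ≤ ρ r * ν (A r)
      step {r} r∈ with 2 ℕ.^ j <?′ r
      ... | no _ = ≤-trans (≡⇒≤ (*-zeroʳ (ν j))) (0≤* (0≤ρ r) (0≤ν (A r)))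
      ... | yes lt = ≤-trans (≡⇒≤ (*-comm (ν j) (ρ r))) (*-monoˡ (0≤ρ r) (ν-mono (ℕₚ.<⇒≤ (ℕₚ.≰⇒> λ A≤j → ℕₚ.<-irrefl refl (ℕₚ.<-≤-trans lt (ℕₚ.≤-trans (r≤2^A r∈) (2^-mono A≤j)))))))
    upper : ∑ RR (λ r → ρ r * ν (A r)) ≤ ℓ K * ∑ (below k) (λ i → U i k)
    upper = ≤-trans (≡⇒≤ (trans (∑-cong RR (λ {r} _ → trans (cong (ρ r *_) (ν-Σⁿ P _)) (trans (sym (∑-*ˡ P (ρ r) _)) (∑-cong P (λ {p} _ → pick r p)))))
        (∑-swap RR P _)))
      (≤-trans (∑-mono P (λ {p} p∈ → ≤-trans (≡⇒≤ (∑-*ˡ RR (ν (bits k p)) _)) (*-monoˡ (0≤ν (bits k p)) (squarefree-multiples (primesUpTo-prime {R = K} p∈) K))))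
      (≡⇒≤ (trans (∑-cong P (λ {p} _ → lem (ν (bits k p)) (ρ p) (ℓ K))) (trans (∑-*ˡ P (ℓ K) _) (cong (ℓ K *_) (∑-bits k k))))))
      where
      lem : ∀ a b c → a * (b * c) ≡ c * (a * b)
      lem = solve-∀ ringℚ
      pick : ∀ r p → ρ r * ν (if does (p ∣? r) then bits k p else 0) ≡ ν (bits k p) * (if does (p ∣? r) then ρ r else 0ℚ)
      pick r p with does (p ∣? r)
      ... | true = *-comm (ρ r) (ν (bits k p))
      ... | false = trans (cong (ρ r *_) ν0) (trans (*-zeroʳ (ρ r)) (sym (*-zeroʳ (ν (bits k p)))))

  abstract
    -- The ratio of the exponents at the two ends of a block. As 64·320 it makes the error 320 i of
    -- `W≤` equal to i J/64; as 16·1280 it fits the form of `mertens-lower`.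
    J : ℕ
    J = 20480

    J≡16*1280 : J ≡ 16 ℕ.* 1280
    J≡16*1280 = refl

    J≡64*320 : J ≡ 64 ℕ.* 320
    J≡64*320 = refl

    2≤J : 2 ℕ.≤ J
    2≤J = ℕₚ.m≤m+n 2 20478

  0<J : 0 ℕ.< J
  0<J = ℕₚ.≤-trans (ℕ.s≤s ℕ.z≤n) 2≤J

  private
    ρ-double : ∀ n → 0 ℕ.< n → ρ (2 ℕ.* n) + ρ (2 ℕ.* n) ≡ ρ n
    ρ-double n 0<n = trans (cong (λ z → z + z) (ρ-* 2 n)) (trans (lem (ρ 2) (ρ n)) (trans (cong (λ z → z * ρ 2 * ρ n) (sym (trans (ν-suc 1) (cong (1ℚ +_) ν1))))
      (trans (cong (_* ρ n) (νρ {2} (ℕ.s≤s ℕ.z≤n))) (*-identityˡ (ρ n)))))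
      where
      lem : ∀ h r → h * r + h * r ≡ (1ℚ + 1ℚ) * h * r
      lem = solve-∀ ringℚ

    -- The step from i to i + 1 adds the dyadic mass `U i (suc i)` to each of i + 1 sums, and
    -- `dyadic-mass` bounds the total addition by 320.
    W≤ : ∀ i → ∑ (below i) (λ j → U j i) ≤ ν i * ν 320
    W≤ zero = ≡⇒≤ (sym (trans (cong (_* ν 320) ν0) (*-zeroˡ (ν 320))))
    W≤ (suc i) = ≤-trans (+-monoʳ-≤ (U i (suc i)) (≤-trans (∑-mono (below i) (λ {j} _ → U-split j i (suc i))) (≡⇒≤ (trans (∑-+ (below i) _ _)
        (cong (∑ (below i) (λ j → U j i) +_) (trans (∑-const (below i) _) (cong (λ z → ν z * U i (suc i)) (length-below i))))))))
      (≤-trans (≡⇒≤ (trans (lem (U i (suc i)) (∑ (below i) (λ j → U j i)) (ν i)) (cong (λ z → ∑ (below i) (λ j → U j i) + z * U i (suc i)) (sym (ν-suc i)))))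
      (≤-trans (+-mono-≤ (W≤ i) (dyadic-mass i)) (≡⇒≤ (trans (lem₂ (ν i) (ν 320)) (cong (_* ν 320) (sym (ν-suc i)))))))
      where
      lem : ∀ u w i → u + (w + i * u) ≡ w + (1ℚ + i) * u
      lem = solve-∀ ringℚ
      lem₂ : ∀ a b → a * b + b ≡ (1ℚ + a) * b
      lem₂ = solve-∀ ringℚ

  -- Let k = i J. By `mertens-lower` the masses `U t k` with t < k add up to at least k/32. For t ≥
  -- i such a mass is at most `U i k`; for t < i it is at most `U t i` + `U i k`, and the `U t i`
  -- add up to at most 320 i = k/64. Hence k times `U i k` is at least k/64.
  block-lower : ∀ i → 0 ℕ.< i → ρ 64 ≤ U i (i ℕ.* J)
  block-lower i 0<i = *-cancelˡ 0<k (≤-by-cancel (≤-trans (≡⇒≤ e₁) (≤-trans m (≤-trans (≡⇒≤ split) (+-mono-≤ high low)))))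
    where
    j = 1280 ℕ.* i
    k = i ℕ.* J
    n = k ℕ.∸ i
    i≤k : i ℕ.≤ k
    i≤k = ℕₚ.m≤m*n i J {{ℕ.>-nonZero 0<J}}
    n+i : n ℕ.+ i ≡ k
    n+i = ℕₚ.m∸n+n≡m i≤k
    k≡ : 16 ℕ.* j ≡ k
    k≡ = trans (sym (ℕₚ.*-assoc 16 1280 i)) (trans (ℕₚ.*-comm (16 ℕ.* 1280) i) (cong (i ℕ.*_) (sym J≡16*1280)))
    0<k : 0ℚ < ν k
    0<k = 0<ν (ℕₚ.*-mono-≤ 0<i 0<J)
    m : ν j * ρ 2 ≤ ∑ (below k) (λ t → U t k)
    m = subst (λ z → ν j * ρ 2 ≤ ∑ (below z) (λ t → U t z)) k≡ (mertens-lower j (ℕₚ.*-mono-≤ {1} {1280} {1} {i} (ℕ.s≤s ℕ.z≤n) 0<i))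
    split : ∑ (below k) (λ t → U t k) ≡ ∑ (below n) (λ t → U (t ℕ.+ i) k) + ∑ (below i) (λ t → U t k)
    split = trans (cong (λ z → ∑ (below z) (λ t → U t k)) (sym n+i)) (∑-below-+ n i _)
    high : ∑ (below n) (λ t → U (t ℕ.+ i) k) ≤ ν n * U i k
    high = ≤-trans (∑-mono (below n) (λ {t} _ → U-anti k (ℕₚ.m≤n+m i t))) (≡⇒≤ (trans (∑-const (below n) _) (cong (λ z → ν z * U i k) (length-below n))))
    low : ∑ (below i) (λ t → U t k) ≤ ν i * ν 320 + ν i * U i k
    low = ≤-trans (∑-mono (below i) (λ {t} _ → U-split t i k)) (≤-trans (≡⇒≤ (trans (∑-+ (below i) _ _) (cong (∑ (below i) (λ t → U t i) +_) (trans (∑-const (below i) _) (cong (λ z → ν z * U i k) (length-below i))))))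
      (+-monoˡ-≤ (ν i * U i k) (W≤ i)))
    X = ν k * ρ 64
    i320 : ν i * ν 320 ≡ X
    i320 = sym (trans (cong (_* ρ 64) (trans (cong (λ z → ν (i ℕ.* z)) J≡64*320) (trans (ν-* i _) (cong (ν i *_) (ν-* 64 320)))))
      (trans (lem (ν i) (ν 64) (ν 320) (ρ 64)) (trans (cong (λ z → ν i * (z * ν 320)) (νρ {64} (ℕ.s≤s ℕ.z≤n))) (cong (ν i *_) (*-identityˡ (ν 320))))))
      where
      lem : ∀ i a b r → i * (a * b) * r ≡ i * ((a * r) * b)
      lem = solve-∀ ringℚ
    e₁ : X + X ≡ ν j * ρ 2
    e₁ = trans (lem (ν k) (ρ 64)) (trans (cong (ν k *_) (ρ-double 32 (ℕ.s≤s ℕ.z≤n))) (trans (cong₂ _*_ (trans (cong ν (sym k≡)) (trans (cong ν (ℕₚ.*-comm 16 j)) (ν-* j 16))) (ρ-* 16 2))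
      (trans (lem₂ (ν j) (ν 16) (ρ 16) (ρ 2)) (trans (cong (λ z → ν j * (z * ρ 2)) (νρ {16} (ℕ.s≤s ℕ.z≤n))) (cong (ν j *_) (*-identityˡ (ρ 2)))))))
      where
      lem : ∀ k r → k * r + k * r ≡ k * (r + r)
      lem = solve-∀ ringℚ
      lem₂ : ∀ j a b c → j * a * (b * c) ≡ j * ((a * b) * c)
      lem₂ = solve-∀ ringℚ
    ≤-by-cancel : X + X ≤ ν n * U i k + (ν i * ν 320 + ν i * U i k) → X ≤ ν k * U i k
    ≤-by-cancel h = ≤-by (ν n * U i k + (ν i * ν 320 + ν i * U i k) - (X + X)) (≤⇒0≤- h)
      (sym (trans (cong (λ z → X + (ν n * U i k + (z + ν i * U i k) - (X + X))) i320) (trans (lem X (ν n) (U i k) (ν i)) (cong (_* U i k) (trans (sym (ν-+ n i)) (cong ν n+i))))))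
      where
      lem : ∀ x n u i → x + (n * u + (x + i * u) - (x + x)) ≡ (n + i) * u
      lem = solve-∀ ringℚ

  Linked : List ℕ → ℕ → Set
  Linked Q p = Any (λ q → q ∣ p ℕ.∸ 1) Q

  linked? : ∀ Q p → Dec (Linked Q p)
  linked? Q p = any? (λ q → q ∣? p ℕ.∸ 1) Q

  good bad : List ℕ → ℕ → ℕ → List ℕ
  good Q i k = filter (linked? Q) (primesBetween i k)
  bad Q i k = filter (λ p → ¬? (linked? Q p)) (primesBetween i k)

  good+bad : ∀ Q i k → ∑ (good Q i k) ρ + ∑ (bad Q i k) ρ ≡ U i k
  good+bad Q i k = trans (cong₂ _+_ (∑-filter (linked? Q) (primesBetween i k) ρ) (∑-filter (λ p → ¬? (linked? Q p)) (primesBetween i k) ρ))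
    (trans (sym (∑-+ (primesBetween i k) _ _)) (∑-cong (primesBetween i k) (λ {p} _ → pick p)))
    where
    pick : ∀ p → (if does (linked? Q p) then ρ p else 0ℚ) + (if does (¬? (linked? Q p)) then ρ p else 0ℚ) ≡ ρ p
    pick p with linked? Q p
    ... | yes _ = +-identityʳ (ρ p)
    ... | no _ = +-identityˡ (ρ p)

  module _ (Q : List ℕ) (Q-unique : Unique Q) (a : ℕ) (1≤a : 1 ℕ.≤ a) (Q-spec : ∀ {q} → q ∈ Q → Prime q × 4 ℕ.≤ q × q ℕ.≤ 2 ℕ.^ a)
    (σ : ℚ) (0≤σ : 0ℚ ≤ σ) (σ≤ : σ ≤ ∑ Q ρ) where

    private
      bad-spec : ∀ {p i k} → p ∈ bad Q i k → p ∈ primesBetween i k × ¬ Linked Q p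
      bad-spec {i = i} {k} p∈ = ∈-filter⁻ (λ p → ¬? (linked? Q p)) {xs = primesBetween i k} p∈

      bad-unique : ∀ i k → Unique (bad Q i k)
      bad-unique i k = filter-unique (λ p → ¬? (linked? Q p)) (primesBetween-unique i k)

    -- The argument of `dyadic-mass` with v = t/10 and the saving σ of `shifted-primes-bound`; the
    -- constant is 20·8·8. The condition 10 a ≤ t ensures q ≤ 2^v.
    bad-dyadic : ∀ t → 10 ℕ.* a ℕ.≤ t → ν (suc t) * (σ * ∑ (bad Q t (suc t)) ρ) ≤ ν 1280
    bad-dyadic t 10a≤t = ≤-trans (*-monoˡ (0≤ν (suc t)) (*-monoˡ 0≤σ (mass≤ t (λ p∈ → proj₁ (proj₂ (spec p∈))))))
      (scale t v 20 8 σ (quotient-bound t 10 10≤t) (ℕ.s≤s ℕ.z≤n) 0≤σ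
      (shifted-primes-bound v (4 ℕ.* 2 ℕ.^ t) N≥ Q-unique (λ q∈ → let (pq , big , q≤) = Q-spec q∈ in pq , big , ℕₚ.≤-trans q≤ (2^-mono a≤v)) σ≤ (bad-unique t (suc t))
        λ p∈ → proj₁ (spec p∈) , lower p∈ , below-4T t (proj₂ (proj₂ (spec p∈))) , λ q∈ d → proj₂ (bad-spec {i = t} {suc t} p∈) (lose q∈ d)))
      where
      v = t / 10
      10≤t : 10 ℕ.≤ t
      10≤t = ℕₚ.≤-trans (ℕₚ.*-monoʳ-≤ 10 1≤a) 10a≤t
      a≤v : a ℕ.≤ v
      a≤v = ℕₚ.≤-trans (ℕₚ.≤-reflexive (sym (trans (cong (_/ 10) (ℕₚ.*-comm 10 a)) (m*n/n≡m a 10)))) (/-monoˡ-≤ 10 10a≤t)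
      spec : ∀ {p} → p ∈ bad Q t (suc t) → _
      spec p∈ = primesBetween-spec {i = t} {suc t} (proj₁ (bad-spec {i = t} {suc t} p∈))
      lower : ∀ {p} → p ∈ bad Q t (suc t) → 2 ℕ.^ (v ℕ.+ v) ℕ.< p
      lower p∈ = ℕₚ.≤-<-trans (2^-mono (ℕₚ.≤-trans (ℕₚ.≤-trans (ℕₚ.≤-reflexive (lem v)) (ℕₚ.*-monoʳ-≤ v (ℕₚ.m≤m+n 2 8))) (m/n*n≤m t 10))) (proj₁ (proj₂ (spec p∈)))
        where
        lem : ∀ v → v ℕ.+ v ≡ v ℕ.* 2
        lem = solve-∀ℕ
      N≥ : 2 ℕ.^ (10 ℕ.* v) ℕ.≤ 4 ℕ.* 2 ℕ.^ t
      N≥ = ℕₚ.≤-trans (2^-mono (ℕₚ.≤-trans (ℕₚ.≤-reflexive (ℕₚ.*-comm 10 v)) (m/n*n≤m t 10))) (ℕₚ.m≤n*m (2 ℕ.^ t) 4)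

    bad-split : ∀ j i k → ∑ (bad Q j k) ρ ≤ ∑ (bad Q j i) ρ + ∑ (bad Q i k) ρ
    bad-split j i k = ≤-trans (∑-⊆ {ys = bad Q j i ++ bad Q i k} (bad-unique j k) sub 0≤ρ) (≡⇒≤ (∑-++ (bad Q j i) (bad Q i k) ρ))
      where
      sub : ∀ {p} → p ∈ bad Q j k → p ∈ bad Q j i ++ bad Q i k
      sub p∈ with bad-spec {i = j} {k} p∈
      ... | m , f with primesBetween-split {j = j} {k} i m
      ...   | inj₁ m′ = ∈-++⁺ˡ (∈-filter⁺ (λ p → ¬? (linked? Q p)) m′ f)
      ...   | inj₂ m′ = ∈-++⁺ʳ (bad Q j i) (∈-filter⁺ (λ p → ¬? (linked? Q p)) m′ f)

    bad-block : ∀ i n → 10 ℕ.* a ℕ.≤ i → ν i * (σ * ∑ (bad Q i (n ℕ.+ i)) ρ) ≤ ν n * ν 1280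
    bad-block i zero _ = ≡⇒≤ (trans (cong (λ z → ν i * (σ * z)) (∑-zero (bad Q i i) (λ p∈ → ⊥-elim (primesBetween-empty i (proj₁ (bad-spec {i = i} {i} p∈))))))
      (trans (lem (ν i) σ) (sym (trans (cong (_* ν 1280) ν0) (*-zeroˡ (ν 1280))))))
      where
      lem : ∀ a b → a * (b * 0ℚ) ≡ 0ℚ
      lem = solve-∀ ringℚ
    bad-block i (suc n) 10a≤ = ≤-trans (*-monoˡ (0≤ν i) (*-monoˡ 0≤σ (bad-split i t (suc t))))
      (≤-trans (≡⇒≤ (lem (ν i) σ _ _)) (≤-trans (+-mono-≤ (bad-block i n 10a≤) (≤-trans (*-monoʳ (0≤* 0≤σ (∑-nonneg (bad Q t (suc t)) (λ {p} _ → 0≤ρ p)))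
        (ν-mono (ℕₚ.≤-trans (ℕₚ.m≤n+m i n) (ℕₚ.n≤1+n t)))) (bad-dyadic t (ℕₚ.≤-trans 10a≤ (ℕₚ.m≤n+m i n)))))
      (≡⇒≤ (trans (lem₂ (ν n) (ν 1280)) (cong (_* ν 1280) (sym (ν-suc n)))))))
      where
      t = n ℕ.+ i
      lem : ∀ i s x y → i * (s * (x + y)) ≡ i * (s * x) + i * (s * y)
      lem = solve-∀ ringℚ
      lem₂ : ∀ a b → a * b + b ≡ (1ℚ + a) * b
      lem₂ = solve-∀ ringℚ

    -- The value of σ bounds the mass of the unlinked primes by J·1280/σ = 1/128, which is half of
    -- the mass 1/64 guaranteed by `block-lower`.
    good-block : σ ≡ ν (J ℕ.* 1280) * ν 128 → ∀ i → 10 ℕ.* a ℕ.≤ i → ρ 128 ≤ ∑ (good Q i (i ℕ.* J)) ρ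
    good-block σ≡ i 10a≤i = ≤-by ((ρ 128 - B) + (U i k - ρ 64)) (0≤+ (≤⇒0≤- B≤) (≤⇒0≤- (block-lower i 0<i)))
      (trans (lem g B) (trans (cong (_- B) (good+bad Q i k)) (trans (lem₂ (U i k) B (ρ 128)) (cong (λ z → ρ 128 + ((ρ 128 - B) + (U i k - z))) (ρ-double 64 (ℕ.s≤s ℕ.z≤n))))))
      where
      k = i ℕ.* J
      n = k ℕ.∸ i
      g = ∑ (good Q i k) ρ
      B = ∑ (bad Q i k) ρ
      0<i : 0 ℕ.< i
      0<i = ℕₚ.≤-trans (ℕₚ.≤-trans 1≤a (ℕₚ.m≤n*m a 10)) 10a≤i
      n+i : n ℕ.+ i ≡ k
      n+i = ℕₚ.m∸n+n≡m (ℕₚ.m≤m*n i J {{ℕ.>-nonZero 0<J}})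
      lem : ∀ g b → g ≡ g + b - b
      lem = solve-∀ ringℚ
      lem₂ : ∀ u b r → u - b ≡ r + ((r - b) + (u - (r + r)))
      lem₂ = solve-∀ ringℚ
      h : ν i * (σ * B) ≤ ν i * ν (J ℕ.* 1280)
      h = ≤-trans (≤-trans (≡⇒≤ (cong (λ z → ν i * (σ * ∑ (bad Q i z) ρ)) (sym n+i))) (bad-block i n 10a≤i)) (≤-trans (*-monoʳ (0≤ν 1280) (ν-mono (ℕₚ.m∸n≤m k i)))
        (≡⇒≤ (trans (sym (ν-* k 1280)) (trans (cong ν (ℕₚ.*-assoc i J 1280)) (ν-* i (J ℕ.* 1280))))))
      B≤ : B ≤ ρ 128
      B≤ = *-cancelˡ (0<ν {128} (ℕ.s≤s ℕ.z≤n)) (≤-trans (*-cancelˡ (0<ν (ℕₚ.*-mono-≤ {1} {J} {1} {1280} 0<J (ℕ.s≤s ℕ.z≤n))) (≤-trans (≡⇒≤ (trans (sym (*-assoc (ν (J ℕ.* 1280)) (ν 128) B)) (cong (_* B) (sym σ≡))))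
        (≤-trans (*-cancelˡ (0<ν 0<i) h) (≡⇒≤ (sym (*-identityʳ (ν (J ℕ.* 1280)))))))) (≡⇒≤ (sym (νρ {128} (ℕ.s≤s ℕ.z≤n)))))

-- Multiplicative orders and Carmichael's function.

module Carmichael where

  open import Defs
  open Sums using (below; length-below; map-unique; ⊆⇒↭; ∉⇒≢; filter-unique)
  open Mod
  open Harmonic using () renaming (∈-upTo⁺ to ∈-upTo⁺′)
  open Harmonic using (∃-prime-divisor; upTo⁺; upTo⁺-bounds; upTo⁺-unique)
  open import Data.Nat
  open import Data.Nat.Properties
  open import Data.Nat.DivMod
  open import Data.Nat.Divisibility
  open import Data.Nat.GCD using (gcd)
  open import Data.Nat.Coprimality as Coprimality using (Coprime; coprime-divisor; coprime⇒gcd≡1; gcd≡1⇒coprime)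
  open import Data.Nat.Primality
  open import Data.Nat.Induction using (<-rec)
  open import Data.Nat.ListAction using (product)
  open import Data.Nat.ListAction.Properties using (product-↭)
  open import Data.Nat.Tactic.RingSolver using (solve-∀)
  open import Data.Bool using (if_then_else_)
  open import Data.Fin as Fin using (Fin; fromℕ<; toℕ)
  import Data.Fin.Properties as Finₚ
  open import Data.List using (List; []; _∷_; map; length; foldr; replicate)
  open import Data.List.Properties using (length-map; length-replicate)
  open import Data.List.Membership.Propositional using (_∈_; find; lose)
  open import Data.List.Membership.Propositional.Properties using (∈-map⁻; ∈-map⁺; ∈-filter⁻; ∈-filter⁺; ∈-upTo⁺; ∈-upTo⁻)
  open import Data.List.Relation.Unary.Any as Any using (here; there; any?)
  open import Data.List.Relation.Unary.All as All using ([]; _∷_)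
  import Data.List.Relation.Unary.AllPairs as AllPairs
  open AllPairs using ([]; _∷_)
  open import Data.List.Relation.Unary.Unique.Propositional using (Unique)
  open import Data.List.Relation.Unary.Unique.Propositional.Properties using () renaming (upTo⁺ to upTo-unique)
  open import Data.List.Relation.Binary.Permutation.Propositional using (_↭_)
  open import Data.Empty using (⊥-elim)
  open import Data.Product using (Σ; ∃-syntax; _×_; _,_; proj₁; proj₂)
  open import Data.Sum using (_⊎_; inj₁; inj₂)
  open import Function using (_∘_)
  open import Relation.Nullary using (yes; no; ¬_; ¬?)
  open import Relation.Nullary.Decidable using (⌊_⌋)
  open import Relation.Binary.PropositionalEquality

  private
    abstract
      search : ℕ → ℕ → ℕ → ℕ → ℕ
      search a m zero k = 0
      search a m (suc f) k = if ⌊ (a ^ k) % suc m ≟ 1 % suc m ⌋ then k else search a m f (suc k)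

      search-zero : ∀ a m k → search a m 0 k ≡ 0
      search-zero a m k = refl

      search-suc : ∀ a m f k → search a m (suc f) k ≡ (if ⌊ (a ^ k) % suc m ≟ 1 % suc m ⌋ then k else search a m f (suc k))
      search-suc a m f k = refl

    search-unique : {F : ℕ → ℕ → ℕ → ℕ → ℕ} → (∀ a m k → F a m 0 k ≡ 0) →
      (∀ a m f k → F a m (suc f) k ≡ (if ⌊ (a ^ k) % suc m ≟ 1 % suc m ⌋ then k else F a m f (suc k))) →
      ∀ a m f k → F a m f k ≡ search a m f k
    search-unique {F} z s a m zero k = trans (z a m k) (sym (search-zero a m k))
    search-unique {F} z s a m (suc f) k =
      trans (s a m f k) (trans (cong (if ⌊ (a ^ k) % suc m ≟ 1 % suc m ⌋ then k else_) (search-unique {F} z s a m f (suc k))) (sym (search-suc a m f k)))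

    unfold : ∀ a m → Σ ℕ λ x → ord a (suc (suc m)) ≡
      (if ⌊ (a ^ 1) % suc (suc m) ≟ 1 % suc (suc m) ⌋ then 1 else (if ⌊ (a ^ 2) % suc (suc m) ≟ 1 % suc (suc m) ⌋ then 2 else x))
    unfold a m = _ , refl

    -- The search loop in the definition of ord is local to it. Generalising the two arguments of the loop
    -- that remain after two unfoldings lets unification recover the loop as the value of searcher.
    mutual
      searcher : ℕ → ℕ → ℕ → ℕ → ℕ
      searcher = _

      searcher-tail : ∀ a m → proj₁ (unfold a m) ≡ searcher a (suc m) m 3
      searcher-tail a m with suc m | 3
      ... | w | k = refl {x = searcher a w m k}

    ord≡search : ∀ a m → ord a (suc (suc m)) ≡ search a (suc m) (suc (suc m)) 1
    ord≡search a m = trans (proj₂ (unfold a m))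
      (trans (cong (λ z → if ⌊ (a ^ 1) % suc (suc m) ≟ 1 % suc (suc m) ⌋ then 1 else (if ⌊ (a ^ 2) % suc (suc m) ≟ 1 % suc (suc m) ⌋ then 2 else z))
      (trans (searcher-tail a m) (search-unique {searcher} (λ _ _ _ → refl) (λ _ _ _ _ → refl) a (suc m) m 3)))
      (trans (cong (if ⌊ (a ^ 1) % suc (suc m) ≟ 1 % suc (suc m) ⌋ then 1 else_) (sym (search-suc a (suc m) m 2)))
      (sym (search-suc a (suc m) (suc m) 1))))

    Found : ℕ → ℕ → ℕ → ℕ → ℕ → Set
    Found a m k e r = k ≤ r × r ≤ e × a ^ r ≈ 1 [ suc m ] × (∀ i → k ≤ i → i < r → ¬ (a ^ i ≈ 1 [ suc m ]))

    abstract
      search-spec : ∀ a m f k e → k ≤ e → e < k + f → a ^ e ≈ 1 [ suc m ] → Found a m k e (search a m f k)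
      search-spec a m zero k e k≤e e<k+0 h = ⊥-elim (<-irrefl refl (≤-<-trans k≤e (subst (e <_) (+-identityʳ k) e<k+0)))
      search-spec a m (suc f) k e k≤e e< h with (a ^ k) % suc m ≟ 1 % suc m
      ... | yes eq = ≤-refl , k≤e , %⇒≈ (suc m) eq , λ i k≤i i<k _ → <-irrefl refl (≤-<-trans k≤i i<k)
      ... | no neq with search-spec a m f (suc k) e (≤∧≢⇒< k≤e λ where refl → neq (≈⇒% h)) (subst (e <_) (+-suc k f) e<) h
      ...   | k< , ≤e , h′ , least = <⇒≤ k< , ≤e , h′ , least′
        where
        least′ : ∀ i → k ≤ i → i < search a m f (suc k) → ¬ (a ^ i ≈ 1 [ suc m ])
        least′ i k≤i i< h″ with k ≟ i
        ... | yes refl = neq (≈⇒% h″)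
        ... | no k≢i = least i (≤∧≢⇒< k≤i k≢i) i< h″

  ^-distribʳ-* : ∀ x y k → (x * y) ^ k ≡ x ^ k * y ^ k
  ^-distribʳ-* x y zero = refl
  ^-distribʳ-* x y (suc k) = trans (cong (x * y *_) (^-distribʳ-* x y k)) ([m*n]*[o*p]≡[m*o]*[n*p] x y (x ^ k) (y ^ k))

  coprime-* : ∀ {a b n} → Coprime a n → Coprime b n → Coprime (a * b) n
  coprime-* {a} {b} {n} ca cb {d} (d∣ab , d∣n) = cb (coprime-divisor (λ (e∣d , e∣a) → ca (e∣a , ∣-trans e∣d d∣n)) d∣ab , d∣n)

  coprime-^ : ∀ {a n} k → Coprime a n → Coprime (a ^ k) n
  coprime-^ zero c (d∣1 , _) = ∣1⇒≡1 d∣1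
  coprime-^ (suc k) c = coprime-* c (coprime-^ k c)

  coprime-∣-* : ∀ {a b m} → Coprime a b → a ∣ m → b ∣ m → a * b ∣ m
  coprime-∣-* {a} {b} {m} c (divides q refl) b∣ = subst (a * b ∣_) (*-comm a q) (*-monoʳ-∣ a (coprime-divisor (Coprimality.sym c) (subst (b ∣_) (*-comm q a) b∣)))

  coprime-≈ : ∀ {a b n} → a ≈ b [ n ] → Coprime a n → Coprime b n
  coprime-≈ (i , j , e) c {d} (d∣b , d∣n) = c (∣m+n∣m⇒∣n (subst (d ∣_) (trans (sym e) (+-comm _ (i * _))) (∣m∣n⇒∣m+n d∣b (∣n⇒∣m*n j d∣n))) (∣n⇒∣m*n i d∣n) , d∣n)

  abstract
    -- Two of a^0, ..., a^n agree modulo n, and the smaller power can be cancelled. The bound k ≤ n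
    -- is needed because `ord` searches no further.
    ∃-order : ∀ {a n} → 0 < n → Coprime a n → ∃[ k ] (0 < k × k ≤ n × a ^ k ≈ 1 [ n ])
    ∃-order {a} {n} 0<n c with Finₚ.pigeonhole (n<1+n n) f
      where
      instance
        n≢0 : NonZero n
        n≢0 = >-nonZero 0<n
      f : Fin (suc n) → Fin n
      f i = fromℕ< (m%n<n (a ^ toℕ i) n)
    ... | i , j , i<j , eq = toℕ j ∸ toℕ i , m<n⇒0<n∸m i<j , ≤-trans (m∸n≤m (toℕ j) (toℕ i)) (s≤s⁻¹ (Finₚ.toℕ<n j)) ,
        ≈-*-cancelʳ (coprime-^ (toℕ i) c) 0<n (≈-trans (≡⇒≈ (trans (sym (^-distribˡ-+-* a (toℕ j ∸ toℕ i) (toℕ i))) (cong (a ^_) (m∸n+n≡m (<⇒≤ i<j)))))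
          (≈-trans (≈-sym same) (≡⇒≈ (sym (*-identityˡ _)))))
      where
      instance
        n≢0 : NonZero n
        n≢0 = >-nonZero 0<n
      same : a ^ toℕ i ≈ a ^ toℕ j [ n ]
      same = %⇒≈ n (trans (sym (Finₚ.toℕ-fromℕ< (m%n<n (a ^ toℕ i) n))) (trans (cong toℕ eq) (Finₚ.toℕ-fromℕ< (m%n<n (a ^ toℕ j) n))))

  private
    ord≡search′ : ∀ a {n} → 1 < n → ord a n ≡ search a (n ∸ 1) n 1
    ord≡search′ a {suc zero} (s≤s ())
    ord≡search′ a {suc (suc m)} _ = ord≡search a m

  ord-spec : ∀ {a n} → 1 < n → Coprime a n → 0 < ord a n × a ^ ord a n ≈ 1 [ n ] × (∀ i → 0 < i → i < ord a n → ¬ (a ^ i ≈ 1 [ n ]))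
  ord-spec {a} {n} 1<n c with ∃-order (<⇒≤ 1<n) c
  ... | k , 0<k , k≤n , h with search-spec a (n ∸ 1) n 1 k 0<k (s≤s k≤n) (subst (λ z → a ^ k ≈ 1 [ z ]) (sym (m+[n∸m]≡n (<⇒≤ 1<n))) h)
  ...   | 0<o , _ , h′ , least = subst P (sym (ord≡search′ a 1<n))
          (0<o , subst (λ z → a ^ search a (n ∸ 1) n 1 ≈ 1 [ z ]) n≡ h′ , λ i 0<i i< hi → least i 0<i i< (subst (λ z → a ^ i ≈ 1 [ z ]) (sym n≡) hi))
    where
    n≡ : suc (n ∸ 1) ≡ n
    n≡ = m+[n∸m]≡n (<⇒≤ 1<n)
    P : ℕ → Set
    P o = 0 < o × a ^ o ≈ 1 [ n ] × (∀ i → 0 < i → i < o → ¬ (a ^ i ≈ 1 [ n ]))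

  ^-*≈ : ∀ {a n} k m → a ^ k ≈ 1 [ n ] → a ^ (k * m) ≈ 1 [ n ]
  ^-*≈ {a} {n} k m h = subst (_≈ 1 [ n ]) (^-*-assoc a k m) (1^≈1 m h)

  ord-∣ : ∀ {a n k} → 1 < n → Coprime a n → a ^ k ≈ 1 [ n ] → ord a n ∣ k
  ord-∣ {a} {n} {k} 1<n c h with ord-spec 1<n c
  ... | 0<o , ho , least with k % ord a n in eq
    where instance _ = >-nonZero 0<o
  ...   | zero = m%n≡0⇒n∣m k (ord a n) eq
    where instance _ = >-nonZero 0<o
  ...   | suc r = ⊥-elim (least (suc r) (s≤s z≤n) (subst (_< ord a n) eq (m%n<n k (ord a n)))
      (≈-trans (≈-sym (≈-trans (≡⇒≈ split) (subst (λ z → a ^ suc r * a ^ (ord a n * (k / ord a n)) ≈ z [ n ]) (*-identityʳ (a ^ suc r)) (≈-* (≈-refl {a ^ suc r}) (^-*≈ (ord a n) (k / ord a n) ho))))) h))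
    where
    instance _ = >-nonZero 0<o
    split : a ^ k ≡ a ^ suc r * a ^ (ord a n * (k / ord a n))
    split = trans (cong (a ^_) (trans (m≡m%n+[m/n]*n k (ord a n)) (cong₂ _+_ eq (*-comm (k / ord a n) (ord a n))))) (^-distribˡ-+-* a (suc r) _)

  units-spec : ∀ {u n} → 1 < n → u ∈ units n → 0 < u × u < n × Coprime u n
  units-spec {u} {n} 1<n u∈ with ∈-filter⁻ (λ a → gcd a n ≟ 1) {xs = range1 n} u∈
  ... | m , g with ∈-map⁻ suc m
  ...   | i , i∈ , refl = s≤s z≤n , ≤∧≢⇒< (∈-upTo⁻ i∈) (λ e → <-irrefl (sym (cop (∣-refl , subst (_ ∣_) e ∣-refl))) (subst (1 <_) (sym e) 1<n)) , cop
    where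
    cop : Coprime u n
    cop = gcd≡1⇒coprime g

  ∈-units : ∀ {u n} → 0 < u → u ≤ n → Coprime u n → u ∈ units n
  ∈-units {suc u} {n} _ u≤n c = ∈-filter⁺ (λ a → gcd a n ≟ 1) (∈-map⁺ suc (∈-upTo⁺ u≤n)) (coprime⇒gcd≡1 c)

  units-unique : ∀ n → Unique (units n)
  units-unique n = filter-unique (λ a → gcd a n ≟ 1) (map-unique (λ _ _ → suc-injective) (upTo-unique n))

  coprime⇒0<% : ∀ {c n} .{{_ : NonZero n}} → 1 < n → Coprime c n → 0 < c % n
  coprime⇒0<% {c} {n} 1<n cop = n≢0⇒n>0 λ e → <-irrefl (sym (cop (m%n≡0⇒n∣m c n e , ∣-refl))) 1<n

  reduce-∈-units : ∀ {c n} .{{_ : NonZero n}} → 1 < n → Coprime c n → c % n ∈ units n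
  reduce-∈-units {c} {n} 1<n cop = ∈-units (coprime⇒0<% 1<n cop) (<⇒≤ (m%n<n c n)) (coprime-≈ (≈-sym (%-≈ c n)) cop)

  private
    ≤max : {A : Set} (f : A → ℕ) {x : A} {xs : List A} → x ∈ xs → f x ≤ foldr _⊔_ 0 (map f xs)
    ≤max f {xs = y ∷ xs} (here refl) = m≤m⊔n (f y) _
    ≤max f {xs = y ∷ xs} (there x∈) = ≤-trans (≤max f x∈) (m≤n⊔m (f y) _)

    max-attained : {A : Set} (f : A → ℕ) (xs : List A) → foldr _⊔_ 0 (map f xs) ≡ 0 ⊎ (∃[ x ] (x ∈ xs × f x ≡ foldr _⊔_ 0 (map f xs)))
    max-attained f [] = inj₁ refl
    max-attained f (x ∷ xs) with ⊔-sel (f x) (foldr _⊔_ 0 (map f xs)) | max-attained f xs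
    ... | inj₁ e | _ = inj₂ (x , here refl , sym e)
    ... | inj₂ e | inj₁ z = inj₁ (trans e z)
    ... | inj₂ e | inj₂ (y , y∈ , e′) = inj₂ (y , there y∈ , trans e′ (sym e))

  -- The fold has default value 0; this is not the maximum because 1 is a unit of positive order.
  λC-attained : ∀ {n} → 1 < n → ∃[ b ] (b ∈ units n × ord b n ≡ λC n)
  λC-attained {n} 1<n with max-attained (λ a → ord a n) (units n)
  ... | inj₂ r = r
  ... | inj₁ z = ⊥-elim (<-irrefl (sym z) (≤-trans (proj₁ (ord-spec 1<n cop1)) (≤max (λ a → ord a n) (∈-units (s≤s z≤n) (<⇒≤ 1<n) cop1))))
    where
    cop1 : Coprime 1 n
    cop1 (d∣1 , _) = ∣1⇒≡1 d∣1

  abstract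
    strip : ∀ {p} → Prime p → ∀ n → 0 < n → ∃[ f ] ∃[ n′ ] (n ≡ p ^ f * n′ × ¬ (p ∣ n′) × 0 < n′)
    strip {p} pp = <-rec _ step
      where
      step : ∀ n → (∀ {m} → m < n → 0 < m → ∃[ f ] ∃[ n′ ] (m ≡ p ^ f * n′ × ¬ (p ∣ n′) × 0 < n′)) → 0 < n →
        ∃[ f ] ∃[ n′ ] (n ≡ p ^ f * n′ × ¬ (p ∣ n′) × 0 < n′)
      step n rec 0<n with p ∣? n
      ... | no p∤n = 0 , n , sym (+-identityʳ n) , p∤n , 0<n
      ... | yes (divides m refl) with rec (m<m*n m p {{>-nonZero 0<m}} (prime⇒1< pp)) 0<m
        where
        0<m : 0 < m
        0<m = n≢0⇒n>0 λ e → <-irrefl (sym (cong (_* p) e)) 0<n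
      ...   | f , n′ , e , p∤ , 0<n′ = suc f , n′ , trans (cong (_* p) e) (lem (p ^ f) n′ p) , p∤ , 0<n′
        where
        lem : ∀ x n p → x * n * p ≡ p * x * n
        lem = solve-∀

  prime-^-coprime : ∀ {p m} e → Prime p → ¬ (p ∣ m) → Coprime (p ^ e) m
  prime-^-coprime e pp p∤m = coprime-^ e (prime-∤⇒coprime pp p∤m)

  -- If the maximal order missed the prime power, multiplying suitable powers of a and of an element of
  -- maximal order would produce an element of larger order.
  prime-power-∣-λC : ∀ {a n l} e → 1 < n → Coprime a n → Prime l → l ^ e ∣ ord a n → l ^ e ∣ λC n
  prime-power-∣-λC {a} {n} {l} e 1<n ca pl (divides t ot) with λC-attained 1<n
  ... | b , b∈ , ob with units-spec 1<n b∈
  ...   | _ , _ , cb with strip pl (λC n) (subst (0 <_) ob (proj₁ (ord-spec 1<n cb)))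
  ...     | v , M , eM , l∤M , 0<M with e ≤? v
  ...       | yes e≤v = subst (l ^ e ∣_) (sym eM) (∣-trans (subst (l ^ e ∣_) (trans (sym (^-distribˡ-+-* l (v ∸ e) e)) (cong (l ^_) (m∸n+n≡m e≤v))) (n∣m*n (l ^ (v ∸ e)))) (m∣m*n M))
  ...       | no e≰v = ⊥-elim (<-irrefl refl (<-≤-trans big (≤-trans (∣⇒≤ {{>-nonZero (proj₁ (ord-spec 1<n c%cop))}} divides-order) (≤max (λ a → ord a n) (reduce-∈-units 1<n cc)))))
    where
    instance _ = >-nonZero (<⇒≤ 1<n)
    -- x has order l^e and y has order M, the part of λ(n) prime to l. The orders are coprime, so x
    -- y has order l^e M, which exceeds l^v M = λ(n) because e > v.
    x = a ^ t
    y = b ^ (l ^ v)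
    c = x * y
    cx : Coprime x n
    cx = coprime-^ t ca
    cc : Coprime c n
    cc = coprime-* cx (coprime-^ (l ^ v) cb)
    0<t : 0 < t
    0<t = n≢0⇒n>0 λ t≡0 → <-irrefl (sym (trans ot (cong (_* l ^ e) t≡0))) (proj₁ (ord-spec 1<n ca))
    x-order : ∀ {k} → x ^ k ≈ 1 [ n ] → l ^ e ∣ k
    x-order {k} h = *-cancelˡ-∣ t {{>-nonZero 0<t}} (subst (_∣ t * k) ot (ord-∣ 1<n ca (subst (_≈ 1 [ n ]) (^-*-assoc a t k) h)))
    y-order : ∀ {k} → y ^ k ≈ 1 [ n ] → M ∣ k
    y-order {k} h = *-cancelˡ-∣ (l ^ v) {{m^n≢0 l v {{prime⇒nonZero pl}}}} (subst (_∣ l ^ v * k) (trans ob eM) (ord-∣ 1<n cb (subst (_≈ 1 [ n ]) (^-*-assoc b (l ^ v) k) h)))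
    x-one : x ^ (l ^ e) ≈ 1 [ n ]
    x-one = subst (_≈ 1 [ n ]) (trans (cong (a ^_) ot) (sym (^-*-assoc a t (l ^ e)))) (proj₁ (proj₂ (ord-spec 1<n ca)))
    y-one : y ^ M ≈ 1 [ n ]
    y-one = subst (_≈ 1 [ n ]) (trans (cong (b ^_) (trans ob eM)) (sym (^-*-assoc b (l ^ v) M))) (proj₁ (proj₂ (ord-spec 1<n cb)))
    c-order : ∀ {k} → c ^ k ≈ 1 [ n ] → l ^ e * M ∣ k
    c-order {k} h = coprime-∣-* cop (coprime-divisor cop (subst (l ^ e ∣_) (*-comm k M) (x-order xk)))
        (coprime-divisor (Coprimality.sym cop) (subst (M ∣_) (*-comm k (l ^ e)) (y-order yk)))
      where
      cop : Coprime (l ^ e) M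
      cop = prime-^-coprime e pl l∤M
      power : ∀ j → x ^ (k * j) * y ^ (k * j) ≈ 1 [ n ]
      power j = subst (_≈ 1 [ n ]) (trans (^-*-assoc c k j) (^-distribʳ-* x y (k * j))) (1^≈1 j h)
      xk : x ^ (k * M) ≈ 1 [ n ]
      xk = ≈-trans (≈-sym (subst (λ z → x ^ (k * M) * y ^ (k * M) ≈ z [ n ]) (*-identityʳ (x ^ (k * M))) (≈-* (≈-refl {x ^ (k * M)}) (subst (λ z → y ^ z ≈ 1 [ n ]) (*-comm M k) (^-*≈ M k y-one))))) (power M)
      yk : y ^ (k * l ^ e) ≈ 1 [ n ]
      yk = ≈-trans (≈-sym (subst (λ z → x ^ (k * l ^ e) * y ^ (k * l ^ e) ≈ z [ n ]) (*-identityˡ (y ^ (k * l ^ e))) (≈-* (subst (λ z → x ^ z ≈ 1 [ n ]) (*-comm (l ^ e) k) (^-*≈ (l ^ e) k x-one)) ≈-refl))) (power (l ^ e))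
    c%cop : Coprime (c % n) n
    c%cop = coprime-≈ (≈-sym (%-≈ c n)) cc
    divides-order : l ^ e * M ∣ ord (c % n) n
    divides-order = c-order (≈-trans (≈-^ (ord (c % n) n) (≈-sym (%-≈ c n))) (proj₁ (proj₂ (ord-spec 1<n c%cop))))
    big : λC n < l ^ e * M
    big = subst (_< l ^ e * M) (sym eM) (*-monoˡ-< M {{>-nonZero 0<M}} (^-monoʳ-< l (prime⇒1< pl) (≰⇒> e≰v)))

  -- Euler's argument: multiplication by b permutes the list.
  euler : ∀ {b n} us → 1 < n → Coprime b n → Unique us → (∀ {u} → u ∈ us → u < n × Coprime u n) →
    (∀ {c} .{{_ : NonZero n}} → Coprime c n → c % n ∈ us) → b ^ length us ≈ 1 [ n ]
  euler {b} {n} us 1<n cb unique spec closed = ≈-*-cancelʳ (cop us spec) (<⇒≤ 1<n)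
    (≈-trans (≈-sym (powers us)) (≡⇒≈ (trans (product-↭ perm) (sym (*-identityˡ (product us))))))
    where
    instance _ = >-nonZero (<⇒≤ 1<n)
    h : ℕ → ℕ
    h u = (b * u) % n
    cop : ∀ vs → (∀ {u} → u ∈ vs → u < n × Coprime u n) → Coprime (product vs) n
    cop [] sp (d∣1 , _) = ∣1⇒≡1 d∣1
    cop (v ∷ vs) sp = coprime-* (proj₂ (sp (here refl))) (cop vs (sp ∘ there))
    powers : ∀ vs → product (map h vs) ≈ b ^ length vs * product vs [ n ]
    powers [] = ≈-refl
    powers (v ∷ vs) = ≈-trans (≈-* (%-≈ (b * v) n) (powers vs)) (≡⇒≈ (lem b v (b ^ length vs) (product vs)))
      where
      lem : ∀ b v x p → b * v * (x * p) ≡ b * x * (v * p)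
      lem = solve-∀
    inj : ∀ {x y} → x ∈ us → y ∈ us → h x ≡ h y → x ≡ y
    inj {x} {y} x∈ y∈ e = ≈-small (proj₁ (spec x∈)) (proj₁ (spec y∈)) (≈-*-cancelʳ cb (<⇒≤ 1<n)
      (subst₂ (_≈_[ n ]) (*-comm b x) (*-comm b y) (%⇒≈ n e)))
    sub : ∀ {x} → x ∈ map h us → x ∈ us
    sub x∈ with ∈-map⁻ h x∈
    ... | u , u∈ , refl = closed (coprime-* cb (proj₂ (spec u∈)))
    perm : map h us ↭ us
    perm = ↭-sym (⊆⇒↭ (map-unique inj unique) sub (≤-reflexive (sym (length-map h us))))
      where open import Data.List.Relation.Binary.Permutation.Propositional using (↭-sym)

  λC∣φ : ∀ {n} → 1 < n → λC n ∣ φ n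
  λC∣φ {n} 1<n with λC-attained 1<n
  ... | b , b∈ , ob = subst (_∣ φ n) ob (ord-∣ 1<n cb (euler (units n) 1<n cb (units-unique n) (λ u∈ → proj₂ (units-spec 1<n u∈)) (λ c → reduce-∈-units 1<n c)))
    where
    cb = proj₂ (proj₂ (units-spec 1<n b∈))

  fermat : ∀ {b p} → Prime p → ¬ (p ∣ b) → b ^ (p ∸ 1) ≈ 1 [ p ]
  fermat {b} {p} pp p∤b = subst (λ z → b ^ z ≈ 1 [ p ]) (trans (length-map suc (below (p ∸ 1))) (length-below (p ∸ 1)))
    (euler (upTo⁺ (p ∸ 1)) (prime⇒1< pp) (Coprimality.sym (prime-∤⇒coprime pp p∤b)) (upTo⁺-unique (p ∸ 1)) spec
      (λ {c} cop → ∈-upTo⁺′ (coprime⇒0<% (prime⇒1< pp) cop) (<⇒≤pred (m%n<n c p))))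
    where

    spec : ∀ {u} → u ∈ upTo⁺ (p ∸ 1) → u < p × Coprime u p
    spec {u} u∈ with upTo⁺-bounds u∈
    ... | 0<u , u≤ = u<p , Coprimality.sym (prime-∤⇒coprime pp λ p∣u → <-irrefl refl (<-≤-trans u<p (∣⇒≤ {{>-nonZero 0<u}} p∣u)))
      where
      u<p : u < p
      u<p = ≤-<-trans u≤ (≤-reflexive (m+[n∸m]≡n (<⇒≤ (prime⇒1< pp))))

  -- A list of coefficients, constant term first, with an implicit leading coefficient 1.
  monic : List ℕ → ℕ → ℕ
  monic [] x = 1
  monic (c ∷ f) x = c + x * monic f x

  -- The quotient by X - r: its coefficients are the values at r of the tails of f, as in Horner's
  -- scheme.
  quotient-at : ℕ → List ℕ → List ℕ
  quotient-at r [] = []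
  quotient-at r (c ∷ []) = []
  quotient-at r (c ∷ f@(_ ∷ _)) = monic f r ∷ quotient-at r f

  length-quotient : ∀ r c f → length (quotient-at r (c ∷ f)) ≡ length f
  length-quotient r c [] = refl
  length-quotient r c (d ∷ f) = cong suc (length-quotient r d f)

  -- f(x) - f(r) = (x - r) q(x), rearranged to avoid subtraction.
  division : ∀ r c f x → monic (c ∷ f) x + r * monic (quotient-at r (c ∷ f)) x ≡ x * monic (quotient-at r (c ∷ f)) x + monic (c ∷ f) r
  division r c [] x = lem c x r
    where
    lem : ∀ c x r → c + x * 1 + r * 1 ≡ x * 1 + (c + r * 1)
    lem = solve-∀
  division r c f@(d ∷ g) x = trans (lem c x (monic f x) r (monic f r) (monic (quotient-at r f) x))
    (trans (cong (λ z → c + r * monic f r + x * z) (division r d g x)) (lem₂ c x (monic f r) (monic (quotient-at r f) x) r))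
    where
    lem : ∀ c x fx r fr q → c + x * fx + r * (fr + x * q) ≡ c + r * fr + x * (fx + r * q)
    lem = solve-∀
    lem₂ : ∀ c x fr q r → c + r * fr + x * (x * q + fr) ≡ x * (fr + x * q) + (c + r * fr)
    lem₂ = solve-∀

  -- If x is a root other than r, then (x - r) q(x) vanishes modulo p, so x is a root of the
  -- quotient q of smaller degree.
  roots-bound : ∀ {p} → Prime p → ∀ n f → length f ≡ n → ∀ rs → Unique rs → (∀ {r} → r ∈ rs → r < p × monic f r ≈ 0 [ p ]) → length rs ≤ n
  roots-bound pp n f lf [] u h = z≤n
  roots-bound pp zero [] lf (r ∷ rs) u h = ⊥-elim (¬prime[1] (subst Prime (∣1⇒≡1 (≈0⇒∣ (proj₂ (h (here refl))))) pp))
  roots-bound {p} pp (suc n) (c ∷ f) lf (r ∷ rs) (r∉ ∷ u) h = s≤s (roots-bound pp n q (trans (length-quotient r c f) (suc-injective lf)) rs u root)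
    where
    q = quotient-at r (c ∷ f)
    root : ∀ {x} → x ∈ rs → x < p × monic q x ≈ 0 [ p ]
    root {x} x∈ with p ∣? monic q x
    ... | yes d = proj₁ (h (there x∈)) , ∣⇒≈0 d
    ... | no nd = ⊥-elim (∉⇒≢ x∈ r∉ (≈-small (proj₁ (h (here refl))) (proj₁ (h (there x∈)))
      (≈-*-cancelʳ (Coprimality.sym (prime-∤⇒coprime pp nd)) (prime⇒0< pp)
        (≈-trans (≈-sym (≈-+ (proj₂ (h (there x∈))) ≈-refl)) (≈-trans (≡⇒≈ (division r c f x))
          (subst (λ z → x * monic q x + monic (c ∷ f) r ≈ z [ p ]) (+-identityʳ _) (≈-+ ≈-refl (proj₂ (h (here refl))))))))))

  private
    monic-replicate : ∀ d x → monic (replicate d 0) x ≡ x ^ d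
    monic-replicate zero x = refl
    monic-replicate (suc d) x = cong (x *_) (monic-replicate d x)

  abstract
    -- x^d - 1 has at most d < p - 1 roots modulo p; its constant term is written as p - 1.
    non-residue : ∀ {p} d → Prime p → d < p ∸ 1 → 0 < d → ∃[ g ] (¬ (p ∣ g) × ¬ (g ^ d ≈ 1 [ p ]))
    non-residue {p} (suc d) pp d< 0<d with any? (λ g → ¬? (p ∣? (p ∸ 1) + g ^ suc d)) (upTo⁺ (p ∸ 1))
    ... | yes any with find any
    ...   | g , g∈ , nd = g , (λ p∣g → <-irrefl refl (<-≤-trans (≤-<-trans (proj₂ (upTo⁺-bounds g∈)) (≤-reflexive 1+p-1)) (∣⇒≤ {{>-nonZero (proj₁ (upTo⁺-bounds g∈))}} p∣g))) ,
            λ h → nd (≈0⇒∣ (≈-trans (≈-+ (≈-refl {p ∸ 1}) h) (∣⇒≈0 (subst (p ∣_) (trans (sym 1+p-1) (+-comm 1 (p ∸ 1))) ∣-refl))))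
      where
      1+p-1 : suc (p ∸ 1) ≡ p
      1+p-1 = m+[n∸m]≡n (<⇒≤ (prime⇒1< pp))
    non-residue {p} (suc d) pp d< 0<d | no none = ⊥-elim (<-irrefl refl (<-≤-trans d< (subst (_≤ suc d) (trans (length-map suc (below (p ∸ 1))) (length-below (p ∸ 1)))
      (roots-bound pp (suc d) ((p ∸ 1) ∷ replicate d 0) (cong suc (length-replicate d)) (upTo⁺ (p ∸ 1)) (upTo⁺-unique (p ∸ 1)) root))))
      where
      root : ∀ {r} → r ∈ upTo⁺ (p ∸ 1) → r < p × (p ∸ 1) + r * monic (replicate d 0) r ≈ 0 [ p ]
      root {r} r∈ with p ∣? (p ∸ 1) + r ^ suc d
      ... | yes dv = ≤-<-trans (proj₂ (upTo⁺-bounds r∈)) (≤-reflexive (m+[n∸m]≡n (<⇒≤ (prime⇒1< pp)))) , ∣⇒≈0 (subst (λ z → p ∣ (p ∸ 1) + r * z) (sym (monic-replicate d r)) dv)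
      ... | no nd = ⊥-elim (none (lose r∈ nd))

  abstract
    -- Write n = p^f n′ with n′ prime to p, and add to g a multiple of p that makes the result 1
    -- modulo n′. It stays prime to p because g is.
    lift-unit : ∀ {p n g} → Prime p → 0 < n → ¬ (p ∣ g) → ∃[ a ] (Coprime a n × a ≈ g [ p ])
    lift-unit {p} {n} {g} pp 0<n p∤g with strip pp n 0<n
    ... | f , n′ , eq , p∤n′ , 0<n′ with inverse (prime-∤⇒coprime pp p∤n′) 0<n′
    ...   | w , hw = a , cop , a≈g
      where
      k a : ℕ
      k = w * (1 + g * (n′ ∸ 1))
      a = g + k * p
      a≈g : a ≈ g [ p ]
      a≈g = +-multiple-≈ g k p
      lem : ∀ g w m p → g + w * (1 + g * m) * p ≡ g + (w * p) * (1 + g * m)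
      lem = solve-∀
      lem₂ : ∀ g m → g + 1 * (1 + g * m) ≡ 1 + g * suc m
      lem₂ = solve-∀
      a≈1 : a ≈ 1 [ n′ ]
      a≈1 = ≈-trans (≡⇒≈ (lem g w (n′ ∸ 1) p)) (≈-trans (≈-+ (≈-refl {g}) (≈-* hw ≈-refl))
        (≈-trans (≡⇒≈ (trans (lem₂ g (n′ ∸ 1)) (cong (λ z → 1 + g * z) (m+[n∸m]≡n 0<n′)))) (+-multiple-≈ 1 g n′)))
      cop : Coprime a n
      cop {zero} (_ , 0∣n) = ⊥-elim (<-irrefl (sym (0∣⇒≡0 0∣n)) 0<n)
      cop {suc zero} _ = refl
      cop {d@(suc (suc _))} (d∣a , d∣n) with ∃-prime-divisor d (s≤s (s≤s z≤n))
      ... | r , pr , r∣d with euclidsLemma (p ^ f) n′ pr (subst (r ∣_) eq (∣-trans r∣d d∣n))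
      ...   | inj₁ r∣p^f with prime-∣-prime pr pp (prime-∣-^ p f pr r∣p^f)
      ...     | refl = ⊥-elim (p∤g (≈0⇒∣ (≈-trans (≈-sym a≈g) (∣⇒≈0 (∣-trans r∣d d∣a)))))
      cop {d@(suc (suc _))} (d∣a , d∣n) | r , pr , r∣d | inj₂ r∣n′ =
        ⊥-elim (¬prime[1] (subst Prime (∣1⇒≡1 (≈0⇒∣ (≈-trans (≈-sym (≈-∣ r∣n′ a≈1)) (∣⇒≈0 (∣-trans r∣d d∣a))))) pr))

  -- Choose g whose power with exponent (p - 1)/l is not 1 modulo p. The order of g divides p - 1
  -- with a cofactor prime to l, so it contains every power of l that divides p - 1; a unit modulo n
  -- that reduces to g has an order divisible by it.
  prime-power-λC : ∀ {p n l} e → Prime p → Prime l → 1 < n → p ∣ n → l ^ e ∣ p ∸ 1 → l ^ e ∣ λC n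
  prime-power-λC zero pp pl 1<n p∣n d = 1∣ _
  prime-power-λC {p} {n} {l} (suc e) pp pl 1<n p∣n (divides t eq) = lifted (non-residue d pp d<p-1 0<d)
    where
    d = t * l ^ e
    p-1≡ : p ∸ 1 ≡ d * l
    p-1≡ = trans eq (lem t l (l ^ e))
      where
      lem : ∀ t l x → t * (l * x) ≡ t * x * l
      lem = solve-∀
    0<d : 0 < d
    0<d = n≢0⇒n>0 λ d≡0 → <-irrefl (sym (trans p-1≡ (cong (_* l) d≡0))) (m<n⇒0<n∸m (prime⇒1< pp))
    d<p-1 : d < p ∸ 1
    d<p-1 = subst (d <_) (sym p-1≡) (m<m*n d l {{>-nonZero 0<d}} (prime⇒1< pl))
    1<p = prime⇒1< pp
    order-mod-p : ∀ {g} → ¬ (p ∣ g) → ¬ (g ^ d ≈ 1 [ p ]) → l ^ suc e ∣ ord g p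
    order-mod-p {g} p∤g ng = from-divides (ord-∣ 1<p cg (fermat pp p∤g))
      where
      cg : Coprime g p
      cg = Coprimality.sym (prime-∤⇒coprime pp p∤g)
      from-divides : ord g p ∣ p ∸ 1 → l ^ suc e ∣ ord g p
      from-divides (divides m em) = coprime-divisor (prime-^-coprime (suc e) pl l∤m) (subst (l ^ suc e ∣_) em (divides t eq))
        where
        l∤m : ¬ (l ∣ m)
        l∤m (divides m′ refl) = ng (subst (λ z → g ^ z ≈ 1 [ p ]) Gm′≡d (^-*≈ (ord g p) m′ (proj₁ (proj₂ (ord-spec 1<p cg)))))
          where
          lem : ∀ G m l → G * m * l ≡ m * l * G
          lem = solve-∀
          Gm′≡d : ord g p * m′ ≡ d
          Gm′≡d = *-cancelʳ-≡ (ord g p * m′) d l {{prime⇒nonZero pl}} (trans (lem (ord g p) m′ l) (trans (sym em) p-1≡))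
    lifted : ∃[ g ] (¬ (p ∣ g) × ¬ (g ^ d ≈ 1 [ p ])) → l ^ suc e ∣ λC n
    lifted (g , p∤g , ng) = finish (lift-unit pp (<⇒≤ 1<n) p∤g)
      where
      finish : ∃[ a ] (Coprime a n × a ≈ g [ p ]) → l ^ suc e ∣ λC n
      finish (a , ca , a≈g) = prime-power-∣-λC (suc e) 1<n ca pl (∣-trans (order-mod-p p∤g ng)
        (ord-∣ 1<p (Coprimality.sym (prime-∤⇒coprime pp p∤g)) (≈-trans (≈-^ (ord a n) (≈-sym a≈g)) (≈-∣ p∣n (proj₁ (proj₂ (ord-spec 1<n ca)))))))

  prime-powers-∣ : ∀ {m} D → 0 < D → (∀ {l} e → Prime l → l ^ e ∣ D → l ^ e ∣ m) → D ∣ m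
  prime-powers-∣ {m} = <-rec _ step
    where
    step : ∀ D → (∀ {D′} → D′ < D → 0 < D′ → (∀ {l} e → Prime l → l ^ e ∣ D′ → l ^ e ∣ m) → D′ ∣ m) →
      0 < D → (∀ {l} e → Prime l → l ^ e ∣ D → l ^ e ∣ m) → D ∣ m
    step zero rec () h
    step (suc zero) rec 0<D h = 1∣ m
    step D@(suc (suc _)) rec 0<D h with ∃-prime-divisor D (s≤s (s≤s z≤n))
    ... | l , pl , l∣D with strip pl D 0<D
    ...   | zero , D′ , eq , l∤ , 0<D′ = ⊥-elim (l∤ (subst (l ∣_) (trans eq (+-identityʳ D′)) l∣D))
    ...   | suc f , D′ , eq , l∤ , 0<D′ = subst (_∣ m) (sym eq) (coprime-∣-* (prime-^-coprime (suc f) pl l∤) (h (suc f) pl (subst (l ^ suc f ∣_) (sym eq) (m∣m*n D′)))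
        (rec D′<D 0<D′ λ {r} e pr d → h e pr (subst (r ^ e ∣_) (sym eq) (∣n⇒∣m*n (l ^ suc f) d))))
      where
      D′<D : D′ < D
      D′<D = subst (D′ <_) (sym eq) (subst (D′ <_) (*-comm D′ (l ^ suc f)) (m<m*n D′ (l ^ suc f) {{>-nonZero 0<D′}} (^-monoʳ-< l (prime⇒1< pl) {0} {suc f} (s≤s z≤n))))

-- Coefficient vectors and quotient rings of ℤ[X].

module Lattice where

  open import Data.Nat as ℕ using (ℕ; zero; suc)
  import Data.Nat.Properties as ℕₚ
  open import Data.Integer using (ℤ; 0ℤ; 1ℤ; -1ℤ; _+_; _*_; _-_; ∣_∣)
  open import Data.Integer.Properties
  open import Data.Integer.Tactic.RingSolver using (solve-∀)
  open import Data.Nat.Tactic.RingSolver using () renaming (solve-∀ to solve-∀ℕ)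
  open import Data.List as List using (List; []; _∷_; length)
  open import Data.Vec as Vec using (Vec; []; _∷_; zipWith; toList)
  open import Data.Vec.Relation.Unary.All as All using (All; []; _∷_)
  open import Data.Product using (∃-syntax; _×_; _,_; proj₁; proj₂)
  open import Relation.Binary.PropositionalEquality

  private
    variable
      n : ℕ

  infixl 6 _⊕_ _⊖_
  infixr 7 _•_

  𝟎 : Vec ℤ n
  𝟎 {n} = Vec.replicate n 0ℤ

  Small : ℕ → Vec ℤ n → Set
  Small b = All (λ a → ∣ a ∣ ℕ.≤ b)

  Small-mono : ∀ {b b′} {v : Vec ℤ n} → b ℕ.≤ b′ → Small b v → Small b′ v
  Small-mono le = All.map (λ h → ℕₚ.≤-trans h le)

  Small-𝟎 : ∀ {b} n → Small b (𝟎 {n})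
  Small-𝟎 zero = []
  Small-𝟎 (suc n) = ℕ.z≤n ∷ Small-𝟎 n

  -- Multiplication by X before reduction: coefficients move up one place, a new one enters at the
  -- bottom, and the top one is handed out to be reduced.
  carry : ℤ → Vec ℤ n → Vec ℤ n × ℤ
  carry a [] = [] , a
  carry a (x ∷ v) = a ∷ proj₁ (carry x v) , proj₂ (carry x v)

  carry-Small : ∀ {a b} {v : Vec ℤ n} → ∣ a ∣ ℕ.≤ b → Small b v → Small b (proj₁ (carry a v)) × ∣ proj₂ (carry a v) ∣ ℕ.≤ b
  carry-Small {v = []} ha [] = [] , ha
  carry-Small {v = x ∷ v} ha (h ∷ hs) = ha ∷ proj₁ (carry-Small h hs) , proj₂ (carry-Small h hs)

  total : Vec ℤ n → ℤ
  total [] = 0ℤ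
  total (x ∷ v) = x + total v

  total-carry : ∀ a (v : Vec ℤ n) → total (proj₁ (carry a v)) + proj₂ (carry a v) ≡ a + total v
  total-carry a [] = trans (+-identityˡ a) (sym (+-identityʳ a))
  total-carry a (x ∷ v) = trans (+-assoc a _ _) (cong (a +_) (total-carry x v))

  abstract
    _⊕_ : Vec ℤ n → Vec ℤ n → Vec ℤ n
    _⊕_ = zipWith _+_

    _•_ : ℤ → Vec ℤ n → Vec ℤ n
    a • v = Vec.map (a *_) v

    _⊖_ : Vec ℤ n → Vec ℤ n → Vec ℤ n
    _⊖_ = zipWith _-_

    ⊕-comm : (u v : Vec ℤ n) → u ⊕ v ≡ v ⊕ u
    ⊕-comm [] [] = refl
    ⊕-comm (a ∷ u) (b ∷ v) = cong₂ _∷_ (+-comm a b) (⊕-comm u v)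

    ⊕-assoc : (u v w : Vec ℤ n) → (u ⊕ v) ⊕ w ≡ u ⊕ (v ⊕ w)
    ⊕-assoc [] [] [] = refl
    ⊕-assoc (a ∷ u) (b ∷ v) (c ∷ w) = cong₂ _∷_ (+-assoc a b c) (⊕-assoc u v w)

    ⊕-identityˡ : (u : Vec ℤ n) → 𝟎 ⊕ u ≡ u
    ⊕-identityˡ [] = refl
    ⊕-identityˡ (a ∷ u) = cong₂ _∷_ (+-identityˡ a) (⊕-identityˡ u)

    ⊕-identityʳ : (u : Vec ℤ n) → u ⊕ 𝟎 ≡ u
    ⊕-identityʳ u = trans (⊕-comm u 𝟎) (⊕-identityˡ u)

    ⊕-interchange : (t u v w : Vec ℤ n) → (t ⊕ u) ⊕ (v ⊕ w) ≡ (t ⊕ v) ⊕ (u ⊕ w)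
    ⊕-interchange [] [] [] [] = refl
    ⊕-interchange (a ∷ t) (b ∷ u) (c ∷ v) (d ∷ w) = cong₂ _∷_ (lem a b c d) (⊕-interchange t u v w)
      where
      lem : ∀ a b c d → (a + b) + (c + d) ≡ (a + c) + (b + d)
      lem = solve-∀

    •-⊕ : ∀ a (u v : Vec ℤ n) → a • (u ⊕ v) ≡ a • u ⊕ a • v
    •-⊕ a [] [] = refl
    •-⊕ a (x ∷ u) (y ∷ v) = cong₂ _∷_ (*-distribˡ-+ a x y) (•-⊕ a u v)

    +-• : ∀ a b (u : Vec ℤ n) → (a + b) • u ≡ a • u ⊕ b • u
    +-• a b [] = refl
    +-• a b (x ∷ u) = cong₂ _∷_ (*-distribʳ-+ x a b) (+-• a b u)

    *-• : ∀ a b (u : Vec ℤ n) → (a * b) • u ≡ a • b • u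
    *-• a b [] = refl
    *-• a b (x ∷ u) = cong₂ _∷_ (*-assoc a b x) (*-• a b u)

    1-• : (u : Vec ℤ n) → 1ℤ • u ≡ u
    1-• [] = refl
    1-• (x ∷ u) = cong₂ _∷_ (*-identityˡ x) (1-• u)

    0-• : (u : Vec ℤ n) → 0ℤ • u ≡ 𝟎
    0-• [] = refl
    0-• (x ∷ u) = cong₂ _∷_ (*-zeroˡ x) (0-• u)

    •-𝟎 : ∀ a → a • 𝟎 {n} ≡ 𝟎
    •-𝟎 {zero} a = refl
    •-𝟎 {suc n} a = cong₂ _∷_ (*-zeroʳ a) (•-𝟎 a)

    ⊖-self : (u : Vec ℤ n) → u ⊖ u ≡ 𝟎
    ⊖-self [] = refl
    ⊖-self (x ∷ u) = cong₂ _∷_ (+-inverseʳ x) (⊖-self u)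

    ⊖≡𝟎⇒≡ : (u v : Vec ℤ n) → u ⊖ v ≡ 𝟎 → u ≡ v
    ⊖≡𝟎⇒≡ [] [] e = refl
    ⊖≡𝟎⇒≡ (x ∷ u) (y ∷ v) e = cong₂ _∷_ (i-j≡0⇒i≡j x y (cong Vec.head e)) (⊖≡𝟎⇒≡ u v (cong Vec.tail e))

    ⊖-as-⊕ : (u v : Vec ℤ n) → u ⊖ v ≡ u ⊕ -1ℤ • v
    ⊖-as-⊕ [] [] = refl
    ⊖-as-⊕ (x ∷ u) (y ∷ v) = cong₂ _∷_ (cong (x +_) (sym (-1*i≡-i y))) (⊖-as-⊕ u v)

    ⊖-⊕-cancel : (u v : Vec ℤ n) → (u ⊖ v) ⊕ v ≡ u
    ⊖-⊕-cancel [] [] = refl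
    ⊖-⊕-cancel (x ∷ u) (y ∷ v) = cong₂ _∷_ (lem x y) (⊖-⊕-cancel u v)
      where
      lem : ∀ x y → x - y + y ≡ x
      lem = solve-∀

    ⊕≡⇒⊖≡ : (a b c d : Vec ℤ n) → a ⊕ b ≡ c ⊕ d → a ⊖ c ≡ d ⊖ b
    ⊕≡⇒⊖≡ [] [] [] [] e = refl
    ⊕≡⇒⊖≡ (a ∷ u) (b ∷ v) (c ∷ w) (d ∷ x) e = cong₂ _∷_ (lem a b c d (cong Vec.head e)) (⊕≡⇒⊖≡ u v w x (cong Vec.tail e))
      where
      l₁ : ∀ a b c → a - c ≡ (a + b) - b - c
      l₁ = solve-∀
      l₂ : ∀ b c d → (c + d) - b - c ≡ d - b
      l₂ = solve-∀
      lem : ∀ a b c d → a + b ≡ c + d → a - c ≡ d - b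
      lem a b c d e = trans (l₁ a b c) (trans (cong (λ z → z - b - c) e) (l₂ b c d))

    Small-⊕ : ∀ {a b} {u v : Vec ℤ n} → Small a u → Small b v → Small (a ℕ.+ b) (u ⊕ v)
    Small-⊕ {u = []} {[]} [] [] = []
    Small-⊕ {u = x ∷ u} {y ∷ v} (h ∷ hs) (k ∷ ks) = ℕₚ.≤-trans (∣i+j∣≤∣i∣+∣j∣ x y) (ℕₚ.+-mono-≤ h k) ∷ Small-⊕ hs ks

    Small-• : ∀ {a b c} {v : Vec ℤ n} → ∣ a ∣ ℕ.≤ c → Small b v → Small (c ℕ.* b) (a • v)
    Small-• {v = []} ha [] = []
    Small-• {a = a} {v = x ∷ v} ha (h ∷ hs) = ℕₚ.≤-trans (ℕₚ.≤-reflexive (abs-* a x)) (ℕₚ.*-mono-≤ ha h) ∷ Small-• {a = a} ha hs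

    carry-⊕ : ∀ a b (u v : Vec ℤ n) → proj₁ (carry (a + b) (u ⊕ v)) ≡ proj₁ (carry a u) ⊕ proj₁ (carry b v) ×
      proj₂ (carry (a + b) (u ⊕ v)) ≡ proj₂ (carry a u) + proj₂ (carry b v)
    carry-⊕ a b [] [] = refl , refl
    carry-⊕ a b (x ∷ u) (y ∷ v) = cong (a + b ∷_) (proj₁ (carry-⊕ x y u v)) , proj₂ (carry-⊕ x y u v)

    carry-• : ∀ k a (u : Vec ℤ n) → proj₁ (carry (k * a) (k • u)) ≡ k • proj₁ (carry a u) × proj₂ (carry (k * a) (k • u)) ≡ k * proj₂ (carry a u)
    carry-• k a [] = refl , refl
    carry-• k a (x ∷ u) = cong (k * a ∷_) (proj₁ (carry-• k x u)) , proj₂ (carry-• k x u)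

    total-⊕ : (u v : Vec ℤ n) → total (u ⊕ v) ≡ total u + total v
    total-⊕ [] [] = refl
    total-⊕ (x ∷ u) (y ∷ v) = trans (cong (x + y +_) (total-⊕ u v)) (lem x y (total u) (total v))
      where
      lem : ∀ a b c d → (a + b) + (c + d) ≡ (a + c) + (b + d)
      lem = solve-∀

    total-• : ∀ a (u : Vec ℤ n) → total (a • u) ≡ a * total u
    total-• a [] = sym (*-zeroʳ a)
    total-• a (x ∷ u) = trans (cong (a * x +_) (total-• a u)) (sym (*-distribˡ-+ a x (total u)))

    ⊖-𝟎 : (u : Vec ℤ n) → u ⊖ 𝟎 ≡ u
    ⊖-𝟎 [] = refl
    ⊖-𝟎 (x ∷ u) = cong₂ _∷_ (+-identityʳ x) (⊖-𝟎 u)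

    ⊖-flip : (u v : Vec ℤ n) → -1ℤ • (u ⊖ v) ≡ v ⊖ u
    ⊖-flip [] [] = refl
    ⊖-flip (x ∷ u) (y ∷ v) = cong₂ _∷_ (lem x y) (⊖-flip u v)
      where
      lem : ∀ x y → -1ℤ * (x - y) ≡ y - x
      lem = solve-∀

    affine-⊖ : ∀ k (a b x y : Vec ℤ n) → (a ⊕ k • (b ⊕ x)) ⊖ (a ⊕ k • (b ⊕ y)) ≡ k • (x ⊖ y)
    affine-⊖ k [] [] [] [] = refl
    affine-⊖ k (a ∷ u) (b ∷ v) (x ∷ w) (y ∷ z) = cong₂ _∷_ (lem k a b x y) (affine-⊖ k u v w z)
      where
      lem : ∀ k a b x y → (a + k * (b + x)) - (a + k * (b + y)) ≡ k * (x - y)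
      lem = solve-∀

    •-∷ : ∀ a x (v : Vec ℤ n) → a • (x ∷ v) ≡ a * x ∷ a • v
    •-∷ a x v = refl

    ⊕-∷ : ∀ x y (u v : Vec ℤ n) → (x ∷ u) ⊕ (y ∷ v) ≡ x + y ∷ u ⊕ v
    ⊕-∷ x y u v = refl

    ⊖-∷ : ∀ x y (u v : Vec ℤ n) → (x ∷ u) ⊖ (y ∷ v) ≡ x - y ∷ u ⊖ v
    ⊖-∷ x y u v = refl

    •-[] : ∀ a → a • [] ≡ []
    •-[] a = refl

    •-𝟏 : ∀ a (v : Vec ℤ n) → a • (1ℤ ∷ 𝟎) ⊕ (0ℤ ∷ v) ≡ a ∷ v
    •-𝟏 a v = cong₂ _∷_ (trans (+-identityʳ (a * 1ℤ)) (*-identityʳ a)) (trans (cong (_⊕ v) (•-𝟎 a)) (⊕-identityˡ v))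

  pad : List ℤ → (n : ℕ) → Vec ℤ n
  pad [] n = 𝟎
  pad (a ∷ f) zero = []
  pad (a ∷ f) (suc n) = a ∷ pad f n

  pad-toList : (v : Vec ℤ n) → pad (toList v) n ≡ v
  pad-toList [] = refl
  pad-toList (x ∷ v) = cong (x ∷_) (pad-toList v)

  carry-𝟎 : ∀ n → carry 0ℤ (𝟎 {n}) ≡ (𝟎 , 0ℤ)
  carry-𝟎 zero = refl
  carry-𝟎 (suc n) = cong (λ z → 0ℤ ∷ proj₁ z , proj₂ z) (carry-𝟎 n)

  carry-pad : ∀ a f n → length f ℕ.< n → carry a (pad f n) ≡ (pad (a ∷ f) n , 0ℤ)
  carry-pad a [] (suc n) lt = cong (λ z → a ∷ proj₁ z , proj₂ z) (carry-𝟎 n)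
  carry-pad a (b ∷ f) (suc n) lt = cong (λ z → a ∷ proj₁ z , proj₂ z) (carry-pad b f n (ℕ.s≤s⁻¹ lt))

  evalℤ : List ℤ → ℤ → ℤ
  evalℤ [] x = 0ℤ
  evalℤ (a ∷ f) x = a + x * evalℤ f x

  -- The ring ℤ[X]/(X^m - Σ cᵢ Xⁱ) on coefficient vectors; τ is multiplication by X.
  module Quotient {m′ : ℕ} (c : Vec ℤ (suc m′)) (c-small : Small 1 c) where

    m : ℕ
    m = suc m′

    V : Set
    V = Vec ℤ m

    τ : V → V
    τ v = proj₁ (carry 0ℤ v) ⊕ proj₂ (carry 0ℤ v) • c

    τ-⊕ : ∀ u v → τ (u ⊕ v) ≡ τ u ⊕ τ v
    τ-⊕ u v with carry-⊕ 0ℤ 0ℤ u v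
    ... | e₁ , e₂ = trans (cong₂ _⊕_ e₁ (trans (cong (_• c) e₂) (+-• _ _ c))) (⊕-interchange _ _ _ _)

    τ-• : ∀ a v → τ (a • v) ≡ a • τ v
    τ-• a v = trans (cong (λ z → proj₁ (carry z (a • v)) ⊕ proj₂ (carry z (a • v)) • c) (sym (*-zeroʳ a)))
      (trans (cong₂ _⊕_ (proj₁ (carry-• a 0ℤ v)) (trans (cong (_• c) (proj₂ (carry-• a 0ℤ v))) (*-• a _ c))) (sym (•-⊕ a _ _)))

    τ-Small : ∀ {b v} → Small b v → Small (b ℕ.+ b) (τ v)
    τ-Small {b} h with carry-Small {a = 0ℤ} ℕ.z≤n h
    ... | h₁ , h₂ = Small-⊕ h₁ (Small-mono (ℕₚ.≤-reflexive (ℕₚ.*-identityʳ b)) (Small-• h₂ c-small))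

    -- The polynomial f in the operator `τ`, applied to v by Horner's rule.
    act : List ℤ → V → V
    act [] v = 𝟎
    act (a ∷ f) v = a • v ⊕ τ (act f v)

    τ-𝟎 : τ 𝟎 ≡ 𝟎
    τ-𝟎 = trans (cong τ (sym (0-• 𝟎))) (trans (τ-• 0ℤ 𝟎) (0-• _))

    act-⊕ : ∀ f u v → act f (u ⊕ v) ≡ act f u ⊕ act f v
    act-⊕ [] u v = sym (⊕-identityˡ 𝟎)
    act-⊕ (a ∷ f) u v = trans (cong₂ _⊕_ (•-⊕ a u v) (trans (cong τ (act-⊕ f u v)) (τ-⊕ _ _))) (⊕-interchange _ _ _ _)

    act-• : ∀ f k v → act f (k • v) ≡ k • act f v
    act-• [] k v = sym (•-𝟎 k)
    act-• (a ∷ f) k v = trans (cong₂ _⊕_ (trans (sym (*-• a k v)) (trans (cong (_• v) (*-comm a k)) (*-• k a v))) (trans (cong τ (act-• f k v)) (τ-• k _))) (sym (•-⊕ k _ _))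

    act-τ : ∀ f v → act f (τ v) ≡ τ (act f v)
    act-τ [] v = sym τ-𝟎
    act-τ (a ∷ f) v = trans (cong₂ _⊕_ (sym (τ-• a v)) (cong τ (act-τ f v))) (sym (τ-⊕ _ _))

    act-𝟎 : ∀ f → act f 𝟎 ≡ 𝟎
    act-𝟎 f = trans (cong (act f) (sym (0-• 𝟎))) (trans (act-• f 0ℤ 𝟎) (0-• _))

    -- Polynomials in one operator commute. Commutativity and associativity of the product are both
    -- deduced from this.
    act-act : ∀ f g v → act f (act g v) ≡ act g (act f v)
    act-act [] g v = sym (act-𝟎 g)
    act-act (a ∷ f) g v = trans (cong₂ _⊕_ (sym (act-• g a v)) (trans (cong τ (act-act f g v)) (sym (act-τ g (act f v))))) (sym (act-⊕ g _ _))

    𝟏 : V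
    𝟏 = 1ℤ ∷ 𝟎

    act-pad : ∀ f → length f ℕ.≤ m → act f 𝟏 ≡ pad f m
    act-pad [] le = refl
    act-pad (a ∷ f) le = trans (cong (λ z → a • 𝟏 ⊕ τ z) (act-pad f (ℕₚ.<⇒≤ le)))
      (trans (cong (a • 𝟏 ⊕_) (trans (cong (λ z → proj₁ z ⊕ proj₂ z • c) (carry-pad 0ℤ f m le)) (trans (cong (pad (0ℤ ∷ f) m ⊕_) (0-• c)) (⊕-identityʳ (pad (0ℤ ∷ f) m)))))
      (•-𝟏 a (pad f m′)))

    length-toList : ∀ {k} (v : Vec ℤ k) → length (toList v) ≡ k
    length-toList [] = refl
    length-toList (x ∷ v) = cong suc (length-toList v)

    infixl 7 _⋆_

    _⋆_ : V → V → V
    u ⋆ v = act (toList u) v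

    ⋆-identityʳ : ∀ u → u ⋆ 𝟏 ≡ u
    ⋆-identityʳ u = trans (act-pad (toList u) (ℕₚ.≤-reflexive (length-toList u))) (pad-toList u)

    ⋆-comm : ∀ u v → u ⋆ v ≡ v ⋆ u
    ⋆-comm u v = trans (cong (u ⋆_) (sym (⋆-identityʳ v))) (trans (act-act (toList u) (toList v) 𝟏) (cong (v ⋆_) (⋆-identityʳ u)))

    ⋆-identityˡ : ∀ u → 𝟏 ⋆ u ≡ u
    ⋆-identityˡ u = trans (⋆-comm 𝟏 u) (⋆-identityʳ u)

    ⋆-swap : ∀ u v w → u ⋆ (v ⋆ w) ≡ v ⋆ (u ⋆ w)
    ⋆-swap u v w = act-act (toList u) (toList v) w

    ⋆-assoc : ∀ u v w → u ⋆ v ⋆ w ≡ u ⋆ (v ⋆ w)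
    ⋆-assoc u v w = trans (⋆-comm (u ⋆ v) w) (trans (⋆-swap w u v) (cong (u ⋆_) (⋆-comm w v)))

    ⋆-distribˡ : ∀ u v w → u ⋆ (v ⊕ w) ≡ u ⋆ v ⊕ u ⋆ w
    ⋆-distribˡ u = act-⊕ (toList u)

    ⋆-distribʳ : ∀ u v w → (u ⊕ v) ⋆ w ≡ u ⋆ w ⊕ v ⋆ w
    ⋆-distribʳ u v w = trans (⋆-comm (u ⊕ v) w) (trans (⋆-distribˡ w u v) (cong₂ _⊕_ (⋆-comm w u) (⋆-comm w v)))

    ⋆-• : ∀ u a v → u ⋆ (a • v) ≡ a • (u ⋆ v)
    ⋆-• u = act-• (toList u)

    •-⋆ : ∀ a u v → (a • u) ⋆ v ≡ a • (u ⋆ v)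
    •-⋆ a u v = trans (⋆-comm (a • u) v) (trans (⋆-• v a u) (cong (a •_) (⋆-comm v u)))

    ⋆-⊖ : ∀ u v w → u ⋆ (v ⊖ w) ≡ u ⋆ v ⊖ u ⋆ w
    ⋆-⊖ u v w = trans (cong (u ⋆_) (⊖-as-⊕ v w)) (trans (⋆-distribˡ u v _) (trans (cong (u ⋆ v ⊕_) (⋆-• u -1ℤ w)) (sym (⊖-as-⊕ _ _))))

    ⊖-⋆ : ∀ u v w → (u ⊖ v) ⋆ w ≡ u ⋆ w ⊖ v ⋆ w
    ⊖-⋆ u v w = trans (⋆-comm (u ⊖ v) w) (trans (⋆-⊖ w u v) (cong₂ _⊖_ (⋆-comm w u) (⋆-comm w v)))

    𝟎-⋆ : ∀ u → 𝟎 ⋆ u ≡ 𝟎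
    𝟎-⋆ u = trans (⋆-comm 𝟎 u) (act-𝟎 (toList u))

    X : V
    X = τ 𝟏

    X-⋆ : ∀ v → X ⋆ v ≡ τ v
    X-⋆ v = trans (⋆-comm X v) (trans (act-τ (toList v) 𝟏) (cong τ (⋆-identityʳ v)))

    act-⋆ : ∀ f v → act f v ≡ act f 𝟏 ⋆ v
    act-⋆ f v = trans (cong (act f) (sym (⋆-identityʳ v))) (trans (act-act f (toList v) 𝟏) (⋆-comm v (act f 𝟏)))

    -- The coefficients of `c` are at most 1 in absolute value, so `τ` at most doubles the largest
    -- coefficient, and the m Horner steps of a product cost a factor below 2^m.
    𝒞 : ℕ
    𝒞 = 2 ℕ.^ m

    act-Small : ∀ {k a b} (u : Vec ℤ k) v → Small a u → Small b v → Small ((2 ℕ.^ k ℕ.∸ 1) ℕ.* (a ℕ.* b)) (act (toList u) v)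
    act-Small [] v [] hv = Small-𝟎 m
    act-Small {suc k} {a} {b} (x ∷ u) v (hx ∷ hu) hv = Small-mono (ℕₚ.≤-reflexive eq) (Small-⊕ (Small-• hx hv) (τ-Small (act-Small u v hu hv)))
      where
      lem : ∀ t ab → ab ℕ.+ (t ℕ.* ab ℕ.+ t ℕ.* ab) ≡ (t ℕ.+ suc t) ℕ.* ab
      lem = solve-∀ℕ
      1+t : suc (2 ℕ.^ k ℕ.∸ 1) ≡ 2 ℕ.^ k
      1+t = ℕₚ.m+[n∸m]≡n (ℕₚ.m^n>0 2 k)
      eq : a ℕ.* b ℕ.+ ((2 ℕ.^ k ℕ.∸ 1) ℕ.* (a ℕ.* b) ℕ.+ (2 ℕ.^ k ℕ.∸ 1) ℕ.* (a ℕ.* b)) ≡ (2 ℕ.^ suc k ℕ.∸ 1) ℕ.* (a ℕ.* b)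
      eq = trans (lem (2 ℕ.^ k ℕ.∸ 1) (a ℕ.* b)) (cong (ℕ._* (a ℕ.* b)) (trans (cong ((2 ℕ.^ k ℕ.∸ 1) ℕ.+_) 1+t)
        (trans (sym (ℕₚ.+-∸-comm (2 ℕ.^ k) (ℕₚ.m^n>0 2 k))) (cong (ℕ._∸ 1) (cong (2 ℕ.^ k ℕ.+_) (sym (ℕₚ.+-identityʳ (2 ℕ.^ k))))))))

    ⋆-Small : ∀ {a b u v} → Small a u → Small b v → Small (𝒞 ℕ.* (a ℕ.* b)) (u ⋆ v)
    ⋆-Small {a} {b} {u} {v} hu hv = Small-mono (ℕₚ.*-monoˡ-≤ (a ℕ.* b) (ℕₚ.m∸n≤m 𝒞 1)) (act-Small u v hu hv)

-- The cyclotomic ring of prime power order is an integral domain.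

module Domain where

  open Lattice
  open Mod using (_≈_[_]; prime⇒0<; prime⇒1<)
  open import Data.Nat as ℕ using (ℕ; zero; suc)
  import Data.Nat.Properties as ℕₚ
  import Data.Nat.Divisibility as ℕ∣
  open import Data.Nat.Primality using (Prime; euclidsLemma)
  open import Data.Nat.Induction using (<-rec)
  open import Data.Integer using (ℤ; 0ℤ; 1ℤ; -1ℤ; _+_; _*_; _-_; -_; ∣_∣) renaming (+_ to int)
  open import Data.Integer.Properties hiding (_≟_)
  open import Data.Integer.Divisibility.Signed using (divides; ∣ᵤ⇒∣; ∣⇒∣ᵤ) renaming (_∣_ to _∣ᶻ_; _∣?_ to _∣ᶻ?_)
  open import Data.Integer.Tactic.RingSolver using (solve-∀)
  open import Data.List as List using (List; []; _∷_; length; _++_; replicate)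
  open import Data.List.Properties using (length-++; length-replicate)
  open import Data.Vec as Vec using (Vec; []; _∷_; toList)
  open import Data.Vec.Relation.Unary.All as All using (All; []; _∷_)
  open import Data.Empty using (⊥; ⊥-elim)
  open import Data.Product using (∃-syntax; _×_; _,_; proj₁; proj₂)
  open import Data.Sum using (_⊎_; inj₁; inj₂)
  open import Function using (_∘_)
  open import Relation.Nullary using (Dec; yes; no; ¬_)
  open import Relation.Binary.PropositionalEquality

  infix 4 _∣ᵥ_

  _∣ᵥ_ : ∀ {n} → ℕ → Vec ℤ n → Set
  p ∣ᵥ x = ∃[ y ] x ≡ int p • y

  euclidℤ : ∀ {p} → Prime p → ∀ a b → int p ∣ᶻ a * b → int p ∣ᶻ a ⊎ int p ∣ᶻ b
  euclidℤ {p} pp a b d with euclidsLemma ∣ a ∣ ∣ b ∣ pp (subst (p ℕ∣.∣_) (abs-* a b) (∣⇒∣ᵤ d))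
  ... | inj₁ h = inj₁ (∣ᵤ⇒∣ h)
  ... | inj₂ h = inj₂ (∣ᵤ⇒∣ h)

  ∣ᵥ-⊕ : ∀ {n p} {x y : Vec ℤ n} → p ∣ᵥ x → p ∣ᵥ y → p ∣ᵥ x ⊕ y
  ∣ᵥ-⊕ {p = p} (u , refl) (v , refl) = u ⊕ v , sym (•-⊕ (int p) u v)

  ∣ᵥ-• : ∀ {n p} {x : Vec ℤ n} a → p ∣ᵥ x → p ∣ᵥ a • x
  ∣ᵥ-• {p = p} a (u , refl) = a • u , trans (sym (*-• a (int p) u)) (trans (cong (_• u) (*-comm a (int p))) (*-• (int p) a u))

  ∣ᵥ-⊖ : ∀ {n p} {x y : Vec ℤ n} → p ∣ᵥ x → p ∣ᵥ y → p ∣ᵥ x ⊖ y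
  ∣ᵥ-⊖ {p = p} {x} {y} dx dy = subst (p ∣ᵥ_) (sym (⊖-as-⊕ x y)) (∣ᵥ-⊕ dx (∣ᵥ-• -1ℤ dy))

  ∣ᵥ-𝟎 : ∀ {n p} → p ∣ᵥ 𝟎 {n}
  ∣ᵥ-𝟎 {p = p} = 𝟎 , sym (•-𝟎 (int p))

  ∣ᵥ-scalar : ∀ {n p a} (x : Vec ℤ n) → int p ∣ᶻ a → p ∣ᵥ a • x
  ∣ᵥ-scalar {p = p} x (divides q refl) = q • x , trans (cong (_• x) (*-comm q (int p))) (*-• (int p) q x)

  ∣ᵥ⇒All : ∀ {n p} {x : Vec ℤ n} → p ∣ᵥ x → All (int p ∣ᶻ_) x
  ∣ᵥ⇒All {x = []} _ = []
  ∣ᵥ⇒All {p = p} {x ∷ v} (y ∷ u , e) = divides y (trans (cong Vec.head e′) (*-comm (int p) y)) ∷ ∣ᵥ⇒All (u , cong Vec.tail e′)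
    where
    e′ : x ∷ v ≡ int p * y ∷ int p • u
    e′ = trans e (•-∷ (int p) y u)

  All⇒∣ᵥ : ∀ {n p} {x : Vec ℤ n} → All (int p ∣ᶻ_) x → p ∣ᵥ x
  All⇒∣ᵥ {p = p} [] = [] , sym (•-[] (int p))
  All⇒∣ᵥ {p = p} (divides q refl ∷ h) with All⇒∣ᵥ h
  ... | u , e = q ∷ u , trans (cong₂ _∷_ (*-comm q (int p)) e) (sym (•-∷ (int p) q u))

  _∣ᵥ?_ : ∀ {n} p (x : Vec ℤ n) → Dec (p ∣ᵥ x)
  p ∣ᵥ? x with All.all? (int p ∣ᶻ?_) x
  ... | yes h = yes (All⇒∣ᵥ h)
  ... | no h = no (h ∘ ∣ᵥ⇒All)

  ∣ᵥ-cancel : ∀ {n p a} {x : Vec ℤ n} → Prime p → ¬ (int p ∣ᶻ a) → p ∣ᵥ a • x → p ∣ᵥ x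
  ∣ᵥ-cancel {p = p} {a} pp na d = All⇒∣ᵥ (go _ (∣ᵥ⇒All d))
    where
    go : ∀ {n} (x : Vec ℤ n) → All (int p ∣ᶻ_) (a • x) → All (int p ∣ᶻ_) x
    go [] _ = []
    go (y ∷ v) h with subst (All (int p ∣ᶻ_)) (•-∷ a y v) h
    ... | k ∷ ks with euclidℤ pp a y k
    ...   | inj₁ bad = ⊥-elim (na bad)
    ...   | inj₂ ok = ok ∷ go v ks

  •-cancel : ∀ {n} a (x : Vec ℤ n) → a ≢ 0ℤ → a • x ≡ 𝟎 → x ≡ 𝟎
  •-cancel a [] na e = refl
  •-cancel a (y ∷ v) na e with trans (sym (•-∷ a y v)) e
  ... | e′ = cong₂ _∷_ (y≡0 (i*j≡0⇒i≡0∨j≡0 a (cong Vec.head e′))) (•-cancel a v na (cong Vec.tail e′))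
    where
    y≡0 : a ≡ 0ℤ ⊎ y ≡ 0ℤ → y ≡ 0ℤ
    y≡0 (inj₁ z) = ⊥-elim (na z)
    y≡0 (inj₂ z) = z

  private
    sumL : List ℤ → ℤ
    sumL [] = 0ℤ
    sumL (a ∷ f) = a + sumL f

    sumL-toList : ∀ {n} (v : Vec ℤ n) → sumL (toList v) ≡ total v
    sumL-toList [] = refl
    sumL-toList (x ∷ v) = cong (x +_) (sumL-toList v)

    nth : List ℤ → ℕ → ℤ
    nth [] i = 0ℤ
    nth (a ∷ f) zero = a
    nth (a ∷ f) (suc i) = nth f i

    addL : List ℤ → List ℤ → List ℤ
    addL [] g = g
    addL f@(_ ∷ _) [] = f
    addL (a ∷ f) (b ∷ g) = a + b ∷ addL f g

    nth-addL : ∀ f g i → nth (addL f g) i ≡ nth f i + nth g i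
    nth-addL [] g i = sym (+-identityˡ (nth g i))
    nth-addL f@(_ ∷ _) [] i = sym (+-identityʳ (nth f i))
    nth-addL (a ∷ f) (b ∷ g) zero = refl
    nth-addL (a ∷ f) (b ∷ g) (suc i) = nth-addL f g i

    length-addL : ∀ f g → length f ℕ.≤ length g → length (addL f g) ≡ length g
    length-addL [] g _ = refl
    length-addL (a ∷ f) (b ∷ g) (ℕ.s≤s le) = cong suc (length-addL f g le)

    row : ℕ → List ℤ
    row zero = 1ℤ ∷ []
    row (suc n) = addL (row n) (0ℤ ∷ row n)

    length-row : ∀ n → length (row n) ≡ suc n
    length-row zero = refl
    length-row (suc n) = trans (length-addL (row n) (0ℤ ∷ row n) (ℕₚ.n≤1+n _)) (cong suc (length-row n))

    pascal : ∀ n i → nth (row (suc n)) (suc i) ≡ nth (row n) (suc i) + nth (row n) i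
    pascal n i = nth-addL (row n) (0ℤ ∷ row n) (suc i)

    row-first : ∀ n → nth (row n) 0 ≡ 1ℤ
    row-first zero = refl
    row-first (suc n) = trans (nth-addL (row n) (0ℤ ∷ row n) 0) (trans (+-identityʳ _) (row-first n))

    nth-beyond : ∀ f i → length f ℕ.≤ i → nth f i ≡ 0ℤ
    nth-beyond [] i le = refl
    nth-beyond (a ∷ f) (suc i) (ℕ.s≤s le) = nth-beyond f i le

    row-last : ∀ n → nth (row n) n ≡ 1ℤ
    row-last zero = refl
    row-last (suc n) = trans (pascal n n) (trans (cong₂ _+_ (nth-beyond (row n) (suc n) (ℕₚ.≤-reflexive (length-row n))) (row-last n)) refl)

    int-suc : ∀ n → int (suc n) ≡ 1ℤ + int n
    int-suc n = refl

    -- (i + 1) C(n + 1, i + 1) = (n + 1) C(n, i)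
    absorb : ∀ n i → int (suc i) * nth (row (suc n)) (suc i) ≡ int (suc n) * nth (row n) i
    absorb zero zero = refl
    absorb zero (suc i) = *-zeroʳ (int (suc (suc i)))
    absorb (suc n) zero = trans (*-identityˡ (nth (row (suc (suc n))) 1)) (trans (pascal (suc n) 0)
      (trans (cong₂ _+_ (trans (sym (*-identityˡ _)) (trans (absorb n zero) (cong (int (suc n) *_) (row-first n)))) (row-first (suc n)))
      (trans (lem (int (suc n))) (sym (trans (cong (int (suc (suc n)) *_) (row-first (suc n))) (cong (_* 1ℤ) (int-suc (suc n))))))))
      where
      lem : ∀ n → n * 1ℤ + 1ℤ ≡ (1ℤ + n) * 1ℤ
      lem = solve-∀
    absorb (suc n) (suc i) = trans (cong (int (suc (suc i)) *_) (pascal (suc n) (suc i)))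
      (trans (cong (_* (a + b)) (int-suc (suc i))) (trans (lem (int (suc i)) a b)
      (trans (cong₂ _+_ (cong (b +_) (absorb n i)) (trans (cong (_* a) (sym (int-suc (suc i)))) (absorb n (suc i))))
      (trans (lem₂ b (int (suc n)) (nth (row n) i) (nth (row n) (suc i))) (trans (cong (λ z → b + int (suc n) * z) (sym (pascal n i))) (trans (lem₃ b (int (suc n))) (cong (_* b) (sym (int-suc (suc n))))))))))
      where
      a = nth (row (suc n)) (suc (suc i))
      b = nth (row (suc n)) (suc i)
      lem : ∀ i a b → (1ℤ + i) * (a + b) ≡ (b + i * b) + (1ℤ + i) * a
      lem = solve-∀
      lem₂ : ∀ b n x y → (b + n * x) + n * y ≡ b + n * (y + x)
      lem₂ = solve-∀
      lem₃ : ∀ b n → b + n * b ≡ (1ℤ + n) * b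
      lem₃ = solve-∀

    -- By `absorb`, l divides (i + 1) C(l, i + 1), and it cannot divide i + 1 < l.
    prime-∣-row : ∀ {l} → Prime l → ∀ i → suc i ℕ.< l → int l ∣ᶻ nth (row l) (suc i)
    prime-∣-row {suc l} pl i lt with euclidℤ pl (int (suc i)) (nth (row (suc l)) (suc i)) (divides (nth (row l) i) (trans (absorb l i) (*-comm (int (suc l)) (nth (row l) i))))
    ... | inj₁ d = ⊥-elim (ℕₚ.<-irrefl refl (ℕₚ.<-≤-trans lt (ℕ∣.∣⇒≤ (∣⇒∣ᵤ d))))
    ... | inj₂ d = d

  -- This is ℤ[ζ] for a root of unity ζ of order l^(e+1), presented by the cyclotomic polynomial 1 +
  -- X^q₀ + ... + X^((l-1) q₀) with q₀ = l^e; `dim` records its degree.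
  module Cyclotomic (l : ℕ) (pl : Prime l) (e m′ : ℕ) (dim : suc m′ ≡ (l ℕ.∸ 1) ℕ.* l ℕ.^ e) where

    q₀ : ℕ
    q₀ = l ℕ.^ e

    0<q₀ : 0 ℕ.< q₀
    0<q₀ = ℕₚ.m^n>0 l {{ℕ.>-nonZero (prime⇒0< pl)}} e

    block : ℤ → List ℤ
    block a = a ∷ replicate (q₀ ℕ.∸ 1) 0ℤ

    -- The polynomial a (1 + X^q₀ + ... + X^((j-1) q₀)), padded with zeros to length j q₀.
    blocks : ℤ → ℕ → List ℤ
    blocks a zero = []
    blocks a (suc j) = block a ++ blocks a j

    length-blocks : ∀ a j → length (blocks a j) ≡ j ℕ.* q₀
    length-blocks a zero = refl
    length-blocks a (suc j) = trans (length-++ (block a)) (cong₂ ℕ._+_ (trans (cong suc (length-replicate (q₀ ℕ.∸ 1))) (ℕₚ.m+[n∸m]≡n 0<q₀)) (length-blocks a j))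

    private
      replicate-Small : ∀ k f n → Small 1 (pad f n) → (∀ n → Small 1 (pad f n)) → Small 1 (pad (replicate k 0ℤ ++ f) n)
      replicate-Small zero f n _ h = h n
      replicate-Small (suc k) f zero _ h = []
      replicate-Small (suc k) f (suc n) _ h = ℕ.z≤n ∷ replicate-Small k f n (h n) h

      blocks-Small : ∀ j n → Small 1 (pad (blocks -1ℤ j) n)
      blocks-Small zero n = Small-𝟎 n
      blocks-Small (suc j) zero = []
      blocks-Small (suc j) (suc n) = ℕ.s≤s ℕ.z≤n ∷ replicate-Small (q₀ ℕ.∸ 1) (blocks -1ℤ j) n (blocks-Small′ n) (blocks-Small j)
        where
        blocks-Small′ : ∀ n → Small 1 (pad (blocks -1ℤ j) n)
        blocks-Small′ = blocks-Small j

    open Quotient {m′} (pad (blocks -1ℤ (l ℕ.∸ 1)) (suc m′)) (blocks-Small (l ℕ.∸ 1) (suc m′)) public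

    Φ : ℕ → List ℤ
    Φ j = blocks 1ℤ j ++ 1ℤ ∷ []

    τ^ : ℕ → V → V
    τ^ zero v = v
    τ^ (suc k) v = τ (τ^ k v)

    τ^-⊕ : ∀ k u v → τ^ k (u ⊕ v) ≡ τ^ k u ⊕ τ^ k v
    τ^-⊕ zero u v = refl
    τ^-⊕ (suc k) u v = trans (cong τ (τ^-⊕ k u v)) (τ-⊕ _ _)

    τ^-+ : ∀ j k v → τ^ (j ℕ.+ k) v ≡ τ^ j (τ^ k v)
    τ^-+ zero k v = refl
    τ^-+ (suc j) k v = cong τ (τ^-+ j k v)

    act-++ : ∀ f g v → act (f ++ g) v ≡ act f v ⊕ τ^ (length f) (act g v)
    act-++ [] g v = sym (⊕-identityˡ _)
    act-++ (a ∷ f) g v = trans (cong (λ z → a • v ⊕ τ z) (act-++ f g v)) (trans (cong (a • v ⊕_) (τ-⊕ _ _)) (sym (⊕-assoc _ _ _)))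

    act-replicate : ∀ k v → act (replicate k 0ℤ) v ≡ 𝟎
    act-replicate zero v = refl
    act-replicate (suc k) v = trans (cong₂ _⊕_ (0-• v) (trans (cong τ (act-replicate k v)) τ-𝟎)) (⊕-identityˡ 𝟎)

    act-block : ∀ a v → act (block a) v ≡ a • v
    act-block a v = trans (cong (a • v ⊕_) (trans (cong τ (act-replicate (q₀ ℕ.∸ 1) v)) τ-𝟎)) (⊕-identityʳ (a • v))

    length-block : ∀ a → length (block a) ≡ q₀
    length-block a = trans (cong suc (length-replicate (q₀ ℕ.∸ 1))) (ℕₚ.m+[n∸m]≡n 0<q₀)

    act-Φ-suc : ∀ j v → act (Φ (suc j)) v ≡ v ⊕ τ^ q₀ (act (Φ j) v)
    act-Φ-suc j v = trans (cong (λ z → act z v) (++-assoc′ (block 1ℤ) (blocks 1ℤ j) (1ℤ ∷ []))) (trans (act-++ (block 1ℤ) (Φ j) v)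
      (cong₂ _⊕_ (trans (act-block 1ℤ v) (1-• v)) (cong (λ z → τ^ z (act (Φ j) v)) (length-block 1ℤ))))
      where
      open import Data.List.Properties using () renaming (++-assoc to ++-assoc′)

    private
      act-neg : ∀ j v → act (blocks 1ℤ j) v ⊕ act (blocks -1ℤ j) v ≡ 𝟎
      act-neg zero v = ⊕-identityˡ 𝟎
      act-neg (suc j) v = trans (cong₂ _⊕_ (step 1ℤ) (step -1ℤ)) (trans (⊕-interchange _ _ _ _)
        (trans (cong₂ _⊕_ (trans (sym (+-• 1ℤ -1ℤ v)) (0-• v)) (trans (sym (τ^-⊕ q₀ _ _)) (trans (cong (τ^ q₀) (act-neg j v)) (τ^-𝟎 q₀)))) (⊕-identityˡ 𝟎)))
        where
        step : ∀ a → act (blocks a (suc j)) v ≡ a • v ⊕ τ^ q₀ (act (blocks a j) v)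
        step a = trans (act-++ (block a) (blocks a j) v) (cong₂ _⊕_ (act-block a v) (cong (λ z → τ^ z (act (blocks a j) v)) (length-block a)))
        τ^-𝟎 : ∀ k → τ^ k 𝟎 ≡ 𝟎
        τ^-𝟎 zero = refl
        τ^-𝟎 (suc k) = trans (cong τ (τ^-𝟎 k)) τ-𝟎

      carry-last : ∀ a k → carry a (pad (replicate k 0ℤ ++ 1ℤ ∷ []) (suc k)) ≡ (pad (a ∷ []) (suc k) , 1ℤ)
      carry-last a zero = refl
      carry-last a (suc k) = trans (cong (λ z → a ∷ proj₁ z , proj₂ z) (carry-last 0ℤ k)) refl

      act-monomial : ∀ k v → act (replicate k 0ℤ ++ 1ℤ ∷ []) v ≡ τ^ k v
      act-monomial k v = trans (act-++ (replicate k 0ℤ) (1ℤ ∷ []) v) (trans (cong₂ _⊕_ (act-replicate k v) (cong₂ τ^ (length-replicate k) (trans (cong₂ _⊕_ (1-• v) τ-𝟎) (⊕-identityʳ v)))) (⊕-identityˡ _))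

      τ^m : τ^ m 𝟏 ≡ act (blocks -1ℤ (l ℕ.∸ 1)) 𝟏
      τ^m = trans (cong τ (trans (sym (act-monomial m′ 𝟏)) (act-pad (replicate m′ 0ℤ ++ 1ℤ ∷ [])
          (ℕₚ.≤-reflexive (trans (length-++ (replicate m′ 0ℤ)) (trans (cong (ℕ._+ 1) (length-replicate m′)) (ℕₚ.+-comm m′ 1)))))))
        (trans (cong (λ z → proj₁ z ⊕ proj₂ z • pad (blocks -1ℤ (l ℕ.∸ 1)) m) (carry-last 0ℤ m′))
        (trans (cong₂ _⊕_ pad-zero (1-• _)) (trans (⊕-identityˡ _) (sym (act-pad (blocks -1ℤ (l ℕ.∸ 1)) (ℕₚ.≤-reflexive (trans (length-blocks -1ℤ (l ℕ.∸ 1)) (sym dim))))))))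
        where
        pad-zero : pad (0ℤ ∷ []) m ≡ 𝟎
        pad-zero = refl

    Φ-zero : ∀ v → act (Φ (l ℕ.∸ 1)) v ≡ 𝟎
    Φ-zero v = trans (act-⋆ (Φ (l ℕ.∸ 1)) v) (trans (cong (_⋆ v) zero₁) (𝟎-⋆ v))
      where
      zero₁ : act (Φ (l ℕ.∸ 1)) 𝟏 ≡ 𝟎
      zero₁ = trans (act-++ (blocks 1ℤ (l ℕ.∸ 1)) (1ℤ ∷ []) 𝟏)
        (trans (cong (act (blocks 1ℤ (l ℕ.∸ 1)) 𝟏 ⊕_) (trans (cong₂ τ^ (trans (length-blocks 1ℤ (l ℕ.∸ 1)) (sym dim)) (trans (cong₂ _⊕_ (1-• 𝟏) τ-𝟎) (⊕-identityʳ 𝟏))) τ^m))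
        (act-neg (l ℕ.∸ 1) 𝟏))

    private
      l≡ : suc (l ℕ.∸ 1) ≡ l
      l≡ = ℕₚ.m+[n∸m]≡n (prime⇒0< pl)

      geometric : ∀ j v → τ^ q₀ (act (Φ j) v) ⊕ v ≡ act (Φ j) v ⊕ τ^ (suc j ℕ.* q₀) v
      geometric zero v = trans (cong (λ z → τ^ q₀ z ⊕ v) e₁) (trans (⊕-comm _ v) (cong₂ _⊕_ (sym e₁) (cong (λ z → τ^ z v) (sym (ℕₚ.+-identityʳ q₀)))))
        where
        e₁ : act (Φ 0) v ≡ v
        e₁ = trans (cong₂ _⊕_ (1-• v) τ-𝟎) (⊕-identityʳ v)
      geometric (suc j) v = trans (cong (λ z → τ^ q₀ z ⊕ v) (act-Φ-suc j v)) (trans (cong (λ z → τ^ q₀ z ⊕ v) (trans (⊕-comm v _) (geometric j v)))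
        (trans (cong (_⊕ v) (τ^-⊕ q₀ _ _)) (trans (⊕-assoc _ _ v) (trans (cong (τ^ q₀ (act (Φ j) v) ⊕_) (⊕-comm _ v)) (trans (sym (⊕-assoc _ v _))
        (cong₂ _⊕_ (trans (⊕-comm _ v) (sym (act-Φ-suc j v))) (sym (τ^-+ q₀ (suc j ℕ.* q₀) v))))))))

    -- X^(l q₀) - 1 is X^q₀ - 1 times the cyclotomic polynomial, which acts as zero; `geometric`
    -- states this without subtraction.
    X-order : ∀ v → τ^ (l ℕ.^ suc e) v ≡ v
    X-order v = sym (trans (sym (⊕-identityˡ v)) (trans (cong (_⊕ v) (sym (trans (cong (τ^ q₀) (Φ-zero v)) (trans (cong (τ^ q₀) (sym (0-• v))) (τ^-0 q₀)))))
      (trans (geometric (l ℕ.∸ 1) v) (trans (cong (_⊕ τ^ (suc (l ℕ.∸ 1) ℕ.* q₀) v) (Φ-zero v)) (trans (⊕-identityˡ _) (cong (λ z → τ^ (z ℕ.* q₀) v) l≡))))))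
      where
      τ^-0 : ∀ k → τ^ k (0ℤ • v) ≡ 𝟎
      τ^-0 zero = 0-• v
      τ^-0 (suc k) = trans (cong τ (τ^-0 k)) τ-𝟎

    pow : V → ℕ → V
    pow x zero = 𝟏
    pow x (suc n) = x ⋆ pow x n

    pow-X : ∀ k → pow X k ≡ τ^ k 𝟏
    pow-X zero = refl
    pow-X (suc k) = trans (X-⋆ (pow X k)) (cong τ (pow-X k))

    pow-+ : ∀ x j k → pow x (j ℕ.+ k) ≡ pow x j ⋆ pow x k
    pow-+ x zero k = sym (⋆-identityˡ _)
    pow-+ x (suc j) k = trans (cong (x ⋆_) (pow-+ x j k)) (sym (⋆-assoc x _ _))

    pow-* : ∀ x j k → pow x (k ℕ.* j) ≡ pow (pow x j) k
    pow-* x j zero = refl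
    pow-* x j (suc k) = trans (pow-+ x j (k ℕ.* j)) (cong (pow x j ⋆_) (pow-* x j k))

    ∣ᵥ-⋆ : ∀ {p x} u → p ∣ᵥ x → p ∣ᵥ u ⋆ x
    ∣ᵥ-⋆ {p} u (y , refl) = u ⋆ y , ⋆-• u (int p) y

    private
      ev : List ℤ → V → V
      ev [] z = 𝟎
      ev (a ∷ f) z = a • 𝟏 ⊕ z ⋆ ev f z

      ev-addL : ∀ f g z → ev (addL f g) z ≡ ev f z ⊕ ev g z
      ev-addL [] g z = sym (⊕-identityˡ _)
      ev-addL (a ∷ f) [] z = sym (⊕-identityʳ _)
      ev-addL (a ∷ f) (b ∷ g) z = trans (cong₂ _⊕_ (+-• a b 𝟏) (trans (cong (z ⋆_) (ev-addL f g z)) (⋆-distribˡ z _ _))) (⊕-interchange _ _ _ _)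

      ev-row : ∀ n z → ev (row n) z ≡ pow (𝟏 ⊕ z) n
      ev-row zero z = trans (cong₂ _⊕_ (1-• 𝟏) (trans (⋆-comm z 𝟎) (𝟎-⋆ z))) (⊕-identityʳ 𝟏)
      ev-row (suc n) z = trans (ev-addL (row n) (0ℤ ∷ row n) z) (trans (cong₂ _⊕_ (sym (⋆-identityˡ _)) (trans (cong (_⊕ z ⋆ ev (row n) z) (0-• 𝟏)) (⊕-identityˡ _)))
        (trans (sym (⋆-distribʳ 𝟏 z (ev (row n) z))) (cong ((𝟏 ⊕ z) ⋆_) (ev-row n z))))

      ev-top : ∀ {p} n f z → length f ≡ suc n → (∀ i → i ℕ.< n → int p ∣ᶻ nth f i) → nth f n ≡ 1ℤ → ∃[ w ] ev f z ≡ pow z n ⊕ int p • w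
      ev-top {p} zero (a ∷ []) z len div refl = 𝟎 , trans (cong₂ _⊕_ (1-• 𝟏) (trans (⋆-comm z 𝟎) (𝟎-⋆ z))) (cong (𝟏 ⊕_) (sym (•-𝟎 (int p))))
      ev-top {p} (suc n) (a ∷ f) z len div last with ev-top {p} n f z (ℕₚ.suc-injective len) (λ i lt → div (suc i) (ℕ.s≤s lt)) last | div 0 (ℕ.s≤s ℕ.z≤n)
      ... | w , eq | divides b refl = b • 𝟏 ⊕ z ⋆ w , trans (cong₂ _⊕_ (trans (cong (_• 𝟏) (*-comm b (int p))) (*-• (int p) b 𝟏)) (trans (cong (z ⋆_) eq) (trans (⋆-distribˡ z _ _) (cong (pow z (suc n) ⊕_) (⋆-• z (int p) w)))))
        (trans (⊕-comm _ _) (trans (⊕-assoc _ _ _) (cong (pow z (suc n) ⊕_) (trans (⊕-comm _ _) (sym (•-⊕ (int p) _ _))))))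

    freshman : ∀ z → ∃[ w ] pow (𝟏 ⊕ z) l ≡ 𝟏 ⊕ pow z l ⊕ int l • w
    freshman z with row l in rl | length-row l
    ... | [] | ()
    ... | a ∷ f | len with ev-top {l} (l ℕ.∸ 1) f z (trans (ℕₚ.suc-injective len) (sym l≡)) div lst
      where
      nth-f : ∀ i → nth f i ≡ nth (row l) (suc i)
      nth-f i = cong (λ r → nth r (suc i)) (sym rl)
      div : ∀ i → i ℕ.< l ℕ.∸ 1 → int l ∣ᶻ nth f i
      div i lt = subst (int l ∣ᶻ_) (sym (nth-f i)) (prime-∣-row pl i (subst (suc i ℕ.<_) l≡ (ℕ.s≤s lt)))
      lst : nth f (l ℕ.∸ 1) ≡ 1ℤ
      lst = trans (nth-f (l ℕ.∸ 1)) (trans (cong (nth (row l)) l≡) (row-last l))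
    ...   | w , eq = z ⋆ w , trans (sym (ev-row l z)) (trans (cong (λ r → ev r z) rl) (trans (cong₂ _⊕_ (trans (cong (_• 𝟏) a≡1) (1-• 𝟏)) (trans (cong (z ⋆_) eq) (trans (⋆-distribˡ z _ _)
        (cong₂ _⊕_ (cong (pow z) l≡) (⋆-• z (int l) w))))) (sym (⊕-assoc 𝟏 _ _))))
      where
      a≡1 : a ≡ 1ℤ
      a≡1 = trans (cong (λ r → nth r 0) (sym rl)) (row-first l)

    π : V
    π = X ⊖ 𝟏

    private
      pow-cong : ∀ x y w → x ≡ y ⊕ int l • w → ∀ n → ∃[ w′ ] pow x n ≡ pow y n ⊕ int l • w′
      pow-cong x y w eq zero = 𝟎 , sym (trans (cong (𝟏 ⊕_) (•-𝟎 (int l))) (⊕-identityʳ 𝟏))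
      pow-cong x y w refl (suc n) with pow-cong x y w refl n
      ... | w′ , eq′ = y ⋆ w′ ⊕ w ⋆ pow x n , trans (⋆-distribʳ y (int l • w) (pow x n)) (trans (cong₂ _⊕_ (trans (cong (y ⋆_) eq′) (trans (⋆-distribˡ y _ _) (cong (y ⋆ pow y n ⊕_) (⋆-• y (int l) w′)))) (•-⋆ (int l) w (pow x n)))
        (trans (⊕-assoc _ _ _) (cong (y ⋆ pow y n ⊕_) (sym (•-⊕ (int l) _ _)))))

      π-power : ∀ k → ∃[ w ] pow X (l ℕ.^ k) ≡ 𝟏 ⊕ pow π (l ℕ.^ k) ⊕ int l • w
      π-power zero = 𝟎 , trans (⋆-identityʳ X) (sym (trans (cong (𝟏 ⊕ π ⋆ 𝟏 ⊕_) (•-𝟎 (int l))) (trans (⊕-identityʳ _) (trans (cong (𝟏 ⊕_) (⋆-identityʳ π)) (trans (⊕-comm 𝟏 π) (⊖-⊕-cancel X 𝟏))))))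
      π-power (suc k) with π-power k
      ... | w , eq with pow-cong _ _ w eq l | freshman (pow π (l ℕ.^ k))
      ...   | w′ , eq′ | w″ , eq″ = w″ ⊕ w′ , trans (pow-* X (l ℕ.^ k) l) (trans eq′ (trans (cong (_⊕ int l • w′) eq″)
          (trans (⊕-assoc _ _ _) (cong₂ _⊕_ (cong (𝟏 ⊕_) (sym (pow-* π (l ℕ.^ k) l))) (sym (•-⊕ (int l) w″ w′))))))

    -- With E = l^(e+1), 1 = X^E = (1 + π)^E, which is congruent to 1 + π^E modulo l.
    π-nilpotent : l ∣ᵥ pow π (l ℕ.^ suc e)
    π-nilpotent with π-power (suc e)
    ... | w , eq = -1ℤ • w , trans (sym (⊕-identityʳ P)) (trans (cong (P ⊕_) (sym z)) (trans (sym (⊕-assoc P _ _)) (trans (cong (_⊕ -1ℤ • (int l • w)) P⊕)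
        (trans (⊕-identityˡ _) (trans (sym (*-• -1ℤ (int l) w)) (trans (cong (_• w) (*-comm -1ℤ (int l))) (*-• (int l) -1ℤ w)))))))
      where
      P = pow π (l ℕ.^ suc e)
      z : int l • w ⊕ -1ℤ • (int l • w) ≡ 𝟎
      z = trans (sym (⊖-as-⊕ _ _)) (⊖-self _)
      P⊕ : P ⊕ int l • w ≡ 𝟎
      P⊕ = trans (sym (⊖-⊕-cancel′ 𝟏 (P ⊕ int l • w))) (trans (cong (_⊖ 𝟏) (trans (sym (⊕-assoc 𝟏 P _)) (trans (sym eq) (trans (pow-X (l ℕ.^ suc e)) (X-order 𝟏))))) (⊖-self 𝟏))
        where
        ⊖-⊕-cancel′ : ∀ (u v : V) → (u ⊕ v) ⊖ u ≡ v
        ⊖-⊕-cancel′ u v = trans (⊕≡⇒⊖≡ (u ⊕ v) 𝟎 u v (⊕-identityʳ _)) (trans (⊖-as-⊕ v 𝟎) (trans (cong (v ⊕_) (•-𝟎 -1ℤ)) (⊕-identityʳ v)))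

    private
      act-mod-π : ∀ f v → ∃[ w ] act f v ≡ sumL f • v ⊕ π ⋆ w
      act-mod-π [] v = 𝟎 , sym (trans (cong₂ _⊕_ (0-• v) (trans (⋆-comm π 𝟎) (𝟎-⋆ π))) (⊕-identityˡ 𝟎))
      act-mod-π (a ∷ f) v with act-mod-π f v
      ... | w , eq = w ⊕ act f v , trans (cong (a • v ⊕_) (trans (sym (X-⋆ _)) (trans (cong (_⋆ act f v) (sym (⊖-⊕-cancel X 𝟏))) (trans (⋆-distribʳ π 𝟏 _) (trans (cong (π ⋆ act f v ⊕_) (trans (⋆-identityˡ _) eq)) (trans (⊕-comm _ _) (⊕-assoc _ _ _)))))))
        (trans (sym (⊕-assoc _ _ _)) (cong₂ _⊕_ (sym (+-• a (sumL f) v)) (sym (⋆-distribˡ π w _))))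

      sumL-++ : ∀ f g → sumL (f ++ g) ≡ sumL f + sumL g
      sumL-++ [] g = sym (+-identityˡ _)
      sumL-++ (a ∷ f) g = trans (cong (a +_) (sumL-++ f g)) (sym (+-assoc a _ _))

      sumL-replicate : ∀ k → sumL (replicate k 0ℤ) ≡ 0ℤ
      sumL-replicate zero = refl
      sumL-replicate (suc k) = trans (+-identityˡ _) (sumL-replicate k)

      sumL-blocks : ∀ a j → sumL (blocks a j) ≡ int j * a
      sumL-blocks a zero = sym (*-zeroˡ a)
      sumL-blocks a (suc j) = trans (sumL-++ (block a) (blocks a j)) (trans (cong₂ _+_ (trans (cong (a +_) (sumL-replicate (q₀ ℕ.∸ 1))) (+-identityʳ a)) (sumL-blocks a j)) (sym (trans (cong (_* a) (int-suc j)) (lem a (int j)))))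
        where
        lem : ∀ a j → (1ℤ + j) * a ≡ a + j * a
        lem = solve-∀

      sumL-Φ : sumL (Φ (l ℕ.∸ 1)) ≡ int l
      sumL-Φ = trans (sumL-++ (blocks 1ℤ (l ℕ.∸ 1)) _) (trans (cong (_+ 1ℤ) (trans (sumL-blocks 1ℤ (l ℕ.∸ 1)) (*-identityʳ (int (l ℕ.∸ 1))))) (trans (+-comm (int (l ℕ.∸ 1)) 1ℤ) (cong int l≡)))

    -- The cyclotomic polynomial is zero in the ring, and modulo X - 1 it becomes its value l at 1.
    l∈π : ∃[ w ] int l • 𝟏 ≡ π ⋆ w
    l∈π with act-mod-π (Φ (l ℕ.∸ 1)) 𝟏
    ... | w , eq = -1ℤ • w , trans (sym (⊕-identityʳ _)) (trans (cong (int l • 𝟏 ⊕_) (sym (trans (sym (⊖-as-⊕ _ _)) (⊖-self (π ⋆ w))))) (trans (sym (⊕-assoc _ _ _))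
      (trans (cong (_⊕ -1ℤ • (π ⋆ w)) (trans (cong (λ z → z • 𝟏 ⊕ π ⋆ w) (sym sumL-Φ)) (trans (sym eq) (Φ-zero 𝟏)))) (trans (⊕-identityˡ _) (sym (⋆-• π -1ℤ w))))))

    -- Modulo π, X becomes 1 and x becomes the sum of its coefficients, a multiple of l; and l is
    -- itself a multiple of π.
    π-factor : ∀ x → int l ∣ᶻ total x → ∃[ y ] x ≡ π ⋆ y
    π-factor x (divides k eq) with act-mod-π (toList x) 𝟏 | l∈π
    ... | w , eq′ | u , eu = k • u ⊕ w , trans (sym (⋆-identityʳ x)) (trans eq′ (trans (cong (_⊕ π ⋆ w) (trans (cong (_• 𝟏) (trans (sumL-toList x) eq)) (trans (*-• k (int l) 𝟏) (trans (cong (k •_) eu) (sym (⋆-• π k u)))))) (sym (⋆-distribˡ π _ _))))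

    π-cancel : ∀ x → π ⋆ x ≡ 𝟎 → x ≡ 𝟎
    π-cancel x eq with l∈π
    ... | u , eu = •-cancel (int l) x (λ h → ℕₚ.<-irrefl (sym (cong ∣_∣ h)) (prime⇒0< pl))
      (trans (cong (int l •_) (sym (⋆-identityˡ x))) (trans (sym (•-⋆ (int l) 𝟏 x)) (trans (cong (_⋆ x) (trans eu (⋆-comm π u))) (trans (⋆-assoc u π x) (trans (cong (u ⋆_) eq) (trans (⋆-comm u 𝟎) (𝟎-⋆ u)))))))

    private
      total-c : total (pad (blocks -1ℤ (l ℕ.∸ 1)) m) ≡ 1ℤ - int l
      total-c = trans (total-pad (blocks -1ℤ (l ℕ.∸ 1)) m (ℕₚ.≤-reflexive (trans (length-blocks -1ℤ (l ℕ.∸ 1)) (sym dim)))) (trans (sumL-blocks -1ℤ (l ℕ.∸ 1))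
        (trans (lem (int (l ℕ.∸ 1))) (cong (λ z → 1ℤ - z) (trans (sym (int-suc (l ℕ.∸ 1))) (cong int l≡)))))
        where
        lem : ∀ j → j * -1ℤ ≡ 1ℤ - (1ℤ + j)
        lem = solve-∀
        total-𝟎 : ∀ n → total (𝟎 {n}) ≡ 0ℤ
        total-𝟎 zero = refl
        total-𝟎 (suc n) = trans (+-identityˡ _) (total-𝟎 n)
        total-pad : ∀ f n → length f ℕ.≤ n → total (pad f n) ≡ sumL f
        total-pad [] n le = total-𝟎 n
        total-pad (a ∷ f) (suc n) (ℕ.s≤s le) = cong (a +_) (total-pad f n le)

      total-τ : ∀ v → ∃[ k ] total (τ v) ≡ total v + int l * k
      total-τ v = - r , trans (total-⊕ _ _) (trans (cong (total (proj₁ (carry 0ℤ v)) +_) (trans (total-• r _) (cong (r *_) total-c)))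
        (trans (lem (total (proj₁ (carry 0ℤ v))) r (int l)) (cong (_+ int l * - r) (trans (total-carry 0ℤ v) (+-identityˡ (total v))))))
        where
        r = proj₂ (carry 0ℤ v)
        lem : ∀ t r l → t + r * (1ℤ - l) ≡ (t + r) + l * - r
        lem = solve-∀

      total-act : ∀ f v → ∃[ k ] total (act f v) ≡ sumL f * total v + int l * k
      total-act [] v = 0ℤ , trans (total-𝟎 m) (sym (trans (cong (0ℤ * total v +_) (*-zeroʳ (int l))) (trans (+-identityʳ _) (*-zeroˡ (total v)))))
        where
        total-𝟎 : ∀ n → total (𝟎 {n}) ≡ 0ℤ
        total-𝟎 zero = refl
        total-𝟎 (suc n) = trans (+-identityˡ _) (total-𝟎 n)
      total-act (a ∷ f) v = finish (total-τ (act f v)) (total-act f v)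
        where
        lem : ∀ a t s l k k′ → a * t + (s * t + l * k′ + l * k) ≡ (a + s) * t + l * (k′ + k)
        lem = solve-∀
        finish : ∃[ k ] total (τ (act f v)) ≡ total (act f v) + int l * k → ∃[ k ] total (act f v) ≡ sumL f * total v + int l * k →
          ∃[ k ] total (act (a ∷ f) v) ≡ sumL (a ∷ f) * total v + int l * k
        finish (k , eq) (k′ , eq′) = k′ + k , trans (total-⊕ _ _) (trans (cong₂ _+_ (total-• a v) (trans eq (cong (_+ int l * k) eq′))) (lem a (total v) (sumL f) (int l) k k′))

    -- The coefficient sum modulo l is multiplicative: it is reduction modulo π, with values in the
    -- field of l elements.
    total-⋆ : ∀ x y → int l ∣ᶻ total (x ⋆ y) → int l ∣ᶻ total x ⊎ int l ∣ᶻ total y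
    total-⋆ x y (divides q eq) with total-act (toList x) y
    ... | k , eq′ = euclidℤ pl (total x) (total y) (divides (q - k) (trans (lem (total x * total y) (int l) k) (trans (cong (_- int l * k) (trans (cong (λ z → z * total y + int l * k) (sym (sumL-toList x))) (trans (sym eq′) eq))) (lem₂ q (int l) k))))
      where
      lem : ∀ t l k → t ≡ (t + l * k) - l * k
      lem = solve-∀
      lem₂ : ∀ q l k → q * l - l * k ≡ (q - k) * l
      lem₂ = solve-∀

    private
      size : ∀ {n} → Vec ℤ n → ℕ
      size [] = 0
      size (x ∷ v) = ∣ x ∣ ℕ.+ size v

      size-• : ∀ {n} a (v : Vec ℤ n) → size (a • v) ≡ ∣ a ∣ ℕ.* size v
      size-• a [] = trans (cong size (•-[] a)) (sym (ℕₚ.*-zeroʳ ∣ a ∣))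
      size-• a (x ∷ v) = trans (cong size (•-∷ a x v)) (trans (cong₂ ℕ._+_ (abs-* a x) (size-• a v)) (sym (ℕₚ.*-distribˡ-+ ∣ a ∣ ∣ x ∣ (size v))))

      size≡0 : ∀ {n} (v : Vec ℤ n) → size v ≡ 0 → v ≡ 𝟎
      size≡0 [] e = refl
      size≡0 (x ∷ v) e = cong₂ _∷_ (∣i∣≡0⇒i≡0 (ℕₚ.m+n≡0⇒m≡0 ∣ x ∣ e)) (size≡0 v (ℕₚ.m+n≡0⇒n≡0 ∣ x ∣ e))

      -- A replacement for f with nonzero image in the residue field of π. For the absence of zero
      -- divisors it is enough that it annihilates whatever f annihilates.
      Reduced : V → Set
      Reduced f = ∃[ f* ] (¬ (int l ∣ᶻ total f*) × (∀ g → f ⋆ g ≡ 𝟎 → f* ⋆ g ≡ 𝟎))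

      divide-out : ∀ n f → Reduced f ⊎ (∃[ g ] f ≡ pow π n ⋆ g)
      divide-out zero f = inj₂ (f , sym (⋆-identityˡ f))
      divide-out (suc n) f with int l ∣ᶻ? total f
      ... | no nd = inj₁ (f , nd , λ g h → h)
      ... | yes d with π-factor f d
      ...   | y , refl with divide-out n y
      ...     | inj₁ (f* , nd , tr) = inj₁ (f* , nd , λ g h → tr g (π-cancel (y ⋆ g) (trans (sym (⋆-assoc π y g)) h)))
      ...     | inj₂ (g , refl) = inj₂ (g , sym (⋆-assoc π (pow π n) g))

      -- Descent: either removing fewer than l^(e+1) factors π leads to a coefficient sum prime to
      -- l, or f is a multiple of π^(l^(e+1)) and so of l, and dividing by l decreases the sum of
      -- the absolute values of the coefficients.
      reduce : ∀ k f → size f ≡ k → f ≢ 𝟎 → Reduced f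
      reduce = <-rec _ step
        where
        step : ∀ k → (∀ {j} → j ℕ.< k → ∀ f → size f ≡ j → f ≢ 𝟎 → Reduced f) → ∀ f → size f ≡ k → f ≢ 𝟎 → Reduced f
        step k rec f sz f≢ with divide-out (l ℕ.^ suc e) f
        ... | inj₁ r = r
        ... | inj₂ (g , refl) with π-nilpotent
        ...   | η , eη with rec smaller h refl h≢
          where
          h = η ⋆ g
          f≡ : pow π (l ℕ.^ suc e) ⋆ g ≡ int l • h
          f≡ = trans (cong (_⋆ g) eη) (•-⋆ (int l) η g)
          h≢ : h ≢ 𝟎
          h≢ h≡ = f≢ (trans f≡ (trans (cong (int l •_) h≡) (•-𝟎 (int l))))
          smaller : size h ℕ.< k
          smaller = subst (size h ℕ.<_) (trans (ℕₚ.*-comm (size h) l) (trans (sym (size-• (int l) h)) (trans (cong size (sym f≡)) sz)))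
            (ℕₚ.m<m*n (size h) l {{ℕ.≢-nonZero (λ s0 → h≢ (size≡0 h s0))}} (prime⇒1< pl))
        ...     | f* , nd , tr = f* , nd , λ g′ h → tr g′ (•-cancel (int l) (η ⋆ g ⋆ g′) (λ z → ℕₚ.<-irrefl (sym (cong ∣_∣ z)) (prime⇒0< pl))
          (trans (sym (•-⋆ (int l) (η ⋆ g) g′)) (trans (cong (_⋆ g′) (trans (sym (•-⋆ (int l) η g)) (cong (_⋆ g) (sym eη)))) h)))

    -- The prime element π = X - 1 has residue field of order l, and no nonzero element is divisible by all its powers.
    domain : ∀ f g → f ≢ 𝟎 → g ≢ 𝟎 → f ⋆ g ≢ 𝟎
    domain f g f≢ g≢ fg = finish (reduce (size f) f refl f≢) (reduce (size g) g refl g≢)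
      where
      total-𝟎 : ∀ n → total (𝟎 {n}) ≡ 0ℤ
      total-𝟎 zero = refl
      total-𝟎 (suc n) = trans (+-identityˡ _) (total-𝟎 n)
      finish : Reduced f → Reduced g → ⊥
      finish (f* , nf , tf) (g* , ng , tg) = conclude (total-⋆ g* f* (subst (int l ∣ᶻ_) (sym (trans (cong total g*f*) (total-𝟎 m))) (divides 0ℤ refl)))
        where
        g*f* : g* ⋆ f* ≡ 𝟎
        g*f* = tg f* (trans (⋆-comm g f*) (tf g fg))
        conclude : int l ∣ᶻ total g* ⊎ int l ∣ᶻ total f* → ⊥
        conclude (inj₁ d) = ng d
        conclude (inj₂ d) = nf d

-- Geometry of numbers in the cyclotomic ring.

module Geometry where

  open import Defs using (ord)
  open Sums using (below; below-<; ∈-below; below-unique; length-below; ∉⇒≢)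
  open Mod
  open Lattice
  open Domain
  open Carmichael using (ord-∣; ord-spec; fermat; prime-^-coprime; ^-distribʳ-*)
  open import Data.Nat as ℕ using (ℕ; zero; suc)
  import Data.Nat.Properties as ℕₚ
  import Data.Nat.Divisibility as ℕ∣
  open import Data.Nat.Coprimality as Coprimality using (Coprime; coprime-divisor)
  open import Data.Nat.Primality using (Prime; prime⇒nonZero; ¬prime[1])
  open import Data.Nat.Tactic.RingSolver using () renaming (solve-∀ to solve-∀ℕ)
  open import Data.Integer using (ℤ; 0ℤ; 1ℤ; -1ℤ; _+_; _*_; _-_; -_; ∣_∣; -[1+_]) renaming (+_ to int)
  open import Data.Integer.Properties hiding (_≟_)
  open import Data.Integer.DivMod using (_%ℕ_; _/ℕ_; a≡a%ℕn+[a/ℕn]*n; n%ℕd<d)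
  open import Data.Integer.Divisibility.Signed using (divides; ∣ᵤ⇒∣; ∣⇒∣ᵤ) renaming (_∣_ to _∣ᶻ_; _∣?_ to _∣ᶻ?_)
  open import Data.Integer.Tactic.RingSolver using (solve-∀)
  open import Data.List as List using (List; []; _∷_; length; _++_; cartesianProduct; cartesianProductWith)
  open import Data.List.Properties using (length-++; length-map; ++-assoc)
  open import Data.List.Membership.Propositional using (_∈_; find; lose)
  open import Data.List.Membership.Propositional.Properties using (∈-∃++; ∈-++⁻; ∈-++⁺ˡ; ∈-++⁺ʳ; ∈-cartesianProductWith⁺; ∈-cartesianProductWith⁻; ∈-cartesianProduct⁻)
  open import Data.List.Relation.Unary.Any as Any using (here; there; any?)
  open import Data.List.Relation.Unary.All as ListAll using () renaming (All to Allᴸ; [] to []ᴸ; _∷_ to _∷ᴸ_)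
  open import Data.List.Relation.Unary.AllPairs as AllPairs using (AllPairs; []; _∷_)
  open import Data.List.Relation.Unary.Unique.Propositional using (Unique)
  open import Data.List.Relation.Unary.Unique.Propositional.Properties using (cartesianProduct⁺; cartesianProductWith⁺)
  open import Data.Vec as Vec using (Vec; []; _∷_)
  open import Data.Vec.Relation.Unary.All as All using (All; []; _∷_)
  import Data.Vec.Properties as Vecₚ
  open import Data.Empty using (⊥; ⊥-elim)
  open import Data.Product using (∃-syntax; _×_; _,_; proj₁; proj₂)
  open import Data.Sum using (_⊎_; inj₁; inj₂)
  open import Function using (_∘_)
  open import Relation.Nullary using (Dec; yes; no; ¬_)
  open import Relation.Binary using (DecidableEquality)
  open import Relation.Binary.PropositionalEquality

  pigeonhole : {A B : Set} → DecidableEquality B → (f : A → B) → ∀ {xs ys} → Unique xs → (∀ {x} → x ∈ xs → f x ∈ ys) →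
    length ys ℕ.< length xs → ∃[ x ] ∃[ x′ ] (x ∈ xs × x′ ∈ xs × x ≢ x′ × f x ≡ f x′)
  pigeonhole _≟_ f {x ∷ xs} {ys} (x∉ ∷ u) sub lt with any? (λ y → f x ≟ f y) xs
  ... | yes any with find any
  ...   | y , y∈ , e = x , y , here refl , there y∈ , ∉⇒≢ y∈ x∉ , e
  pigeonhole _≟_ f {x ∷ xs} {ys} (x∉ ∷ u) sub lt | no none with ∈-∃++ (sub (here refl))
  ... | as , bs , refl with pigeonhole _≟_ f {xs} {as ++ bs} u sub′ lt′
    where
    sub′ : ∀ {y} → y ∈ xs → f y ∈ as ++ bs
    sub′ {y} y∈ with ∈-++⁻ as (sub (there y∈))
    ... | inj₁ p = ∈-++⁺ˡ p
    ... | inj₂ (here e) = ⊥-elim (none (lose y∈ (sym e)))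
    ... | inj₂ (there p) = ∈-++⁺ʳ as p
    lt′ : length (as ++ bs) ℕ.< length xs
    lt′ = ℕ.s≤s⁻¹ (subst (ℕ._< suc (length xs)) (trans (length-++ as) (trans (ℕₚ.+-suc (length as) (length bs)) (cong suc (sym (length-++ as))))) lt)
  ...   | y , z , y∈ , z∈ , ne , e = y , z , there y∈ , there z∈ , ne , e

  length-cartesianProductWith : {A B C : Set} (f : A → B → C) (xs : List A) (ys : List B) → length (cartesianProductWith f xs ys) ≡ length xs ℕ.* length ys
  length-cartesianProductWith f [] ys = refl
  length-cartesianProductWith f (x ∷ xs) ys = trans (length-++ (List.map (f x) ys)) (cong₂ ℕ._+_ (length-map (f x) ys) (length-cartesianProductWith f xs ys))

  box : ℕ → (n : ℕ) → List (Vec ℕ n)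
  box H zero = [] ∷ []
  box H (suc n) = cartesianProductWith _∷_ (below H) (box H n)

  length-box : ∀ H n → length (box H n) ≡ H ℕ.^ n
  length-box H zero = refl
  length-box H (suc n) = trans (length-cartesianProductWith _∷_ (below H) (box H n)) (cong₂ ℕ._*_ (length-below H) (length-box H n))

  box-unique : ∀ H n → Unique (box H n)
  box-unique H zero = []ᴸ ∷ []
  box-unique H (suc n) = cartesianProductWith⁺ _∷_ (λ e → Vecₚ.∷-injectiveˡ e , Vecₚ.∷-injectiveʳ e) (below-unique H) (box-unique H n)

  ∈-box : ∀ {H n} {v : Vec ℕ n} → All (ℕ._< H) v → v ∈ box H n
  ∈-box [] = here refl
  ∈-box (h ∷ hs) = ∈-cartesianProductWith⁺ _∷_ (∈-below h) (∈-box hs)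

  box-< : ∀ {H n} {v : Vec ℕ n} → v ∈ box H n → All (ℕ._< H) v
  box-< {n = zero} {[]} _ = []
  box-< {H} {suc n} v∈ with ∈-cartesianProductWith⁻ _∷_ (below H) (box H n) v∈
  ... | i , w , i∈ , w∈ , refl = below-< i∈ ∷ box-< w∈

  _≟ᵥ_ : ∀ {n} → DecidableEquality (Vec ℕ n)
  _≟ᵥ_ = Vecₚ.≡-dec ℕ._≟_

  ⌈_⌉ : ∀ {n} → Vec ℕ n → Vec ℤ n
  ⌈_⌉ = Vec.map int

  ⌈⌉-injective : ∀ {n} {u v : Vec ℕ n} → ⌈ u ⌉ ≡ ⌈ v ⌉ → u ≡ v
  ⌈⌉-injective {u = []} {[]} e = refl
  ⌈⌉-injective {u = x ∷ u} {y ∷ v} e = cong₂ _∷_ (+-injective (Vecₚ.∷-injectiveˡ e)) (⌈⌉-injective (Vecₚ.∷-injectiveʳ e))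

  ⌈⌉-Small : ∀ {H n} {v : Vec ℕ n} → All (ℕ._< H) v → Small H ⌈ v ⌉
  ⌈⌉-Small [] = []
  ⌈⌉-Small (h ∷ hs) = ℕₚ.<⇒≤ h ∷ ⌈⌉-Small hs

  encode : ∀ {n} → ℕ → Vec ℤ n → Vec ℕ n
  encode B = Vec.map (λ a → ∣ a + int B ∣)

  private
    shifted : ∀ a B → ∣ a ∣ ℕ.≤ B → int ∣ a + int B ∣ ≡ a + int B
    shifted (int n) B le = refl
    shifted -[1+ n ] B le = 0≤i⇒+∣i∣≡i (subst (Data.Integer._≤_ 0ℤ) (sym (⊖-≥ le)) (Data.Integer.+≤+ ℕ.z≤n))

  encode-∈ : ∀ {B n} {v : Vec ℤ n} → Small B v → encode B v ∈ box (suc (B ℕ.+ B)) n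
  encode-∈ h = ∈-box (go h)
    where
    go : ∀ {B n} {v : Vec ℤ n} → Small B v → All (ℕ._< suc (B ℕ.+ B)) (encode B v)
    go [] = []
    go {B} {v = a ∷ v} (h ∷ hs) = ℕ.s≤s (ℕₚ.≤-trans (∣i+j∣≤∣i∣+∣j∣ a (int B)) (ℕₚ.+-monoˡ-≤ B h)) ∷ go hs

  encode-injective : ∀ {B n} {u v : Vec ℤ n} → Small B u → Small B v → encode B u ≡ encode B v → u ≡ v
  encode-injective {u = []} {[]} [] [] e = refl
  encode-injective {B} {u = x ∷ u} {y ∷ v} (h ∷ hs) (k ∷ ks) e = cong₂ _∷_ x≡y (encode-injective hs ks (Vecₚ.∷-injectiveʳ e))
    where
    lem : ∀ a b → a ≡ (a + b) - b
    lem = solve-∀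
    x≡y : x ≡ y
    x≡y = trans (lem x (int B)) (trans (cong (λ z → z - int B) (trans (sym (shifted x B h)) (trans (cong int (Vecₚ.∷-injectiveˡ e)) (shifted y B k)))) (sym (lem y (int B))))

  small-difference : ∀ {p i j} → i ℕ.< p → j ℕ.< p → int p ∣ᶻ int i - int j → i ≡ j
  small-difference {p} {i} {j} i<p j<p (divides q eq) = go (ℕₚ.≤-total i j)
    where
    lem : ∀ i j k → i - j ≡ k → i ≡ k + j
    lem i j k e = trans (l i j) (cong (_+ j) e)
      where
      l : ∀ i j → i ≡ (i - j) + j
      l = solve-∀
    zero-of : ∀ d → d ℕ.< p → p ℕ∣.∣ d → d ≡ 0
    zero-of zero _ _ = refl
    zero-of (suc d) lt dv = ⊥-elim (ℕₚ.<-irrefl refl (ℕₚ.<-≤-trans lt (ℕ∣.∣⇒≤ dv)))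
    dv : p ℕ∣.∣ ∣ int i - int j ∣
    dv = ∣⇒∣ᵤ (divides q eq)
    go : i ℕ.≤ j ⊎ j ℕ.≤ i → i ≡ j
    go (inj₁ le) = ℕₚ.≤-antisym le (ℕₚ.m∸n≡0⇒m≤n (zero-of (j ℕ.∸ i) (ℕₚ.≤-<-trans (ℕₚ.m∸n≤m j i) j<p) (subst (p ℕ∣.∣_) (trans (cong ∣_∣ (m-n≡m⊖n i j)) (trans (∣m⊖n∣≡∣n⊖m∣ i j) (cong ∣_∣ (⊖-≥ le)))) dv)))
    go (inj₂ le) = ℕₚ.≤-antisym (ℕₚ.m∸n≡0⇒m≤n (zero-of (i ℕ.∸ j) (ℕₚ.≤-<-trans (ℕₚ.m∸n≤m i j) i<p) (subst (p ℕ∣.∣_) (trans (cong ∣_∣ (m-n≡m⊖n i j)) (cong ∣_∣ (⊖-≥ le))) dv))) le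

  geometricℕ : ℕ → ℕ → ℕ
  geometricℕ zero y = 1
  geometricℕ (suc j) y = 1 ℕ.+ y ℕ.* geometricℕ j y

  private
    geometricℕ-≡ : ∀ j y → y ℕ.* geometricℕ j y ℕ.+ 1 ≡ geometricℕ j y ℕ.+ y ℕ.^ suc j
    geometricℕ-≡ zero y = ℕₚ.+-comm (y ℕ.* 1) 1
    geometricℕ-≡ (suc j) y = trans (lem y (geometricℕ j y)) (trans (cong (λ z → y ℕ.* z ℕ.+ 1) (geometricℕ-≡ j y)) (lem₂ y (geometricℕ j y) (y ℕ.^ suc j)))
      where
      lem : ∀ y g → y ℕ.* (1 ℕ.+ y ℕ.* g) ℕ.+ 1 ≡ y ℕ.* (y ℕ.* g ℕ.+ 1) ℕ.+ 1
      lem = solve-∀ℕ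
      lem₂ : ∀ y g p → y ℕ.* (g ℕ.+ p) ℕ.+ 1 ≡ 1 ℕ.+ y ℕ.* g ℕ.+ y ℕ.* p
      lem₂ = solve-∀ℕ

    geometricℕ-one : ∀ {p y} j → y ≈ 1 [ p ] → geometricℕ j y ≈ suc j [ p ]
    geometricℕ-one zero h = ≈-refl
    geometricℕ-one {p} {y} (suc j) h = ≈-+ (≈-refl {1}) (subst (λ z → y ℕ.* geometricℕ j y ≈ z [ p ]) (ℕₚ.*-identityˡ (suc j)) (≈-* h (geometricℕ-one j h)))

  -- The order of ω divides l^(e+1). Were it a proper divisor, it would divide l^e; then ω^(l^e)
  -- would be 1 and the geometric sum would be l modulo p, which is not 0. So l^(e+1) divides the
  -- order of ω, and that divides p - 1.
  cyclotomic-root : ∀ {p l} e ω → Prime p → Prime l → p ≢ l → geometricℕ (l ℕ.∸ 1) (ω ℕ.^ (l ℕ.^ e)) ≈ 0 [ p ] → l ℕ.^ suc e ℕ∣.∣ p ℕ.∸ 1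
  cyclotomic-root {p} {l} e ω pp pl p≢l h = ℕ∣.∣-trans l^∣o (ord-∣ 1<p cω (fermat pp p∤ω))
    where
    1<p = prime⇒1< pp
    y = ω ℕ.^ (l ℕ.^ e)
    E = geometricℕ (l ℕ.∸ 1) y
    l≡ : suc (l ℕ.∸ 1) ≡ l
    l≡ = ℕₚ.m+[n∸m]≡n (prime⇒0< pl)
    y^l : y ℕ.^ l ≈ 1 [ p ]
    y^l = ≈-sym (≈-trans (subst (λ z → 1 ≈ z ℕ.+ 1 [ p ]) (ℕₚ.*-comm E y) (≈-+ (≈-sym (≈-* h (≈-refl {y}))) (≈-refl {1})))
      (≈-trans (≡⇒≈ (geometricℕ-≡ (l ℕ.∸ 1) y)) (≈-trans (≈-+ h ≈-refl) (≡⇒≈ (cong (y ℕ.^_) l≡)))))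
    ω^ : ω ℕ.^ (l ℕ.^ suc e) ≈ 1 [ p ]
    ω^ = subst (_≈ 1 [ p ]) (trans (ℕₚ.^-*-assoc ω (l ℕ.^ e) l) (cong (ω ℕ.^_) (ℕₚ.*-comm (l ℕ.^ e) l))) y^l
    p∤ω : ¬ (p ℕ∣.∣ ω)
    p∤ω d = ¬prime[1] (subst Prime (ℕ∣.∣1⇒≡1 (≈0⇒∣ (≈-trans (≈-sym ω^) (subst (λ z → z ≈ 0 [ p ]) (cong (ω ℕ.^_) 1+) (∣⇒≈0 (ℕ∣.∣-trans d (ℕ∣.m∣m*n (ω ℕ.^ (l ℕ.^ suc e ℕ.∸ 1))))))))) pp)
      where
      1+ : suc (l ℕ.^ suc e ℕ.∸ 1) ≡ l ℕ.^ suc e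
      1+ = ℕₚ.m+[n∸m]≡n (ℕₚ.m^n>0 l {{prime⇒nonZero pl}} (suc e))
    cω : Coprime ω p
    cω = Coprimality.sym (prime-∤⇒coprime pp p∤ω)
    l^∣o : l ℕ.^ suc e ℕ∣.∣ ord ω p
    l^∣o = from-divides (ord-∣ 1<p cω ω^)
     where
     from-divides : ord ω p ℕ∣.∣ l ℕ.^ suc e → l ℕ.^ suc e ℕ∣.∣ ord ω p
     from-divides (ℕ∣.divides t et) = coprime-divisor (prime-^-coprime (suc e) pl l∤t) (ℕ∣.divides 1 (trans (sym et) (sym (ℕₚ.*-identityˡ _))))
      where
      l∤t : ¬ (l ℕ∣.∣ t)
      l∤t (ℕ∣.divides t′ refl) = p≢l (prime-∣-prime pp pl (≈0⇒∣ (≈-trans (≈-sym (subst (λ z → E ≈ z [ p ]) l≡ (geometricℕ-one (l ℕ.∸ 1) y≈1))) h)))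
        where
        o = ord ω p
        lem : ∀ a b c → a ℕ.* b ℕ.* c ≡ b ℕ.* (c ℕ.* a)
        lem = solve-∀ℕ
        l^e : l ℕ.^ e ≡ o ℕ.* t′
        l^e = ℕₚ.*-cancelˡ-≡ (l ℕ.^ e) (o ℕ.* t′) l {{prime⇒nonZero pl}} (trans et (trans (cong (ℕ._* o) (ℕₚ.*-comm t′ l)) (trans (ℕₚ.*-assoc l t′ o) (cong (l ℕ.*_) (ℕₚ.*-comm t′ o)))))
        y≈1 : y ≈ 1 [ p ]
        y≈1 = subst (λ z → ω ℕ.^ z ≈ 1 [ p ]) (sym l^e) (subst (_≈ 1 [ p ]) (ℕₚ.^-*-assoc ω o t′) (1^≈1 t′ (proj₁ (proj₂ (ord-spec 1<p cω)))))

  module Ideals (l : ℕ) (pl : Prime l) (e m′ : ℕ) (dim : suc m′ ≡ (l ℕ.∸ 1) ℕ.* l ℕ.^ e) where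

    open Cyclotomic l pl e m′ dim public

    1≤𝒞 : 1 ℕ.≤ 𝒞
    1≤𝒞 = ℕₚ.m^n>0 2 m

    -- In effect the quotient by δ has at most (5 𝒞 s)^m elements. With x in a box of side H, the
    -- elements v i + x δ lie in a box of side 2 (H + 𝒞 H s) + 1 ≤ 5 𝒞 s H, so two of them coincide.
    -- Their indices differ, since otherwise δ would annihilate a nonzero difference x′ - x.
    collide : {I : Set} {is : List I} {v : I → V} {δ : V} (s H : ℕ) → 0 ℕ.< s → 0 ℕ.< H → Unique is → (∀ {i} → i ∈ is → Small H (v i)) →
      Small s δ → δ ≢ 𝟎 → (5 ℕ.* 𝒞 ℕ.* s) ℕ.^ m ℕ.< length is →
      ∃[ i ] ∃[ j ] (i ∈ is × j ∈ is × i ≢ j × ∃[ y ] v i ⊖ v j ≡ y ⋆ δ)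
    collide {I} {is} {v} {δ} s H 0<s 0<H u v-small δ-small δ≢ big
      = finish (pigeonhole _≟ᵥ_ f {cartesianProduct is (box H m)} {box (suc (B ℕ.+ B)) m} (cartesianProduct⁺ u (box-unique H m)) mem len)
      where
      B = H ℕ.+ 𝒞 ℕ.* (H ℕ.* s)
      f : I × Vec ℕ m → Vec ℕ m
      f (i , x) = encode B (v i ⊕ ⌈ x ⌉ ⋆ δ)
      mem : ∀ {z} → z ∈ cartesianProduct is (box H m) → f z ∈ box (suc (B ℕ.+ B)) m
      mem z∈ with ∈-cartesianProduct⁻ is (box H m) z∈
      ... | i∈ , x∈ = encode-∈ (Small-⊕ (v-small i∈) (⋆-Small (⌈⌉-Small (box-< {H} x∈)) δ-small))
      le : suc (B ℕ.+ B) ℕ.≤ 5 ℕ.* 𝒞 ℕ.* s ℕ.* H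
      le = ℕₚ.≤-trans (ℕₚ.+-mono-≤ (ℕₚ.*-mono-≤ 0<H 1≤𝒞s) (ℕₚ.+-mono-≤ (ℕₚ.+-monoˡ-≤ _ H≤) (ℕₚ.+-monoˡ-≤ _ H≤))) (ℕₚ.≤-reflexive (lem H 𝒞 s))
        where
        1≤𝒞s : 1 ℕ.≤ 𝒞 ℕ.* s
        1≤𝒞s = ℕₚ.*-mono-≤ 1≤𝒞 0<s
        H≤ : H ℕ.≤ H ℕ.* (𝒞 ℕ.* s)
        H≤ = ℕₚ.m≤m*n H (𝒞 ℕ.* s) {{ℕ.>-nonZero 1≤𝒞s}}
        lem : ∀ H c s → H ℕ.* (c ℕ.* s) ℕ.+ ((H ℕ.* (c ℕ.* s) ℕ.+ c ℕ.* (H ℕ.* s)) ℕ.+ (H ℕ.* (c ℕ.* s) ℕ.+ c ℕ.* (H ℕ.* s))) ≡ 5 ℕ.* c ℕ.* s ℕ.* H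
        lem = solve-∀ℕ
      len : length (box (suc (B ℕ.+ B)) m) ℕ.< length (cartesianProduct is (box H m))
      len = subst₂ ℕ._<_ (sym (length-box (suc (B ℕ.+ B)) m)) (sym (trans (length-cartesianProductWith _,_ is (box H m)) (cong (length is ℕ.*_) (length-box H m))))
        (ℕₚ.≤-<-trans (ℕₚ.^-monoˡ-≤ m le) (subst (ℕ._< length is ℕ.* H ℕ.^ m) (sym (^-distribʳ-* (5 ℕ.* 𝒞 ℕ.* s) H m)) (ℕₚ.*-monoˡ-< (H ℕ.^ m) {{ℕₚ.m^n≢0 H m {{ℕ.>-nonZero 0<H}}}} big)))
      finish : ∃[ z ] ∃[ z′ ] (z ∈ cartesianProduct is (box H m) × z′ ∈ cartesianProduct is (box H m) × z ≢ z′ × f z ≡ f z′) →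
        ∃[ i ] ∃[ j ] (i ∈ is × j ∈ is × i ≢ j × ∃[ y ] v i ⊖ v j ≡ y ⋆ δ)
      finish ((i , x) , (j , x′) , z∈ , z′∈ , ne , eq) with ∈-cartesianProduct⁻ is (box H m) z∈ | ∈-cartesianProduct⁻ is (box H m) z′∈
      ... | i∈ , x∈ | j∈ , x′∈ = i , j , i∈ , j∈ , i≢j , ⌈ x′ ⌉ ⊖ ⌈ x ⌉ , trans diff (sym (⊖-⋆ ⌈ x′ ⌉ ⌈ x ⌉ δ))
        where
        same : v i ⊕ ⌈ x ⌉ ⋆ δ ≡ v j ⊕ ⌈ x′ ⌉ ⋆ δ
        same = encode-injective (Small-⊕ (v-small i∈) (⋆-Small (⌈⌉-Small (box-< {H} x∈)) δ-small)) (Small-⊕ (v-small j∈) (⋆-Small (⌈⌉-Small (box-< {H} x′∈)) δ-small)) eq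
        diff : v i ⊖ v j ≡ ⌈ x′ ⌉ ⋆ δ ⊖ ⌈ x ⌉ ⋆ δ
        diff = ⊕≡⇒⊖≡ _ _ _ _ same
        i≢j : i ≢ j
        i≢j refl with x ≟ᵥ x′
        ... | yes refl = ne refl
        ... | no x≢ = domain (⌈ x′ ⌉ ⊖ ⌈ x ⌉) δ (λ z → x≢ (sym (⌈⌉-injective (⊖≡𝟎⇒≡ _ _ z)))) δ≢ (trans (⊖-⋆ ⌈ x′ ⌉ ⌈ x ⌉ δ) (trans (sym diff) (⊖-self (v i))))

    -- δ is a zero divisor modulo p; in the language of ideals, it lies in a prime ideal above p.
    Singular : ℕ → V → Set
    Singular p δ = ∃[ γ ] (¬ (p ∣ᵥ γ) × p ∣ᵥ δ ⋆ γ)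

    𝟏-Small : Small 1 𝟏
    𝟏-Small = ℕ.s≤s ℕ.z≤n ∷ Small-𝟎 m′

    scalar-⋆ : ∀ a γ → (a • 𝟏) ⋆ γ ≡ a • γ
    scalar-⋆ a γ = trans (•-⋆ a 𝟏 γ) (cong (a •_) (⋆-identityˡ γ))

    -- Two of the scalars 0, ..., p - 1 are congruent modulo δ. Their difference is prime to p and
    -- yet annihilates γ modulo p.
    non-singular : ∀ {p δ} s → Prime p → δ ≢ 𝟎 → Small s δ → 0 ℕ.< s → (5 ℕ.* 𝒞 ℕ.* s) ℕ.^ m ℕ.< p → ¬ Singular p δ
    non-singular {p} {δ} s pp δ≢ δ-small 0<s big (γ , p∤γ , p∣δγ)
      = finish (collide {v = λ i → int i • 𝟏} s (p ℕ.* 1) 0<s (ℕₚ.*-mono-≤ (prime⇒0< pp) (ℕ.s≤s ℕ.z≤n)) (below-unique p) (λ i∈ → Small-• (ℕₚ.<⇒≤ (below-< i∈)) 𝟏-Small) δ-small δ≢ (subst (_ ℕ.<_) (sym (length-below p)) big))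
     where
     finish : ∃[ i ] ∃[ j ] (i ∈ below p × j ∈ below p × i ≢ j × ∃[ y ] int i • 𝟏 ⊖ int j • 𝟏 ≡ y ⋆ δ) → ⊥
     finish (i , j , i∈ , j∈ , i≢j , y , eq) = p∤γ (∣ᵥ-cancel {a = int i - int j} pp (λ d → i≢j (small-difference (below-< i∈) (below-< j∈) d)) (subst (p ∣ᵥ_) e′ (∣ᵥ-⋆ y p∣δγ)))
      where
      e′ : y ⋆ (δ ⋆ γ) ≡ (int i - int j) • γ
      e′ = trans (sym (⋆-assoc y δ γ)) (trans (cong (_⋆ γ) (sym eq)) (trans (⊖-⋆ _ _ γ) (trans (cong₂ _⊖_ (scalar-⋆ (int i) γ) (scalar-⋆ (int j) γ))
        (trans (⊖-as-⊕ _ _) (trans (cong (int i • γ ⊕_) (sym (*-• -1ℤ (int j) γ))) (trans (sym (+-• (int i) (-1ℤ * int j) γ)) (cong (λ z → (int i + z) • γ) (-1*i≡-i (int j)))))))))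

    private
      eigen-act : ∀ {p γ} ω → p ∣ᵥ τ γ ⊖ ω • γ → ∀ f → p ∣ᵥ act f γ ⊖ evalℤ f ω • γ
      eigen-act {γ = γ} ω h [] = subst (_ ∣ᵥ_) (sym (trans (cong (𝟎 ⊖_) (0-• γ)) (⊖-self 𝟎))) ∣ᵥ-𝟎
      eigen-act {p} {γ} ω h (a ∷ f) with eigen-act ω h f
      ... | (z , ez) = subst (p ∣ᵥ_) (sym eq) (∣ᵥ-⊕ (τ z , trans (cong τ ez) (τ-• (int p) z)) (∣ᵥ-• E h))
        where
        E = evalℤ f ω
        u = act f γ
        lem : ∀ (a u v w : V) → (a ⊕ u) ⊖ (a ⊕ w) ≡ (u ⊖ v) ⊕ (v ⊖ w)
        lem a u v w = trans (⊕≡⇒⊖≡ (a ⊕ u) w (a ⊕ w) u (trans (⊕-assoc a u w) (trans (cong (a ⊕_) (⊕-comm u w)) (sym (⊕-assoc a w u)))))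
          (sym (trans (cong₂ _⊕_ (⊖-as-⊕ u v) (⊖-as-⊕ v w)) (trans (⊕-assoc _ _ _) (trans (cong (u ⊕_) (trans (sym (⊕-assoc _ _ _)) (trans (cong (_⊕ -1ℤ • w) (trans (⊕-comm _ _) (trans (sym (⊖-as-⊕ v v)) (⊖-self v)))) (⊕-identityˡ _)))) (sym (⊖-as-⊕ u w))))))
        τ-⊖ : ∀ u v → τ (u ⊖ v) ≡ τ u ⊖ τ v
        τ-⊖ u v = trans (sym (X-⋆ _)) (trans (⋆-⊖ X u v) (cong₂ _⊖_ (X-⋆ u) (X-⋆ v)))
        eq : act (a ∷ f) γ ⊖ evalℤ (a ∷ f) ω • γ ≡ τ (u ⊖ E • γ) ⊕ E • (τ γ ⊖ ω • γ)
        eq = trans (cong ((a • γ ⊕ τ u) ⊖_) (trans (+-• a (ω * E) γ) (cong (a • γ ⊕_) (trans (cong (_• γ) (*-comm ω E)) (*-• E ω γ)))))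
          (trans (lem (a • γ) (τ u) (E • τ γ) (E • ω • γ)) (cong₂ _⊕_ (sym (trans (τ-⊖ u _) (cong (τ u ⊖_) (τ-• E γ))))
          (sym (trans (cong (E •_) (⊖-as-⊕ _ _)) (trans (•-⊕ E _ _) (trans (cong (E • τ γ ⊕_) (trans (sym (*-• E -1ℤ _)) (trans (cong (_• (ω • γ)) (*-comm E -1ℤ)) (*-• -1ℤ E _)))) (sym (⊖-as-⊕ _ _))))))))

      evalℤ-++ : ∀ f g x → evalℤ (f ++ g) (int x) ≡ evalℤ f (int x) + int (x ℕ.^ length f) * evalℤ g (int x)
      evalℤ-++ [] g x = sym (trans (+-identityˡ _) (*-identityˡ _))
      evalℤ-++ (a ∷ f) g x = trans (cong (λ z → a + int x * z) (evalℤ-++ f g x)) (trans (lem a (int x) (evalℤ f (int x)) (int (x ℕ.^ length f)) (evalℤ g (int x)))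
        (cong (λ z → a + int x * evalℤ f (int x) + z * evalℤ g (int x)) (sym (pos-* x (x ℕ.^ length f)))))
        where
        lem : ∀ a x f y g → a + x * (f + y * g) ≡ a + x * f + x * y * g
        lem = solve-∀

      evalℤ-replicate : ∀ k x → evalℤ (List.replicate k 0ℤ) x ≡ 0ℤ
      evalℤ-replicate zero x = refl
      evalℤ-replicate (suc k) x = trans (+-identityˡ _) (trans (cong (x *_) (evalℤ-replicate k x)) (*-zeroʳ x))

      evalℤ-Φ : ∀ j x → evalℤ (Φ j) (int x) ≡ int (geometricℕ j (x ℕ.^ q₀))
      evalℤ-Φ zero x = trans (cong (1ℤ +_) (*-zeroʳ (int x))) refl
      evalℤ-Φ (suc j) x = trans (cong (λ z → evalℤ z (int x)) (++-assoc (block 1ℤ) (blocks 1ℤ j) (1ℤ ∷ [])))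
        (trans (evalℤ-++ (block 1ℤ) (Φ j) x) (trans (cong₂ (λ y z → y + int (x ℕ.^ z) * evalℤ (Φ j) (int x)) (trans (cong (λ z → 1ℤ + int x * z) (evalℤ-replicate (q₀ ℕ.∸ 1) (int x))) (cong (1ℤ +_) (*-zeroʳ (int x)))) (length-block 1ℤ))
        (trans (cong (λ z → 1ℤ + 0ℤ + int (x ℕ.^ q₀) * z) (evalℤ-Φ j x)) (cong (1ℤ +_) (sym (pos-* (x ℕ.^ q₀) (geometricℕ j (x ℕ.^ q₀))))))))

      eigenvalue : ∀ {p γ a} n → Prime p → ¬ (p ℕ∣.∣ n) → p ∣ᵥ a • γ ⊕ int n • τ γ → ∃[ ω ] p ∣ᵥ τ γ ⊖ int ω • γ
      eigenvalue {p} {γ} {a} n pp p∤n (z , ez) = finish (inverse (Coprimality.sym (prime-∤⇒coprime pp p∤n)) (prime⇒0< pp))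
       where
       finish : ∃[ u ] u ℕ.* n ≈ 1 [ p ] → ∃[ ω ] p ∣ᵥ τ γ ⊖ int ω • γ
       finish (u , i , j , eu) = ω , subst (p ∣ᵥ_) (sym eq) (∣ᵥ-⊕ (∣ᵥ-• (int u) (z , ez)) (∣ᵥ-⊕ (∣ᵥ-scalar (τ γ) (divides (int i - int j) refl)) (∣ᵥ-scalar γ (divides Q refl))))
        where
        instance _ = prime⇒nonZero pp
        ω = (- (int u * a)) %ℕ p
        Q = (- (int u * a)) /ℕ p
        lin : ∀ x y x′ y′ → x ≡ x′ → y ≡ y′ → x • γ ⊕ y • τ γ ≡ x′ • γ ⊕ y′ • τ γ
        lin _ _ _ _ refl refl = refl
        combine : ∀ x y x′ y′ → (x • γ ⊕ y • τ γ) ⊕ (y′ • τ γ ⊕ x′ • γ) ≡ (x + x′) • γ ⊕ (y + y′) • τ γ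
        combine x y x′ y′ = trans (cong ((x • γ ⊕ y • τ γ) ⊕_) (⊕-comm _ _)) (trans (⊕-interchange _ _ _ _) (cong₂ _⊕_ (sym (+-• x x′ γ)) (sym (+-• y y′ (τ γ)))))
        int-eu : int u * int n + int i * int p ≡ 1ℤ + int j * int p
        int-eu = trans (cong₂ _+_ (sym (pos-* u n)) (sym (pos-* i p))) (trans (cong int eu) (cong (1ℤ +_) (pos-* j p)))
        yeq : int u * int n + (int i - int j) * int p ≡ 1ℤ
        yeq = trans (l₁ (int u * int n) (int i) (int j) (int p)) (trans (cong (λ t → t - int j * int p) int-eu) (l₂ (int j * int p)))
          where
          l₁ : ∀ x i j p → x + (i - j) * p ≡ (x + i * p) - j * p
          l₁ = solve-∀
          l₂ : ∀ x → (1ℤ + x) - x ≡ 1ℤ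
          l₂ = solve-∀
        xeq : int u * a + Q * int p ≡ - int ω
        xeq = trans (l₁ (int u * a) (Q * int p) (int ω)) (trans (cong (λ t → int u * a + t - int ω) (sym (a≡a%ℕn+[a/ℕn]*n (- (int u * a)) p))) (l₂ (int u * a) (int ω)))
          where
          l₁ : ∀ x q w → x + q ≡ x + (w + q) - w
          l₁ = solve-∀
          l₂ : ∀ x w → x + - x - w ≡ - w
          l₂ = solve-∀
        eq : τ γ ⊖ int ω • γ ≡ int u • (a • γ ⊕ int n • τ γ) ⊕ (((int i - int j) * int p) • τ γ ⊕ (Q * int p) • γ)
        eq = sym (trans (cong (_⊕ (((int i - int j) * int p) • τ γ ⊕ (Q * int p) • γ)) (trans (•-⊕ (int u) _ _) (cong₂ _⊕_ (sym (*-• (int u) a γ)) (sym (*-• (int u) (int n) (τ γ))))))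
          (trans (combine (int u * a) (int u * int n) (Q * int p) ((int i - int j) * int p)) (trans (lin _ _ _ _ xeq yeq)
          (trans (cong₂ _⊕_ (trans (cong (_• γ) (sym (-1*i≡-i (int ω)))) (*-• -1ℤ (int ω) γ)) (1-• (τ γ))) (trans (⊕-comm _ _) (sym (⊖-as-⊕ _ _)))))))

    -- As b is invertible modulo p, γ is an eigenvector of X modulo p. Its eigenvalue is then a root
    -- modulo p of the cyclotomic polynomial, which acts as zero on γ.
    eigenvector⇒split : ∀ {p γ a} b → Prime p → p ≢ l → ¬ (p ∣ᵥ γ) → ¬ (int p ∣ᶻ b) → p ∣ᵥ a • γ ⊕ b • τ γ → l ℕ.^ suc e ℕ∣.∣ p ℕ.∸ 1
    eigenvector⇒split {p} {γ} (int n) pp p≢l p∤γ p∤b h = finish (eigenvalue n pp (λ d → p∤b (∣ᵤ⇒∣ d)) h)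
     where
     finish : ∃[ ω ] p ∣ᵥ τ γ ⊖ int ω • γ → l ℕ.^ suc e ℕ∣.∣ p ℕ.∸ 1
     finish (ω , d) = cyclotomic-root e ω pp pl p≢l (∣⇒≈0 (∣⇒∣ᵤ (root (int p ∣ᶻ? E))))
      where
      E = int (geometricℕ (l ℕ.∸ 1) (ω ℕ.^ q₀))
      pE : p ∣ᵥ E • γ
      pE = subst (p ∣ᵥ_) (trans (sym (*-• -1ℤ -1ℤ _)) (1-• (E • γ))) (∣ᵥ-• -1ℤ (subst (p ∣ᵥ_) (trans (⊖-as-⊕ _ _) (trans (cong₂ (λ x y → x ⊕ -1ℤ • (y • γ)) (Φ-zero γ) (evalℤ-Φ (l ℕ.∸ 1) ω)) (⊕-identityˡ _))) (eigen-act (int ω) d (Φ (l ℕ.∸ 1)))))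
      root : Dec (int p ∣ᶻ E) → int p ∣ᶻ E
      root (yes r) = r
      root (no nr) = ⊥-elim (p∤γ (∣ᵥ-cancel pp nr pE))
    eigenvector⇒split {p} {γ} {a} -[1+ n ] pp p≢l p∤γ p∤b h = eigenvector⇒split {a = -1ℤ * a} (int (suc n)) pp p≢l p∤γ (λ d → p∤b (∣ᵤ⇒∣ (∣⇒∣ᵤ d)))
      (subst (p ∣ᵥ_) (trans (•-⊕ -1ℤ _ _) (cong₂ _⊕_ (sym (*-• -1ℤ a γ)) (trans (sym (*-• -1ℤ -[1+ n ] (τ γ))) (cong (_• τ γ) (-1*i≡-i -[1+ n ]))))) (∣ᵥ-• -1ℤ h))

    -- The p^2 elements i + j X now take the place of the scalars: in a relation a γ + b X γ ≡ 0
    -- modulo p, first b and then a must be divisible by p. Behind this is that prime ideals above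
    -- such p have norm at least p^2.
    non-singular² : ∀ {p δ} s → Prime p → p ≢ l → ¬ (l ℕ.^ suc e ℕ∣.∣ p ℕ.∸ 1) → δ ≢ 𝟎 → Small s δ → 0 ℕ.< s → (5 ℕ.* 𝒞 ℕ.* s) ℕ.^ m ℕ.< p ℕ.* p → ¬ Singular p δ
    non-singular² {p} {δ} s pp p≢l not-split δ≢ δ-small 0<s big (γ , p∤γ , p∣δγ)
      = finish₀ (collide {v = λ (i , j) → int i • 𝟏 ⊕ int j • X} s (p ℕ.* 1 ℕ.+ p ℕ.* 2) 0<s (ℕₚ.m≤n⇒m≤n+o (p ℕ.* 2) (ℕₚ.*-mono-≤ (prime⇒0< pp) (ℕ.s≤s (ℕ.z≤n {0})))) (cartesianProduct⁺ (below-unique p) (below-unique p))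
        (λ z∈ → let (i∈ , j∈) = ∈-cartesianProduct⁻ (below p) (below p) z∈ in Small-⊕ (Small-• (ℕₚ.<⇒≤ (below-< i∈)) 𝟏-Small) (Small-• (ℕₚ.<⇒≤ (below-< j∈)) (τ-Small 𝟏-Small)))
        δ-small δ≢ (subst (_ ℕ.<_) (sym (trans (length-cartesianProductWith _,_ (below p) (below p)) (cong₂ ℕ._*_ (length-below p) (length-below p)))) big))
     where
     finish₀ : ∃[ z ] ∃[ z′ ] (z ∈ cartesianProduct (below p) (below p) × z′ ∈ cartesianProduct (below p) (below p) × z ≢ z′ ×
       ∃[ y ] (int (proj₁ z) • 𝟏 ⊕ int (proj₂ z) • X) ⊖ (int (proj₁ z′) • 𝟏 ⊕ int (proj₂ z′) • X) ≡ y ⋆ δ) → ⊥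
     finish₀ ((i , j) , (i′ , j′) , z∈ , z′∈ , ne , y , eq) with ∈-cartesianProduct⁻ (below p) (below p) z∈ | ∈-cartesianProduct⁻ (below p) (below p) z′∈
     ... | i∈ , j∈ | i′∈ , j′∈ = finish (int p ∣ᶻ? (int j - int j′))
      where
      a = int i - int i′
      b = int j - int j′
      value : ∀ i j → (int i • 𝟏 ⊕ int j • X) ⋆ γ ≡ int i • γ ⊕ int j • τ γ
      value i j = trans (⋆-distribʳ _ _ γ) (cong₂ _⊕_ (scalar-⋆ (int i) γ) (trans (•-⋆ (int j) X γ) (cong (int j •_) (X-⋆ γ))))
      •-⊖ : ∀ x y (u : V) → (x - y) • u ≡ x • u ⊕ -1ℤ • (y • u)
      •-⊖ x y u = trans (cong (λ z → (x + z) • u) (sym (-1*i≡-i y))) (trans (+-• x (-1ℤ * y) u) (cong (x • u ⊕_) (*-• -1ℤ y u)))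
      e′ : y ⋆ (δ ⋆ γ) ≡ a • γ ⊕ b • τ γ
      e′ = trans (sym (⋆-assoc y δ γ)) (trans (cong (_⋆ γ) (sym eq)) (trans (⊖-⋆ _ _ γ) (trans (cong₂ _⊖_ (value i j) (value i′ j′)) (trans (⊖-as-⊕ _ _)
        (trans (cong ((int i • γ ⊕ int j • τ γ) ⊕_) (•-⊕ -1ℤ _ _)) (trans (⊕-interchange _ _ _ _) (cong₂ _⊕_ (sym (•-⊖ (int i) (int i′) γ)) (sym (•-⊖ (int j) (int j′) (τ γ))))))))))
      h : p ∣ᵥ a • γ ⊕ b • τ γ
      h = subst (p ∣ᵥ_) e′ (∣ᵥ-⋆ y p∣δγ)
      finish : Dec (int p ∣ᶻ b) → ⊥
      finish (no nb) = not-split (eigenvector⇒split b pp p≢l p∤γ nb h)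
      finish (yes db) with small-difference (below-< j∈) (below-< j′∈) db
      ... | refl = p∤γ (∣ᵥ-cancel {a = a} pp (λ d → ne (cong (_, j) (small-difference (below-< i∈) (below-< i′∈) d))) (subst (p ∣ᵥ_) (trans (cong (a • γ ⊕_) (trans (cong (_• τ γ) (+-inverseʳ (int j))) (0-• (τ γ)))) (⊕-identityʳ (a • γ))) h))

    comb : {T : Set} → (T → V) → (ts : List T) → Vec ℤ (length ts) → V
    comb g [] [] = 𝟎
    comb g (t ∷ ts) (d ∷ ds) = d • g t ⊕ comb g ts ds

    private
      comb-⊖ : ∀ {T : Set} (g : T → V) ts ds ds′ → comb g ts ds ⊖ comb g ts ds′ ≡ comb g ts (ds ⊖ ds′)
      comb-⊖ g [] [] [] = trans (⊖-self 𝟎) (cong (comb g []) (sym []⊖[]))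
        where
        []⊖[] : [] ⊖ [] ≡ []
        []⊖[] = ⊖-self []
      comb-⊖ g (t ∷ ts) (d ∷ ds) (d′ ∷ ds′) = trans (⊖-as-⊕ _ _) (trans (cong ((d • g t ⊕ comb g ts ds) ⊕_) (•-⊕ -1ℤ _ _)) (trans (⊕-interchange _ _ _ _)
        (trans (cong₂ _⊕_ (trans (cong (d • g t ⊕_) (sym (*-• -1ℤ d′ (g t)))) (trans (sym (+-• d (-1ℤ * d′) (g t))) (cong (λ z → (d + z) • g t) (-1*i≡-i d′))))
          (trans (sym (⊖-as-⊕ _ _)) (comb-⊖ g ts ds ds′))) (cong (comb g (t ∷ ts)) (sym (⊖-∷ d d′ ds ds′))))))

      comb-shift : ∀ {T : Set} {p} (el g : T → V) α ts → (∀ {t} → t ∈ ts → p ∣ᵥ el t ⋆ g t) → ∀ ds → p ∣ᵥ α ⋆ comb g ts ds → p ∣ᵥ comb (λ t → (α ⊖ el t) ⋆ g t) ts ds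
      comb-shift {p = p} el g α ts h ds d = subst (p ∣ᵥ_) (⊖-cancel (α ⋆ comb g ts ds) _) (∣ᵥ-⊖ d (error ts h ds))
        where
        ⊖-cancel : ∀ (u v : V) → u ⊖ (u ⊖ v) ≡ v
        ⊖-cancel u v = trans (⊕≡⇒⊖≡ u v (u ⊖ v) (v ⊕ v) (trans (cong (_⊕ v) (sym (⊖-⊕-cancel u v))) (⊕-assoc _ v v))) (trans (⊕≡⇒⊖≡ (v ⊕ v) 𝟎 v v (⊕-identityʳ _)) (trans (⊖-as-⊕ v 𝟎) (trans (cong (v ⊕_) (•-𝟎 -1ℤ)) (⊕-identityʳ v))))
        error : ∀ ts → (∀ {t} → t ∈ ts → p ∣ᵥ el t ⋆ g t) → ∀ ds → p ∣ᵥ α ⋆ comb g ts ds ⊖ comb (λ t → (α ⊖ el t) ⋆ g t) ts ds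
        error [] h [] = subst (p ∣ᵥ_) (sym (trans (cong (_⊖ 𝟎) (trans (⋆-comm α 𝟎) (𝟎-⋆ α))) (⊖-self 𝟎))) ∣ᵥ-𝟎
        error (t ∷ ts) h (d ∷ ds) = subst (p ∣ᵥ_) (sym eq) (∣ᵥ-⊕ (∣ᵥ-• d (h (here refl))) (error ts (h ∘ there) ds))
          where
          G = g t
          eq : α ⋆ (d • G ⊕ comb g ts ds) ⊖ (d • ((α ⊖ el t) ⋆ G) ⊕ comb (λ t → (α ⊖ el t) ⋆ g t) ts ds) ≡ d • (el t ⋆ G) ⊕ (α ⋆ comb g ts ds ⊖ comb (λ t → (α ⊖ el t) ⋆ g t) ts ds)
          eq = trans (cong (_⊖ (d • ((α ⊖ el t) ⋆ G) ⊕ comb (λ t → (α ⊖ el t) ⋆ g t) ts ds)) (⋆-distribˡ α _ _)) (trans (⊖-as-⊕ _ _) (trans (cong ((α ⋆ (d • G) ⊕ α ⋆ comb g ts ds) ⊕_) (•-⊕ -1ℤ _ _)) (trans (⊕-interchange _ _ _ _)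
            (cong₂ _⊕_ (trans (sym (⊖-as-⊕ _ _)) (trans (cong₂ _⊖_ (⋆-• α d G) (trans (cong (d •_) (⊖-⋆ α (el t) G)) refl)) first)) (sym (⊖-as-⊕ _ _))))))
            where
            first : d • (α ⋆ G) ⊖ d • (α ⋆ G ⊖ el t ⋆ G) ≡ d • (el t ⋆ G)
            first = trans (cong (d • (α ⋆ G) ⊖_) (trans (cong (d •_) (⊖-as-⊕ _ _)) (trans (•-⊕ d _ _) (trans (cong (d • (α ⋆ G) ⊕_) (trans (sym (*-• d -1ℤ _)) (trans (cong (_• (el t ⋆ G)) (*-comm d -1ℤ)) (*-• -1ℤ d _)))) (sym (⊖-as-⊕ _ _)))))) (⊖-cancel _ _)

    -- If the αᵢ have kernel vectors g αᵢ mod p and pairwise nonsingular differences, then multiplying a linear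
    -- relation by the first α kills one term and rescales the others by nonsingular elements.
    kernel-independent : ∀ {T : Set} {p} → Prime p → ∀ (el g : T → V) ts → (∀ {t} → t ∈ ts → ¬ (p ∣ᵥ g t) × p ∣ᵥ el t ⋆ g t) → AllPairs (λ s t → ¬ Singular p (el s ⊖ el t)) ts →
      ∀ ds → p ∣ᵥ comb g ts ds → All (int p ∣ᶻ_) ds
    kernel-independent pp el g [] good pairs [] h = []
    kernel-independent {T} {p} pp el g (t ∷ ts) good (ns ∷ pairs) (d ∷ ds) h = head ∷ rest
      where
      g′ : T → V
      g′ s = (el t ⊖ el s) ⋆ g s
      rest : All (int p ∣ᶻ_) ds
      rest = kernel-independent pp el g′ ts good′ pairs ds (comb-shift el g (el t) ts (proj₂ ∘ good ∘ there) ds (subst (p ∣ᵥ_) (cancel _ _) (∣ᵥ-⊖ (subst (p ∣ᵥ_) (⋆-distribˡ (el t) _ _) (∣ᵥ-⋆ (el t) h)) (subst (p ∣ᵥ_) (sym (⋆-• (el t) d (g t))) (∣ᵥ-• d (proj₂ (good (here refl))))))))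
        where
        cancel : ∀ (u v : V) → (u ⊕ v) ⊖ u ≡ v
        cancel u v = trans (⊕≡⇒⊖≡ (u ⊕ v) 𝟎 u v (⊕-identityʳ _)) (trans (⊖-as-⊕ v 𝟎) (trans (cong (v ⊕_) (•-𝟎 -1ℤ)) (⊕-identityʳ v)))
        good′ : ∀ {s} → s ∈ ts → ¬ (p ∣ᵥ g′ s) × p ∣ᵥ el s ⋆ g′ s
        good′ {s} s∈ = (λ d′ → ListAll.lookup ns s∈ (g s , proj₁ (good (there s∈)) , d′)) , subst (p ∣ᵥ_) (⋆-swap (el t ⊖ el s) (el s) (g s)) (∣ᵥ-⋆ (el t ⊖ el s) (proj₂ (good (there s∈))))
      head : int p ∣ᶻ d
      head with int p ∣ᶻ? d
      ... | yes dv = dv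
      ... | no nd = ⊥-elim (proj₁ (good (here refl)) (∣ᵥ-cancel pp nd (subst (p ∣ᵥ_) (cancel _ _) (∣ᵥ-⊖ h (combination ts ds rest)))))
        where
        cancel : ∀ (u v : V) → (u ⊕ v) ⊖ v ≡ u
        cancel u v = trans (⊕≡⇒⊖≡ (u ⊕ v) 𝟎 v u (trans (⊕-identityʳ _) (⊕-comm u v))) (trans (⊖-as-⊕ u 𝟎) (trans (cong (u ⊕_) (•-𝟎 -1ℤ)) (⊕-identityʳ u)))
        combination : ∀ ts ds → All (int p ∣ᶻ_) ds → p ∣ᵥ comb g ts ds
        combination [] [] [] = ∣ᵥ-𝟎
        combination (t ∷ ts) (d ∷ ds) (dv ∷ dvs) = ∣ᵥ-⊕ (∣ᵥ-scalar (g t) dv) (combination ts ds dvs)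

    -- The kernel vectors are independent over the field of p elements in a space of dimension m; in
    -- counting terms, all combinations with coefficients below p are distinct modulo p.
    no-crowd : ∀ {T : Set} {p} → Prime p → ∀ (el g : T → V) ts → (∀ {t} → t ∈ ts → ¬ (p ∣ᵥ g t) × p ∣ᵥ el t ⋆ g t) → AllPairs (λ s t → ¬ Singular p (el s ⊖ el t)) ts → length ts ℕ.≤ m
    no-crowd {p = p} pp el g ts good pairs with length ts ℕ.≤? m
    ... | yes le = le
    ... | no nle = finish (pigeonhole _≟ᵥ_ f {box p (length ts)} {box p m} (box-unique p (length ts)) (λ _ → ∈-box (residues _))
          (subst₂ ℕ._<_ (sym (length-box p m)) (sym (length-box p (length ts))) (ℕₚ.^-monoʳ-< p (prime⇒1< pp) (ℕₚ.≰⇒> nle))))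
      where
      instance _ = prime⇒nonZero pp
      f : Vec ℕ (length ts) → Vec ℕ m
      f ds = Vec.map (_%ℕ p) (comb g ts ⌈ ds ⌉)
      residues : ∀ {n} (v : Vec ℤ n) → All (ℕ._< p) (Vec.map (_%ℕ p) v)
      residues [] = []
      residues (x ∷ v) = n%ℕd<d x p ∷ residues v
      congruent : ∀ {n} (u v : Vec ℤ n) → Vec.map (_%ℕ p) u ≡ Vec.map (_%ℕ p) v → p ∣ᵥ u ⊖ v
      congruent [] [] e = subst (p ∣ᵥ_) (sym (⊖-self [])) ∣ᵥ-𝟎
      congruent (x ∷ u) (y ∷ v) e = subst (p ∣ᵥ_) (sym (⊖-∷ x y u v)) (All⇒∣ᵥ (divides (x /ℕ p - y /ℕ p) (trans (cong₂ _-_ (a≡a%ℕn+[a/ℕn]*n x p) (trans (a≡a%ℕn+[a/ℕn]*n y p) (cong (λ z → int z + (y /ℕ p) * int p) (sym (Vecₚ.∷-injectiveˡ e))))) (lem (int (x %ℕ p)) (x /ℕ p) (y /ℕ p) (int p))) ∷ ∣ᵥ⇒All (congruent u v (Vecₚ.∷-injectiveʳ e))))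
        where
        lem : ∀ r a b p → (r + a * p) - (r + b * p) ≡ (a - b) * p
        lem = solve-∀
      same : ∀ {n} {u v : Vec ℕ n} → All (ℕ._< p) u → All (ℕ._< p) v → All (int p ∣ᶻ_) (⌈ u ⌉ ⊖ ⌈ v ⌉) → u ≡ v
      same {u = []} {[]} [] [] _ = refl
      same {u = x ∷ u} {y ∷ v} (hx ∷ hu) (hy ∷ hv) h with subst (All (int p ∣ᶻ_)) (⊖-∷ (int x) (int y) ⌈ u ⌉ ⌈ v ⌉) h
      ... | d ∷ ds = cong₂ _∷_ (small-difference hx hy d) (same hu hv ds)
      finish : ∃[ ds ] ∃[ ds′ ] (ds ∈ box p (length ts) × ds′ ∈ box p (length ts) × ds ≢ ds′ × f ds ≡ f ds′) → length ts ℕ.≤ m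
      finish (ds , ds′ , ds∈ , ds′∈ , ne , eq) = ⊥-elim (ne (same (box-< ds∈) (box-< ds′∈) (kernel-independent pp el g ts good pairs _ (subst (p ∣ᵥ_) (comb-⊖ g ts ⌈ ds ⌉ ⌈ ds′ ⌉) (congruent _ _ eq)))))

-- Nonunits congruent to 1 modulo all small primes.

module Singular where

  open Sums using (∉⇒≢)
  open Mod
  open Sieve using (Π; Π-0<; ∣-Π; prime-∣-Π)
  open Harmonic using (upTo⁺; ∈-upTo⁺; upTo⁺-bounds; ∃-prime-divisor)
  open Sums using (below; below-<; below-unique; length-below)
  open Lattice
  open Domain
  open Geometry
  open import Data.Nat as ℕ using (ℕ; zero; suc)
  import Data.Nat.Properties as ℕₚ
  open import Data.Nat.DivMod using (_/_; _%_; m≡m%n+[m/n]*n; m%n<n)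
  import Data.Nat.Divisibility as ℕ∣
  open import Data.Nat.Induction using (<-rec)
  open import Data.Nat.Primality using (Prime)
  open import Data.Nat.Tactic.RingSolver using () renaming (solve-∀ to solve-∀ℕ)
  open import Data.Integer using (ℤ; 1ℤ; -1ℤ; _+_; _*_; _-_; ∣_∣) renaming (+_ to int)
  open import Data.Integer.Properties hiding (_≟_)
  open import Data.Integer.Divisibility.Signed using (divides; ∣ᵤ⇒∣; ∣⇒∣ᵤ) renaming (_∣_ to _∣ᶻ_)
  open import Data.Integer.Tactic.RingSolver using (solve-∀)
  open import Data.List as List using ([]; _∷_; length)
  open import Data.List.Membership.Propositional using (_∈_)
  open import Data.List.Relation.Unary.Any using (here; there)
  open import Data.List.Relation.Unary.All as ListAll using ()
  open import Data.List.Relation.Unary.AllPairs as AllPairs using (AllPairs; []; _∷_)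
  open import Data.List.Relation.Unary.Unique.Propositional using (Unique)
  open import Data.Vec as Vec using (Vec; []; _∷_)
  open import Data.Vec.Relation.Unary.All as All using (All; []; _∷_)
  open import Data.Vec.Relation.Unary.Any as VecAny using (Any; here; there)
  import Data.Vec.Properties as Vecₚ
  open import Data.Empty using (⊥; ⊥-elim)
  open import Data.Product using (∃-syntax; _×_; _,_; proj₁; proj₂)
  open import Data.Sum using (_⊎_; inj₁; inj₂)
  open import Function using (_∘_)
  open import Relation.Nullary using (yes; no; ¬_)
  open import Relation.Binary using (tri<; tri≈; tri>)
  open import Relation.Binary.PropositionalEquality

  private
    coordinate : ∀ {n} {u w v : Vec ℤ n} a {b B U} → v ≡ int a • u ⊕ w → Small B w → Small b v → Any (λ x → ∣ x ∣ ≡ U) u → a ℕ.* U ℕ.≤ b ℕ.+ B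
    coordinate {u = x ∷ u} {y ∷ w} {z ∷ v} a eq (hy ∷ hw) (hz ∷ hv) any with trans eq (trans (cong (_⊕ (y ∷ w)) (•-∷ (int a) x u)) (⊕-∷ _ y _ w))
    ... | eq′ with any
    ...   | there t = coordinate a (Vecₚ.∷-injectiveʳ eq′) hw hv t
    ...   | here refl = ℕₚ.≤-trans (ℕₚ.≤-reflexive (trans (sym (abs-* (int a) x)) (cong ∣_∣ (trans (lem (int a * x) y) (cong (λ t → t - y) (sym (Vecₚ.∷-injectiveˡ eq′)))))))
      (ℕₚ.≤-trans (∣i-j∣≤∣i∣+∣j∣ z y) (ℕₚ.+-mono-≤ hz hy))
      where
      lem : ∀ t y → t ≡ t + y - y
      lem = solve-∀

    maximal : ∀ {n} (u : Vec ℤ n) → u ≡ 𝟎 ⊎ (∃[ U ] (0 ℕ.< U × Small U u × Any (λ x → ∣ x ∣ ≡ U) u))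
    maximal [] = inj₁ refl
    maximal (x ∷ u) with maximal u | ∣ x ∣ ℕ.≟ 0
    ... | inj₁ refl | yes z = inj₁ (cong (_∷ 𝟎) (∣i∣≡0⇒i≡0 z))
    ... | inj₁ refl | no nz = inj₂ (∣ x ∣ , ℕₚ.n≢0⇒n>0 nz , ℕₚ.≤-refl ∷ Small-𝟎 _ , here refl)
    ... | inj₂ (U , 0<U , sm , at) | _ with ∣ x ∣ ℕ.≤? U
    ...   | yes le = inj₂ (U , 0<U , le ∷ sm , there at)
    ...   | no nle = inj₂ (∣ x ∣ , ℕₚ.<-trans 0<U (ℕₚ.≰⇒> nle) , ℕₚ.≤-refl ∷ Small-mono (ℕₚ.<⇒≤ (ℕₚ.≰⇒> nle)) sm , here refl)

  cell : ∀ {n} s .{{_ : ℕ.NonZero s}} → Vec ℕ n → Vec ℕ n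
  cell s = Vec.map (_/ s)

  cell-Small : ∀ {n} s .{{_ : ℕ.NonZero s}} (u v : Vec ℕ n) → cell s u ≡ cell s v → Small s (⌈ u ⌉ ⊖ ⌈ v ⌉)
  cell-Small s [] [] e = subst (Small s) (sym (⊖-self [])) []
  cell-Small s (x ∷ u) (y ∷ v) e = subst (Small s) (sym (⊖-∷ (int x) (int y) ⌈ u ⌉ ⌈ v ⌉)) (bound ∷ cell-Small s u v (Vecₚ.∷-injectiveʳ e))
    where
    lem : ∀ r q r′ → (r + q) - (r′ + q) ≡ r - r′
    lem = solve-∀
    diff : int x - int y ≡ int (x % s) - int (y % s)
    diff = trans (cong₂ (λ a b → int a - int b) (m≡m%n+[m/n]*n x s) (trans (m≡m%n+[m/n]*n y s) (cong (λ z → y % s ℕ.+ z ℕ.* s) (sym (Vecₚ.∷-injectiveˡ e)))))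
      (lem (int (x % s)) (int (x / s ℕ.* s)) (int (y % s)))
    bound : ∣ int x - int y ∣ ℕ.≤ s
    bound = ℕₚ.≤-trans (ℕₚ.≤-reflexive (trans (cong ∣_∣ diff) (cong ∣_∣ (m-n≡m⊖n (x % s) (y % s)))))
      (ℕₚ.≤-trans (∣m⊝n∣≤m⊔n (x % s) (y % s)) (ℕₚ.⊔-lub (ℕₚ.<⇒≤ (m%n<n x s)) (ℕₚ.<⇒≤ (m%n<n y s))))

  -- The elements α β, for β in a box of side A, are congruent to 1 modulo all primes up to w and have a dominant
  -- constant term. So they are not units, and each of them is singular modulo some prime larger than w.
  module Residues (l : ℕ) (pl : Prime l) (e m′ : ℕ) (dim : suc m′ ≡ (l ℕ.∸ 1) ℕ.* l ℕ.^ e) (w A : ℕ) (0<A : 0 ℕ.< A) where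

    open Ideals l pl e m′ dim public

    -- `W` is the factorial of w. `b₀` exceeds 𝒞 A, by which multiplication with a vector of entries
    -- below A can enlarge coefficients, so the constant term of `shift β` dominates. `S` bounds the
    -- coefficients of `α β`.
    W b₀ S : ℕ
    W = Π (upTo⁺ w) (λ i → i)
    b₀ = 𝒞 ℕ.* A ℕ.+ 1
    S = 1 ℕ.+ W ℕ.* (b₀ ℕ.* 1 ℕ.+ A)

    0<W : 0 ℕ.< W
    0<W = Π-0< (upTo⁺ w) (λ i∈ → proj₁ (upTo⁺-bounds i∈))

    shift : Vec ℕ m → V
    shift β = int b₀ • 𝟏 ⊕ ⌈ β ⌉

    α : Vec ℕ m → V
    α β = 𝟏 ⊕ int W • shift β

    α-⋆ : ∀ β u → α β ⋆ u ≡ u ⊕ int W • (shift β ⋆ u)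
    α-⋆ β u = trans (⋆-distribʳ 𝟏 _ u) (cong₂ _⊕_ (⋆-identityˡ u) (•-⋆ (int W) (shift β) u))

    α-Small : ∀ {β} → All (ℕ._< A) β → Small S (α β)
    α-Small h = Small-⊕ 𝟏-Small (Small-• ℕₚ.≤-refl (Small-⊕ (Small-• ℕₚ.≤-refl 𝟏-Small) (⌈⌉-Small h)))

    private
      a₀ : ℕ
      a₀ = 1 ℕ.+ W ℕ.* b₀

      α-⋆′ : ∀ β u → α β ⋆ u ≡ int a₀ • u ⊕ int W • (⌈ β ⌉ ⋆ u)
      α-⋆′ β u = trans (α-⋆ β u) (trans (cong (λ z → u ⊕ int W • z) (trans (⋆-distribʳ _ _ u) (cong (_⊕ ⌈ β ⌉ ⋆ u) (scalar-⋆ (int b₀) u))))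
        (trans (cong (u ⊕_) (•-⊕ (int W) _ _)) (trans (sym (⊕-assoc u _ _)) (cong (_⊕ int W • (⌈ β ⌉ ⋆ u))
        (trans (cong₂ _⊕_ (sym (1-• u)) (trans (sym (*-• (int W) (int b₀) u)) (cong (_• u) (sym (pos-* W b₀))))) (sym (+-• 1ℤ (int (W ℕ.* b₀)) u)))))))

      -- Where u attains its largest coefficient U, the constant term of `α β` contributes (1 + W
      -- b₀) U and the rest at most W 𝒞 A U, leaving at least U + W U > 1.
      too-large : ∀ {β} → All (ℕ._< A) β → ∀ u → u ≢ 𝟎 → ¬ Small 1 (α β ⋆ u)
      too-large {β} h u u≢ sm = finish (maximal u)
        where
        finish : u ≡ 𝟎 ⊎ (∃[ U ] (0 ℕ.< U × Small U u × Any (λ x → ∣ x ∣ ≡ U) u)) → ⊥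
        finish (inj₁ z) = u≢ z
        finish (inj₂ (U , 0<U , smU , at)) = ℕₚ.<-irrefl refl (ℕₚ.<-≤-trans strict (coordinate a₀ (α-⋆′ β u) (Small-• ℕₚ.≤-refl (⋆-Small (⌈⌉-Small h) smU)) sm at))
          where
          lem : ∀ U W C A → (1 ℕ.+ W ℕ.* (C ℕ.* A ℕ.+ 1)) ℕ.* U ≡ U ℕ.+ W ℕ.* (C ℕ.* (A ℕ.* U)) ℕ.+ W ℕ.* U
          lem = solve-∀ℕ
          strict : 1 ℕ.+ W ℕ.* (𝒞 ℕ.* (A ℕ.* U)) ℕ.< a₀ ℕ.* U
          strict = ℕₚ.<-≤-trans (ℕₚ.m<m+n _ (ℕₚ.*-mono-≤ 0<W 0<U)) (ℕₚ.≤-trans (ℕₚ.+-monoˡ-≤ (W ℕ.* U) (ℕₚ.+-monoˡ-≤ (W ℕ.* (𝒞 ℕ.* (A ℕ.* U))) 0<U)) (ℕₚ.≤-reflexive (sym (lem U W 𝒞 A))))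

      𝟏≢𝟎 : 𝟏 ≢ 𝟎
      𝟏≢𝟎 eq with +-injective (Vecₚ.∷-injectiveˡ eq)
      ... | ()

    α≢𝟎 : ∀ {β} → All (ℕ._< A) β → α β ≢ 𝟎
    α≢𝟎 {β} h z = too-large h 𝟏 𝟏≢𝟎 (subst (Small 1) (sym (trans (⋆-identityʳ (α β)) z)) (Small-𝟎 m))

    private
      ∣ᵥ-add : ∀ {p} (x y : V) → p ∣ᵥ x ⊕ y → p ∣ᵥ y → p ∣ᵥ x
      ∣ᵥ-add {p} x y h hy = subst (p ∣ᵥ_) (trans (⊕≡⇒⊖≡ (x ⊕ y) 𝟎 y x (trans (⊕-identityʳ _) (⊕-comm x y))) (⊖-𝟎 x)) (∣ᵥ-⊖ h hy)

      -- Descent on n: a prime p dividing n either does not divide u, and then u witnesses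
      -- singularity, or can be cancelled on both sides. The case n = 1 cannot occur, since the
      -- product would be too small for `too-large`.
      search : ∀ {β} → All (ℕ._< A) β → ∀ n → 0 ℕ.< n → ∀ u → α β ⋆ u ≡ int n • 𝟏 → ∃[ p ] (Prime p × Singular p (α β))
      search {β} h = <-rec _ step
        where
        step : ∀ n → (∀ {j} → j ℕ.< n → 0 ℕ.< j → ∀ u → α β ⋆ u ≡ int j • 𝟏 → ∃[ p ] (Prime p × Singular p (α β))) →
          0 ℕ.< n → ∀ u → α β ⋆ u ≡ int n • 𝟏 → ∃[ p ] (Prime p × Singular p (α β))
        step (suc zero) rec _ u eq = ⊥-elim (too-large h u (λ z → 𝟏≢𝟎 (trans (sym (1-• 𝟏)) (trans (sym eq) (trans (cong (α β ⋆_) z) (trans (⋆-comm (α β) 𝟎) (𝟎-⋆ (α β)))))))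
          (subst (Small 1) (sym (trans eq (1-• 𝟏))) 𝟏-Small))
        step n@(suc (suc _)) rec 0<n u eq = finish (∃-prime-divisor n (ℕ.s≤s (ℕ.s≤s ℕ.z≤n)))
          where
          finish : ∃[ p ] (Prime p × p ℕ∣.∣ n) → ∃[ p ] (Prime p × Singular p (α β))
          finish (p , pp , ℕ∣.divides k en) with p ∣ᵥ? u
          ... | no nd = p , pp , u , nd , subst (p ∣ᵥ_) (sym eq) (∣ᵥ-scalar 𝟏 (∣ᵤ⇒∣ (ℕ∣.divides k en)))
          ... | yes (u′ , refl) = rec k<n 0<k u′ (⊖≡𝟎⇒≡ _ _ (•-cancel (int p) _ (λ z → ℕₚ.<-irrefl (sym (cong ∣_∣ z)) (prime⇒0< pp))
            (trans (cong (int p •_) (⊖-as-⊕ _ _)) (trans (•-⊕ (int p) _ _) (trans (cong₂ _⊕_ (trans (sym (⋆-• (α β) (int p) u′)) (trans eq (trans (cong (λ z → int z • 𝟏) (trans en (ℕₚ.*-comm k p))) (trans (cong (_• 𝟏) (pos-* p k)) (*-• (int p) (int k) 𝟏)))))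
              (trans (sym (*-• (int p) -1ℤ _)) (trans (cong (_• (int k • 𝟏)) (*-comm (int p) -1ℤ)) (*-• -1ℤ (int p) _)))) (trans (sym (⊖-as-⊕ _ _)) (⊖-self _)))))))
            where
            0<k : 0 ℕ.< k
            0<k = ℕₚ.n≢0⇒n>0 λ z → ℕₚ.<-irrefl (sym (trans en (cong (ℕ._* p) z))) 0<n
            k<n : k ℕ.< n
            k<n = subst (k ℕ.<_) (sym en) (ℕₚ.m<m*n k p {{ℕ.>-nonZero 0<k}} (prime⇒1< pp))

      scalar-⊖ : ∀ i j → j ℕ.≤ i → int i • 𝟏 ⊖ int j • 𝟏 ≡ int (i ℕ.∸ j) • 𝟏
      scalar-⊖ i j le = trans (⊕≡⇒⊖≡ (int i • 𝟏) 𝟎 (int j • 𝟏) (int (i ℕ.∸ j) • 𝟏) (trans (⊕-identityʳ _) (trans (cong (λ z → int z • 𝟏) (sym (ℕₚ.m+[n∸m]≡n le))) (+-• (int j) (int (i ℕ.∸ j)) 𝟏)))) (⊖-𝟎 _)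

    p∤W : ∀ {p} → Prime p → w ℕ.< p → ¬ (int p ∣ᶻ int W)
    p∤W {p} pp w<p d = finish (prime-∣-Π {xs = upTo⁺ w} pp (∣⇒∣ᵤ d))
      where
      finish : ∃[ i ] (i ∈ upTo⁺ w × p ℕ∣.∣ i) → ⊥
      finish (i , i∈ , p∣i) with upTo⁺-bounds i∈
      ... | 0<i , i≤w = ℕₚ.<-irrefl refl (ℕₚ.<-≤-trans w<p (ℕₚ.≤-trans (ℕ∣.∣⇒≤ {{ℕ.>-nonZero 0<i}} p∣i) i≤w))

    Y : ℕ
    Y = (5 ℕ.* 𝒞 ℕ.* S) ℕ.^ m

    abstract
      -- Two of Y + 1 scalars agree modulo `α β`, so some positive integer is a multiple of it and
      -- `search` applies. The prime exceeds w because `α β` is 1 modulo the primes up to w, and it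
      -- is at most Y by `non-singular`.
      singular-prime : ∀ β → All (ℕ._< A) β → ∃[ p ] (Prime p × w ℕ.< p × p ℕ.≤ Y × Singular p (α β))
      singular-prime β h = located (start (collide {v = λ i → int i • 𝟏} S (suc Y ℕ.* 1) (ℕ.s≤s ℕ.z≤n) (ℕ.s≤s ℕ.z≤n) (below-unique (suc Y))
          (λ i∈ → Small-• (ℕₚ.<⇒≤ (below-< i∈)) 𝟏-Small) (α-Small h) (α≢𝟎 h) (ℕₚ.≤-reflexive (sym (length-below (suc Y))))))
        where
        start : ∃[ i ] ∃[ j ] (i ∈ below (suc Y) × j ∈ below (suc Y) × i ≢ j × ∃[ y ] int i • 𝟏 ⊖ int j • 𝟏 ≡ y ⋆ α β) → ∃[ p ] (Prime p × Singular p (α β))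
        start (i , j , _ , _ , i≢j , y , eq) with ℕₚ.<-cmp i j
        ... | tri≈ _ i≡j _ = ⊥-elim (i≢j i≡j)
        ... | tri> _ _ j<i = search h (i ℕ.∸ j) (ℕₚ.m<n⇒0<n∸m j<i) y (trans (⋆-comm (α β) y) (trans (sym eq) (scalar-⊖ i j (ℕₚ.<⇒≤ j<i))))
        ... | tri< i<j _ _ = search h (j ℕ.∸ i) (ℕₚ.m<n⇒0<n∸m i<j) (-1ℤ • y) (trans (⋆-• (α β) -1ℤ y) (trans (cong (-1ℤ •_) (trans (⋆-comm (α β) y) (sym eq)))
            (trans (⊖-flip _ _) (scalar-⊖ j i (ℕₚ.<⇒≤ i<j)))))
        located : ∃[ p ] (Prime p × Singular p (α β)) → ∃[ p ] (Prime p × w ℕ.< p × p ℕ.≤ Y × Singular p (α β))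
        located (p , pp , sing@(γ , p∤γ , p∣αγ)) = p , pp , ℕₚ.≰⇒> small-prime , ℕₚ.≮⇒≥ (λ lt → non-singular S pp (α≢𝟎 h) (α-Small h) (ℕ.s≤s ℕ.z≤n) lt sing) , sing
          where
          small-prime : ¬ (p ℕ.≤ w)
          small-prime p≤w = p∤γ (∣ᵥ-add γ _ (subst (p ∣ᵥ_) (α-⋆ β γ) p∣αγ) (∣ᵥ-scalar (shift β ⋆ γ) (∣ᵤ⇒∣ (∣-Π {f = λ i → i} (∈-upTo⁺ (prime⇒0< pp) p≤w)))))

    α-nonsingular : ∀ {p β β′} s → Prime p → w ℕ.< p → (∀ {δ} → δ ≢ 𝟎 → Small s δ → ¬ Singular p δ) → β ≢ β′ → Small s (⌈ β ⌉ ⊖ ⌈ β′ ⌉) →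
      ¬ Singular p (α β ⊖ α β′)
    α-nonsingular {p} {β} {β′} s pp w<p ns β≢ sm (γ , p∤γ , d) = ns (λ z → β≢ (⌈⌉-injective (⊖≡𝟎⇒≡ _ _ z))) sm
      (γ , p∤γ , ∣ᵥ-cancel {a = int W} pp (p∤W pp w<p) (subst (p ∣ᵥ_) (trans (cong (_⋆ γ) (affine-⊖ (int W) 𝟏 (int b₀ • 𝟏) ⌈ β ⌉ ⌈ β′ ⌉)) (•-⋆ (int W) (⌈ β ⌉ ⊖ ⌈ β′ ⌉) γ)) d))

    private
      default : Vec ℕ m → ℕ × V
      default β with All.all? (λ x → x ℕ.<? A) β
      ... | yes h = proj₁ (singular-prime β h) , proj₁ (proj₂ (proj₂ (proj₂ (proj₂ (singular-prime β h)))))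
      ... | no _ = 0 , 𝟎

    prime-of : Vec ℕ m → ℕ
    prime-of β = proj₁ (default β)

    kernel-of : Vec ℕ m → V
    kernel-of β = proj₂ (default β)

    prime-of-spec : ∀ {β} → All (ℕ._< A) β → Prime (prime-of β) × w ℕ.< prime-of β × prime-of β ℕ.≤ Y × ¬ (prime-of β ∣ᵥ kernel-of β) × prime-of β ∣ᵥ α β ⋆ kernel-of β
    prime-of-spec {β} h with All.all? (λ x → x ℕ.<? A) β
    ... | no nh = ⊥-elim (nh h)
    ... | yes h′ = let (p , pp , lo , hi , γ , a , b) = singular-prime β h′ in pp , lo , hi , a , b

    -- Within a cell the differences of the β have coefficients at most s, so the corresponding
    -- differences of the `α β` are nonsingular modulo p and `no-crowd` applies.
    crowd-bound : ∀ {p} s .{{_ : ℕ.NonZero s}} → Prime p → w ℕ.< p → (∀ {δ} → δ ≢ 𝟎 → Small s δ → ¬ Singular p δ) →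
      ∀ {c} ts → Unique ts → (∀ {β} → β ∈ ts → All (ℕ._< A) β × prime-of β ≡ p × cell s β ≡ c) → length ts ℕ.≤ m
    crowd-bound {p} s pp w<p ns {c} ts u h = no-crowd pp α kernel-of ts good (pairs ts u h)
      where
      good : ∀ {β} → β ∈ ts → ¬ (p ∣ᵥ kernel-of β) × p ∣ᵥ α β ⋆ kernel-of β
      good {β} β∈ with h β∈
      ... | hb , refl , _ = proj₁ (proj₂ (proj₂ (proj₂ (prime-of-spec hb)))) , proj₂ (proj₂ (proj₂ (proj₂ (prime-of-spec hb))))
      pairs : ∀ ts → Unique ts → (∀ {β} → β ∈ ts → All (ℕ._< A) β × prime-of β ≡ p × cell s β ≡ c) → AllPairs (λ β β′ → ¬ Singular p (α β ⊖ α β′)) ts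
      pairs [] [] h = []
      pairs (β ∷ ts) (β∉ ∷ u) h = ListAll.tabulate (λ {β′} β′∈ → α-nonsingular s pp w<p ns (∉⇒≢ β′∈ β∉)
        (cell-Small s β β′ (trans (proj₂ (proj₂ (h (here refl)))) (sym (proj₂ (proj₂ (h (there β′∈)))))))) ∷ pairs ts u (h ∘ there)

-- Primes congruent to 1 modulo a prime power.

module Dirichlet where

  open Rat
  open Sums
  open Mod
  open Sieve using (Π)
  open Harmonic
  open PrimeBounds
  open Carmichael using (^-distribʳ-*)
  open Geometry using (box; length-box; box-unique; box-<; ∈-box; _≟ᵥ_)
  open Singular
  open import Data.Nat as ℕ using (ℕ; zero; suc)
  import Data.Nat.Properties as ℕₚ
  open import Data.Nat.DivMod using (_/_; m<n⇒m/n≡0; /-monoˡ-≤; m/n*n≤m)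
  open import Data.Nat.Divisibility using (_∣_; _∣?_)
  open import Data.Nat.Primality using (Prime)
  open import Data.Nat.Tactic.RingSolver renaming (solve-∀ to solve-∀ℕ)
  open import Data.Bool using (true; false; if_then_else_)
  open import Data.Rational hiding (NonZero; _/_)
  open import Data.Rational.Properties
  open import Data.List using (List; []; _∷_; _++_; map; length; filter)
  open import Data.List.Properties using (length-map; length-++)
  open import Data.List.Membership.Propositional using (_∈_)
  open import Data.List.Membership.Propositional.Properties using (∈-filter⁻; ∈-filter⁺; ∈-map⁺; ∈-++⁺ˡ; ∈-++⁺ʳ)
  open import Data.List.Relation.Unary.Any using (here; there)
  open import Data.List.Relation.Unary.Unique.Propositional using (Unique)
  open import Data.Vec as Vec using (Vec; []; _∷_)
  open import Data.Vec.Relation.Unary.All as All using (All; []; _∷_)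
  open import Data.Empty using (⊥-elim)
  open import Data.Product using (∃-syntax; _×_; _,_; proj₁; proj₂)
  open import Relation.Nullary using (Dec; yes; no; ¬_; does)
  open import Relation.Nullary.Decidable using (dec-true)
  open import Relation.Binary using (DecidableEquality)
  open import Relation.Binary.PropositionalEquality
  open import Tactic.RingSolver using (solve-∀)

  ∑-∋ : {A : Set} {xs : List A} {f : A → ℚ} {x : A} → (∀ y → 0ℚ ≤ f y) → x ∈ xs → f x ≤ ∑ xs f
  ∑-∋ {xs = y ∷ xs} {f} nn (here refl) = ≤-by (∑ xs f) (∑-nonneg xs (λ {z} _ → nn z)) refl
  ∑-∋ {xs = y ∷ xs} {f} nn (there x∈) = ≤-trans (∑-∋ nn x∈) (≤-by (f y) (nn y) (+-comm (f y) (∑ xs f)))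

  fibres : {A B : Set} (_≟_ : DecidableEquality B) (f : A → B) (L : List A) (cs : List B) → (∀ {x} → x ∈ L → f x ∈ cs) →
    ν (length L) ≤ ∑ cs (λ c → ν (length (filter (λ x → f x ≟ c) L)))
  fibres _≟_ f L cs mem = ≤-trans (≡⇒≤ (sym (∑-1 L))) (≤-trans (∑-mono L covered)
    (≡⇒≤ (trans (∑-swap L cs _) (∑-cong cs (λ {c} _ → trans (sym (∑-filter (λ x → f x ≟ c) L (λ _ → 1ℚ))) (∑-1 (filter (λ x → f x ≟ c) L)))))))
    where
    ind : ∀ x c → ℚ
    ind x c = if does (f x ≟ c) then 1ℚ else 0ℚ
    0≤ind : ∀ x c → 0ℚ ≤ ind x c
    0≤ind x c with does (f x ≟ c)
    ... | true = 0≤1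
    ... | false = ≤-refl
    covered : ∀ {x} → x ∈ L → 1ℚ ≤ ∑ cs (ind x)
    covered {x} x∈ = ≤-trans (≡⇒≤ (sym (cong (if_then 1ℚ else 0ℚ) (dec-true (f x ≟ f x) refl)))) (∑-∋ {f = ind x} (0≤ind x) (mem x∈))

  primesIn : ℕ → ℕ → List ℕ
  primesIn w Y = filter (w <?′_) (primesUpTo Y)

  primesIn-spec : ∀ {p w Y} → p ∈ primesIn w Y → Prime p × w ℕ.< p × p ℕ.≤ Y
  primesIn-spec {w = w} {Y} p∈ with ∈-filter⁻ (w <?′_) {xs = primesUpTo Y} p∈
  ... | m , lo = primesUpTo-prime {R = Y} m , lo , primesUpTo-≤ {R = Y} m

  ∈-primesIn : ∀ {p w Y} → Prime p → w ℕ.< p → p ℕ.≤ Y → p ∈ primesIn w Y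
  ∈-primesIn {w = w} pp lo hi = ∈-filter⁺ (w <?′_) (∈-primesUpTo pp hi) lo

  primesIn-unique : ∀ w Y → Unique (primesIn w Y)
  primesIn-unique w Y = filter-unique (w <?′_) (primesUpTo-unique Y)

  ∑-squares : ∀ w n → 0 ℕ.< w → ∑ (below n) (λ i → ρ (suc (i ℕ.+ w) ℕ.* suc (i ℕ.+ w))) + ρ (n ℕ.+ w) ≤ ρ w
  ∑-squares w zero 0<w = ≡⇒≤ (+-identityˡ (ρ w))
  ∑-squares w (suc n) 0<w = ≤-trans (≡⇒≤ (lem (ρ (suc (n ℕ.+ w) ℕ.* suc (n ℕ.+ w))) rest (ρ (suc (n ℕ.+ w)))))
    (≤-trans (+-monoʳ-≤ rest (telescope (n ℕ.+ w) (ℕₚ.≤-trans 0<w (ℕₚ.m≤n+m w n)))) (∑-squares w n 0<w))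
    where
    rest = ∑ (below n) (λ i → ρ (suc (i ℕ.+ w) ℕ.* suc (i ℕ.+ w)))
    lem : ∀ a b c → a + b + c ≡ b + (a + c)
    lem = solve-∀ ringℚ

  prime-squares : ∀ w Y → 0 ℕ.< w → ∑ (primesIn w Y) (λ p → ρ (p ℕ.* p)) ≤ ρ w
  prime-squares w Y 0<w = ≤-trans (∑-⊆ {ys = map (λ i → suc (i ℕ.+ w)) (below Y)} {f = λ p → ρ (p ℕ.* p)} (primesIn-unique w Y) sub (λ p → 0≤ρ (p ℕ.* p)))
    (≤-trans (≡⇒≤ (∑-map (λ i → suc (i ℕ.+ w)) (below Y) (λ p → ρ (p ℕ.* p)))) (≤-trans (≤-by (ρ (Y ℕ.+ w)) (0≤ρ (Y ℕ.+ w)) refl) (∑-squares w Y 0<w)))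
    where
    sub : ∀ {p} → p ∈ primesIn w Y → p ∈ map (λ i → suc (i ℕ.+ w)) (below Y)
    sub {p} p∈ with primesIn-spec {w = w} {Y} p∈
    ... | _ , lo , hi = subst (_∈ map (λ i → suc (i ℕ.+ w)) (below Y)) eq (∈-map⁺ (λ i → suc (i ℕ.+ w)) (∈-below i<Y))
      where
      eq : suc (p ℕ.∸ suc w ℕ.+ w) ≡ p
      eq = trans (sym (ℕₚ.+-suc (p ℕ.∸ suc w) w)) (ℕₚ.m∸n+n≡m lo)
      i<Y : p ℕ.∸ suc w ℕ.< Y
      i<Y = ℕₚ.<-≤-trans (ℕₚ.∸-monoʳ-< {p} {suc w} {0} (ℕ.s≤s ℕ.z≤n) lo) hi

  module _ (l : ℕ) (pl : Prime l) (e m′ : ℕ) (dim : suc m′ ≡ (l ℕ.∸ 1) ℕ.* l ℕ.^ e) where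

    module Count (w A : ℕ) (0<A : 0 ℕ.< A) (l≤w : l ℕ.≤ w) where

      open Residues l pl e m′ dim w A 0<A using (m; 𝒞; 1≤𝒞; W; 0<W; S; Y; Singular; non-singular; non-singular²; prime-of; prime-of-spec; crowd-bound; V) public
      open Residues l pl e m′ dim w A 0<A using () renaming (_⋆_ to _⋆′_)

      D : ℕ
      D = l ℕ.^ suc e

      -- For p > w, a lower bound for the norm of the prime ideals above p: only the primes
      -- congruent to 1 modulo `D` can have ideals of norm p.
      P : ℕ → ℕ
      P p = if does (D ∣? p ℕ.∸ 1) then p else p ℕ.* p

      T : ℕ
      T = (20 ℕ.* 𝒞 ℕ.* A) ℕ.^ m

      fibre : ℕ → List (Vec ℕ m)
      fibre p = filter (λ β → prime-of β ℕ.≟ p) (box A m)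

      crowd : ∀ {p} s .{{_ : ℕ.NonZero s}} → Prime p → w ℕ.< p → (5 ℕ.* 𝒞 ℕ.* s) ℕ.^ m ℕ.< P p → ν (length (fibre p)) ≤ ν (suc (A / s) ℕ.^ m) * ν m
      crowd {p} s pp w<p big = ≤-trans (fibres _≟ᵥ_ (cell s) (fibre p) (box (suc (A / s)) m) cells)
        (≤-trans (∑-mono (box (suc (A / s)) m) (λ {c} _ → ν-mono (bounded c))) (≡⇒≤ (trans (∑-const (box (suc (A / s)) m) (ν m)) (cong (λ z → ν z * ν m) (length-box (suc (A / s)) m)))))
        where
        0<s : 0 ℕ.< s
        0<s = ℕ.>-nonZero⁻¹ s
        in-fibre : ∀ {β} → β ∈ fibre p → β ∈ box A m × prime-of β ≡ p
        in-fibre β∈ = ∈-filter⁻ (λ β → prime-of β ℕ.≟ p) {xs = box A m} β∈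
        cells : ∀ {β} → β ∈ fibre p → cell s β ∈ box (suc (A / s)) m
        cells β∈ = ∈-box (go (box-< (proj₁ (in-fibre β∈))))
          where
          go : ∀ {n} {v : Vec ℕ n} → All (ℕ._< A) v → All (ℕ._< suc (A / s)) (cell s v)
          go [] = []
          go (h ∷ hs) = ℕ.s≤s (/-monoˡ-≤ s (ℕₚ.<⇒≤ h)) ∷ go hs
        ns : ∀ {δ} → δ ≢ _ → _ → ¬ Singular p δ
        ns {δ} δ≢ sm = by-cases (D ∣? p ℕ.∸ 1) refl
          where
          by-cases : (d : Dec (D ∣ p ℕ.∸ 1)) → does (D ∣? p ℕ.∸ 1) ≡ does d → ¬ Singular p δ
          by-cases (yes _) eq = non-singular s pp δ≢ sm 0<s (subst ((5 ℕ.* 𝒞 ℕ.* s) ℕ.^ m ℕ.<_) (cong (if_then p else p ℕ.* p) eq) big)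
          by-cases (no nd) eq = non-singular² s pp (λ p≡l → ℕₚ.<-irrefl (sym p≡l) (ℕₚ.≤-<-trans l≤w w<p)) nd δ≢ sm 0<s (subst ((5 ℕ.* 𝒞 ℕ.* s) ℕ.^ m ℕ.<_) (cong (if_then p else p ℕ.* p) eq) big)
        bounded : ∀ c → length (filter (λ β → cell s β ≟ᵥ c) (fibre p)) ℕ.≤ m
        bounded c = crowd-bound s pp w<p ns {c} _ (filter-unique (λ β → cell s β ≟ᵥ c) (filter-unique (λ β → prime-of β ℕ.≟ p) (box-unique A m))) facts
          where
          facts : ∀ {β} → β ∈ filter (λ β → cell s β ≟ᵥ c) (fibre p) → All (ℕ._< A) β × prime-of β ≡ p × cell s β ≡ c
          facts β∈ with ∈-filter⁻ (λ β → cell s β ≟ᵥ c) {xs = fibre p} β∈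
          ... | β∈′ , ec = box-< (proj₁ (in-fibre β∈′)) , proj₂ (in-fibre β∈′) , ec

      -- The largest side s for which cells of side s are guaranteed to be uncrowded.
      side : ∀ N k → (5 ℕ.* 𝒞 ℕ.* 1) ℕ.^ m ℕ.< N → N ℕ.≤ (5 ℕ.* 𝒞 ℕ.* suc k) ℕ.^ m →
        ∃[ s ] (0 ℕ.< s × (5 ℕ.* 𝒞 ℕ.* s) ℕ.^ m ℕ.< N × N ℕ.≤ (5 ℕ.* 𝒞 ℕ.* suc s) ℕ.^ m)
      side N zero lo hi = ⊥-elim (ℕₚ.<-irrefl refl (ℕₚ.<-≤-trans lo hi))
      side N (suc k) lo hi = by-cases ((5 ℕ.* 𝒞 ℕ.* suc k) ℕ.^ m ℕ.<? N)
        where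
        by-cases : Dec ((5 ℕ.* 𝒞 ℕ.* suc k) ℕ.^ m ℕ.< N) → _
        by-cases (yes lt) = suc k , ℕ.s≤s ℕ.z≤n , lt , hi
        by-cases (no nlt) = side N k lo (ℕₚ.≮⇒≥ nlt)

      -- Take the largest side s with (5 𝒞 s)^m < `P p`; the lower bound for w makes s = 1
      -- admissible. There is one cell if s > A, and otherwise there are at most T / `P p`, because
      -- (A/s + 1)(s + 1) ≤ 2 (A + s) ≤ 4 A, which explains the 20 in T.
      fibre-bound : ∀ {p} → (5 ℕ.* 𝒞 ℕ.* 1) ℕ.^ m ℕ.≤ w → Prime p → w ℕ.< p → ν (length (fibre p)) ≤ (ν T * ρ (P p) + 1ℚ) * ν m
      fibre-bound {p} w-large pp w<p = finish (side (P p) (P p) (ℕₚ.≤-<-trans w-large (ℕₚ.<-≤-trans w<p p≤P)) P≤)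
        where
        p≤P : p ℕ.≤ P p
        p≤P with does (D ∣? p ℕ.∸ 1)
        ... | true = ℕₚ.≤-refl
        ... | false = ℕₚ.m≤m*n p p {{ℕ.>-nonZero (prime⇒0< pp)}}
        0<P : 0 ℕ.< P p
        0<P = ℕₚ.≤-trans (prime⇒0< pp) p≤P
        P≤ : P p ℕ.≤ (5 ℕ.* 𝒞 ℕ.* suc (P p)) ℕ.^ m
        P≤ = ℕₚ.≤-trans (ℕₚ.n≤1+n (P p)) (ℕₚ.≤-trans (ℕₚ.m≤n*m (suc (P p)) (5 ℕ.* 𝒞) {{ℕ.>-nonZero (ℕₚ.*-mono-≤ {1} {5} {1} {𝒞} (ℕ.s≤s ℕ.z≤n) 1≤𝒞)}})
          (ℕₚ.m≤m*n _ _ {{ℕₚ.m^n≢0 (5 ℕ.* 𝒞 ℕ.* suc (P p)) m′ {{ℕ.>-nonZero (ℕₚ.*-mono-≤ {1} {5 ℕ.* 𝒞} {1} (ℕₚ.*-mono-≤ {1} {5} {1} {𝒞} (ℕ.s≤s ℕ.z≤n) 1≤𝒞) (ℕ.s≤s ℕ.z≤n))}}}}))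
        finish : ∃[ s ] (0 ℕ.< s × (5 ℕ.* 𝒞 ℕ.* s) ℕ.^ m ℕ.< P p × P p ℕ.≤ (5 ℕ.* 𝒞 ℕ.* suc s) ℕ.^ m) → ν (length (fibre p)) ≤ (ν T * ρ (P p) + 1ℚ) * ν m
        finish (s , 0<s , lo , hi) = ≤-trans (crowd s pp w<p lo) (*-monoʳ (0≤ν m) cells≤)
          where
          instance
            s≢0 : ℕ.NonZero s
            s≢0 = ℕ.>-nonZero 0<s
          N = suc (A / s) ℕ.^ m
          NP≤ : N ℕ.* P p ℕ.≤ T ℕ.+ P p
          NP≤ with s ℕ.≤? A
          ... | no A<s = ℕₚ.≤-trans (ℕₚ.≤-reflexive (trans (cong (λ z → suc z ℕ.^ m ℕ.* P p) (m<n⇒m/n≡0 (ℕₚ.≰⇒> A<s))) (trans (cong (ℕ._* P p) (ℕₚ.^-zeroˡ m)) (ℕₚ.*-identityˡ (P p))))) (ℕₚ.m≤n+m (P p) T)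
          ... | yes s≤A = ℕₚ.≤-trans (ℕₚ.*-monoʳ-≤ N hi) (ℕₚ.≤-trans (ℕₚ.≤-reflexive (sym (^-distribʳ-* (suc (A / s)) (5 ℕ.* 𝒞 ℕ.* suc s) m)))
              (ℕₚ.≤-trans (ℕₚ.^-monoˡ-≤ m base≤) (ℕₚ.m≤m+n T (P p))))
            where
            lem : ∀ q C s → suc q ℕ.* (5 ℕ.* C ℕ.* (s ℕ.+ s)) ≡ 10 ℕ.* C ℕ.* (q ℕ.* s ℕ.+ s)
            lem = solve-∀ℕ
            lem₂ : ∀ C A → 10 ℕ.* C ℕ.* (A ℕ.+ A) ≡ 20 ℕ.* C ℕ.* A
            lem₂ = solve-∀ℕ
            base≤ : suc (A / s) ℕ.* (5 ℕ.* 𝒞 ℕ.* suc s) ℕ.≤ 20 ℕ.* 𝒞 ℕ.* A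
            base≤ = ℕₚ.≤-trans (ℕₚ.*-monoʳ-≤ (suc (A / s)) (ℕₚ.*-monoʳ-≤ (5 ℕ.* 𝒞) (ℕₚ.+-monoˡ-≤ s 0<s))) (ℕₚ.≤-trans (ℕₚ.≤-reflexive (lem (A / s) 𝒞 s))
              (ℕₚ.≤-trans (ℕₚ.*-monoʳ-≤ (10 ℕ.* 𝒞) (ℕₚ.+-mono-≤ (m/n*n≤m A s) s≤A)) (ℕₚ.≤-reflexive (lem₂ 𝒞 A))))
          lem : ∀ t x r → (t + x) * r ≡ t * r + x * r
          lem = solve-∀ ringℚ
          cells≤ : ν N ≤ ν T * ρ (P p) + 1ℚ
          cells≤ = ≤-trans (≡⇒≤ (sym (trans (cong (_* ρ (P p)) (ν-* N (P p))) (trans (*-assoc (ν N) (ν (P p)) (ρ (P p))) (trans (cong (ν N *_) (νρ 0<P)) (*-identityʳ (ν N)))))))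
            (≤-trans (*-monoʳ (0≤ρ (P p)) (ν-mono NP≤)) (≡⇒≤ (trans (cong (_* ρ (P p)) (ν-+ T (P p))) (trans (lem (ν T) (ν (P p)) (ρ (P p))) (cong (ν T * ρ (P p) +_) (νρ 0<P))))))

      split : ℕ → List ℕ
      split Y = filter (λ p → D ∣? p ℕ.∸ 1) (primesIn w Y)

      -- Each of the A^m elements is assigned to one prime above w. Primes not congruent to 1 enter
      -- with 1/p^2, and these add up to at most 1/w.
      count : (5 ℕ.* 𝒞 ℕ.* 1) ℕ.^ m ℕ.≤ w → 0 ℕ.< w → ∀ Y′ → Y ℕ.≤ Y′ → ν (A ℕ.^ m) ≤ (ν T * (∑ (split Y′) ρ + ρ w) + ν (length (primesIn w Y′))) * ν m
      count w-large 0<w Y′ Y≤Y′ = ≤-trans (≡⇒≤ (cong ν (sym (length-box A m)))) (≤-trans (fibres ℕ._≟_ prime-of (box A m) Ps mem)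
        (≤-trans (∑-mono Ps (λ p∈ → let (pp , lo , _) = primesIn-spec {w = w} {Y′} p∈ in fibre-bound w-large pp lo))
        (≤-trans (≡⇒≤ (trans (∑-*ʳ Ps (ν m) _) (cong (_* ν m) (trans (∑-+ Ps _ _) (cong₂ _+_ (∑-*ˡ Ps (ν T) _) (∑-1 Ps))))))
        (*-monoʳ (0≤ν m) (+-monoˡ-≤ (ν (length Ps)) (*-monoˡ (0≤ν T) reciprocals))))))
        where
        Ps = primesIn w Y′
        mem : ∀ {β} → β ∈ box A m → prime-of β ∈ Ps
        mem β∈ = let (pp , lo , hi , _) = prime-of-spec (box-< β∈) in ∈-primesIn pp lo (ℕₚ.≤-trans hi Y≤Y′)
        pick : ∀ p → ρ (P p) ≤ (if does (D ∣? p ℕ.∸ 1) then ρ p else 0ℚ) + ρ (p ℕ.* p)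
        pick p with does (D ∣? p ℕ.∸ 1)
        ... | true = ≤-by (ρ (p ℕ.* p)) (0≤ρ (p ℕ.* p)) refl
        ... | false = ≡⇒≤ (sym (+-identityˡ (ρ (p ℕ.* p))))
        reciprocals : ∑ Ps (λ p → ρ (P p)) ≤ ∑ (split Y′) ρ + ρ w
        reciprocals = ≤-trans (∑-mono Ps (λ {p} _ → pick p)) (≤-trans (≡⇒≤ (∑-+ Ps _ _)) (+-mono-≤ (≡⇒≤ (sym (∑-filter (λ p → D ∣? p ℕ.∸ 1) Ps ρ))) (prime-squares w Y′ 0<w)))

  prime-count : ∀ v y → 5 ℕ.* v ℕ.≤ y → length (primesUpTo (2 ℕ.^ y)) ℕ.* v ℕ.≤ 2 ℕ.^ v ℕ.* v ℕ.+ 16 ℕ.* 2 ℕ.^ y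
  prime-count v y 5v≤y = ℕₚ.≤-trans (ℕₚ.*-monoˡ-≤ v (ℕₚ.≤-trans (length-⊆ {ys = upTo⁺ (2 ℕ.^ v) ++ large} (primesUpTo-unique (2 ℕ.^ y)) cover)
      (ℕₚ.≤-reflexive (trans (length-++ (upTo⁺ (2 ℕ.^ v))) (cong (ℕ._+ length large) (trans (length-map suc (below (2 ℕ.^ v))) (length-below (2 ℕ.^ v))))))))
    (ℕₚ.≤-trans (ℕₚ.≤-reflexive (ℕₚ.*-distribʳ-+ v (2 ℕ.^ v) (length large))) (ℕₚ.+-monoʳ-≤ (2 ℕ.^ v ℕ.* v) large≤))
    where
    large = primesIn (2 ℕ.^ v) (2 ℕ.^ y)
    N = 2 ℕ.* 2 ℕ.^ y
    cover : ∀ {p} → p ∈ primesUpTo (2 ℕ.^ y) → p ∈ upTo⁺ (2 ℕ.^ v) ++ large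
    cover {p} p∈ with 2 ℕ.^ v <?′ p
    ... | yes lt = ∈-++⁺ʳ (upTo⁺ (2 ℕ.^ v)) (∈-filter⁺ (2 ℕ.^ v <?′_) p∈ lt)
    ... | no nlt = ∈-++⁺ˡ (∈-upTo⁺ (prime⇒0< (primesUpTo-prime {R = 2 ℕ.^ y} p∈)) (ℕₚ.≮⇒≥ nlt))
    N≥ : 2 ℕ.^ (5 ℕ.* v) ℕ.≤ N
    N≥ = ℕₚ.≤-trans (2^-mono 5v≤y) (ℕₚ.m≤n*m (2 ℕ.^ y) 2)
    bound : ν (length large) * (ν v * ρ 4) ≤ ν N + ν N
    bound = primes-bound v N N≥ (primesIn-unique (2 ℕ.^ v) (2 ℕ.^ y)) λ p∈ → let (pp , lo , hi) = primesIn-spec {w = 2 ℕ.^ v} {2 ℕ.^ y} p∈ in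
      pp , lo , ℕₚ.≤-<-trans hi (ℕₚ.m<m+n (2 ℕ.^ y) (ℕₚ.≤-trans (ℕₚ.m^n>0 2 y) (ℕₚ.≤-reflexive (sym (ℕₚ.+-identityʳ (2 ℕ.^ y))))))
    large≤ : length large ℕ.* v ℕ.≤ 16 ℕ.* 2 ℕ.^ y
    large≤ = ν-cancel (≤-trans (≡⇒≤ (trans (ν-* (length large) v) (trans (sym (*-identityʳ _)) (trans (cong (ν (length large) * ν v *_) (sym (ρν {4} (ℕ.s≤s ℕ.z≤n)))) (lem (ν (length large)) (ν v) (ρ 4) (ν 4))))))
      (≤-trans (*-monoʳ (0≤ν 4) bound) (≡⇒≤ (trans (cong (_* ν 4) (sym (ν-+ N N))) (trans (sym (ν-* (N ℕ.+ N) 4)) (cong ν (lem₂ (2 ℕ.^ y))))))))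
      where
      lem : ∀ a b c d → a * b * (c * d) ≡ a * (b * c) * d
      lem = solve-∀ ringℚ
      lem₂ : ∀ x → (2 ℕ.* x ℕ.+ 2 ℕ.* x) ℕ.* 4 ≡ 16 ℕ.* x
      lem₂ = solve-∀ℕ

  n<2^n : ∀ n → n ℕ.< 2 ℕ.^ n
  n<2^n zero = ℕ.s≤s ℕ.z≤n
  n<2^n (suc n) = ℕₚ.≤-trans (ℕₚ.+-mono-≤ (ℕₚ.m^n>0 2 n) (n<2^n n)) (ℕₚ.+-monoʳ-≤ (2 ℕ.^ n) (ℕₚ.≤-reflexive (sym (ℕₚ.+-identityʳ (2 ℕ.^ n)))))

  abstract
    -- In `count`, T m is K₀ A^m. The term 1/w accounts for at most a quarter of A^m because 4 K₀ ≤
    -- w, and the number of primes for another quarter. The primes congruent to 1 account for the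
    -- rest, so their reciprocal sum is at least 1/(2 K₀), a bound independent of w.
    dirichlet : ∀ {l} → Prime l → ∀ e → ∃[ K ] ∃[ w₀ ] (0 ℕ.< K × (∀ w → w₀ ℕ.≤ w → ∃[ Y ] ρ K ≤ ∑ (filter (λ p → l ℕ.^ suc e ∣? p ℕ.∸ 1) (primesIn w Y)) ρ))
    dirichlet {l} pl e = 2 ℕ.* K₀ , w₀ , ℕₚ.*-mono-≤ {1} {2} {1} (ℕ.s≤s ℕ.z≤n) 0<K₀ , step
      where
      M m′ m C K₀ w₀ : ℕ
      M = (l ℕ.∸ 1) ℕ.* l ℕ.^ e
      m′ = M ℕ.∸ 1
      m = suc m′
      0<M : 0 ℕ.< M
      0<M = ℕₚ.*-mono-≤ {1} {l ℕ.∸ 1} {1} (ℕₚ.m<n⇒0<n∸m (prime⇒1< pl)) (ℕₚ.m^n>0 l {{ℕ.>-nonZero (prime⇒0< pl)}} e)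
      dim : m ≡ M
      dim = ℕₚ.m+[n∸m]≡n 0<M
      C = 2 ℕ.^ m
      K₀ = m ℕ.* (20 ℕ.* C) ℕ.^ m
      w₀ = l ℕ.+ ((5 ℕ.* C ℕ.* 1) ℕ.^ m ℕ.+ 4 ℕ.* K₀)
      0<K₀ : 0 ℕ.< K₀
      0<K₀ = ℕₚ.*-mono-≤ {1} {m} {1} (ℕ.s≤s ℕ.z≤n) (ℕₚ.m^n>0 (20 ℕ.* C) {{ℕ.>-nonZero (ℕₚ.*-mono-≤ {1} {20} {1} (ℕ.s≤s ℕ.z≤n) (ℕₚ.m^n>0 2 m))}} m)
      step : ∀ w → w₀ ℕ.≤ w → ∃[ Y ] ρ (2 ℕ.* K₀) ≤ ∑ (filter (λ p → l ℕ.^ suc e ∣? p ℕ.∸ 1) (primesIn w Y)) ρ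
      step w w₀≤w = 2 ℕ.^ y , *-cancelˡ 0<2K₀ (≤-trans (≡⇒≤ (νρ 0<2K₀ℕ)) final)
        where
        W Z g v A y : ℕ
        W = Π (upTo⁺ w) (λ i → i)
        Z = 5 ℕ.* C ℕ.* (W ℕ.* (C ℕ.+ 3))
        g = Z
        -- Y is at most 2^(g m) A^m, where g depends on w. The proportion of primes below such a
        -- bound is of order 1/v, and v is chosen to outweigh the factor 2^(g m).
        v = 128 ℕ.* (m ℕ.* 2 ℕ.^ (g ℕ.* m))
        A = 2 ℕ.^ (5 ℕ.* v)
        y = (g ℕ.+ 5 ℕ.* v) ℕ.* m
        0<A : 0 ℕ.< A
        0<A = ℕₚ.m^n>0 2 (5 ℕ.* v)
        l≤w : l ℕ.≤ w
        l≤w = ℕₚ.≤-trans (ℕₚ.m≤m+n l _) w₀≤w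
        0<w : 0 ℕ.< w
        0<w = ℕₚ.≤-trans (prime⇒0< pl) l≤w
        w-large : (5 ℕ.* C ℕ.* 1) ℕ.^ m ℕ.≤ w
        w-large = ℕₚ.≤-trans (ℕₚ.≤-trans (ℕₚ.m≤m+n ((5 ℕ.* C ℕ.* 1) ℕ.^ m) (4 ℕ.* K₀)) (ℕₚ.m≤n+m ((5 ℕ.* C ℕ.* 1) ℕ.^ m ℕ.+ 4 ℕ.* K₀) l)) w₀≤w
        4K₀≤w : 4 ℕ.* K₀ ℕ.≤ w
        4K₀≤w = ℕₚ.≤-trans (ℕₚ.≤-trans (ℕₚ.m≤n+m (4 ℕ.* K₀) ((5 ℕ.* C ℕ.* 1) ℕ.^ m)) (ℕₚ.m≤n+m ((5 ℕ.* C ℕ.* 1) ℕ.^ m ℕ.+ 4 ℕ.* K₀) l)) w₀≤w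
        0<2K₀ℕ : 0 ℕ.< 2 ℕ.* K₀
        0<2K₀ℕ = ℕₚ.*-mono-≤ {1} {2} {1} (ℕ.s≤s ℕ.z≤n) 0<K₀
        0<2K₀ : 0ℚ < ν (2 ℕ.* K₀)
        0<2K₀ = 0<ν 0<2K₀ℕ
        open Count l pl e m′ dim w A 0<A l≤w using (Y; S; T; count; 0<W; 1≤𝒞)
        S≤ : S ℕ.≤ W ℕ.* (C ℕ.+ 3) ℕ.* A
        S≤ = ℕₚ.≤-trans (ℕₚ.+-mono-≤ (ℕₚ.*-mono-≤ 0<W 0<A) (ℕₚ.*-monoʳ-≤ W (ℕₚ.+-monoˡ-≤ A (ℕₚ.*-monoˡ-≤ 1 (ℕₚ.+-monoʳ-≤ (C ℕ.* A) 0<A))))) (ℕₚ.≤-reflexive (lem W C A))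
          where
          lem : ∀ W C A → W ℕ.* A ℕ.+ W ℕ.* ((C ℕ.* A ℕ.+ A) ℕ.* 1 ℕ.+ A) ≡ W ℕ.* (C ℕ.+ 3) ℕ.* A
          lem = solve-∀ℕ
        Y≤ : Y ℕ.≤ 2 ℕ.^ y
        Y≤ = ℕₚ.≤-trans (ℕₚ.^-monoˡ-≤ m (ℕₚ.≤-trans (ℕₚ.*-monoʳ-≤ (5 ℕ.* C) S≤) (ℕₚ.≤-trans (ℕₚ.≤-reflexive (sym (ℕₚ.*-assoc (5 ℕ.* C) (W ℕ.* (C ℕ.+ 3)) A)))
          (ℕₚ.≤-trans (ℕₚ.*-monoˡ-≤ A (ℕₚ.<⇒≤ (n<2^n Z))) (ℕₚ.≤-reflexive (sym (ℕₚ.^-distribˡ-+-* 2 g (5 ℕ.* v)))))))) (ℕₚ.≤-reflexive (ℕₚ.^-*-assoc 2 (g ℕ.+ 5 ℕ.* v) m))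
        Aᵐ : ℕ
        Aᵐ = A ℕ.^ m
        2^y : 2 ℕ.^ y ≡ 2 ℕ.^ (g ℕ.* m) ℕ.* Aᵐ
        2^y = trans (cong (2 ℕ.^_) (ℕₚ.*-distribʳ-+ m g (5 ℕ.* v))) (trans (ℕₚ.^-distribˡ-+-* 2 (g ℕ.* m) (5 ℕ.* v ℕ.* m)) (cong (2 ℕ.^ (g ℕ.* m) ℕ.*_) (sym (ℕₚ.^-*-assoc 2 (5 ℕ.* v) m))))
        0<2^gm : 0 ℕ.< 2 ℕ.^ (g ℕ.* m)
        0<2^gm = ℕₚ.m^n>0 2 (g ℕ.* m)
        8m≤v : 8 ℕ.* m ℕ.≤ v
        8m≤v = ℕₚ.*-mono-≤ {8} {128} (ℕₚ.m≤m+n 8 120) (ℕₚ.m≤m*n m (2 ℕ.^ (g ℕ.* m)) {{ℕ.>-nonZero 0<2^gm}})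
        0<v : 0 ℕ.< v
        0<v = ℕₚ.≤-trans (ℕₚ.*-mono-≤ {1} {8} {1} {m} (ℕ.s≤s ℕ.z≤n) (ℕ.s≤s ℕ.z≤n)) 8m≤v
        n : ℕ
        n = length (primesIn w (2 ℕ.^ y))
        small-part : 8 ℕ.* m ℕ.* 2 ℕ.^ v ℕ.≤ Aᵐ
        small-part = ℕₚ.≤-trans (ℕₚ.*-monoˡ-≤ (2 ℕ.^ v) (ℕₚ.≤-trans 8m≤v (ℕₚ.<⇒≤ (n<2^n v)))) (ℕₚ.≤-trans (ℕₚ.≤-reflexive (sym (ℕₚ.^-distribˡ-+-* 2 v v)))
          (ℕₚ.≤-trans (2^-mono (ℕₚ.≤-trans (ℕₚ.≤-reflexive (lem v)) (ℕₚ.*-monoˡ-≤ v (ℕₚ.m≤m+n 2 3)))) (ℕₚ.m≤m*n A (A ℕ.^ m′) {{ℕₚ.m^n≢0 A m′ {{ℕ.>-nonZero 0<A}}}})))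
          where
          lem : ∀ v → v ℕ.+ v ≡ 2 ℕ.* v
          lem = solve-∀ℕ
        sparse : 4 ℕ.* (m ℕ.* n) ℕ.≤ Aᵐ
        sparse = ℕₚ.*-cancelʳ-≤ (4 ℕ.* (m ℕ.* n)) Aᵐ (2 ℕ.* v) {{ℕ.>-nonZero (ℕₚ.*-mono-≤ {1} {2} {1} (ℕ.s≤s ℕ.z≤n) 0<v)}}
          (ℕₚ.≤-trans (ℕₚ.≤-reflexive (lem₁ m n v)) (ℕₚ.≤-trans (ℕₚ.*-monoʳ-≤ (8 ℕ.* m) (ℕₚ.≤-trans (ℕₚ.*-monoˡ-≤ v n≤) (prime-count v y 5v≤y)))
          (ℕₚ.≤-trans (ℕₚ.≤-reflexive (trans (lem₂ m (2 ℕ.^ v) v (2 ℕ.^ y)) (cong (λ z → 8 ℕ.* m ℕ.* 2 ℕ.^ v ℕ.* v ℕ.+ 128 ℕ.* m ℕ.* z) 2^y)))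
          (ℕₚ.≤-trans (ℕₚ.+-monoˡ-≤ _ (ℕₚ.*-monoˡ-≤ v small-part)) (ℕₚ.≤-reflexive (lem₃ Aᵐ v m (2 ℕ.^ (g ℕ.* m)) refl))))))
          where
          lem₁ : ∀ m n v → 4 ℕ.* (m ℕ.* n) ℕ.* (2 ℕ.* v) ≡ 8 ℕ.* m ℕ.* (n ℕ.* v)
          lem₁ = solve-∀ℕ
          lem₂ : ∀ m a v b → 8 ℕ.* m ℕ.* (a ℕ.* v ℕ.+ 16 ℕ.* b) ≡ 8 ℕ.* m ℕ.* a ℕ.* v ℕ.+ 128 ℕ.* m ℕ.* b
          lem₂ = solve-∀ℕ
          lem₄ : ∀ a m b → a ℕ.* (128 ℕ.* (m ℕ.* b)) ℕ.+ 128 ℕ.* m ℕ.* (b ℕ.* a) ≡ a ℕ.* (2 ℕ.* (128 ℕ.* (m ℕ.* b)))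
          lem₄ = solve-∀ℕ
          lem₃ : ∀ a v m b → v ≡ 128 ℕ.* (m ℕ.* b) → a ℕ.* v ℕ.+ 128 ℕ.* m ℕ.* (b ℕ.* a) ≡ a ℕ.* (2 ℕ.* v)
          lem₃ a _ m b refl = lem₄ a m b
          n≤ : n ℕ.≤ length (primesUpTo (2 ℕ.^ y))
          n≤ = length-⊆ (primesIn-unique w (2 ℕ.^ y)) (λ p∈ → proj₁ (∈-filter⁻ (w <?′_) {xs = primesUpTo (2 ℕ.^ y)} p∈))
          5v≤y : 5 ℕ.* v ℕ.≤ y
          5v≤y = ℕₚ.≤-trans (ℕₚ.m≤n+m (5 ℕ.* v) g) (ℕₚ.m≤m*n (g ℕ.+ 5 ℕ.* v) m)
        Σ : ℚ
        Σ = ∑ (filter (λ p → l ℕ.^ suc e ∣? p ℕ.∸ 1) (primesIn w (2 ℕ.^ y))) ρ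
        a k : ℚ
        a = ν Aᵐ
        k = ν K₀
        0<a : 0ℚ < a
        0<a = 0<ν (ℕₚ.m^n>0 A {{ℕ.>-nonZero 0<A}} m)
        main : a ≤ a * (k * (Σ + ρ w)) + ν (m ℕ.* n)
        main = ≤-trans (count w-large 0<w (2 ℕ.^ y) Y≤) (≡⇒≤ (trans (lem (ν T) (Σ + ρ w) (ν n) (ν m)) (cong₂ _+_ (trans (cong (_* (Σ + ρ w)) e₁) (*-assoc a k (Σ + ρ w))) (sym (ν-* m n)))))
          where
          lem : ∀ t s n m → (t * s + n) * m ≡ t * m * s + m * n
          lem = solve-∀ ringℚ
          e₁ : ν T * ν m ≡ a * k
          e₁ = trans (sym (ν-* T m)) (trans (cong ν (trans (cong (ℕ._* m) (^-distribʳ-* (20 ℕ.* C) A m)) (lem₂ ((20 ℕ.* C) ℕ.^ m) Aᵐ m))) (ν-* Aᵐ K₀))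
            where
            lem₂ : ∀ c a m → c ℕ.* a ℕ.* m ≡ a ℕ.* (m ℕ.* c)
            lem₂ = solve-∀ℕ
        kw : ν 4 * (k * ρ w) ≤ 1ℚ
        kw = ≤-trans (≡⇒≤ (trans (sym (*-assoc (ν 4) k (ρ w))) (cong (_* ρ w) (sym (ν-* 4 K₀))))) (≤-trans (*-monoʳ (0≤ρ w) (ν-mono 4K₀≤w)) (≡⇒≤ (νρ 0<w)))
        mn : ν 4 * ν (m ℕ.* n) ≤ a
        mn = ≤-trans (≡⇒≤ (sym (ν-* 4 (m ℕ.* n)))) (ν-mono sparse)
        four : ν 4 ≡ 1ℚ + 1ℚ + 1ℚ + 1ℚ
        four = trans (ν-suc 3) (trans (cong (1ℚ +_) (trans (ν-suc 2) (cong (1ℚ +_) (trans (ν-suc 1) (cong (1ℚ +_) ν1))))) refl)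
        two : ν 2 ≡ 1ℚ + 1ℚ
        two = trans (ν-suc 1) (cong (1ℚ +_) ν1)
        final : 1ℚ ≤ ν (2 ℕ.* K₀) * Σ
        final = *-cancelˡ 0<a (*-cancelˡ (0<ν {2} (ℕ.s≤s ℕ.z≤n)) (≤-by (ν 4 * (main-slack) + a * (1ℚ - ν 4 * (k * ρ w)) + (a - ν 4 * ν (m ℕ.* n)))
          (0≤+ (0≤+ (0≤* (0≤ν 4) (≤⇒0≤- main)) (0≤* (<⇒≤ 0<a) (≤⇒0≤- kw))) (≤⇒0≤- mn)) (trans (cong₂ (λ x z → x * (a * (z * Σ))) two (trans (ν-* 2 K₀) (cong (_* k) two)))
          (trans (lem a k Σ (ρ w) (ν (m ℕ.* n))) (sym (cong₂ (λ f t → t * (a * 1ℚ) + (f * (a * (k * (Σ + ρ w)) + ν (m ℕ.* n) - a) + a * (1ℚ - f * (k * ρ w)) + (a - f * ν (m ℕ.* n)))) four two))))))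
          where
          main-slack : ℚ
          main-slack = a * (k * (Σ + ρ w)) + ν (m ℕ.* n) - a
          lem : ∀ a k s r x → (1ℚ + 1ℚ) * (a * ((1ℚ + 1ℚ) * k * s)) ≡ (1ℚ + 1ℚ) * (a * 1ℚ) + ((1ℚ + 1ℚ + 1ℚ + 1ℚ) * (a * (k * (s + r)) + x - a) + a * (1ℚ - (1ℚ + 1ℚ + 1ℚ + 1ℚ) * (k * r)) + (a - (1ℚ + 1ℚ + 1ℚ + 1ℚ) * x))
          lem = solve-∀ ringℚ

-- Sieving by consecutive blocks of primes.

module BlockSieve where

  open import Defs using (_^ℚ_)
  open Rat
  open Sums
  open Mod
  open Harmonic
  open Weights
  open import Data.Nat as ℕ using (ℕ; zero; suc)
  import Data.Nat.Properties as ℕₚ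
  open import Data.Nat.Divisibility using (_∣_; ∣1⇒≡1; m∣m*n)
  open import Data.Nat.Primality using (Prime; euclidsLemma; prime⇒nonZero; ¬prime[1])
  open import Data.Bool using (false)
  open import Data.Rational hiding (NonZero; _/_)
  open import Data.Rational.Properties
  open import Data.List using (List; []; _∷_; _++_; map; length; concatMap)
  open import Data.List.Membership.Propositional using (_∈_)
  open import Data.List.Membership.Propositional.Properties using (∈-map⁻; ∈-++⁻; ∈-++⁺ˡ; ∈-++⁺ʳ)
  open import Data.List.Relation.Unary.Any using (here; there)
  open import Data.List.Relation.Unary.All as All using ([]; _∷_)
  import Data.List.Relation.Unary.AllPairs as AllPairs
  open AllPairs using ([]; _∷_)
  open import Data.List.Relation.Unary.Unique.Propositional using (Unique)
  open import Data.Empty using (⊥-elim)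
  open import Data.Product using (∃-syntax; _×_; _,_; proj₁; proj₂)
  open import Data.Sum using (inj₁; inj₂)
  open import Function using (_∘_)
  open import Relation.Nullary using (¬_)
  open import Relation.Binary.PropositionalEquality hiding (J)
  open import Tactic.RingSolver using (solve-∀)

  ∈-concatMap⁻ : {A B : Set} (f : A → List B) (xs : List A) {y : B} → y ∈ concatMap f xs → ∃[ x ] (x ∈ xs × y ∈ f x)
  ∈-concatMap⁻ f (x ∷ xs) y∈ with ∈-++⁻ (f x) y∈
  ... | inj₁ m = x , here refl , m
  ... | inj₂ m with ∈-concatMap⁻ f xs m
  ...   | x′ , x′∈ , m′ = x′ , there x′∈ , m′

  ∈-concatMap⁺ : {A B : Set} (f : A → List B) {xs : List A} {x : A} {y : B} → x ∈ xs → y ∈ f x → y ∈ concatMap f xs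
  ∈-concatMap⁺ f {x ∷ xs} (here refl) m = ∈-++⁺ˡ m
  ∈-concatMap⁺ f {x ∷ xs} (there x∈) m = ∈-++⁺ʳ (f x) (∈-concatMap⁺ f x∈ m)

  concatMap-unique : {A B : Set} (f : A → List B) {xs : List A} → Unique xs → (∀ {x} → x ∈ xs → Unique (f x)) →
    (∀ {x y z} → x ∈ xs → y ∈ xs → z ∈ f x → z ∈ f y → x ≡ y) → Unique (concatMap f xs)
  concatMap-unique f [] u d = []
  concatMap-unique f {x ∷ xs} (x∉ ∷ xs!) u d = ++-unique (u (here refl)) (concatMap-unique f xs! (u ∘ there) (λ p q → d (there p) (there q)))
    λ z∈ z∈′ → let (y , y∈ , m) = ∈-concatMap⁻ f xs z∈′ in ∉⇒≢ y∈ x∉ (d (here refl) (there y∈) z∈ m)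

  ^ℚ-nonneg : ∀ {a} → 0ℚ ≤ a → ∀ k → 0ℚ ≤ a ^ℚ k
  ^ℚ-nonneg 0≤a zero = 0≤1
  ^ℚ-nonneg 0≤a (suc k) = 0≤* 0≤a (^ℚ-nonneg 0≤a k)

  ^ℚ-+ : ∀ a m n → a ^ℚ (m ℕ.+ n) ≡ a ^ℚ m * a ^ℚ n
  ^ℚ-+ a zero n = sym (*-identityˡ (a ^ℚ n))
  ^ℚ-+ a (suc m) n = trans (cong (a *_) (^ℚ-+ a m n)) (sym (*-assoc a (a ^ℚ m) (a ^ℚ n)))

  ^ℚ-mono : ∀ {a b} → 0ℚ ≤ a → a ≤ b → ∀ k → a ^ℚ k ≤ b ^ℚ k
  ^ℚ-mono 0≤a a≤b zero = ≤-refl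
  ^ℚ-mono 0≤a a≤b (suc k) = *-mono 0≤a (^ℚ-nonneg 0≤a k) a≤b (^ℚ-mono 0≤a a≤b k)

  ν-^ : ∀ n k → ν n ^ℚ k ≡ ν (n ℕ.^ k)
  ν-^ n zero = sym ν1
  ν-^ n (suc k) = trans (cong (ν n *_) (ν-^ n k)) (sym (ν-* n (n ℕ.^ k)))

  bernoulli : ∀ {c} → 0ℚ ≤ c → ∀ T → 1ℚ + ν T * c ≤ (1ℚ + c) ^ℚ T
  bernoulli {c} 0≤c zero = ≡⇒≤ (trans (cong (λ z → 1ℚ + z * c) ν0) (trans (cong (1ℚ +_) (*-zeroˡ c)) (+-identityʳ 1ℚ)))
  bernoulli {c} 0≤c (suc T) = ≤-trans (≤-by (ν T * (c * c)) (0≤* (0≤ν T) (0≤* 0≤c 0≤c)) (trans (lem c (ν T)) (cong (λ z → 1ℚ + z * c + ν T * (c * c)) (sym (ν-suc T)))))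
    (*-monoˡ (0≤+ 0≤1 0≤c) (bernoulli 0≤c T))
    where
    lem : ∀ c t → (1ℚ + c) * (1ℚ + t * c) ≡ 1ℚ + (1ℚ + t) * c + t * (c * c)
    lem = solve-∀ ringℚ

  module Sieving (G : ℕ → List ℕ) (H : ℕ → ℕ) (G-unique : ∀ s → Unique (G s))
    (G-spec : ∀ {s p} → p ∈ G s → Prime p × H s ℕ.< p × p ℕ.≤ H (suc s))
    (0<H : ∀ s → 0 ℕ.< H s) (H-mono : ∀ s → H s ℕ.≤ H (suc s)) where

    blocks : ℕ → List ℕ
    blocks zero = []
    blocks (suc T) = G T ++ blocks T

    -- Products with at most one prime from each of T blocks: their reciprocal sum factors into the
    -- 1 + Σ 1/p over the single blocks.
    products : ℕ → List ℕ
    products zero = 1 ∷ []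
    products (suc T) = products T ++ concatMap (λ p → map (p ℕ.*_) (products T)) (G T)

    ∈-blocks : ∀ {T s p} → s ℕ.< T → p ∈ G s → p ∈ blocks T
    ∈-blocks {suc T} {s} s<T p∈ with ℕₚ.m≤n⇒m<n∨m≡n (ℕ.s≤s⁻¹ s<T)
    ... | inj₁ lt = ∈-++⁺ʳ (G T) (∈-blocks lt p∈)
    ... | inj₂ refl = ∈-++⁺ˡ p∈

    blocks-∈ : ∀ {T p} → p ∈ blocks T → ∃[ s ] (s ℕ.< T × p ∈ G s)
    blocks-∈ {suc T} p∈ with ∈-++⁻ (G T) p∈
    ... | inj₁ m = T , ℕₚ.n<1+n T , m
    ... | inj₂ m = let (s , s<T , m′) = blocks-∈ {T} m in s , ℕₚ.m<n⇒m<1+n s<T , m′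

    blocks-prime : ∀ {T p} → p ∈ blocks T → Prime p
    blocks-prime {T} p∈ = let (s , _ , m) = blocks-∈ {T} p∈ in proj₁ (G-spec m)

    blocks-≤ : ∀ {T p} → p ∈ blocks T → p ℕ.≤ H T
    blocks-≤ {suc T} p∈ with ∈-++⁻ (G T) p∈
    ... | inj₁ m = proj₂ (proj₂ (G-spec m))
    ... | inj₂ m = ℕₚ.≤-trans (blocks-≤ {T} m) (H-mono T)

    blocks-unique : ∀ T → Unique (blocks T)
    blocks-unique zero = []
    blocks-unique (suc T) = ++-unique (G-unique T) (blocks-unique T) λ p∈ p∈′ →
      ℕₚ.<-irrefl refl (ℕₚ.<-≤-trans (proj₁ (proj₂ (G-spec p∈))) (blocks-≤ {T} p∈′))

    products-bound : ℕ → ℕ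
    products-bound zero = 1
    products-bound (suc T) = H (suc T) ℕ.* products-bound T

    products-spec : ∀ {T r} → r ∈ products T → 0 ℕ.< r × r ℕ.≤ products-bound T × Squarefree r × (∀ {p} → Prime p → p ∣ r → p ∈ blocks T)
    products-spec {zero} (here refl) = ℕ.s≤s ℕ.z≤n , ℕₚ.≤-refl ,
      squarefree-intro (λ {p} pp d → ¬prime[1] (subst Prime (ℕₚ.m*n≡1⇒m≡1 p p (∣1⇒≡1 d)) pp)) ,
      λ pp d → ⊥-elim (¬prime[1] (subst Prime (∣1⇒≡1 d) pp))
    products-spec {suc T} r∈ with ∈-++⁻ (products T) r∈
    ... | inj₁ m = let (0<r , r≤ , sf , ps) = products-spec {T} m in
      0<r , ℕₚ.≤-trans r≤ (ℕₚ.m≤n*m (products-bound T) (H (suc T)) {{ℕ.>-nonZero (0<H (suc T))}}) , sf , λ pp d → ∈-++⁺ʳ (G T) (ps pp d)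
    ... | inj₂ m with ∈-concatMap⁻ (λ p → map (p ℕ.*_) (products T)) (G T) m
    ...   | p , p∈ , m′ with ∈-map⁻ (p ℕ.*_) {xs = products T} m′
    ...     | b , b∈ , refl = ℕₚ.*-mono-≤ (prime⇒0< pp) 0<b , ℕₚ.*-mono-≤ p≤ b≤ , squarefree-* 0<b pp p∤b sf , mem
      where
      pp = proj₁ (G-spec p∈)
      p≤ = proj₂ (proj₂ (G-spec p∈))
      ih = products-spec {T} b∈
      0<b = proj₁ ih
      b≤ = proj₁ (proj₂ ih)
      sf = proj₁ (proj₂ (proj₂ ih))
      p∤b : ¬ (p ∣ b)
      p∤b d = ℕₚ.<-irrefl refl (ℕₚ.<-≤-trans (proj₁ (proj₂ (G-spec p∈))) (blocks-≤ {T} (proj₂ (proj₂ (proj₂ ih)) pp d)))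
      mem : ∀ {q} → Prime q → q ∣ p ℕ.* b → q ∈ G T ++ blocks T
      mem pq d with euclidsLemma p b pq d
      ... | inj₁ e = ∈-++⁺ˡ (subst (_∈ G T) (sym (prime-∣-prime pq pp e)) p∈)
      ... | inj₂ e = ∈-++⁺ʳ (G T) (proj₂ (proj₂ (proj₂ ih)) pq e)

    coprime-block : ∀ {T p r} → p ∈ G T → r ∈ products T → ¬ (p ∣ r)
    coprime-block {T} p∈ r∈ d = ℕₚ.<-irrefl refl (ℕₚ.<-≤-trans (proj₁ (proj₂ (G-spec p∈))) (blocks-≤ {T} (proj₂ (proj₂ (proj₂ (products-spec {T} r∈))) (proj₁ (G-spec p∈)) d)))

    products-unique : ∀ T → Unique (products T)
    products-unique zero = [] ∷ []
    products-unique (suc T) = ++-unique (products-unique T)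
      (concatMap-unique (λ p → map (p ℕ.*_) (products T)) (G-unique T)
        (λ {p} p∈ → map-unique (λ {x} {y} _ _ e → ℕₚ.*-cancelˡ-≡ x y p {{prime⇒nonZero (proj₁ (G-spec p∈))}} e) (products-unique T)) same)
      λ r∈ r∈′ → let (p , p∈ , m) = ∈-concatMap⁻ (λ p → map (p ℕ.*_) (products T)) (G T) r∈′ ; (b , _ , e) = ∈-map⁻ (p ℕ.*_) {xs = products T} m in
        coprime-block p∈ r∈ (subst (p ∣_) (sym e) (m∣m*n b))
      where
      same : ∀ {p q z} → p ∈ G T → q ∈ G T → z ∈ map (p ℕ.*_) (products T) → z ∈ map (q ℕ.*_) (products T) → p ≡ q
      same {p} {q} p∈ q∈ z∈ z∈′ with ∈-map⁻ (p ℕ.*_) {xs = products T} z∈ | ∈-map⁻ (q ℕ.*_) {xs = products T} z∈′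
      ... | b , b∈ , refl | c , c∈ , e with euclidsLemma q c (proj₁ (G-spec p∈)) (subst (p ∣_) e (m∣m*n b))
      ...   | inj₁ d = prime-∣-prime (proj₁ (G-spec p∈)) (proj₁ (G-spec q∈)) d
      ...   | inj₂ d = ⊥-elim (coprime-block p∈ c∈ d)

    products-mass : ∀ {c} → 0ℚ ≤ c → ∀ T → (∀ s → s ℕ.< T → c ≤ ∑ (G s) ρ) → (1ℚ + c) ^ℚ T ≤ ∑ (products T) ρ
    products-mass 0≤c zero mass = ≡⇒≤ (trans (sym ρ1) (sym (+-identityʳ (ρ 1))))
    products-mass {c} 0≤c (suc T) mass = ≤-trans (*-mono (0≤+ 0≤1 0≤c) (^ℚ-nonneg (0≤+ 0≤1 0≤c) T) (+-monoʳ-≤ 1ℚ (mass T (ℕₚ.n<1+n T))) (products-mass 0≤c T (λ s s<T → mass s (ℕₚ.m<n⇒m<1+n s<T))))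
      (≡⇒≤ (trans (lem (∑ (G T) ρ) L) (sym (trans (∑-++ (products T) _ ρ) (cong (L +_) (trans (∑-concatMap (λ p → map (p ℕ.*_) (products T)) (G T) ρ)
        (trans (∑-cong (G T) (λ {p} _ → trans (∑-map (p ℕ.*_) (products T) ρ) (trans (∑-cong (products T) (λ {r} _ → ρ-* p r)) (∑-*ˡ (products T) (ρ p) ρ)))) (∑-*ʳ (G T) L ρ))))))))
      where
      L = ∑ (products T) ρ
      lem : ∀ g l → (1ℚ + g) * l ≡ l + g * l
      lem = solve-∀ ringℚ

    -- The large sieve for the class 0 at the primes of the blocks, with L taken over `products T`.
    -- The saving is exponential in T however small the mass c of a single block.
    block-sieve : ∀ {c} → 0ℚ ≤ c → ∀ T → (∀ s → s ℕ.< T → c ≤ ∑ (G s) ρ) → ∀ R → products-bound T ℕ.≤ R →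
      ∀ N → R ℕ.* (R ℕ.* R ℕ.* (R ℕ.* R)) ℕ.≤ N → ∀ {S} → Unique S → (∀ {n} → n ∈ S → n ℕ.< N) →
      (∀ {n s p} → n ∈ S → s ℕ.< T → p ∈ G s → ¬ (p ∣ n)) → ν (length S) * (1ℚ + c) ^ℚ T ≤ ν N + ν N
    block-sieve {c} 0≤c T mass R le N R⁵≤N {S} S-unique S<N S-free = ≤-trans (*-monoˡ (0≤ν (length S)) L≥)
      (large-sieve R N (products-unique T) ok R⁵≤N S-unique S<N one)
      where
      open SieveWith (λ _ → false) (blocks T) (blocks-unique T) (blocks-prime {T}) (λ _ ()) using (rad; large-sieve; G-lower) renaming (G to weights)
      ok : ∀ {r} → r ∈ products T → 0 ℕ.< r × r ℕ.≤ R × rad r ≡ r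
      ok r∈ = let (0<r , r≤ , sf , ps) = products-spec {T} r∈ in
        0<r , ℕₚ.≤-trans r≤ le , radical-squarefree (blocks-prime {T}) (blocks-unique T) 0<r sf ps
      L≥ : (1ℚ + c) ^ℚ T ≤ ∑ (products T) weights
      L≥ = ≤-trans (products-mass 0≤c T mass) (∑-mono (products T) (λ r∈ → G-lower (proj₂ (proj₂ (ok r∈)))))
      one : ∀ {n p r} → n ∈ S → p ∈ blocks T → r ∈ products T → p ∣ r → weight (λ _ → false) p n ≡ 1ℚ
      one n∈ p∈ _ _ = let (s , s<T , m) = blocks-∈ {T} p∈ in weight-one (λ _ → false) (prime⇒1< (blocks-prime {T} p∈)) (S-free n∈ s<T m) (λ ())

-- Chains of prime factors producing distinct moduli.

module Chains where

  open import Defs using (_^ℚ_)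
  open Rat
  open Sums
  open Mod
  open Harmonic using (upTo⁺; ∈-upTo⁺; upTo⁺-bounds; upTo⁺-unique)
  open BlockSieve using (∈-concatMap⁺; bernoulli)
  open import Data.Nat as ℕ using (ℕ; zero; suc)
  import Data.Nat.Properties as ℕₚ
  open import Data.Nat.DivMod using (_/_; /-monoˡ-≤; m*n/n≡m; m/n*n≤m)
  open import Data.Nat.Divisibility using (_∣_; _∣?_; divides; ∣-trans)
  open import Data.Nat.Primality using (Prime)
  open import Data.Rational hiding (NonZero; _/_; _÷_; ∣_∣)
  open import Data.Rational.Properties
  open import Data.List using (List; []; _∷_; _++_; map; length; filter; concatMap)
  open import Data.List.Membership.Propositional using (_∈_; _∉_; find; lose)
  open import Data.List.Membership.Propositional.Properties using (∈-map⁺; ∈-filter⁻; ∈-filter⁺; ∈-++⁺ˡ; ∈-++⁺ʳ)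
  open import Data.List.Relation.Unary.Any as Any using (Any; here; there; any?)
  open import Data.List.Relation.Unary.All as All using (All; []; _∷_)
  import Data.List.Relation.Unary.AllPairs as AllPairs
  open AllPairs using ([]; _∷_)
  open import Data.List.Relation.Unary.Unique.Propositional using (Unique)
  open import Data.Empty using (⊥; ⊥-elim)
  open import Data.Unit using (⊤; tt)
  open import Data.Product using (∃-syntax; _×_; _,_; proj₁; proj₂)
  open import Function using (_∘_)
  open import Level using (0ℓ)
  open import Relation.Nullary using (Dec; yes; no; ¬_; ¬?; _×-dec_)
  open import Relation.Unary using (Pred; Decidable)
  open import Relation.Binary.PropositionalEquality hiding (J)
  open import Tactic.RingSolver using (solve-∀)

  _÷_ : ℕ → ℕ → ℕ
  n ÷ zero = 0
  n ÷ suc k = n / suc k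

  *-÷ : ∀ p n → 0 ℕ.< p → (p ℕ.* n) ÷ p ≡ n
  *-÷ (suc k) n _ = trans (cong (_/ suc k) (ℕₚ.*-comm (suc k) n)) (m*n/n≡m n (suc k))

  ÷-* : ∀ {p n} → 0 ℕ.< p → p ∣ n → p ℕ.* (n ÷ p) ≡ n
  ÷-* {p} 0<p (divides m refl) = trans (cong (λ z → p ℕ.* (z ÷ p)) (ℕₚ.*-comm m p)) (trans (cong (p ℕ.*_) (*-÷ p m 0<p)) (ℕₚ.*-comm p m))

  ÷-∣ : ∀ {p n} → 0 ℕ.< p → p ∣ n → n ÷ p ∣ n
  ÷-∣ {p} {n} 0<p d = divides p (sym (÷-* 0<p d))

  ≤-÷ : ∀ {p m n} → 0 ℕ.< p → m ℕ.* p ℕ.≤ n → m ℕ.≤ n ÷ p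
  ≤-÷ {suc k} {m} {n} _ le = ℕₚ.≤-trans (ℕₚ.≤-reflexive (sym (m*n/n≡m m (suc k)))) (/-monoˡ-≤ (suc k) le)

  ν-÷ : ∀ p n → 0 ℕ.< p → ν (n ÷ p) ≤ ν n * ρ p
  ν-÷ p@(suc k) n 0<p = *-cancelˡ (0<ν 0<p) (≤-trans (≡⇒≤ (trans (*-comm (ν p) (ν (n / p))) (sym (ν-* (n / p) p)))) (≤-trans (ν-mono (m/n*n≤m n p))
    (≡⇒≤ (trans (sym (*-identityʳ (ν n))) (trans (cong (ν n *_) (sym (νρ 0<p))) (lem (ν n) (ν p) (ρ p)))))))
    where
    lem : ∀ a b c → a * (b * c) ≡ b * (a * c)
    lem = solve-∀ ringℚ

  misses : {P : Pred ℕ 0ℓ} → Decidable P → ℕ → List ℕ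
  misses P? N = filter (¬? ∘ P?) (upTo⁺ N)

  module _ {P : Pred ℕ 0ℓ} (P? : Decidable P) where

    misses-unique : ∀ N → Unique (misses P? N)
    misses-unique N = filter-unique (¬? ∘ P?) (upTo⁺-unique N)

    misses-spec : ∀ {N n} → n ∈ misses P? N → (0 ℕ.< n × n ℕ.≤ N) × ¬ P n
    misses-spec {N} n∈ = let (m , ¬p) = ∈-filter⁻ (¬? ∘ P?) {xs = upTo⁺ N} n∈ in upTo⁺-bounds m , ¬p

    ∈-misses : ∀ {N n} → 0 ℕ.< n → n ℕ.≤ N → ¬ P n → n ∈ misses P? N
    ∈-misses 0<n n≤N ¬p = ∈-filter⁺ (¬? ∘ P?) (∈-upTo⁺ 0<n n≤N) ¬p

  module _ (B : List ℕ) (B-prime : ∀ {p} → p ∈ B → Prime p) (Link : List ℕ → ℕ → Set) (link? : ∀ E p → Dec (Link E p)) (pick : List ℕ → ℕ → ℕ) where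

    -- E collects the moduli q already produced. In the application `Link E p` means that p - 1 is
    -- divisible by an admissible q outside E, and `pick E p` is such a q.
    Hit : List ℕ → ℕ → Set
    Hit E n = Any (λ p → p ∣ n × Link E p) B

    hit? : ∀ E n → Dec (Hit E n)
    hit? E n = any? (λ p → (p ∣? n) ×-dec link? E p) B

    -- The recursion passes to n ÷ p, so that the numbers below N without a chain are counted through those below N ÷ p.
    Chain : ℕ → List ℕ → ℕ → Set
    Chain zero E n = ⊤
    Chain (suc R) E n = Any (λ p → p ∣ n × Link E p × Chain R (pick E p ∷ E) (n ÷ p)) B

    chain? : ∀ R E n → Dec (Chain R E n)
    chain? zero E n = yes tt
    chain? (suc R) E n = any? (λ p → (p ∣? n) ×-dec (link? E p ×-dec chain? R (pick E p ∷ E) (n ÷ p))) B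

    module _ {Q : List ℕ} (pick-spec : ∀ {E p} → Link E p → pick E p ∈ Q × pick E p ∉ E × pick E p ∣ p ℕ.∸ 1) where

      Reached : ℕ → ℕ → Set
      Reached n q = q ∈ Q × ∃[ p ] (Prime p × p ∣ n × q ∣ p ℕ.∸ 1)

      chain-reaches : ∀ R {E n} → Chain R E n → ∃[ qs ] (length qs ≡ R × Unique qs × (∀ {q} → q ∈ qs → q ∉ E × Reached n q))
      chain-reaches zero c = [] , refl , [] , λ ()
      chain-reaches (suc R) {E} {n} c with find c
      ... | p , p∈ , p∣n , l , c′ with chain-reaches R c′
      ...   | qs , len , u , spec = q₀ ∷ qs , cong suc len , All.tabulate (λ q∈ e → proj₁ (spec q∈) (here (sym e))) ∷ u , all
        where
        pp = B-prime p∈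
        q₀ = pick E p
        all : ∀ {q} → q ∈ q₀ ∷ qs → q ∉ E × Reached n q
        all (here refl) = let (a , b , d) = pick-spec l in b , a , p , pp , p∣n , d
        all (there q∈) = let (q∉ , qQ , p′ , pp′ , d , e) = spec q∈ in q∉ ∘ there , qQ , p′ , pp′ , ∣-trans d (÷-∣ (prime⇒0< pp) p∣n) , e

    module _ (R₀ M Z : ℕ) (0<Z : 0 ℕ.< Z) (B-≤ : ∀ {p} → p ∈ B → p ℕ.≤ Z) (Λ κ u : ℚ) (0≤Λ : 0ℚ ≤ Λ) (0≤κ : 0ℚ ≤ κ) (B-mass : ∑ B ρ ≤ u)
      (sieve : ∀ E N → length E ℕ.< R₀ → M ℕ.≤ N → ν (length (misses (hit? E) N)) * Λ ≤ ν N * κ) where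

      V : ℕ → ℚ
      V zero = 0ℚ
      V (suc R) = κ + u * V R

      0≤u : 0ℚ ≤ u
      0≤u = ≤-trans (∑-nonneg B (λ {p} _ → 0≤ρ p)) B-mass

      0≤V : ∀ R → 0ℚ ≤ V R
      0≤V zero = ≤-refl
      0≤V (suc R) = 0≤+ 0≤κ (0≤* 0≤u (0≤V R))

      V-bound : ∀ R → V R ≤ κ * (1ℚ + u) ^ℚ R
      V-bound zero = 0≤* 0≤κ 0≤1
      V-bound (suc R) = ≤-trans (+-mono-≤ κ≤ (*-monoˡ 0≤u (V-bound R))) (≡⇒≤ (lem κ u ((1ℚ + u) ^ℚ R)))
        where
        κ≤ : κ ≤ κ * (1ℚ + u) ^ℚ R
        κ≤ = ≤-trans (≡⇒≤ (sym (*-identityʳ κ))) (*-monoˡ 0≤κ (≤-trans (≤-by (ν R * u) (0≤* (0≤ν R) 0≤u) refl) (bernoulli 0≤u R)))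
        lem : ∀ k u w → k * w + u * (k * w) ≡ k * ((1ℚ + u) * w)
        lem = solve-∀ ringℚ

      -- A number without a chain either is not hit at all or is p n′ with p linked and n′ ≤ N/p
      -- without a chain for the enlarged E. The lower bound for N keeps the range of the sieve
      -- after R divisions by primes up to Z.
      count-misses : ∀ R E N → length E ℕ.+ R ℕ.≤ R₀ → M ℕ.* Z ℕ.^ R ℕ.≤ N → ν (length (misses (chain? R E) N)) * Λ ≤ ν N * V R
      count-misses zero E N le big = ≡⇒≤ (trans (cong (λ z → ν z * Λ) (none (misses (chain? 0 E) N) (λ m → proj₂ (misses-spec (chain? 0 E) {N} m) tt)))
        (trans (cong (_* Λ) ν0) (trans (*-zeroˡ Λ) (sym (*-zeroʳ (ν N))))))
        where
        none : ∀ (xs : List ℕ) → (∀ {x} → x ∈ xs → ⊥) → length xs ≡ 0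
        none [] h = refl
        none (x ∷ xs) h = ⊥-elim (h (here refl))
      count-misses (suc R) E N le big = ≤-trans (*-monoʳ 0≤Λ split) (≤-trans (≡⇒≤ (trans (*-distribʳ-+ Λ (ν (length (misses (hit? E) N))) X) (cong (ν (length (misses (hit? E) N)) * Λ +_) (sym (∑-*ʳ B Λ _)))))
        (≤-trans (+-mono-≤ (sieve E N E< M≤N) (∑-mono B inner))
        (≤-trans (+-monoʳ-≤ (ν N * κ) (≤-trans (≡⇒≤ (trans (∑-*ʳ B (V R) (λ p → ν N * ρ p)) (cong (_* V R) (∑-*ˡ B (ν N) ρ)))) (*-monoʳ (0≤V R) (*-monoˡ (0≤ν N) B-mass))))
        (≡⇒≤ (lem (ν N) κ u (V R))))))
        where
        lem : ∀ n k u v → n * k + n * u * v ≡ n * (k + u * v)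
        lem = solve-∀ ringℚ
        X = ∑ B (λ p → ν (length (misses (chain? R (pick E p ∷ E)) (N ÷ p))))
        E< : length E ℕ.< R₀
        E< = ℕₚ.≤-trans (ℕₚ.m<m+n (length E) {suc R} (ℕ.s≤s ℕ.z≤n)) le
        big′ : ∀ {p} → p ∈ B → M ℕ.* Z ℕ.^ R ℕ.* p ℕ.≤ N
        big′ {p} p∈ = ℕₚ.≤-trans (ℕₚ.≤-reflexive (ℕₚ.*-assoc M (Z ℕ.^ R) p)) (ℕₚ.≤-trans (ℕₚ.*-monoʳ-≤ M (ℕₚ.≤-trans (ℕₚ.*-monoʳ-≤ (Z ℕ.^ R) (B-≤ p∈)) (ℕₚ.≤-reflexive (ℕₚ.*-comm (Z ℕ.^ R) Z)))) big)
        M≤N : M ℕ.≤ N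
        M≤N = ℕₚ.≤-trans (ℕₚ.m≤m*n M (Z ℕ.^ suc R) {{ℕ.>-nonZero (ℕₚ.m^n>0 Z {{ℕ.>-nonZero 0<Z}} (suc R))}}) big
        member : ∀ {n} → n ∈ misses (chain? (suc R) E) N → n ∈ misses (hit? E) N ++ concatMap (λ p → map (p ℕ.*_) (misses (chain? R (pick E p ∷ E)) (N ÷ p))) B
        member {n} n∈ = by-cases (hit? E n)
          where
          s = misses-spec (chain? (suc R) E) {N} n∈
          0<n = proj₁ (proj₁ s)
          n≤N = proj₂ (proj₁ s)
          by-cases : Dec (Hit E n) → n ∈ misses (hit? E) N ++ concatMap (λ p → map (p ℕ.*_) (misses (chain? R (pick E p ∷ E)) (N ÷ p))) B
          by-cases (no ¬h) = ∈-++⁺ˡ (∈-misses (hit? E) 0<n n≤N ¬h)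
          by-cases (yes h) with find h
          ... | p , p∈ , p∣n , l = ∈-++⁺ʳ (misses (hit? E) N) (∈-concatMap⁺ (λ p → map (p ℕ.*_) (misses (chain? R (pick E p ∷ E)) (N ÷ p))) p∈
              (subst (_∈ map (p ℕ.*_) (misses (chain? R (pick E p ∷ E)) (N ÷ p))) (÷-* 0<p p∣n) (∈-map⁺ (p ℕ.*_)
                (∈-misses (chain? R (pick E p ∷ E)) 0<n÷p (≤-÷ 0<p (ℕₚ.≤-trans (ℕₚ.≤-reflexive (trans (ℕₚ.*-comm (n ÷ p) p) (÷-* 0<p p∣n))) n≤N))
                  λ c → proj₂ s (lose p∈ (p∣n , l , c))))))
            where
            0<p = prime⇒0< (B-prime p∈)
            0<n÷p : 0 ℕ.< n ÷ p
            0<n÷p = ℕₚ.n≢0⇒n>0 λ e → ℕₚ.<-irrefl (trans (sym (ℕₚ.*-zeroʳ p)) (trans (cong (p ℕ.*_) (sym e)) (÷-* 0<p p∣n))) 0<n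
        split : ν (length (misses (chain? (suc R) E) N)) ≤ ν (length (misses (hit? E) N)) + X
        split = ≤-trans (≡⇒≤ (sym (∑-1 (misses (chain? (suc R) E) N)))) (≤-trans (∑-⊆ {f = λ _ → 1ℚ} (misses-unique (chain? (suc R) E) N) member (λ _ → 0≤1))
          (≡⇒≤ (trans (∑-++ (misses (hit? E) N) _ (λ _ → 1ℚ)) (cong₂ _+_ (∑-1 (misses (hit? E) N))
            (trans (∑-concatMap (λ p → map (p ℕ.*_) (misses (chain? R (pick E p ∷ E)) (N ÷ p))) B (λ _ → 1ℚ)) (∑-cong B (λ {p} _ → trans (∑-map (p ℕ.*_) (misses (chain? R (pick E p ∷ E)) (N ÷ p)) (λ _ → 1ℚ)) (∑-1 (misses (chain? R (pick E p ∷ E)) (N ÷ p))))))))))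
        inner : ∀ {p} → p ∈ B → ν (length (misses (chain? R (pick E p ∷ E)) (N ÷ p))) * Λ ≤ ν N * ρ p * V R
        inner {p} p∈ = ≤-trans (count-misses R (pick E p ∷ E) (N ÷ p) (ℕₚ.≤-trans (ℕₚ.≤-reflexive (sym (ℕₚ.+-suc (length E) R))) le) (≤-÷ (prime⇒0< (B-prime p∈)) (big′ p∈)))
          (*-monoʳ (0≤V R) (ν-÷ p N (prime⇒0< (B-prime p∈))))

-- Building dense divisors.

module Density where

  open Rat
  open Mod
  open Sieve using (Π; Π-0<; ∣-Π; prime-∣-Π)
  open Harmonic using (upTo⁺; ∈-upTo⁺; upTo⁺-bounds)
  open Carmichael using (coprime-∣-*)
  open import Data.Nat as ℕ using (ℕ; zero; suc)
  import Data.Nat.Properties as ℕₚ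
  import Data.Nat.Coprimality as Coprimality
  open import Data.Nat.Divisibility using (_∣_; ∣⇒≤; ∣-trans; m∣m*n; *-monoˡ-∣)
  open import Data.Nat.Primality using (Prime; euclidsLemma)
  import Data.Integer as ℤ
  import Data.Integer.Properties as ℤₚ
  open import Data.Rational hiding (NonZero; _/_; _÷_; ∣_∣; floor)
  open import Data.Rational.Properties
  import Data.Rational.Unnormalised as ℚᵘ
  import Data.Rational.Unnormalised.Properties as ℚᵘₚ
  open import Data.List using (List; []; _∷_; length)
  open import Data.List.Membership.Propositional using (_∈_)
  open import Data.List.Relation.Unary.Any using (here; there)
  import Data.List.Relation.Unary.AllPairs as AllPairs
  open AllPairs using ([]; _∷_)
  open import Data.List.Relation.Unary.Unique.Propositional using (Unique)
  open Sums using (∉⇒≢)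
  open import Data.Empty using (⊥-elim)
  open import Data.Product using (∃-syntax; _×_; _,_; proj₁; proj₂)
  open import Data.Sum using (_⊎_; inj₁; inj₂)
  open import Function using (_∘_)
  open import Relation.Nullary using (Dec; yes; no; ¬_)
  open import Relation.Binary.PropositionalEquality hiding (J)
  open import Tactic.RingSolver using (solve-∀)

  abstract
    archimedean : ∀ x → ∃[ n ] x < ν n
    archimedean x@(mkℚ n d _) = suc ℤ.∣ n ∣ , ≤-<-trans x≤ (ν-mono-< (ℕₚ.n<1+n ℤ.∣ n ∣))
      where
      ≤abs : ∀ i → i ℤ.≤ ℤ.+ ℤ.∣ i ∣
      ≤abs (ℤ.+ _) = ℤₚ.≤-refl
      ≤abs ℤ.-[1+ _ ] = ℤ.-≤+
      x≤ : x ≤ ν ℤ.∣ n ∣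
      x≤ = toℚᵘ-cancel-≤ (ℚᵘₚ.≤-respʳ-≃ (ℚᵘₚ.≃-sym (ιᵘ ℤ.∣ n ∣)) (ℚᵘ.*≤* (ℤₚ.≤-trans (ℤₚ.≤-reflexive (ℤₚ.*-identityʳ n))
        (ℤₚ.≤-trans (≤abs n) (subst (ℤ.+ ℤ.∣ n ∣ ℤ.≤_) (ℤₚ.pos-* ℤ.∣ n ∣ (suc d)) (ℤ.+≤+ (ℕₚ.m≤m*n ℤ.∣ n ∣ (suc d))))))))

    archimedean⁻¹ : ∀ δ → 0ℚ < δ → ∃[ k ] (0 ℕ.< k × ρ k ≤ δ)
    archimedean⁻¹ (mkℚ (ℤ.+ zero) d _) 0<δ with positive 0<δ
    ... | ()
    archimedean⁻¹ (mkℚ ℤ.-[1+ n ] d _) 0<δ with positive 0<δ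
    ... | ()
    archimedean⁻¹ δ@(mkℚ ℤ.+[1+ n ] d _) _ = suc d , ℕ.s≤s ℕ.z≤n ,
      toℚᵘ-cancel-≤ (ℚᵘₚ.≤-respˡ-≃ (ℚᵘₚ.≃-sym (recipᵘ d)) (ℚᵘ.*≤* (ℤₚ.*-monoʳ-≤-nonNeg (ℤ.+ suc d) (ℤ.+≤+ (ℕ.s≤s (ℕ.z≤n {n}))))))

  floor : ∀ {y} Y → 0ℚ ≤ y → y < ν Y → ∃[ N ] (N ℕ.< Y × ν N ≤ y × y < ν (suc N))
  floor zero 0≤y y< = ⊥-elim (<-irrefl refl (≤-<-trans 0≤y (<-≤-trans y< (≡⇒≤ ν0))))
  floor {y} (suc Y) 0≤y y< = by-cases (y <? ν Y)
    where
    by-cases : Dec (y < ν Y) → ∃[ N ] (N ℕ.< suc Y × ν N ≤ y × y < ν (suc N))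
    by-cases (yes lt) = let (N , N< , lo , hi) = floor Y 0≤y lt in N , ℕₚ.m<n⇒m<1+n N< , lo , hi
    by-cases (no ge) = Y , ℕₚ.n<1+n Y , ≮⇒≥ ge , y<

  scale : ℕ → ℕ → ℕ → ℕ
  scale K a zero = a
  scale K a (suc j) = K ℕ.* scale K a j

  Stock : ℕ → ℕ → ℕ → List ℕ → Set
  Stock n K a qs = length qs ≡ K ℕ.* K × Unique qs × (∀ {q} → q ∈ qs → Prime q × q ∣ n × 2 ℕ.^ a ℕ.< q × q ℕ.≤ 2 ℕ.^ (K ℕ.* a))

  module _ (h : ℕ) (0<h : 0 ℕ.< h) where

    Dense : ℕ → ℕ → Set
    Dense m Y = ∀ y → ν h ≤ y → y < ν Y → ∃[ d ] (d ∣ m × y < ν d × ν d ≤ (1ℚ + ρ h) * y)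

    dense-∣ : ∀ {m n Y} → m ∣ n → Dense m Y → Dense n Y
    dense-∣ m∣n D y lo hi = let (d , d∣m , a , b) = D y lo hi in d , ∣-trans d∣m m∣n , a , b

    dense-≤ : ∀ {m Y Y′} → Y′ ℕ.≤ Y → Dense m Y → Dense m Y′
    dense-≤ Y′≤Y D y lo hi = D y lo (<-≤-trans hi (ν-mono Y′≤Y))

    -- Below Y the divisors of m serve. For Y ≤ y < q Y, a divisor found at y/q, which is at least h
    -- because q h ≤ Y, is multiplied by q.
    dense-* : ∀ {m Y} q → 0 ℕ.< q → q ℕ.* h ℕ.≤ Y → Dense m Y → Dense (m ℕ.* q) (q ℕ.* Y)
    dense-* {m} {Y} q 0<q qh≤Y D y lo hi = by-cases (y <? ν Y)
      where
      y′ = ρ q * y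
      y≡ : ν q * y′ ≡ y
      y≡ = trans (sym (*-assoc (ν q) (ρ q) y)) (trans (cong (_* y) (νρ 0<q)) (*-identityˡ y))
      scaled : ∃[ d ] (d ∣ m × y′ < ν d × ν d ≤ (1ℚ + ρ h) * y′) → ∃[ d ] (d ∣ m ℕ.* q × y < ν d × ν d ≤ (1ℚ + ρ h) * y)
      scaled (d , d∣m , a , b) = d ℕ.* q , *-monoˡ-∣ q d∣m , subst₂ _<_ y≡ eq (*-monoˡ-< (0<ν 0<q) a) ,
        subst₂ _≤_ eq (trans (lem (ν q) (1ℚ + ρ h) y′) (cong ((1ℚ + ρ h) *_) y≡)) (*-monoˡ (0≤ν q) b)
        where
        eq : ν q * ν d ≡ ν (d ℕ.* q)
        eq = trans (*-comm (ν q) (ν d)) (sym (ν-* d q))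
        lem : ∀ a b c → a * (b * c) ≡ b * (a * c)
        lem = solve-∀ ringℚ
      by-cases : Dec (y < ν Y) → ∃[ d ] (d ∣ m ℕ.* q × y < ν d × ν d ≤ (1ℚ + ρ h) * y)
      by-cases (yes lt) = dense-∣ {m} {m ℕ.* q} {Y} (m∣m*n q) D y lo lt
      by-cases (no ge) = scaled (D y′
        (*-cancelˡ (0<ν 0<q) (≤-trans (≡⇒≤ (sym (ν-* q h))) (≤-trans (ν-mono qh≤Y) (≤-trans (≮⇒≥ ge) (≡⇒≤ (sym y≡))))))
        (*-cancelˡ-< (0≤ν q) (subst₂ _<_ (sym y≡) (ν-* q Y) hi)))

    base : ℕ → ℕ
    base zero = Π (upTo⁺ (2 ℕ.* h)) (λ i → i)
    base (suc L) = base L ℕ.* 2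

    reach : ℕ → ℕ
    reach zero = 2 ℕ.* h
    reach (suc L) = 2 ℕ.* reach L

    2h≤reach : ∀ L → 2 ℕ.* h ℕ.≤ reach L
    2h≤reach zero = ℕₚ.≤-refl
    2h≤reach (suc L) = ℕₚ.≤-trans (2h≤reach L) (ℕₚ.m≤n*m (reach L) 2)

    ≤reach : ∀ L → 2 ℕ.^ L ℕ.* h ℕ.≤ reach L
    ≤reach zero = ℕₚ.*-monoˡ-≤ h (ℕ.s≤s (ℕ.z≤n {1}))
    ≤reach (suc L) = ℕₚ.≤-trans (ℕₚ.≤-reflexive (ℕₚ.*-assoc 2 (2 ℕ.^ L) h)) (ℕₚ.*-monoʳ-≤ 2 (≤reach L))

    -- Every positive integer up to 2 h divides (2 h)!, and the first integer above y ≥ h is at most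
    -- y + 1 ≤ (1 + 1/h) y. Each further factor 2 doubles the range.
    base-dense : ∀ L → Dense (base L) (reach L)
    base-dense zero y lo hi = finish (floor (2 ℕ.* h) (≤-trans (0≤ν h) lo) hi)
      where
      finish : ∃[ N ] (N ℕ.< 2 ℕ.* h × ν N ≤ y × y < ν (suc N)) → ∃[ d ] (d ∣ base 0 × y < ν d × ν d ≤ (1ℚ + ρ h) * y)
      finish (N , N< , a , b) = suc N , ∣-Π {xs = upTo⁺ (2 ℕ.* h)} {f = λ i → i} (∈-upTo⁺ (ℕ.s≤s ℕ.z≤n) N<) , b ,
        ≤-trans (≡⇒≤ (trans (ν-suc N) (trans (+-comm 1ℚ (ν N)) (cong (ν N +_) (sym (ρν 0<h))))))
        (≤-trans (+-mono-≤ a (*-monoˡ (0≤ρ h) lo)) (≡⇒≤ (lem (ρ h) y)))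
        where
        lem : ∀ r y → y + r * y ≡ (1ℚ + r) * y
        lem = solve-∀ ringℚ
    base-dense (suc L) = dense-* {base L} {reach L} 2 (ℕ.s≤s ℕ.z≤n) (2h≤reach L) (base-dense L)

    0<base : ∀ L → 0 ℕ.< base L
    0<base zero = Π-0< (upTo⁺ (2 ℕ.* h)) (λ i∈ → proj₁ (upTo⁺-bounds i∈))
    0<base (suc L) = ℕₚ.*-mono-≤ (0<base L) (ℕ.s≤s (ℕ.z≤n {1}))

    base-primes : ∀ L {p} → Prime p → p ∣ base L → p ℕ.≤ 2 ℕ.* h
    base-primes zero pp d with prime-∣-Π {xs = upTo⁺ (2 ℕ.* h)} pp d
    ... | i , i∈ , p∣i = let (0<i , i≤) = upTo⁺-bounds i∈ in ℕₚ.≤-trans (∣⇒≤ {{ℕ.>-nonZero 0<i}} p∣i) i≤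
    base-primes (suc L) {p} pp d with euclidsLemma (base L) 2 pp d
    ... | inj₁ e = base-primes L pp e
    ... | inj₂ e = ℕₚ.≤-trans (∣⇒≤ e) (ℕₚ.m≤m*n 2 h {{ℕ.>-nonZero 0<h}})

    module _ {n : ℕ} where

      -- The primes are adjoined one by one. The condition hi h ≤ Y persists because the range only
      -- grows, and keeping track of the prime factors shows that each new prime is coprime to the
      -- divisor built so far.
      dense-primes : ∀ {m Y} qs lo hi → m ∣ n → Dense m Y → 0 ℕ.< lo → hi ℕ.* h ℕ.≤ Y → Unique qs →
        (∀ {q} → q ∈ qs → Prime q × q ∣ n × lo ℕ.≤ q × q ℕ.≤ hi × ¬ (q ∣ m)) →
        ∃[ m′ ] (m′ ∣ n × Dense m′ (lo ℕ.^ length qs ℕ.* Y) × (∀ {p} → Prime p → p ∣ m′ → p ∣ m ⊎ p ∈ qs))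
      dense-primes {m} {Y} [] lo hi m∣n D 0<lo hi≤ u spec = m , m∣n , dense-≤ {m} (ℕₚ.≤-reflexive (ℕₚ.*-identityˡ Y)) D , λ _ → inj₁
      dense-primes {m} {Y} (q ∷ qs) lo hi m∣n D 0<lo hi≤ (q∉ ∷ u) spec = finish (dense-primes {m} {Y} qs lo hi m∣n D 0<lo hi≤ u (spec ∘ there))
        where
        pq = proj₁ (spec (here refl))
        Y₁ = lo ℕ.^ length qs ℕ.* Y
        Y≤Y₁ : Y ℕ.≤ Y₁
        Y≤Y₁ = ℕₚ.m≤n*m Y (lo ℕ.^ length qs) {{ℕ.>-nonZero (ℕₚ.m^n>0 lo {{ℕ.>-nonZero 0<lo}} (length qs))}}
        finish : ∃[ m′ ] (m′ ∣ n × Dense m′ Y₁ × (∀ {p} → Prime p → p ∣ m′ → p ∣ m ⊎ p ∈ qs)) →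
          ∃[ m′ ] (m′ ∣ n × Dense m′ (lo ℕ.^ suc (length qs) ℕ.* Y) × (∀ {p} → Prime p → p ∣ m′ → p ∣ m ⊎ p ∈ q ∷ qs))
        finish (m′ , m′∣n , D′ , ps) = m′ ℕ.* q , coprime-∣-* (Coprimality.sym (prime-∤⇒coprime pq q∤m′)) m′∣n (proj₁ (proj₂ (spec (here refl)))) ,
          dense-≤ {m′ ℕ.* q} (ℕₚ.≤-trans (ℕₚ.≤-reflexive (ℕₚ.*-assoc lo (lo ℕ.^ length qs) Y)) (ℕₚ.*-monoˡ-≤ Y₁ (proj₁ (proj₂ (proj₂ (spec (here refl)))))))
            (dense-* {m′} {Y₁} q (prime⇒0< pq) (ℕₚ.≤-trans (ℕₚ.*-monoˡ-≤ h (proj₁ (proj₂ (proj₂ (proj₂ (spec (here refl))))))) (ℕₚ.≤-trans hi≤ Y≤Y₁)) D′) , mem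
          where
          q∤m′ : ¬ (q ∣ m′)
          q∤m′ d with ps pq d
          ... | inj₁ e = proj₂ (proj₂ (proj₂ (proj₂ (spec (here refl))))) e
          ... | inj₂ e = ∉⇒≢ e q∉ refl
          mem : ∀ {p} → Prime p → p ∣ m′ ℕ.* q → p ∣ m ⊎ p ∈ q ∷ qs
          mem pp d with euclidsLemma m′ q pp d
          ... | inj₂ e = inj₂ (here (prime-∣-prime pp pq e))
          ... | inj₁ e with ps pp e
          ...   | inj₁ e′ = inj₁ e′
          ...   | inj₂ e′ = inj₂ (there e′)

    -- The range admits every prime up to 2^(K a), and m has no prime factor above 2^a, so the
    -- primes of the stock at a can be adjoined.
    Rung : ℕ → ℕ → ℕ → Set
    Rung n K a = ∃[ m ] ∃[ Y ] (m ∣ n × Dense m Y × 2 ℕ.^ (K ℕ.* a) ℕ.* h ℕ.≤ Y × (∀ {p} → Prime p → p ∣ m → p ℕ.≤ 2 ℕ.^ a))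

    -- K^2 primes above 2^a multiply the range by at least 2^(K (K a)), which is what the next scale
    -- requires of it; hence the size of the stock.
    climb : ∀ {n K a qs} → 0 ℕ.< K → Stock n K a qs → Rung n K a → Rung n K (K ℕ.* a)
    climb {n} {K} {a} {qs} 0<K (len , u , spec) (m , Y , m∣n , D , big , small) =
      finish (dense-primes {n} {m} {Y} qs (2 ℕ.^ a) (2 ℕ.^ (K ℕ.* a)) m∣n D (ℕₚ.m^n>0 2 a) big u
        λ q∈ → let (pq , d , lo , hi) = spec q∈ in pq , d , ℕₚ.<⇒≤ lo , hi , λ e → ℕₚ.<-irrefl refl (ℕₚ.<-≤-trans lo (small pq e)))
      where
      h≤Y : h ℕ.≤ Y
      h≤Y = ℕₚ.≤-trans (ℕₚ.m≤n*m h (2 ℕ.^ (K ℕ.* a)) {{ℕ.>-nonZero (ℕₚ.m^n>0 2 (K ℕ.* a))}}) big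
      exponent : (2 ℕ.^ a) ℕ.^ length qs ≡ 2 ℕ.^ (K ℕ.* (K ℕ.* a))
      exponent = trans (ℕₚ.^-*-assoc 2 a (length qs)) (cong (2 ℕ.^_) (trans (cong (a ℕ.*_) len) (trans (ℕₚ.*-comm a (K ℕ.* K)) (ℕₚ.*-assoc K K a))))
      a≤Ka : a ℕ.≤ K ℕ.* a
      a≤Ka = ℕₚ.m≤n*m a K {{ℕ.>-nonZero 0<K}}
      finish : ∃[ m′ ] (m′ ∣ n × Dense m′ ((2 ℕ.^ a) ℕ.^ length qs ℕ.* Y) × (∀ {p} → Prime p → p ∣ m′ → p ∣ m ⊎ p ∈ qs)) → Rung n K (K ℕ.* a)
      finish (m′ , m′∣n , D′ , ps) = m′ , (2 ℕ.^ a) ℕ.^ length qs ℕ.* Y , m′∣n , D′ ,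
        ℕₚ.*-mono-≤ (ℕₚ.≤-reflexive (sym exponent)) h≤Y , bound
        where
        bound : ∀ {p} → Prime p → p ∣ m′ → p ℕ.≤ 2 ℕ.^ (K ℕ.* a)
        bound pp d with ps pp d
        ... | inj₁ e = ℕₚ.≤-trans (small pp e) (ℕₚ.^-monoʳ-≤ 2 a≤Ka)
        ... | inj₂ e = proj₂ (proj₂ (proj₂ (spec e)))

    ladder : ∀ {n K a} k → 0 ℕ.< K → (∀ j → j ℕ.< k → ∃[ qs ] Stock n K (scale K a j) qs) → Rung n K a → Rung n K (scale K a k)
    ladder zero 0<K stock r = r
    ladder (suc k) 0<K stock r = climb 0<K (proj₂ (stock k (ℕₚ.n<1+n k))) (ladder k 0<K (λ j j<k → stock j (ℕₚ.m<n⇒m<1+n j<k)) r)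

-- Failure probability at a single scale.

module Scales where

  open import Defs using (_^ℚ_)
  open Rat
  open Sums
  open Mod
  open PrimeBounds using (primesBetween; ∈-primesBetween; primesBetween-spec; primesBetween-unique; 2^-mono; 5th)
  open Blocks
  open Carmichael using (^-distribʳ-*)
  open Dirichlet using (n<2^n)
  open BlockSieve
  open Chains
  open import Data.Nat as ℕ using (ℕ; zero; suc; NonZero)
  import Data.Nat.Properties as ℕₚ
  open import Data.Nat.DivMod using (_/_; m≡m%n+[m/n]*n; m%n<n; m/n*n≤m)
  open import Data.Nat.Divisibility using (_∣_)
  open import Data.Nat.Primality using (Prime)
  open import Data.Nat.Tactic.RingSolver renaming (solve-∀ to solve-∀ℕ)
  open import Data.Bool using (true; false; if_then_else_)
  open import Data.Rational hiding (NonZero; _/_; _÷_; ∣_∣)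
  open import Data.Rational.Properties
  open import Data.List using (List; []; _++_; length; filter)
  open import Data.List.Membership.Propositional using (_∈_; _∉_; find; lose)
  open import Data.List.Membership.Propositional.Properties using (∈-filter⁻; ∈-++⁻)
  open import Data.List.Membership.DecPropositional ℕₚ._≟_ using (_∈?_)
  open import Data.List.Relation.Unary.Unique.Propositional using (Unique)
  open import Data.Empty using (⊥-elim)
  open import Data.Product using (∃-syntax; _×_; _,_; proj₁; proj₂)
  open import Data.Sum using (inj₁; inj₂)
  open import Relation.Nullary using (Dec; yes; no; ¬_; does; ¬?)
  open import Relation.Binary.PropositionalEquality hiding (J)
  open import Tactic.RingSolver using (solve-∀)

  n<k*⌈n/k⌉ : ∀ n k .{{_ : NonZero k}} → n ℕ.< k ℕ.* suc (n / k)
  n<k*⌈n/k⌉ n k = ℕₚ.≤-trans (ℕₚ.≤-reflexive (cong suc (m≡m%n+[m/n]*n n k))) (ℕₚ.≤-trans (ℕₚ.+-monoˡ-≤ (n / k ℕ.* k) (m%n<n n k)) (ℕₚ.≤-reflexive (ℕₚ.*-comm (suc (n / k)) k)))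

  -- n ≤ k s with s = ⌊n/k⌋ + 1 and s ≤ 2 ^ s.
  power≤exponential : ∀ k n .{{_ : NonZero k}} → n ℕ.^ k ℕ.≤ k ℕ.^ k ℕ.* 2 ℕ.^ k ℕ.* 2 ℕ.^ n
  power≤exponential k n = begin
    n ℕ.^ k                               ≤⟨ ℕₚ.^-monoˡ-≤ k (ℕₚ.≤-trans (ℕₚ.<⇒≤ (n<k*⌈n/k⌉ n k)) (ℕₚ.*-monoʳ-≤ k (ℕₚ.<⇒≤ (n<2^n s)))) ⟩
    (k ℕ.* 2 ℕ.^ s) ℕ.^ k                 ≡⟨ ^-distribʳ-* k (2 ℕ.^ s) k ⟩
    k ℕ.^ k ℕ.* (2 ℕ.^ s) ℕ.^ k           ≤⟨ ℕₚ.*-monoʳ-≤ (k ℕ.^ k) (ℕₚ.≤-trans (ℕₚ.≤-reflexive (ℕₚ.^-*-assoc 2 s k)) (2^-mono (ℕₚ.+-monoʳ-≤ k (m/n*n≤m n k)))) ⟩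
    k ℕ.^ k ℕ.* 2 ℕ.^ (k ℕ.+ n)           ≡⟨ cong (k ℕ.^ k ℕ.*_) (ℕₚ.^-distribˡ-+-* 2 k n) ⟩
    k ℕ.^ k ℕ.* (2 ℕ.^ k ℕ.* 2 ℕ.^ n)     ≡⟨ sym (ℕₚ.*-assoc (k ℕ.^ k) (2 ℕ.^ k) (2 ℕ.^ n)) ⟩
    k ℕ.^ k ℕ.* 2 ℕ.^ k ℕ.* 2 ℕ.^ n       ∎
    where
    open ℕₚ.≤-Reasoning
    s = suc (n / k)

  -- `power≤exponential` is used one degree higher, and the spare factor t absorbs the constants.
  polynomial≤exponential : ∀ A C k → ∃[ t₀ ] (∀ t → t₀ ℕ.≤ t → A ℕ.* (1 ℕ.+ t ℕ.* C) ℕ.^ k ℕ.≤ 2 ℕ.^ t)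
  polynomial≤exponential A C k = t₀ , λ t t₀≤t → ℕₚ.*-cancelˡ-≤ c {{ℕ.>-nonZero 0<c}} (begin
    c ℕ.* (A ℕ.* (1 ℕ.+ t ℕ.* C) ℕ.^ k)             ≤⟨ ℕₚ.*-monoʳ-≤ c (ℕₚ.*-monoʳ-≤ A (ℕₚ.^-monoˡ-≤ k (linear t t₀≤t))) ⟩
    c ℕ.* (A ℕ.* ((1 ℕ.+ C) ℕ.* t) ℕ.^ k)           ≡⟨ cong (λ z → c ℕ.* (A ℕ.* z)) (^-distribʳ-* (1 ℕ.+ C) t k) ⟩
    c ℕ.* (A ℕ.* ((1 ℕ.+ C) ℕ.^ k ℕ.* t ℕ.^ k))     ≡⟨ lem c A ((1 ℕ.+ C) ℕ.^ k) (t ℕ.^ k) ⟩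
    A ℕ.* (1 ℕ.+ C) ℕ.^ k ℕ.* c ℕ.* t ℕ.^ k         ≤⟨ ℕₚ.*-monoˡ-≤ (t ℕ.^ k) (ℕₚ.≤-trans (ℕₚ.n≤1+n (A ℕ.* (1 ℕ.+ C) ℕ.^ k ℕ.* c)) t₀≤t) ⟩
    t ℕ.^ suc k                                     ≤⟨ power≤exponential (suc k) t ⟩
    c ℕ.* 2 ℕ.^ t                                   ∎)
    where
    open ℕₚ.≤-Reasoning
    c = suc k ℕ.^ suc k ℕ.* 2 ℕ.^ suc k
    0<c : 0 ℕ.< c
    0<c = ℕₚ.*-mono-≤ (ℕₚ.m^n>0 (suc k) (suc k)) (ℕₚ.m^n>0 2 (suc k))
    t₀ = suc (A ℕ.* (1 ℕ.+ C) ℕ.^ k ℕ.* c)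
    linear : ∀ t → t₀ ℕ.≤ t → 1 ℕ.+ t ℕ.* C ℕ.≤ (1 ℕ.+ C) ℕ.* t
    linear t t₀≤t = ℕₚ.+-mono-≤ (ℕₚ.≤-trans (ℕ.s≤s ℕ.z≤n) t₀≤t) (ℕₚ.≤-reflexive (ℕₚ.*-comm t C))
    lem : ∀ c a b d → c ℕ.* (a ℕ.* (b ℕ.* d)) ≡ a ℕ.* b ℕ.* c ℕ.* d
    lem = solve-∀ℕ

  U-join : ∀ {i j k} → i ℕ.≤ j → j ℕ.≤ k → U i j + U j k ≤ U i k
  U-join {i} {j} {k} i≤j j≤k = ≤-trans (≡⇒≤ (sym (∑-++ (primesBetween i j) (primesBetween j k) ρ)))
    (∑-⊆ (++-unique (primesBetween-unique i j) (primesBetween-unique j k)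
      (λ p∈ p∈′ → ℕₚ.<-irrefl refl (ℕₚ.<-≤-trans (proj₁ (proj₂ (primesBetween-spec {i = j} {k} p∈′))) (proj₂ (proj₂ (primesBetween-spec {i = i} {j} p∈)))))) sub 0≤ρ)
    where
    sub : ∀ {p} → p ∈ primesBetween i j ++ primesBetween j k → p ∈ primesBetween i k
    sub p∈ with ∈-++⁻ (primesBetween i j) p∈
    ... | inj₁ m = let (pp , lo , hi) = primesBetween-spec {i = i} {j} m in ∈-primesBetween pp lo (ℕₚ.≤-trans hi (2^-mono j≤k))
    ... | inj₂ m = let (pp , lo , hi) = primesBetween-spec {i = j} {k} m in ∈-primesBetween pp (ℕₚ.≤-<-trans (2^-mono i≤j) lo) hi

  U-blocks : ∀ {a} → 0 ℕ.< a → ∀ e → ν e * ρ 64 ≤ U a (J ℕ.^ e ℕ.* a)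
  U-blocks {a} 0<a zero = ≤-trans (≡⇒≤ (trans (cong (_* ρ 64) ν0) (*-zeroˡ (ρ 64)))) (0≤U a (1 ℕ.* a))
  U-blocks {a} 0<a (suc e) = ≤-trans (≡⇒≤ (trans (cong (_* ρ 64) (ν-suc e)) (lem (ν e) (ρ 64))))
    (≤-trans (+-mono-≤ (U-blocks 0<a e) (block-lower i (ℕₚ.*-mono-≤ 0<Jᵉ 0<a))) (≤-trans (U-join (ℕₚ.m≤n*m a (J ℕ.^ e) {{ℕ.>-nonZero 0<Jᵉ}}) (ℕₚ.m≤m*n i J {{ℕ.>-nonZero 0<J}}))
    (≡⇒≤ (cong (U a) (lem₂ (J ℕ.^ e) a J)))))
    where
    i = J ℕ.^ e ℕ.* a
    0<Jᵉ : 0 ℕ.< J ℕ.^ e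
    0<Jᵉ = ℕₚ.m^n>0 J {{ℕ.>-nonZero 0<J}} e
    lem : ∀ e r → (1ℚ + e) * r ≡ e * r + r
    lem = solve-∀ ringℚ
    lem₂ : ∀ x a j → x ℕ.* a ℕ.* j ≡ j ℕ.* x ℕ.* a
    lem₂ = solve-∀ℕ

  block-mass : ∀ i → 0 ℕ.< i → U i (i ℕ.* J) ≤ ν (320 ℕ.* J)
  block-mass i 0<i = *-cancelˡ (0<ν 0<i) (≤-trans (≡⇒≤ (cong (λ z → ν i * U i z) (sym n+i))) (≤-trans (block-upper i n) (≤-trans (*-monoʳ (0≤ν 320) (ν-mono (ℕₚ.m∸n≤m (i ℕ.* J) i)))
    (≡⇒≤ (trans (sym (ν-* (i ℕ.* J) 320)) (trans (cong ν (trans (ℕₚ.*-assoc i J 320) (cong (i ℕ.*_) (ℕₚ.*-comm J 320)))) (ν-* i (320 ℕ.* J))))))))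
    where
    n = i ℕ.* J ℕ.∸ i
    n+i : n ℕ.+ i ≡ i ℕ.* J
    n+i = ℕₚ.m∸n+n≡m (ℕₚ.m≤m*n i J {{ℕ.>-nonZero 0<J}})

  σ : ℚ
  σ = ν (J ℕ.* 1280) * ν 128

  0≤σ : 0ℚ ≤ σ
  0≤σ = 0≤* (0≤ν (J ℕ.* 1280)) (0≤ν 128)

  abstract
    -- 384 = 3·128, so that (1 + 1/128)^384 ≥ 1 + 3.
    window : ℕ
    window = 384

    window-growth : ν 4 ≤ (1ℚ + ρ 128) ^ℚ window
    window-growth = ≤-trans (≡⇒≤ (trans (ν-suc 3) (cong (1ℚ +_) three))) (bernoulli (0≤ρ 128) 384)
      where
      three : ν 3 ≡ ν 384 * ρ 128
      three = sym (trans (cong (_* ρ 128) (ν-* 3 128)) (trans (*-assoc (ν 3) (ν 128) (ρ 128)) (trans (cong (ν 3 *_) (νρ {128} (ℕ.s≤s ℕ.z≤n))) (*-identityʳ (ν 3)))))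

    -- A block has mass at least 1/64, so `levels` blocks have mass at least σ + 6, which leaves
    -- room for removing moduli. The 6 also makes `levels` at least 64·6 = `window`, whence
    -- J^`window` ≤ `K`.
    levels : ℕ
    levels = 64 ℕ.* (J ℕ.* 1280 ℕ.* 128 ℕ.+ 6)

    K : ℕ
    K = J ℕ.^ levels

    Jʷ≤K : J ℕ.^ window ℕ.≤ K
    Jʷ≤K = ℕₚ.^-monoʳ-≤ J {{ℕ.>-nonZero 0<J}} (ℕₚ.*-monoʳ-≤ 64 (ℕₚ.m≤n+m 6 (J ℕ.* 1280 ℕ.* 128)))

    2≤K : 2 ℕ.≤ K
    2≤K = ℕₚ.≤-trans 2≤J (ℕₚ.≤-trans (ℕₚ.≤-reflexive (sym (ℕₚ.*-identityʳ J))) (ℕₚ.^-monoʳ-≤ J {{ℕ.>-nonZero 0<J}} {1} (ℕₚ.≤-trans (ℕₚ.m≤n+m 1 5) (ℕₚ.≤-trans (ℕₚ.m≤n+m 6 (J ℕ.* 1280 ℕ.* 128)) (ℕₚ.m≤n*m (J ℕ.* 1280 ℕ.* 128 ℕ.+ 6) 64)))))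

    scale-mass : ∀ {a} → 0 ℕ.< a → σ + 1ℚ ≤ U a (K ℕ.* a)
    scale-mass {a} 0<a = ≤-trans σ+1≤ (U-blocks 0<a levels)
      where
      s : ℕ
      s = J ℕ.* 1280 ℕ.* 128
      lem : ∀ a b c → a * b * c ≡ (a * c) * b
      lem = solve-∀ ringℚ
      value : ν levels * ρ 64 ≡ ν (s ℕ.+ 6)
      value = trans (cong (_* ρ 64) (ν-* 64 (s ℕ.+ 6))) (trans (lem (ν 64) (ν (s ℕ.+ 6)) (ρ 64)) (trans (cong (_* ν (s ℕ.+ 6)) (νρ {64} (ℕ.s≤s ℕ.z≤n))) (*-identityˡ (ν (s ℕ.+ 6)))))
      σ+1≤ : σ + 1ℚ ≤ ν levels * ρ 64
      σ+1≤ = ≤-trans (≡⇒≤ (trans (cong₂ _+_ (sym (ν-* (J ℕ.* 1280) 128)) (sym ν1)) (sym (ν-+ s 1)))) (≤-trans (ν-mono (ℕₚ.+-monoʳ-≤ s (ℕ.s≤s (ℕ.z≤n {5})))) (≡⇒≤ (sym value)))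

  windows-growth : ∀ t → ν (4 ℕ.^ t) ≤ (1ℚ + ρ 128) ^ℚ (t ℕ.* window)
  windows-growth zero = ≡⇒≤ ν1
  windows-growth (suc t) = ≤-trans (≡⇒≤ (ν-* 4 (4 ℕ.^ t))) (≤-trans (*-mono (0≤ν 4) (0≤ν (4 ℕ.^ t)) window-growth (windows-growth t)) (≡⇒≤ (sym (^ℚ-+ (1ℚ + ρ 128) window (t ℕ.* window)))))

  0<K : 0 ℕ.< K
  0<K = ℕₚ.≤-trans (ℕ.s≤s ℕ.z≤n) 2≤K

  steps : ℕ → ℕ → ℕ
  steps b zero = b
  steps b (suc s) = steps b s ℕ.* J

  steps-^ : ∀ b s → steps b s ≡ b ℕ.* J ℕ.^ s
  steps-^ b zero = sym (ℕₚ.*-identityʳ b)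
  steps-^ b (suc s) = trans (cong (ℕ._* J) (steps-^ b s)) (lem b (J ℕ.^ s) J)
    where
    lem : ∀ b x j → b ℕ.* x ℕ.* j ≡ b ℕ.* (j ℕ.* x)
    lem = solve-∀ℕ

  steps-≥ : ∀ b s → b ℕ.≤ steps b s
  steps-≥ b zero = ℕₚ.≤-refl
  steps-≥ b (suc s) = ℕₚ.≤-trans (steps-≥ b s) (ℕₚ.m≤m*n (steps b s) J {{ℕ.>-nonZero 0<J}})

  steps-mono : ∀ b {s T} → s ℕ.≤ T → steps b s ℕ.≤ steps b T
  steps-mono b {s} {T} s≤T = subst₂ ℕ._≤_ (sym (steps-^ b s)) (sym (steps-^ b T)) (ℕₚ.*-monoʳ-≤ b (ℕₚ.^-monoʳ-≤ J {{ℕ.>-nonZero 0<J}} s≤T))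

  U-steps : ∀ b → 0 ℕ.< b → ∀ T → U b (steps b T) ≤ ν (T ℕ.* (320 ℕ.* J))
  U-steps b 0<b zero = ≡⇒≤ (trans (U-empty b) (sym ν0))
  U-steps b 0<b (suc T) = ≤-trans (U-split b (steps b T) (steps b T ℕ.* J)) (≤-trans (+-mono-≤ (U-steps b 0<b T) (block-mass (steps b T) (ℕₚ.≤-trans 0<b (steps-≥ b T))))
    (≡⇒≤ (trans (+-comm (ν (T ℕ.* (320 ℕ.* J))) (ν (320 ℕ.* J))) (sym (ν-+ (320 ℕ.* J) (T ℕ.* (320 ℕ.* J)))))))

  module AtScale (a : ℕ) (2≤a : 2 ℕ.≤ a) (large : K ℕ.* K ℕ.≤ 2 ℕ.^ a) where

    0<a : 0 ℕ.< a
    0<a = ℕₚ.≤-trans (ℕ.s≤s ℕ.z≤n) 2≤a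

    Q : List ℕ
    Q = primesBetween a (K ℕ.* a)

    rest : List ℕ → List ℕ
    rest E = filter (λ q → ¬? (q ∈? E)) Q

    rest-spec : ∀ {E q} → q ∈ rest E → q ∈ Q × q ∉ E
    rest-spec {E} q∈ = ∈-filter⁻ (λ q → ¬? (q ∈? E)) {xs = Q} q∈

    rest-unique : ∀ E → Unique (rest E)
    rest-unique E = filter-unique (λ q → ¬? (q ∈? E)) (primesBetween-unique a (K ℕ.* a))

    rest-bounds : ∀ {E q} → q ∈ rest E → Prime q × 4 ℕ.≤ q × q ℕ.≤ 2 ℕ.^ (K ℕ.* a)
    rest-bounds {E} q∈ = let (pq , lo , hi) = primesBetween-spec {i = a} {K ℕ.* a} (proj₁ (rest-spec {E} q∈)) in
      pq , ℕₚ.≤-trans (2^-mono 2≤a) (ℕₚ.<⇒≤ lo) , hi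

    -- The at most K^2 removed primes all exceed 2^a ≥ K^2, so the mass lost is at most 1.
    rest-mass : ∀ {E} → length E ℕ.≤ K ℕ.* K → σ ≤ ∑ (rest E) ρ
    rest-mass {E} E≤ = ≤-by ((1ℚ - X) + (U a (K ℕ.* a) - (σ + 1ℚ))) (0≤+ (≤⇒0≤- X≤1) (≤⇒0≤- (scale-mass 0<a)))
      (trans (lem Y X) (trans (cong (_- X) split) (lem₂ (U a (K ℕ.* a)) X σ)))
      where
      used = filter (_∈? E) Q
      X = ∑ used ρ
      Y = ∑ (rest E) ρ
      lem : ∀ y x → y ≡ (y + x) - x
      lem = solve-∀ ringℚ
      lem₂ : ∀ u x s → u - x ≡ s + ((1ℚ - x) + (u - (s + 1ℚ)))
      lem₂ = solve-∀ ringℚ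
      pick′ : ∀ q → (if does (¬? (q ∈? E)) then ρ q else 0ℚ) + (if does (q ∈? E) then ρ q else 0ℚ) ≡ ρ q
      pick′ q with does (q ∈? E)
      ... | true = +-identityˡ (ρ q)
      ... | false = +-identityʳ (ρ q)
      split : Y + X ≡ U a (K ℕ.* a)
      split = trans (cong₂ _+_ (∑-filter (λ q → ¬? (q ∈? E)) Q ρ) (∑-filter (_∈? E) Q ρ)) (trans (sym (∑-+ Q _ _)) (∑-cong Q (λ {q} _ → pick′ q)))
      X≤1 : X ≤ 1ℚ
      X≤1 = ≤-trans (∑-mono used {g = λ _ → ρ (2 ℕ.^ a)} (λ {q} q∈ → ρ-anti (ℕₚ.m^n>0 2 a) (ℕₚ.<⇒≤ (proj₁ (proj₂ (primesBetween-spec {i = a} {K ℕ.* a} (proj₁ (∈-filter⁻ (_∈? E) {xs = Q} q∈))))))))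
        (≤-trans (≡⇒≤ (∑-const used (ρ (2 ℕ.^ a)))) (≤-trans (*-monoʳ (0≤ρ (2 ℕ.^ a)) (ν-mono (ℕₚ.≤-trans (length-⊆ (filter-unique (_∈? E) (primesBetween-unique a (K ℕ.* a)))
          (λ q∈ → proj₂ (∈-filter⁻ (_∈? E) {xs = Q} q∈))) (ℕₚ.≤-trans E≤ large)))) (≡⇒≤ (νρ (ℕₚ.m^n>0 2 a)))))

    Link : List ℕ → ℕ → Set
    Link E p = Linked (rest E) p

    link? : ∀ E p → Dec (Link E p)
    link? E p = linked? (rest E) p

    choose : ∀ E p → Dec (Link E p) → ℕ
    choose E p (yes l) = proj₁ (find l)
    choose E p (no _) = 0

    pick : List ℕ → ℕ → ℕ
    pick E p = choose E p (link? E p)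

    pick-spec : ∀ {E p} → Link E p → pick E p ∈ Q × pick E p ∉ E × pick E p ∣ p ℕ.∸ 1
    pick-spec {E} {p} l = by-cases (link? E p)
      where
      by-cases : (d : Dec (Link E p)) → choose E p d ∈ Q × choose E p d ∉ E × choose E p d ∣ p ℕ.∸ 1
      by-cases (yes l′) = let (q , q∈ , d) = find l′ in proj₁ (rest-spec {E} q∈) , proj₂ (rest-spec {E} q∈) , d
      by-cases (no ¬l) = ⊥-elim (¬l l)

    -- The moduli go up to 2^(K a), and `good-block` needs blocks that start at ten times this
    -- exponent.
    b : ℕ
    b = 10 ℕ.* (K ℕ.* a)

    0<b : 0 ℕ.< b
    0<b = ℕₚ.*-mono-≤ {1} {10} {1} (ℕ.s≤s ℕ.z≤n) (ℕₚ.*-mono-≤ 0<K 0<a)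

    module _ (T : ℕ) where

      top : ℕ
      top = steps b T

      B : List ℕ
      B = primesBetween b top

      B-prime : ∀ {p} → p ∈ B → Prime p
      B-prime p∈ = proj₁ (primesBetween-spec {i = b} {top} p∈)

      private
        hit : ∀ E n → Dec (Hit B B-prime Link link? pick E n)
        hit = hit? B B-prime Link link? pick

      module _ (E : List ℕ) (E≤ : length E ℕ.≤ K ℕ.* K) where

        private
          G : ℕ → List ℕ
          G s = good (rest E) (steps b s) (steps b s ℕ.* J)

          H : ℕ → ℕ
          H s = 2 ℕ.^ steps b s

          G-∈ : ∀ {s p} → p ∈ G s → p ∈ primesBetween (steps b s) (steps b s ℕ.* J) × Link E p
          G-∈ {s} p∈ = ∈-filter⁻ (linked? (rest E)) {xs = primesBetween (steps b s) (steps b s ℕ.* J)} p∈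

          G-spec : ∀ {s p} → p ∈ G s → Prime p × H s ℕ.< p × p ℕ.≤ H (suc s)
          G-spec {s} p∈ = primesBetween-spec {i = steps b s} {steps b s ℕ.* J} (proj₁ (G-∈ {s} p∈))

        open Sieving G H (λ s → filter-unique (linked? (rest E)) (primesBetween-unique (steps b s) (steps b s ℕ.* J)))
          (λ {s} → G-spec {s}) (λ s → ℕₚ.m^n>0 2 (steps b s)) (λ s → 2^-mono (steps-mono b (ℕₚ.n≤1+n s)))
          using (products-bound; block-sieve)

        -- The exponents of the block ends grow by the factor J ≥ 2, so they add up to at most twice
        -- the last one.
        products≤ : ∀ S → products-bound S ℕ.≤ 2 ℕ.^ (2 ℕ.* steps b S)
        products≤ zero = ℕₚ.m^n>0 2 (2 ℕ.* b)
        products≤ (suc S) = ℕₚ.≤-trans (ℕₚ.*-monoʳ-≤ (2 ℕ.^ i) (ℕₚ.≤-trans (products≤ S) (2^-mono (ℕₚ.≤-trans (ℕₚ.*-monoˡ-≤ (steps b S) 2≤J) (ℕₚ.≤-reflexive (ℕₚ.*-comm J (steps b S)))))))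
          (ℕₚ.≤-reflexive (trans (sym (ℕₚ.^-distribˡ-+-* 2 i i)) (cong (λ z → 2 ℕ.^ (i ℕ.+ z)) (sym (ℕₚ.+-identityʳ i)))))
          where
          i = steps b S ℕ.* J

        -- A missed n has no prime factor among the primes linked to the moduli outside E, and by
        -- `good-block` these have mass at least 1/128 in every block.
        hit-sieve : ∀ N → 2 ℕ.^ (10 ℕ.* top) ℕ.≤ N → ν (length (misses (hit E) N)) * (1ℚ + ρ 128) ^ℚ T ≤ ν N * ν 4
        hit-sieve N big = ≤-trans (block-sieve (0≤ρ 128) T
            (λ s _ → good-block (rest E) (rest-unique E) (K ℕ.* a) (ℕₚ.*-mono-≤ 0<K 0<a) (rest-bounds {E}) σ 0≤σ (rest-mass E≤) refl (steps b s) (steps-≥ b s))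
            (2 ℕ.^ (2 ℕ.* top)) (products≤ T) (suc N) (ℕₚ.≤-trans (ℕₚ.≤-reflexive (trans (5th (2 ℕ.* top)) (cong (2 ℕ.^_) (sym (ℕₚ.*-assoc 5 2 top))))) (ℕₚ.≤-trans big (ℕₚ.n≤1+n N)))
            (misses-unique (hit E) N) (λ n∈ → ℕ.s≤s (proj₂ (proj₁ (misses-spec (hit E) {N} n∈)))) free)
          (≤-trans (≡⇒≤ (sym (ν-+ (suc N) (suc N)))) (≤-trans (ν-mono 2N+2≤) (≡⇒≤ (ν-* N 4))))
          where
          1≤N : 1 ℕ.≤ N
          1≤N = ℕₚ.≤-trans (ℕₚ.m^n>0 2 (10 ℕ.* top)) big
          2N+2≤ : suc N ℕ.+ suc N ℕ.≤ N ℕ.* 4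
          2N+2≤ = ℕₚ.≤-trans (ℕₚ.+-mono-≤ (ℕₚ.+-monoˡ-≤ N 1≤N) (ℕₚ.+-monoˡ-≤ N 1≤N)) (ℕₚ.≤-reflexive (lem N))
            where
            lem : ∀ n → n ℕ.+ n ℕ.+ (n ℕ.+ n) ≡ n ℕ.* 4
            lem = solve-∀ℕ
          free : ∀ {n s p} → n ∈ misses (hit E) N → s ℕ.< T → p ∈ G s → ¬ (p ∣ n)
          free {n} {s} n∈ s<T p∈ d = let (pp , lo , hi) = G-spec {s} p∈ in
            proj₂ (misses-spec (hit E) {N} n∈) (lose (∈-primesBetween pp (ℕₚ.≤-<-trans (2^-mono (steps-≥ b s)) lo) (ℕₚ.≤-trans hi (2^-mono (steps-mono b s<T)))) (d , proj₂ (G-∈ {s} p∈)))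

      Rich : ℕ → Set
      Rich = Chain B B-prime Link link? pick (K ℕ.* K) []

      rich? : ∀ n → Dec (Rich n)
      rich? = chain? B B-prime Link link? pick (K ℕ.* K) []

      -- The mass u of B is linear in T, so K^2 successive removals cost the polynomial (1 +
      -- u)^(K^2) against the exponential gain of `hit-sieve`.
      rich-count : ∀ N → 2 ℕ.^ ((10 ℕ.+ K ℕ.* K) ℕ.* top) ℕ.≤ N →
        ν (length (misses rich? N)) * (1ℚ + ρ 128) ^ℚ T ≤ ν N * (ν 4 * ν (1 ℕ.+ T ℕ.* (320 ℕ.* J)) ^ℚ (K ℕ.* K))
      rich-count N big = ≤-trans (count-misses B B-prime Link link? pick R₀ (2 ℕ.^ (10 ℕ.* top)) (2 ℕ.^ top) (ℕₚ.m^n>0 2 top) (λ p∈ → proj₂ (proj₂ (primesBetween-spec {i = b} {top} p∈)))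
          Λ (ν 4) u 0≤Λ (0≤ν 4) (U-steps b 0<b T) sieve R₀ [] N ℕₚ.≤-refl big′)
        (*-monoˡ (0≤ν N) (≤-trans (V-bound B B-prime Link link? pick R₀ (2 ℕ.^ (10 ℕ.* top)) (2 ℕ.^ top) (ℕₚ.m^n>0 2 top) (λ p∈ → proj₂ (proj₂ (primesBetween-spec {i = b} {top} p∈)))
          Λ (ν 4) u 0≤Λ (0≤ν 4) (U-steps b 0<b T) sieve R₀) (≡⇒≤ (cong (λ z → ν 4 * z ^ℚ R₀) (sym (ν-suc (T ℕ.* (320 ℕ.* J))))))))
        where
        R₀ = K ℕ.* K
        u = ν (T ℕ.* (320 ℕ.* J))
        Λ = (1ℚ + ρ 128) ^ℚ T
        0≤Λ : 0ℚ ≤ Λ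
        0≤Λ = ^ℚ-nonneg (0≤+ 0≤1 (0≤ρ 128)) T
        sieve : ∀ E N → length E ℕ.< R₀ → 2 ℕ.^ (10 ℕ.* top) ℕ.≤ N → ν (length (misses (hit E) N)) * Λ ≤ ν N * ν 4
        sieve E N E< = hit-sieve E (ℕₚ.<⇒≤ E<) N
        big′ : 2 ℕ.^ (10 ℕ.* top) ℕ.* (2 ℕ.^ top) ℕ.^ R₀ ℕ.≤ N
        big′ = ℕₚ.≤-trans (ℕₚ.≤-reflexive (trans (cong (2 ℕ.^ (10 ℕ.* top) ℕ.*_) (ℕₚ.^-*-assoc 2 top R₀)) (trans (sym (ℕₚ.^-distribˡ-+-* 2 (10 ℕ.* top) (top ℕ.* R₀)))
          (cong (2 ℕ.^_) (trans (cong (10 ℕ.* top ℕ.+_) (ℕₚ.*-comm top R₀)) (sym (ℕₚ.*-distribʳ-+ top 10 R₀))))))) big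

  -- t windows gain 4^t: one factor 2^t pays for the polynomial loss and for A, the other remains.
  -- The bound t₀ does not depend on the scale a.
  scale-count : ∀ A → ∃[ t₀ ] (∀ t → t₀ ℕ.≤ t → ∀ a (2≤a : 2 ℕ.≤ a) (large : K ℕ.* K ℕ.≤ 2 ℕ.^ a) → let open AtScale a 2≤a large in
    ∀ N → 2 ℕ.^ ((10 ℕ.+ K ℕ.* K) ℕ.* top (t ℕ.* window)) ℕ.≤ N → length (misses (rich? (t ℕ.* window)) N) ℕ.* (A ℕ.* 2 ℕ.^ t) ℕ.≤ N)
  scale-count A = proj₁ poly , λ t t₀≤t a 2≤a large N big → finish t t₀≤t a 2≤a large N big
    where
    C = window ℕ.* (320 ℕ.* J)
    R₀ = K ℕ.* K
    poly = polynomial≤exponential (A ℕ.* 4) C R₀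
    module _ (t : ℕ) (t₀≤t : proj₁ poly ℕ.≤ t) (a : ℕ) (2≤a : 2 ℕ.≤ a) (large : K ℕ.* K ℕ.≤ 2 ℕ.^ a) (N : ℕ) where
      open AtScale a 2≤a large
      T = t ℕ.* window
      finish : 2 ℕ.^ ((10 ℕ.+ K ℕ.* K) ℕ.* top T) ℕ.≤ N → length (misses (rich? T) N) ℕ.* (A ℕ.* 2 ℕ.^ t) ℕ.≤ N
      finish big = ℕₚ.*-cancelʳ-≤ (len ℕ.* (A ℕ.* 2 ℕ.^ t)) N (2 ℕ.^ t) {{ℕ.>-nonZero (ℕₚ.m^n>0 2 t)}}
        (ℕₚ.≤-trans (ℕₚ.≤-reflexive (trans (lem len A (2 ℕ.^ t)) (cong (λ z → A ℕ.* (len ℕ.* z)) (sym (^-distribʳ-* 2 2 t)))))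
        (ℕₚ.≤-trans (ℕₚ.*-monoʳ-≤ A count) (ℕₚ.≤-trans (ℕₚ.≤-reflexive (lem₂ A N ((1 ℕ.+ t ℕ.* C) ℕ.^ R₀))) (ℕₚ.*-monoʳ-≤ N (proj₂ poly t t₀≤t)))))
        where
        len = length (misses (rich? T) N)
        lem : ∀ l a x → l ℕ.* (a ℕ.* x) ℕ.* x ≡ a ℕ.* (l ℕ.* (x ℕ.* x))
        lem = solve-∀ℕ
        lem₂ : ∀ a n w → a ℕ.* (n ℕ.* (4 ℕ.* w)) ≡ n ℕ.* (a ℕ.* 4 ℕ.* w)
        lem₂ = solve-∀ℕ
        count : len ℕ.* 4 ℕ.^ t ℕ.≤ N ℕ.* (4 ℕ.* (1 ℕ.+ t ℕ.* C) ℕ.^ R₀)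
        count = ν-cancel (≤-trans (≡⇒≤ (ν-* len (4 ℕ.^ t))) (≤-trans (*-monoˡ (0≤ν len) (windows-growth t)) (≤-trans (rich-count T N big)
          (≡⇒≤ (sym (trans (ν-* N (4 ℕ.* (1 ℕ.+ t ℕ.* C) ℕ.^ R₀)) (cong (ν N *_) (trans (ν-* 4 ((1 ℕ.+ t ℕ.* C) ℕ.^ R₀)) (cong (ν 4 *_) (trans (sym (ν-^ (1 ℕ.+ t ℕ.* C) R₀))
            (cong (λ z → ν (1 ℕ.+ z) ^ℚ R₀) (sym (ℕₚ.*-assoc t window (320 ℕ.* J)))))))))))))) 

-- Almost all integers, all scales at once.

module Final where

  open import Defs
  open Rat
  open Sums
  open Mod
  open Harmonic using (upTo⁺; upTo⁺-bounds; upTo⁺-unique; primesUpTo; ∈-primesUpTo; primesUpTo-prime)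
  open PrimeBounds using (2^-mono; primesBetween-spec)
  open Blocks using (J; 0<J)
  open Carmichael using (prime-power-λC; prime-powers-∣; λC∣φ)
  open Dirichlet using (dirichlet; primesIn; primesIn-spec; primesIn-unique; n<2^n)
  open BlockSieve
  open Chains
  open Density
  open Scales
  open import Data.Nat as ℕ using (ℕ; zero; suc)
  import Data.Nat.Properties as ℕₚ
  open import Data.Nat.Divisibility using (_∣_; _∣?_; ∣⇒≤; ∣-trans; ∣-refl; m∣m*n; 1∣_)
  open import Data.Nat.Primality using (Prime)
  open import Data.Nat.Tactic.RingSolver renaming (solve-∀ to solve-∀ℕ)
  open import Data.Rational hiding (NonZero; _/_; _÷_; ∣_∣; floor)
  open import Data.Rational.Properties
  open import Data.List using (List; []; _∷_; _++_; length; filter; cartesianProduct)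
  open import Data.List.Properties using (length-map; length-++)
  open import Data.List.Membership.Propositional using (_∈_; find; lose)
  open import Data.List.Membership.Propositional.Properties using (∈-filter⁻; ∈-filter⁺; ∈-++⁺ˡ; ∈-++⁺ʳ; ∈-cartesianProduct⁺)
  open import Data.List.Relation.Unary.Any as Any using (Any; here; there; any?)
  open import Data.List.Relation.Unary.All as All using (All)
  open import Data.List.Relation.Unary.Unique.Propositional using (Unique)
  open import Data.Empty using (⊥; ⊥-elim)
  open import Data.Unit using (⊤; tt)
  open import Data.Product using (∃-syntax; _×_; _,_; proj₁; proj₂)
  open import Data.Sum using (_⊎_; inj₁; inj₂)
  open import Function using (_∘_)
  open import Level using (0ℓ)
  open import Relation.Nullary using (Dec; yes; no; ¬_; _×-dec_)
  open import Relation.Unary using (Pred; Decidable)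
  open import Relation.Binary.PropositionalEquality hiding (J)
  open import Tactic.RingSolver using (solve-∀)

  _×?_ : {P Q : Pred ℕ 0ℓ} → Decidable P → Decidable Q → Decidable (λ n → P n × Q n)
  (P? ×? Q?) n = P? n ×-dec Q? n

  misses-× : {P Q : Pred ℕ 0ℓ} (P? : Decidable P) (Q? : Decidable Q) → ∀ N →
    length (misses (P? ×? Q?) N) ℕ.≤ length (misses P? N) ℕ.+ length (misses Q? N)
  misses-× {P} {Q} P? Q? N = ℕₚ.≤-trans (length-⊆ (misses-unique (P? ×? Q?) N) sub) (ℕₚ.≤-reflexive (length-++ (misses P? N)))
    where
    sub : ∀ {n} → n ∈ misses (P? ×? Q?) N → n ∈ misses P? N ++ misses Q? N
    sub {n} n∈ = by-cases (misses-spec (P? ×? Q?) {N} n∈) (P? n)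
      where
      by-cases : (0 ℕ.< n × n ℕ.≤ N) × ¬ (P n × Q n) → Dec (P n) → n ∈ misses P? N ++ misses Q? N
      by-cases ((lo , hi) , ¬pq) (no ¬p) = ∈-++⁺ˡ (∈-misses P? lo hi ¬p)
      by-cases ((lo , hi) , ¬pq) (yes p) = ∈-++⁺ʳ (misses P? N) (∈-misses Q? lo hi (λ q → ¬pq (p , q)))

  hits+misses : {P : Pred ℕ 0ℓ} (P? : Decidable P) → ∀ N → N ℕ.≤ length (filter P? (upTo⁺ N)) ℕ.+ length (misses P? N)
  hits+misses {P} P? N = ℕₚ.≤-trans (ℕₚ.≤-reflexive (sym (trans (length-map suc (below N)) (length-below N))))
    (ℕₚ.≤-trans (length-⊆ (upTo⁺-unique N) sub) (ℕₚ.≤-reflexive (length-++ (filter P? (upTo⁺ N)))))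
    where
    sub : ∀ {n} → n ∈ upTo⁺ N → n ∈ filter P? (upTo⁺ N) ++ misses P? N
    sub {n} n∈ = by-cases (P? n)
      where
      by-cases : Dec (P n) → n ∈ filter P? (upTo⁺ N) ++ misses P? N
      by-cases (yes p) = ∈-++⁺ˡ (∈-filter⁺ P? n∈ p)
      by-cases (no ¬p) = ∈-++⁺ʳ (filter P? (upTo⁺ N)) (∈-misses P? (proj₁ (upTo⁺-bounds n∈)) (proj₂ (upTo⁺-bounds n∈)) ¬p)

  no-misses : {P : Pred ℕ 0ℓ} (P? : Decidable P) → (∀ n → P n) → ∀ N → length (misses P? N) ≡ 0
  no-misses P? p N = none (misses P? N) λ {n} n∈ → proj₂ (misses-spec P? {N} n∈) (p n)
    where
    none : ∀ (xs : List ℕ) → (∀ {x} → x ∈ xs → ⊥) → length xs ≡ 0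
    none [] h = refl
    none (x ∷ xs) h = ⊥-elim (h (here refl))

  half-+ : ∀ {a b η N} → a ℕ.* (2 ℕ.* η) ℕ.≤ N → b ℕ.* (2 ℕ.* η) ℕ.≤ N → (a ℕ.+ b) ℕ.* η ℕ.≤ N
  half-+ {a} {b} {η} {N} ha hb = ℕₚ.*-cancelˡ-≤ 2 (ℕₚ.≤-trans (ℕₚ.≤-reflexive (lem a b η)) (ℕₚ.≤-trans (ℕₚ.+-mono-≤ ha hb) (ℕₚ.≤-reflexive (cong (N ℕ.+_) (sym (ℕₚ.+-identityʳ N))))))
    where
    lem : ∀ a b η → 2 ℕ.* ((a ℕ.+ b) ℕ.* η) ≡ a ℕ.* (2 ℕ.* η) ℕ.+ b ℕ.* (2 ℕ.* η)
    lem = solve-∀ℕ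

  -- A property of all but at most N/η of the integers up to N. The exceptions are counted through a
  -- decidable sufficient condition, which can be combined with others.
  record Frequent (η : ℕ) (Conclusion : ℕ → Set) : Set₁ where
    field
      Condition : Pred ℕ 0ℓ
      condition? : Decidable Condition
      start : ℕ
      implies : ∀ {n} → 1 ℕ.< n → Condition n → Conclusion n
      rare : ∀ N → start ℕ.≤ N → length (misses condition? N) ℕ.* η ℕ.≤ N

  open Frequent

  frequent-× : ∀ {η C C′} → Frequent (2 ℕ.* η) C → Frequent (2 ℕ.* η) C′ → Frequent η (λ n → C n × C′ n)
  frequent-× {η} F F′ .Condition n = Condition F n × Condition F′ n
  frequent-× {η} F F′ .condition? = condition? F ×? condition? F′
  frequent-× {η} F F′ .start = start F ℕ.+ start F′
  frequent-× {η} F F′ .implies 1<n (c , c′) = implies F 1<n c , implies F′ 1<n c′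
  frequent-× {η} F F′ .rare N le = ℕₚ.≤-trans (ℕₚ.*-monoˡ-≤ η (misses-× (condition? F) (condition? F′) N))
    (half-+ {length (misses (condition? F) N)} (rare F N (ℕₚ.m+n≤o⇒m≤o (start F) le)) (rare F′ N (ℕₚ.m+n≤o⇒n≤o (start F) le)))

  frequent-all : {A : Set} {C : A → ℕ → Set} → (∀ η x → Frequent η (C x)) → ∀ η (xs : List A) → Frequent η (λ n → All (λ x → C x n) xs)
  frequent-all F η [] .Condition n = ⊤
  frequent-all F η [] .condition? n = yes tt
  frequent-all F η [] .start = 0
  frequent-all F η [] .implies _ _ = All.[]
  frequent-all F η [] .rare N _ = ℕₚ.≤-trans (ℕₚ.≤-reflexive (cong (ℕ._* η) (no-misses (λ _ → yes tt) (λ _ → tt) N))) ℕ.z≤n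
  frequent-all {A} {C} F η (x ∷ xs) = record { Condition = Condition F× ; condition? = condition? F× ; start = start F× ;
    implies = λ 1<n c → let (a , b) = implies F× 1<n c in a All.∷ b ; rare = rare F× }
    where
    F× = frequent-× (F (2 ℕ.* η) x) (frequent-all F (2 ℕ.* η) xs)

  module _ {l : ℕ} (pl : Prime l) (e : ℕ) (η : ℕ) where

    private
      κ : ℕ
      κ = proj₁ (dirichlet pl e)

      w₀ : ℕ
      w₀ = proj₁ (proj₂ (dirichlet pl e))

      0<κ : 0 ℕ.< κ
      0<κ = proj₁ (proj₂ (proj₂ (dirichlet pl e)))

      next : ∀ w → w₀ ℕ.≤ w → ∃[ Y ] ρ κ ≤ ∑ (filter (λ p → l ℕ.^ suc e ∣? p ℕ.∸ 1) (primesIn w Y)) ρ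
      next = proj₂ (proj₂ (proj₂ (dirichlet pl e)))

      -- Each block ends at or beyond the bound that `dirichlet` returns for its start, and the next
      -- one starts there; so there are infinitely many disjoint blocks of mass at least 1/κ.
      stage : ℕ → ∃[ w ] suc w₀ ℕ.≤ w
      stage zero = suc w₀ , ℕₚ.≤-refl
      stage (suc s) = let (w , le) = stage s ; (Y , _) = next w (ℕₚ.≤-trans (ℕₚ.n≤1+n w₀) le) in w ℕ.⊔ Y , ℕₚ.≤-trans le (ℕₚ.m≤m⊔n w Y)

      H : ℕ → ℕ
      H s = proj₁ (stage s)

      w₀≤ : ∀ s → w₀ ℕ.≤ H s
      w₀≤ s = ℕₚ.≤-trans (ℕₚ.n≤1+n w₀) (proj₂ (stage s))

      Y : ℕ → ℕ
      Y s = proj₁ (next (H s) (w₀≤ s))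

      G : ℕ → List ℕ
      G s = filter (λ p → l ℕ.^ suc e ∣? p ℕ.∸ 1) (primesIn (H s) (Y s))

      G-∈ : ∀ {s p} → p ∈ G s → p ∈ primesIn (H s) (Y s) × l ℕ.^ suc e ∣ p ℕ.∸ 1
      G-∈ {s} = ∈-filter⁻ (λ p → l ℕ.^ suc e ∣? p ℕ.∸ 1) {xs = primesIn (H s) (Y s)}

      G-spec : ∀ {s p} → p ∈ G s → Prime p × H s ℕ.< p × p ℕ.≤ H (suc s)
      G-spec {s} p∈ = let (pp , lo , hi) = primesIn-spec {w = H s} {Y s} (proj₁ (G-∈ {s} p∈)) in pp , lo , ℕₚ.≤-trans hi (ℕₚ.m≤n⊔m (H s) (Y s))

      open Sieving G H (λ s → filter-unique (λ p → l ℕ.^ suc e ∣? p ℕ.∸ 1) (primesIn-unique (H s) (Y s))) (λ {s} → G-spec {s})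
        (λ s → ℕₚ.≤-trans (ℕ.s≤s ℕ.z≤n) (proj₂ (stage s))) (λ s → ℕₚ.m≤m⊔n (H s) (Y s))

      T : ℕ
      -- By Bernoulli's inequality (1 + 1/κ)^T exceeds 4 η; the factor 4 covers 2 (N + 1) ≤ 4 N.
      T = κ ℕ.* (4 ℕ.* η)

      R : ℕ
      R = products-bound T

      R⁵ : ℕ
      R⁵ = R ℕ.* (R ℕ.* R ℕ.* (R ℕ.* R))

      Hit′ : ℕ → Set
      Hit′ n = Any (_∣ n) (blocks T)

      hit′? : Decidable Hit′
      hit′? n = any? (_∣? n) (blocks T)

      growth : ν (4 ℕ.* η) ≤ (1ℚ + ρ κ) ^ℚ T
      growth = ≤-trans (≤-by 1ℚ 0≤1 (trans (cong (1ℚ +_) value) (+-comm 1ℚ (ν (4 ℕ.* η))))) (bernoulli (0≤ρ κ) T)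
        where
        lem : ∀ k x r → k * x * r ≡ (k * r) * x
        lem = solve-∀ ringℚ
        value : ν T * ρ κ ≡ ν (4 ℕ.* η)
        value = trans (cong (_* ρ κ) (ν-* κ (4 ℕ.* η))) (trans (lem (ν κ) (ν (4 ℕ.* η)) (ρ κ)) (trans (cong (_* ν (4 ℕ.* η)) (νρ 0<κ)) (*-identityˡ (ν (4 ℕ.* η)))))

      count : ∀ N → suc R⁵ ℕ.≤ N → length (misses hit′? N) ℕ.* η ℕ.≤ N
      count N le = ℕₚ.*-cancelʳ-≤ (len ℕ.* η) N 4 (ν-cancel (≤-trans (≡⇒≤ (trans (cong ν (lem len η)) (ν-* len (4 ℕ.* η)))) (≤-trans (*-monoˡ (0≤ν len) growth) (≤-trans sieve
        (≤-trans (≡⇒≤ (sym (ν-+ (suc N) (suc N)))) (ν-mono 2N+2≤))))))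
        where
        len = length (misses hit′? N)
        lem : ∀ l η → l ℕ.* η ℕ.* 4 ≡ l ℕ.* (4 ℕ.* η)
        lem = solve-∀ℕ
        lem₂ : ∀ n → n ℕ.+ n ℕ.+ (n ℕ.+ n) ≡ n ℕ.* 4
        lem₂ = solve-∀ℕ
        1≤N : 1 ℕ.≤ N
        1≤N = ℕₚ.≤-trans (ℕ.s≤s ℕ.z≤n) le
        2N+2≤ : suc N ℕ.+ suc N ℕ.≤ N ℕ.* 4
        2N+2≤ = ℕₚ.≤-trans (ℕₚ.+-mono-≤ (ℕₚ.+-monoˡ-≤ N 1≤N) (ℕₚ.+-monoˡ-≤ N 1≤N)) (ℕₚ.≤-reflexive (lem₂ N))
        sieve : ν len * (1ℚ + ρ κ) ^ℚ T ≤ ν (suc N) + ν (suc N)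
        sieve = block-sieve (0≤ρ κ) T (λ s _ → proj₂ (next (H s) (w₀≤ s))) R ℕₚ.≤-refl (suc N) (ℕₚ.≤-trans (ℕₚ.n≤1+n R⁵) (ℕₚ.≤-trans le (ℕₚ.n≤1+n N)))
          (misses-unique hit′? N) (λ n∈ → ℕ.s≤s (proj₂ (proj₁ (misses-spec hit′? {N} n∈))))
          (λ n∈ s<T p∈ d → proj₂ (misses-spec hit′? {N} n∈) (lose (∈-blocks s<T p∈) d))

    frequent-prime-power : Frequent η (λ n → l ℕ.^ suc e ∣ λC n)
    frequent-prime-power = record { Condition = Hit′ ; condition? = hit′? ; start = suc R⁵ ; rare = count ;
      implies = λ 1<n hit → let (p , p∈ , d) = find hit ; (s , _ , m) = blocks-∈ {T} p∈ in
        prime-power-λC (suc e) (proj₁ (G-spec {s} m)) pl 1<n d (proj₂ (G-∈ {s} m)) }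

  -- It suffices that all prime powers dividing D divide λ(n), and these are among the finitely many
  -- l^(e+1) with l ≤ D and e < D.
  frequent-divisor : ∀ η D → 0 ℕ.< D → Frequent η (λ n → D ∣ λC n)
  frequent-divisor η D 0<D = record { Condition = Condition F ; condition? = condition? F ; start = start F ; rare = rare F ; implies = λ {n} 1<n c → divides-λC {n} (implies F {n} 1<n c) }
    where
    PrimeBelow : Set
    PrimeBelow = ∃[ l ] Prime l
    attach : ∀ (xs : List ℕ) → (∀ {p} → p ∈ xs → Prime p) → List PrimeBelow
    attach [] pr = []
    attach (p ∷ xs) pr = (p , pr (here refl)) ∷ attach xs (pr ∘ there)
    ∈-attach : ∀ xs (pr : ∀ {p} → p ∈ xs → Prime p) {p} → p ∈ xs → ∃[ pp ] ((p , pp) ∈ attach xs pr)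
    ∈-attach (p ∷ xs) pr (here refl) = pr (here refl) , here refl
    ∈-attach (p ∷ xs) pr (there p∈) = let (pp , m) = ∈-attach xs (pr ∘ there) p∈ in pp , there m
    primes = attach (primesUpTo D) (primesUpTo-prime {R = D})
    pairs : List (PrimeBelow × ℕ)
    pairs = cartesianProduct primes (below D)
    C : PrimeBelow × ℕ → ℕ → Set
    C ((l , _) , e) n = l ℕ.^ suc e ∣ λC n
    F : Frequent η (λ n → All (λ x → C x n) pairs)
    F = frequent-all {C = C} (λ { η ((l , pl) , e) → frequent-prime-power pl e η }) η pairs
    divides-λC : ∀ {n} → All (λ x → C x n) pairs → D ∣ λC n
    divides-λC {n} all = prime-powers-∣ D 0<D power
      where
      power : ∀ {l} e → Prime l → l ℕ.^ e ∣ D → l ℕ.^ e ∣ λC n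
      power zero pl d = 1∣ λC n
      power {l} (suc e) pl d = let (pp , m) = ∈-attach (primesUpTo D) (primesUpTo-prime {R = D}) (∈-primesUpTo pl (∣⇒≤ {{ℕ.>-nonZero 0<D}} (∣-trans (m∣m*n (l ℕ.^ e)) d))) in
        All.lookup all (∈-cartesianProduct⁺ m (∈-below e<D))
        where
        e<D : e ℕ.< D
        e<D = ℕₚ.<-≤-trans (n<2^n e) (ℕₚ.≤-trans (ℕₚ.^-monoˡ-≤ e (prime⇒1< pl)) (ℕₚ.≤-trans (ℕₚ.m≤n*m (l ℕ.^ e) l {{ℕ.>-nonZero (prime⇒0< pl)}}) (∣⇒≤ {{ℕ.>-nonZero 0<D}} d)))

  scale-^ : ∀ k a i j → scale k a (i ℕ.+ j) ≡ k ℕ.^ i ℕ.* scale k a j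
  scale-^ k a zero j = sym (ℕₚ.*-identityˡ (scale k a j))
  scale-^ k a (suc i) j = trans (cong (k ℕ.*_) (scale-^ k a i j)) (sym (ℕₚ.*-assoc k (k ℕ.^ i) (scale k a j)))

  scale-≥ : ∀ {k} a → 0 ℕ.< k → ∀ j → a ℕ.≤ scale k a j
  scale-≥ a 0<k zero = ℕₚ.≤-refl
  scale-≥ {k} a 0<k (suc j) = ℕₚ.≤-trans (scale-≥ a 0<k j) (ℕₚ.m≤n*m (scale k a j) k {{ℕ.>-nonZero 0<k}})

  scale-> : ∀ {k a} → 2 ℕ.≤ k → 0 ℕ.< a → ∀ j → j ℕ.< scale k a j
  scale-> 2≤k 0<a zero = 0<a
  scale-> {k} {a} 2≤k 0<a (suc j) = ℕₚ.≤-trans (ℕₚ.+-mono-≤ {1} {suc j} (ℕ.s≤s ℕ.z≤n) (ℕₚ.≤-reflexive (sym (ℕₚ.+-identityʳ (suc j))))) (ℕₚ.*-mono-≤ 2≤k (scale-> 2≤k 0<a j))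

  bracket : ∀ (f : ℕ → ℕ) N k → f 0 ℕ.≤ N → N ℕ.< f k → ∃[ j ] (f j ℕ.≤ N × N ℕ.< f (suc j))
  bracket f N zero lo hi = ⊥-elim (ℕₚ.<-irrefl refl (ℕₚ.<-≤-trans hi lo))
  bracket f N (suc k) lo hi = by-cases (ℕₚ.≤-<-connex (f k) N)
    where
    by-cases : f k ℕ.≤ N ⊎ N ℕ.< f k → ∃[ j ] (f j ℕ.≤ N × N ℕ.< f (suc j))
    by-cases (inj₁ le) = k , le , hi
    by-cases (inj₂ lt) = bracket f N k lo lt

  module _ (h : ℕ) (0<h : 0 ℕ.< h) (k : ℕ) where

    private
      -- The summands provide a ≥ 2, the bound 2 h ≤ 2^a₀ for the prime factors of the base, and K^2
      -- ≤ 2^a.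
      a₀ : ℕ
      a₀ = 2 ℕ.+ 2 ℕ.* h ℕ.+ K ℕ.* K

      s : ℕ → ℕ
      s = scale K a₀

      2≤s : ∀ j → 2 ℕ.≤ s j
      2≤s j = ℕₚ.≤-trans (ℕₚ.m≤m+n 2 (2 ℕ.* h ℕ.+ K ℕ.* K)) (ℕₚ.≤-trans (ℕₚ.≤-reflexive (sym (ℕₚ.+-assoc 2 (2 ℕ.* h) (K ℕ.* K)))) (scale-≥ a₀ 0<K j))

      large : ∀ j → K ℕ.* K ℕ.≤ 2 ℕ.^ s j
      large j = ℕₚ.≤-trans (ℕₚ.m≤n+m (K ℕ.* K) (2 ℕ.+ 2 ℕ.* h)) (ℕₚ.≤-trans (scale-≥ a₀ 0<K j) (ℕₚ.<⇒≤ (n<2^n (s j))))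

      -- K a₀ factors 2 give the range 2^(K a₀) h demanded by the lowest rung.
      D : ℕ
      D = base h 0<h (K ℕ.* a₀)

      η : ℕ
      η = 4 ℕ.* k

      F : Frequent η (λ n → D ∣ λC n)
      F = frequent-divisor η D (0<base h 0<h (K ℕ.* a₀))

      t₀ : ℕ
      t₀ = proj₁ (scale-count (2 ℕ.* η))

      c₁ : ℕ
      c₁ = 10 ℕ.+ K ℕ.* K

      c₂ : ℕ
      c₂ = J ℕ.^ (t₀ ℕ.* window)

    -- The reciprocal of c. With t₀ windows at scale a the blocks end at exponent 10 K a c₂, and the
    -- count is valid from 2^(c₁ 10 K a c₂) on, which is 2^(`exponent` a).
    exponent : ℕ
    exponent = c₁ ℕ.* (10 ℕ.* (K ℕ.* c₂))

    0<exponent : 0 ℕ.< exponent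
    0<exponent = ℕₚ.*-mono-≤ {1} {c₁} {1} (ℕ.s≤s ℕ.z≤n) (ℕₚ.*-mono-≤ {1} {10} {1} (ℕ.s≤s ℕ.z≤n) (ℕₚ.*-mono-≤ 0<K (ℕₚ.m^n>0 J {{ℕ.>-nonZero 0<J}} (t₀ ℕ.* window))))

    private
      limit : ℕ → ℕ
      limit j = 2 ℕ.^ (exponent ℕ.* s j)

    module _ (N Jm : ℕ) (limit≤N : limit Jm ℕ.≤ N) where

      private
        -- One additional window for each scale below the top scale `Jm`.
        windows : ℕ → ℕ
        windows j = (t₀ ℕ.+ (Jm ℕ.∸ j)) ℕ.* window

        module At (j : ℕ) = AtScale (s j) (2≤s j) (large j)

        Rich : ℕ → ℕ → Set
        Rich j = At.Rich j (windows j)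

        rich? : ∀ j → Decidable (Rich j)
        rich? j = At.rich? j (windows j)

        AllRich : ℕ → ℕ → Set
        AllRich zero n = ⊤
        AllRich (suc j) n = Rich j n × AllRich j n

        all-rich? : ∀ j → Decidable (AllRich j)
        all-rich? zero n = yes tt
        all-rich? (suc j) = rich? j ×? all-rich? j

        AllRich-∈ : ∀ {i j n} → i ℕ.< j → AllRich j n → Rich i n
        AllRich-∈ {i} {suc j} i<j (r , rs) with ℕₚ.m≤n⇒m<n∨m≡n (ℕ.s≤s⁻¹ i<j)
        ... | inj₁ lt = AllRich-∈ lt rs
        ... | inj₂ refl = r

        -- Going down i scales divides a by K^i, while i more windows multiply the end of the blocks
        -- by J^(i `window`) ≤ K^i; so the limit of the top scale serves for all.
        top≤ : ∀ i j → j ℕ.+ i ≡ Jm → c₁ ℕ.* At.top j ((t₀ ℕ.+ i) ℕ.* window) ℕ.≤ exponent ℕ.* s Jm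
        top≤ i j refl = begin
          c₁ ℕ.* At.top j ((t₀ ℕ.+ i) ℕ.* window)                                ≡⟨ cong (c₁ ℕ.*_) (steps-^ (10 ℕ.* (K ℕ.* s j)) ((t₀ ℕ.+ i) ℕ.* window)) ⟩
          c₁ ℕ.* (10 ℕ.* (K ℕ.* s j) ℕ.* J ℕ.^ ((t₀ ℕ.+ i) ℕ.* window))         ≡⟨ cong (λ z → c₁ ℕ.* (10 ℕ.* (K ℕ.* s j) ℕ.* z)) power ⟩
          c₁ ℕ.* (10 ℕ.* (K ℕ.* s j) ℕ.* (c₂ ℕ.* (J ℕ.^ window) ℕ.^ i))         ≡⟨ lem c₁ K (s j) c₂ ((J ℕ.^ window) ℕ.^ i) ⟩
          exponent ℕ.* ((J ℕ.^ window) ℕ.^ i ℕ.* s j)                           ≤⟨ ℕₚ.*-monoʳ-≤ exponent (ℕₚ.*-monoˡ-≤ (s j) (ℕₚ.^-monoˡ-≤ i Jʷ≤K)) ⟩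
          exponent ℕ.* (K ℕ.^ i ℕ.* s j)                                        ≡⟨ cong (exponent ℕ.*_) (trans (sym (scale-^ K a₀ i j)) (cong s (ℕₚ.+-comm i j))) ⟩
          exponent ℕ.* s (j ℕ.+ i)                                              ∎
          where
          open ℕₚ.≤-Reasoning
          lem : ∀ c k s d w → c ℕ.* (10 ℕ.* (k ℕ.* s) ℕ.* (d ℕ.* w)) ≡ c ℕ.* (10 ℕ.* (k ℕ.* d)) ℕ.* (w ℕ.* s)
          lem = solve-∀ℕ
          power : J ℕ.^ ((t₀ ℕ.+ i) ℕ.* window) ≡ c₂ ℕ.* (J ℕ.^ window) ℕ.^ i
          power = trans (cong (J ℕ.^_) (ℕₚ.*-distribʳ-+ window t₀ i)) (trans (ℕₚ.^-distribˡ-+-* J (t₀ ℕ.* window) (i ℕ.* window))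
            (cong (c₂ ℕ.*_) (trans (cong (J ℕ.^_) (ℕₚ.*-comm i window)) (sym (ℕₚ.^-*-assoc J window i)))))

        rich-rare : ∀ i j → j ℕ.+ i ≡ Jm → length (misses (rich? j) N) ℕ.* (2 ℕ.* η ℕ.* 2 ℕ.^ i) ℕ.≤ N
        rich-rare i j eq = ℕₚ.≤-trans (ℕₚ.*-monoʳ-≤ (length (misses (rich? j) N)) (ℕₚ.*-monoʳ-≤ (2 ℕ.* η) (2^-mono (ℕₚ.m≤n+m i t₀))))
          (subst (λ z → length (misses (At.rich? j ((t₀ ℕ.+ z) ℕ.* window)) N) ℕ.* (2 ℕ.* η ℕ.* 2 ℕ.^ (t₀ ℕ.+ i)) ℕ.≤ N) (sym gap)
            (proj₂ (scale-count (2 ℕ.* η)) (t₀ ℕ.+ i) (ℕₚ.m≤m+n t₀ i) (s j) (2≤s j) (large j) N (ℕₚ.≤-trans (2^-mono (top≤ i j eq)) limit≤N)))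
          where
          gap : Jm ℕ.∸ j ≡ i
          gap = trans (cong (ℕ._∸ j) (sym eq)) (ℕₚ.m+n∸m≡n j i)

        -- The bounds for the single scales double from each scale to the next one up, so the sum
        -- over all scales below j is at most twice its last term.
        all-rich-rare : ∀ i j → j ℕ.+ i ≡ suc Jm → length (misses (all-rich? j) N) ℕ.* (2 ℕ.* η ℕ.* 2 ℕ.^ i) ℕ.≤ 2 ℕ.* N
        all-rich-rare i zero eq = ℕₚ.≤-trans (ℕₚ.≤-reflexive (cong (ℕ._* (2 ℕ.* η ℕ.* 2 ℕ.^ i)) (no-misses (all-rich? 0) (λ _ → tt) N))) ℕ.z≤n
        all-rich-rare i (suc j) eq = ℕₚ.≤-trans (ℕₚ.*-monoˡ-≤ w (misses-× (rich? j) (all-rich? j) N))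
          (ℕₚ.≤-trans (ℕₚ.≤-reflexive (ℕₚ.*-distribʳ-+ w x y)) (ℕₚ.≤-trans (ℕₚ.+-mono-≤ (rich-rare i j (ℕₚ.suc-injective eq)) previous) (ℕₚ.≤-reflexive (cong (N ℕ.+_) (sym (ℕₚ.+-identityʳ N))))))
          where
          w = 2 ℕ.* η ℕ.* 2 ℕ.^ i
          x = length (misses (rich? j) N)
          y = length (misses (all-rich? j) N)
          lem : ∀ y η z → 2 ℕ.* (y ℕ.* (2 ℕ.* η ℕ.* z)) ≡ y ℕ.* (2 ℕ.* η ℕ.* (2 ℕ.* z))
          lem = solve-∀ℕ
          previous : y ℕ.* w ℕ.≤ N
          previous = ℕₚ.*-cancelˡ-≤ 2 (ℕₚ.≤-trans (ℕₚ.≤-reflexive (lem y η (2 ℕ.^ i))) (all-rich-rare (suc i) j (trans (ℕₚ.+-suc j i) eq)))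

        Good : ℕ → Set
        Good n = Condition F n × AllRich (suc Jm) n

        good? : Decidable Good
        good? = condition? F ×? all-rich? (suc Jm)

      good-list : List ℕ
      good-list = filter good? (upTo⁺ N)

      exceptions : ℕ
      exceptions = length (misses good? N)

      good-list-unique : Unique good-list
      good-list-unique = filter-unique good? (upTo⁺-unique N)

      good+exceptions : N ℕ.≤ length good-list ℕ.+ exceptions
      good+exceptions = hits+misses good? N

      -- The base divisor and the scales together each fail for at most N/(4 k) integers.
      few-exceptions : start F ℕ.≤ N → exceptions ℕ.* (2 ℕ.* k) ℕ.≤ N
      few-exceptions le = ℕₚ.*-cancelˡ-≤ 2 (ℕₚ.≤-trans (ℕₚ.≤-reflexive (lem exceptions k)) (ℕₚ.≤-trans (ℕₚ.*-monoˡ-≤ η (misses-× (condition? F) (all-rich? (suc Jm)) N))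
        (ℕₚ.≤-trans (ℕₚ.≤-reflexive (ℕₚ.*-distribʳ-+ η x y)) (ℕₚ.≤-trans (ℕₚ.+-mono-≤ (rare F N le) y≤) (ℕₚ.≤-reflexive (cong (N ℕ.+_) (sym (ℕₚ.+-identityʳ N))))))))
        where
        x = length (misses (condition? F) N)
        y = length (misses (all-rich? (suc Jm)) N)
        lem : ∀ b k → 2 ℕ.* (b ℕ.* (2 ℕ.* k)) ≡ b ℕ.* (4 ℕ.* k)
        lem = solve-∀ℕ
        lem₂ : ∀ y η → 2 ℕ.* (y ℕ.* η) ≡ y ℕ.* (2 ℕ.* η ℕ.* 1)
        lem₂ = solve-∀ℕ
        y≤ : y ℕ.* η ℕ.≤ N
        y≤ = ℕₚ.*-cancelˡ-≤ 2 (ℕₚ.≤-trans (ℕₚ.≤-reflexive (lem₂ y η)) (all-rich-rare 0 (suc Jm) (ℕₚ.+-identityʳ (suc Jm))))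

      private
        stock : ∀ {n} → 0 ℕ.< n → ∀ j → Rich j n → 1 ℕ.< n × ∃[ qs ] Stock (λC n) K (s j) qs
        stock {n} 0<n j r = finish (chain-reaches (At.B j T) (At.B-prime j T) (At.Link j) (At.link? j) (At.pick j) {Q = At.Q j} (λ {E} {p} → At.pick-spec j {E} {p}) (K ℕ.* K) r)
          where
          T = windows j
          Reaches : ℕ → Set
          Reaches q = q ∈ At.Q j × ∃[ p ] (Prime p × p ∣ n × q ∣ p ℕ.∸ 1)
          finish : ∃[ qs ] (length qs ≡ K ℕ.* K × Unique qs × (∀ {q} → q ∈ qs → _ × Reaches q)) → 1 ℕ.< n × ∃[ qs ] Stock (λC n) K (s j) qs
          finish (qs , len , u , spec) = 1<n , qs , len , u , λ {q} q∈ →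
            let (q∈Q , p , pp , p∣n , q∣) = proj₂ (spec q∈) ; (pq , lo , hi) = primesBetween-spec {i = s j} {K ℕ.* s j} q∈Q in
            pq , subst (_∣ λC n) (ℕₚ.*-identityʳ q) (prime-power-λC 1 pp pq 1<n p∣n (subst (_∣ p ℕ.∸ 1) (sym (ℕₚ.*-identityʳ q)) q∣)) , lo , hi
            where
            first : ∀ (xs : List ℕ) → 0 ℕ.< length xs → ∃[ x ] x ∈ xs
            first (x ∷ xs) _ = x , here refl
            -- The facts about λ(n) need n > 1; a nonempty chain provides a prime factor of n.
            1<n : 1 ℕ.< n
            1<n = let (q , q∈) = first qs (subst (0 ℕ.<_) (sym len) (ℕₚ.*-mono-≤ 0<K 0<K)) ; (_ , _ , p , pp , p∣n , _) = spec q∈ in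
              ℕₚ.<-≤-trans (prime⇒1< pp) (∣⇒≤ {{ℕ.>-nonZero 0<n}} p∣n)

      good-dense : ∀ {n} → n ∈ good-list → (0 ℕ.< n × n ℕ.≤ N) × λC n ∣ φ n × Dense h 0<h (λC n) (2 ℕ.^ s (suc Jm))
      good-dense {n} n∈ = finish (∈-filter⁻ good? {xs = upTo⁺ N} n∈)
        where
        finish : n ∈ upTo⁺ N × Good n → (0 ℕ.< n × n ℕ.≤ N) × λC n ∣ φ n × Dense h 0<h (λC n) (2 ℕ.^ s (suc Jm))
        finish (m , c , rs) = upTo⁺-bounds m , λC∣φ 1<n , conclude (ladder h 0<h (suc Jm) 0<K (λ j j≤ → proj₂ (stock 0<n j (AllRich-∈ j≤ rs))) bottom)
          where
          0<n = proj₁ (upTo⁺-bounds m)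
          1<n : 1 ℕ.< n
          1<n = proj₁ (stock 0<n 0 (AllRich-∈ (ℕ.s≤s ℕ.z≤n) rs))
          2h≤ : 2 ℕ.* h ℕ.≤ 2 ℕ.^ a₀
          2h≤ = ℕₚ.≤-trans (ℕₚ.≤-trans (ℕₚ.m≤n+m (2 ℕ.* h) 2) (ℕₚ.m≤m+n (2 ℕ.+ 2 ℕ.* h) (K ℕ.* K))) (ℕₚ.<⇒≤ (n<2^n a₀))
          bottom : Rung h 0<h (λC n) K a₀
          bottom = D , reach h 0<h (K ℕ.* a₀) , implies F 1<n c , base-dense h 0<h (K ℕ.* a₀) , ≤reach h 0<h (K ℕ.* a₀) ,
            λ pp d → ℕₚ.≤-trans (base-primes h 0<h (K ℕ.* a₀) pp d) 2h≤
          conclude : Rung h 0<h (λC n) K (s (suc Jm)) → Dense h 0<h (λC n) (2 ℕ.^ s (suc Jm))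
          conclude (d , Y , d∣ , dense , Y≥ , _) = dense-∣ h 0<h {d} {λC n} d∣ (dense-≤ h 0<h {d}
            (ℕₚ.≤-trans (ℕₚ.≤-trans (2^-mono (ℕₚ.m≤n*m (s (suc Jm)) K {{ℕ.>-nonZero 0<K}})) (ℕₚ.m≤m*n (2 ℕ.^ (K ℕ.* s (suc Jm))) h {{ℕ.>-nonZero 0<h}})) Y≥) dense)

    threshold : ℕ
    threshold = start F ℕ.+ limit 0 ℕ.+ 2 ℕ.* k

    large-enough : ∀ {N} → threshold ℕ.≤ N → 2 ℕ.* k ℕ.≤ N
    large-enough = ℕₚ.m+n≤o⇒n≤o (start F ℕ.+ limit 0)

    record Conclusion (N : ℕ) : Set where
      field
        Y : ℕ
        members : List ℕ
        unique : Unique members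
        N<Y^ : N ℕ.< Y ℕ.^ exponent
        dense : ∀ {n} → n ∈ members → (0 ℕ.< n × n ℕ.≤ N) × λC n ∣ φ n × Dense h 0<h (λC n) Y
        missing : ℕ
        size : N ℕ.≤ length members ℕ.+ missing
        few : missing ℕ.* (2 ℕ.* k) ℕ.≤ N

    -- The top scale j has limit(j) ≤ N < limit(j + 1). The climb ends with Y = 2^(s(j + 1)), and
    -- limit(j + 1) is precisely the power Y^`exponent`.
    conclusion : ∀ N → threshold ℕ.≤ N → Conclusion N
    conclusion N le = finish (bracket limit N N limit₀≤N N<limit)
      where
      start≤N : start F ℕ.≤ N
      start≤N = ℕₚ.m+n≤o⇒m≤o (start F) (ℕₚ.m+n≤o⇒m≤o (start F ℕ.+ limit 0) le)
      limit₀≤N : limit 0 ℕ.≤ N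
      limit₀≤N = ℕₚ.m+n≤o⇒n≤o (start F) (ℕₚ.m+n≤o⇒m≤o (start F ℕ.+ limit 0) le)
      N<limit : N ℕ.< limit N
      N<limit = ℕₚ.≤-<-trans (ℕₚ.≤-trans (ℕₚ.<⇒≤ (scale-> 2≤K (ℕₚ.≤-trans (ℕ.s≤s ℕ.z≤n) (2≤s 0)) N)) (ℕₚ.m≤n*m (s N) exponent {{ℕ.>-nonZero 0<exponent}})) (n<2^n (exponent ℕ.* s N))
      finish : ∃[ j ] (limit j ℕ.≤ N × N ℕ.< limit (suc j)) → Conclusion N
      finish (j , lo , hi) = record
        { Y = 2 ℕ.^ s (suc j)
        ; members = good-list N j lo
        ; unique = good-list-unique N j lo
        ; N<Y^ = ℕₚ.<-≤-trans hi (ℕₚ.≤-reflexive (trans (cong (2 ℕ.^_) (ℕₚ.*-comm exponent (s (suc j)))) (sym (ℕₚ.^-*-assoc 2 (s (suc j)) exponent))))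
        ; dense = good-dense N j lo
        ; missing = exceptions N j lo
        ; size = good+exceptions N j lo
        ; few = few-exceptions N j lo start≤N }

  module _ {h : ℕ} (0<h : 0 ℕ.< h) {δ : ℚ} (0<δ : 0ℚ < δ) (δ<1 : δ < 1ℚ) where

    private
      k : ℕ
      k = proj₁ (archimedean⁻¹ δ 0<δ)

      0<k : 0 ℕ.< k
      0<k = proj₁ (proj₂ (archimedean⁻¹ δ 0<δ))

      ρk≤δ : ρ k ≤ δ
      ρk≤δ = proj₂ (proj₂ (archimedean⁻¹ δ 0<δ))

    -- y^q ≤ x < N + 1 ≤ Y^q forces y < Y; here the reached Y is turned into the power x^(1/q).
    dense-in : ∀ {x n m N Y} → Dense h 0<h n Y → n ∣ m → x < ν (suc N) → N ℕ.< Y ℕ.^ exponent h 0<h k → DenseIn (1ℚ + recip h) m (ι h) x 1 (exponent h 0<h k)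
    dense-in {x} {n} {m} {N} {Y} D n∣m x< N< y lo hi = finish (dense-∣ h 0<h {n} {m} n∣m D y (subst (_≤ y) (sym (ν≡ι h)) lo) y<Y)
      where
      q = exponent h 0<h k
      y<Y : y < ν Y
      y<Y = by-cases (y <? ν Y)
        where
        by-cases : Dec (y < ν Y) → y < ν Y
        by-cases (yes lt) = lt
        by-cases (no ge) = ⊥-elim (<-irrefl refl (<-≤-trans x< (≤-trans (ν-mono N<) (≤-trans (≡⇒≤ (sym (ν-^ Y q))) (≤-trans (^ℚ-mono (0≤ν Y) (≮⇒≥ ge) q) (≤-trans hi (≡⇒≤ (*-identityʳ x))))))))
      finish : ∃[ d ] (d ∣ m × y < ν d × ν d ≤ (1ℚ + ρ h) * y) → ∃[ d ] (d ∣ m × y < ι d × ι d ≤ (1ℚ + recip h) * y)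
      finish (d , d∣m , a , b) = d , d∣m , subst (y <_) (ν≡ι d) a , subst₂ _≤_ (ν≡ι d) (cong (λ z → (1ℚ + z) * y) (ρ≡recip h)) b

    -- The exceptions take at most half of the admissible share 1/k ≤ δ. The other half covers the
    -- passage from x to N + 1, by 2 k ≤ N, and makes the inequality strict.
    majority : ∀ {x N} (c : Conclusion h 0<h k N) → 2 ℕ.* k ℕ.≤ N → x < ν (suc N) → (1ℚ - δ) * x < ι (length (Conclusion.members c))
    majority {x} {N} c 2k≤N x< = subst ((1ℚ - δ) * x <_) (ν≡ι l) (≤-<-trans (*-monoˡ (≤⇒0≤- (<⇒≤ δ<1)) (<⇒≤ x<))
      (≤-<-trans (*-monoʳ (0≤ν (suc N)) (+-monoʳ-≤ 1ℚ (neg-antimono-≤ ρk≤δ))) (*-cancelˡ-< (0≤ν k) (subst (_< ν k * ν l) (sym expand) strict))))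
      where
      open Conclusion c
      l = length members
      M = suc N
      lem : ∀ k r n → k * ((1ℚ - r) * n) ≡ k * n - (k * r) * n
      lem = solve-∀ ringℚ
      expand : ν k * ((1ℚ - ρ k) * ν M) ≡ ν k * ν M - ν M
      expand = trans (lem (ν k) (ρ k) (ν M)) (cong (λ z → ν k * ν M - z) (trans (cong (_* ν M) (νρ 0<k)) (*-identityˡ (ν M))))
      natural : k ℕ.* M ℕ.< k ℕ.* l ℕ.+ M
      natural = ℕₚ.*-cancelˡ-< 2 (k ℕ.* M) (k ℕ.* l ℕ.+ M) (ℕₚ.≤-<-trans (ℕₚ.*-monoʳ-≤ 2 (ℕₚ.*-monoʳ-≤ k (ℕ.s≤s size)))
        (ℕₚ.≤-<-trans (ℕₚ.≤-trans (ℕₚ.≤-reflexive (lem₁ k l missing)) (ℕₚ.+-monoʳ-≤ (2 ℕ.* (k ℕ.* l)) (ℕₚ.+-mono-≤ few 2k≤N)))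
        (ℕₚ.<-≤-trans (ℕₚ.+-monoʳ-< (2 ℕ.* (k ℕ.* l)) (ℕₚ.+-mono-< (ℕₚ.n<1+n N) (ℕₚ.n<1+n N))) (ℕₚ.≤-reflexive (lem₂ (k ℕ.* l) M)))))
        where
        lem₁ : ∀ k l m → 2 ℕ.* (k ℕ.* (1 ℕ.+ (l ℕ.+ m))) ≡ 2 ℕ.* (k ℕ.* l) ℕ.+ (m ℕ.* (2 ℕ.* k) ℕ.+ 2 ℕ.* k)
        lem₁ = solve-∀ℕ
        lem₂ : ∀ a m → 2 ℕ.* a ℕ.+ (m ℕ.+ m) ≡ 2 ℕ.* (a ℕ.+ m)
        lem₂ = solve-∀ℕ
      strict : ν k * ν M - ν M < ν k * ν l
      strict = subst (ν k * ν M - ν M <_) (trans (cong (_- ν M) (trans (ν-+ (k ℕ.* l) M) (cong (_+ ν M) (ν-* k l)))) (lem₃ (ν k * ν l) (ν M)))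
        (+-monoˡ-< (- ν M) (subst (_< ν (k ℕ.* l ℕ.+ M)) (ν-* k M) (ν-mono-< natural)))
        where
        lem₃ : ∀ a b → a + b - b ≡ a
        lem₃ = solve-∀ ringℚ

    frequently-dense : ∃[ q ] (0 ℕ.< q × ∃[ X ] (∀ x → X ≤ x → ∃[ S ] (Unique S × All (λ n → 1 ℕ.≤ n × ι n ≤ x ×
      DenseIn (1ℚ + recip h) (φ n) (ι h) x 1 q × DenseIn (1ℚ + recip h) (λC n) (ι h) x 1 q) S × (1ℚ - δ) * x < ι (length S))))
    frequently-dense = exponent h 0<h k , 0<exponent h 0<h k , ν X₀ , λ x X≤x → at x X≤x (archimedean x)
      where
      X₀ = threshold h 0<h k
      at : ∀ x → ν X₀ ≤ x → ∃[ B ] x < ν B → ∃[ S ] (Unique S × All (λ n → 1 ℕ.≤ n × ι n ≤ x ×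
        DenseIn (1ℚ + recip h) (φ n) (ι h) x 1 (exponent h 0<h k) × DenseIn (1ℚ + recip h) (λC n) (ι h) x 1 (exponent h 0<h k)) S × (1ℚ - δ) * x < ι (length S))
      at x X≤x (B , x<B) = within (floor B (≤-trans (0≤ν X₀) X≤x) x<B)
        where
        within : ∃[ N ] (N ℕ.< B × ν N ≤ x × x < ν (suc N)) → ∃[ S ] (Unique S × All (λ n → 1 ℕ.≤ n × ι n ≤ x ×
          DenseIn (1ℚ + recip h) (φ n) (ι h) x 1 (exponent h 0<h k) × DenseIn (1ℚ + recip h) (λC n) (ι h) x 1 (exponent h 0<h k)) S × (1ℚ - δ) * x < ι (length S))
        within (N , _ , lo , hi) = members , unique , All.tabulate each , majority C (large-enough h 0<h k X₀≤N) hi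
          where
          X₀≤N : X₀ ℕ.≤ N
          X₀≤N = ℕₚ.≮⇒≥ λ N<X₀ → <-irrefl refl (<-≤-trans hi (≤-trans (ν-mono N<X₀) X≤x))
          C = conclusion h 0<h k N X₀≤N
          open Conclusion C
          each : ∀ {n} → n ∈ members → 1 ℕ.≤ n × ι n ≤ x × DenseIn (1ℚ + recip h) (φ n) (ι h) x 1 (exponent h 0<h k) × DenseIn (1ℚ + recip h) (λC n) (ι h) x 1 (exponent h 0<h k)
          each {n} n∈ = let ((0<n , n≤N) , λ∣φ , D) = dense n∈ in 0<n , ≤-trans (≡⇒≤ (sym (ν≡ι n))) (≤-trans (ν-mono n≤N) lo) ,
            dense-in {x} {λC n} {φ n} {N} {Y} D λ∣φ hi N<Y^ , dense-in {x} {λC n} {λC n} {N} {Y} D ∣-refl hi N<Y^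

open import Defs
open import Data.Nat using (ℕ; _>_; s≤s; z≤n) renaming (_≤_ to _≤ℕ_)
open import Data.Rational using (ℚ; 0ℚ; 1ℚ; _+_; _-_; _*_; _<_; _≤_)
open import Data.Product using (∃; _×_; _,_)
open import Data.List using (List; length)
open import Data.List.Relation.Unary.All using (All)
open import Data.List.Relation.Unary.Unique.Propositional using (Unique)

theorem3 : ∀ (h : ℕ) → h > 0 → ∀ (δ : ℚ) → 0ℚ < δ → δ < 1ℚ →
    ∃ λ (p : ℕ) → ∃ λ (q : ℕ) → p > 0 × q > 0 ×
    ∃ λ (X : ℚ) → ∀ (x : ℚ) → X ≤ x →
    ∃ λ (S : List ℕ) → Unique S ×
      All (λ n → 1 ≤ℕ n × ι n ≤ x ×
                 DenseIn (1ℚ + recip h) (φ n) (ι h) x p q ×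
                 DenseIn (1ℚ + recip h) (λC n) (ι h) x p q) S ×
      (1ℚ - δ) * x < ι (length S)
theorem3 h 0<h δ 0<δ δ<1 =
  -- The exponent c is 1/q.
  let (q , 0<q , X , dense) = Final.frequently-dense {h} 0<h {δ} 0<δ δ<1 in 1 , q , s≤s z≤n , 0<q , X , dense
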